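{- Let $q\ge 6$ be a prime power. Let $\bar{\mathcal C}$ be an $\mathbb F_q$-conic in an $\mathbb F_q$-subplane $\bar\pi$ of $\mathrm{PG}(2,q^3)$ that is exterior to $\ell_\infty$, and let $\bar E,\bar E^{\bar{\mathsf c}_\pi}\in\ell_\infty$ be the $(\bar\pi,\ell_\infty)$-carriers of $\bar\pi$ on $\ell_\infty$. In the exact-at-infinity Bruck-Bose representation in $\mathrm{PG}(6,q)$ we have the following. 1. If $\bar{\mathcal C}^+\cap\ell_\infty=\{\bar E,\bar E^{\bar{\mathsf c}_\pi}\}$, then $\mathcal V([\mathcal C])$ consists of a 3-dimensional normal rational curve $\mathcal N_3$ of $\mathrm{PG}(6,q)$. Further, $\mathcal V([\mathcal C])^\star\cap\Sigma_\infty^\star$ is the three T-lines $h=E(E^{\mathsf c_\pi})^{q^2}$ (the line joining $E$ and $(E^{\mathsf c_\pi})^{q^2}$), $h^q$, $h^{q^2}$. Further, $\mathcal N_3^\star\cap\Sigma_\infty^\star=\{R,R^q,R^{q^2}\}$ where $R\in h$, and $R$ is not contained in an extended spread plane. 2. Otherwise $\bar{\mathcal C}^+$ meets $\ell_\infty$ in two points $\bar P,\bar Q$ which are not $(\bar\pi,\ell_\infty)$-carriers, possibly repeated, possibly in the quadratic extension. In this case $\mathcal V([\mathcal C])$ is a 6-dimensional normal rational curve $\mathcal N_6$ of $\mathrm{PG}(6,q)$. Further, $\mathcal N_6^\star$ meets $\Sigma_\infty^\star$ in six points $\{P,P^q,P^{q^2},Q,Q^q,Q^{q^2}\}$, where $P,Q\in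 g$, possibly repeated, or possibly in the extension $g^{\star\star}\setminus g$ (the intersection then being that of $\mathcal N_6^{\star\star}$ with $\Sigma_\infty^{\star\star}$), in which case $Q=P^{q^3}$.
   Context: **$\mathbb F_q$-conics.** An $\mathbb F_q$-subplane of $\mathrm{PG}(2,q^3)$ is a subplane of order $q$; it is secant, tangent or exterior to a line if it meets it in $q+1$, $1$ or $0$ points. An $\mathbb F_q$-conic is a non-degenerate conic of an $\mathbb F_q$-subplane. For an $\mathbb F_q$-conic $\bar{\mathcal C}$, $\bar{\mathcal C}^{+}$ is the unique non-degenerate conic of $\mathrm{PG}(2,q^3)$ containing it, and $\bar{\mathcal C}^{++}$ the unique non-degenerate conic of $\mathrm{PG}(2,q^6)$ containing $\bar{\mathcal C}^+$ (if $\bar{\mathcal C}^+\cap\ell_\infty=\emptyset$, the points $\bar P,\bar Q$ are the intersections of $\bar{\mathcal C}^{++}$ with the extension of $\ell_\infty$ to $\mathrm{PG}(2,q^6)$). A line $\ell_\infty$ of $\mathrm{PG}(2,q^3)$ is fixed as line at infinity. **Normal rational curves.** An $r$-dimensional normal rational curve in $\mathrm{PG}(n,q)$ is a set of points lying in an $r$-space and projectively equivalent to $\{(1,\theta,\dots,\theta^r):\theta\in\mathbb F_q\}\cup\{(0,\dots,0,1)\}$; it extends naturally to a normal rational curve over extension fields. **Conjugacy and carriers.** For an $\mathbb F_q$-subplane $\bar\pi$, $\bar{\mathsf c}_\pi$ is the collineation $\bar X\mapsto B\bar X^q$ ($B\in\mathrm{GL}(3,q^3)$) of $\mathrm{PG}(2,q^3)$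 that has order 3 and fixes $\bar\pi$ pointwise; the same formula defines it on $\mathrm{PG}(2,q^6)$, where it has order 6. If $\bar\pi$ is exterior to $\ell_\infty$, the $(\bar\pi,\ell_\infty)$-carriers are the three points $\ell_\infty\cap\ell_\infty^{\bar{\mathsf c}_\pi}$, $\ell_\infty\cap\ell_\infty^{\bar{\mathsf c}_\pi^2}$, $\ell_\infty^{\bar{\mathsf c}_\pi}\cap\ell_\infty^{\bar{\mathsf c}_\pi^2}$; two of them lie on $\ell_\infty$, and they are denoted $\bar E,\bar E^{\bar{\mathsf c}_\pi},\bar E^{\bar{\mathsf c}_\pi^2}$ with $\bar E,\bar E^{\bar{\mathsf c}_\pi}\in\ell_\infty$. **Bose representation.** Embed $\mathrm{PG}(8,q)\subset\mathrm{PG}(8,q^3)\subset\mathrm{PG}(8,q^6)$; $X^q$ is obtained by raising coordinates to the $q$-th power. For a subspace or variety $\mathcal K$ given over $\mathbb F_q$ (including normal rational curves), $\mathcal K^\star$ and $\mathcal K^{\star\star}$ denote its extensions to $\mathbb F_{q^3}$ and $\mathbb F_{q^6}$; for a subspace $\Sigma$ of $\mathrm{PG}(8,q^3)$, $\Sigma^{\star\star}$ is its extension to $\mathrm{PG}(8,q^6)$. Let $\Gamma$ be a plane of $\mathrm{PG}(8,q^3)$ disjoint from $\mathrm{PG}(8,q)$ such that $\Gamma,\Gamma^q,\Gamma^{q^2}$ span $\mathrm{PG}(8,q^3)$. The planes $[\![X]\!]=\langle X,X^q,X^{q^2}\rangle\cap\mathrm{PG}(8,q)$, $X\in\Gamma$,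 form a regular 2-spread of $\mathrm{PG}(8,q)$. Identify $\mathrm{PG}(2,q^3)$ with $\Gamma$ (and $\mathrm{PG}(2,q^6)$ with $\Gamma^{\star\star}$) by a linear isomorphism, $\bar X\leftrightarrow X$; dropping the bar denotes the corresponding object in $\Gamma$ or $\Gamma^{\star\star}$ (so $\mathcal C,\mathcal C^+,\mathcal C^{++},\mathsf c_\pi$). **Scroll-planes.** For $X\in\Gamma^{\star\star}$, the $\pi$-scroll-plane is $(\!(X)\!)_\pi=\langle X,(X^{\mathsf c_\pi^5})^q,(X^{\mathsf c_\pi^4})^{q^2}\rangle$; for $X\in\Gamma$ this is $\langle X,(X^{\mathsf c_\pi^2})^q,(X^{\mathsf c_\pi})^{q^2}\rangle$. **Exact-at-infinity Bruck-Bose representation.** Let $g\subset\Gamma$ be the line corresponding to $\ell_\infty$, $\Sigma_\infty=\langle g,g^q,g^{q^2}\rangle\cap\mathrm{PG}(8,q)$ (a 5-space), and $\Sigma_{6,q}\cong\mathrm{PG}(6,q)$ a 6-space of $\mathrm{PG}(8,q)$ containing $\Sigma_\infty$ as its hyperplane at infinity. The planes $[\![X]\!]$, $X\in g$, form a regular 2-spread $\mathcal S$ of $\Sigma_\infty$, with transversal lines $g,g^q,g^{q^2}$; its elements are the spread planes, and an extended spread plane is the extension $\langle X,X^q,X^{q^2}\rangle$ of one. A T-line of $\Sigma_\infty^\star$ is a line meeting two of $g,g^q,g^{q^2}$. For a point $\bar X$ let $[X]=[\![X]\!]\cap\Sigma_{6,q}$: a point of $\Sigma_{6,q}\setminus\Sigma_\infty$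 if $\bar X\notin\ell_\infty$, the spread plane $[\![X]\!]$ if $\bar X\in\ell_\infty$. $[\mathcal C]$ is the set of points lying in the $[X]$, $\bar X\in\bar{\mathcal C}$. **Varieties.** It is known that the pointset of $\{[\![X]\!]:X\in\mathcal C\}$ is an intersection $\mathcal V([\![\mathcal C]\!])$ of nine quadrics of $\mathrm{PG}(8,q)$, that $\mathcal V([\![\mathcal C]\!])^\star$ is the set of points on the planes $(\!(X)\!)_\pi$, $X\in\mathcal C^+$, and $\mathcal V([\![\mathcal C]\!])^{\star\star}$ is the set of points on the planes $(\!(X)\!)_\pi$, $X\in\mathcal C^{++}$. Put $\mathcal V([\mathcal C])=\mathcal V([\![\mathcal C]\!])\cap\Sigma_{6,q}$ (its pointset is $[\mathcal C]$), with extension $\mathcal V([\mathcal C])^\star=\mathcal V([\![\mathcal C]\!])^\star\cap\Sigma_{6,q}^\star$. -}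

module Defs where

open import Algebra.Bundles using (CommutativeRing)
import Algebra.Properties.Monoid.Sum as MonoidSum
import Algebra.Properties.Semiring.Exp as SemiringExp
open import Data.Fin.Base using (Fin; zero; suc; toℕ; fromℕ)
open import Data.List.Base using (List; []; _∷_)
open import Data.List.Relation.Unary.Any using (Any)
open import Data.Nat.Base as ℕ using (ℕ; zero; suc)
open import Data.Nat.GeneralisedArithmetic using (fold)
open import Data.Nat.Primality using (Prime)
open import Data.Product.Base using (∃; ∃₂; _×_)
open import Data.Sum.Base using (_⊎_)
open import Data.Vec.Functional using (Vector)
open import Function.Bundles using (Inverse)
open import Level using (Level; _⊔_) renaming (suc to lsuc)
open import Relation.Binary.PropositionalEquality.Core using (_≡_)
open import Relation.Binary.PropositionalEquality.Properties using () renaming (setoid to ≡-setoid)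
open import Relation.Nullary.Negation.Core using (¬_)
open import Relation.Unary using (Pred; _∈_; _∉_; _⊆_; _≐_; _∩_; _∪_; _≬_; Empty)

IsPrimePower : ℕ → Set
IsPrimePower q = ∃₂ λ p e → Prime p × q ≡ p ℕ.^ suc e

record FiniteField (c ℓ : Level) (order : ℕ) : Set (lsuc (c ⊔ ℓ)) where
  field
    commutativeRing : CommutativeRing c ℓ
  open CommutativeRing commutativeRing public
  field
    1≉0         : ¬ (1# ≈ 0#)
    inverse     : ∀ x → ¬ (x ≈ 0#) → ∃ λ y → x * y ≈ 1#
    enumeration : Inverse setoid (≡-setoid (Fin order))

-- All the geometry takes place over one field K of order q⁶, which contains the
-- fields of orders q and q³ as its subfields.
module Geometry {c ℓ : Level} (q : ℕ) (K : FiniteField c ℓ (q ℕ.^ 6)) where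

  open FiniteField K
  open MonoidSum +-monoid using (sum)
  open SemiringExp semiring using (_^_)

  -- The subfield of order qᵏ, for k a divisor of 6.
  F : ℕ → Pred Carrier ℓ
  F k a = a ^ (q ℕ.^ k) ≈ a

  infix 4 _≋_ _∼_

  _≋_ : ∀ {n} → Vector Carrier n → Vector Carrier n → Set ℓ
  x ≋ y = ∀ i → x i ≈ y i

  𝟎 : ∀ {n} → Vector Carrier n
  𝟎 _ = 0#

  _∼_ : ∀ {n} → Vector Carrier n → Vector Carrier n → Set (c ⊔ ℓ)
  x ∼ y = ∃ λ a → ¬ (a ≈ 0#) × x ≋ (λ i → a * y i)

  Matrix : ℕ → ℕ → Set c
  Matrix m n = Fin m → Fin n → Carrier

  infix 4 _Over_

  _Over_ : ∀ {m n} → Matrix m n → ℕ → Set ℓ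
  A Over k = ∀ i j → A i j ∈ F k

  infixr 8 _*ᵥ_

  _*ᵥ_ : ∀ {m n} → Matrix m n → Vector Carrier n → Vector Carrier m
  (A *ᵥ x) i = sum (λ j → A i j * x j)

  -- For square matrices this is membership of GL; in general it says that the
  -- columns are linearly independent.
  Nonsingular : ∀ {m n} → Matrix m n → Set (c ⊔ ℓ)
  Nonsingular A = ∀ x → A *ᵥ x ≋ 𝟎 → x ≋ 𝟎

  -- A point of PG(n,q⁶) is represented by any of its coordinate vectors, and a
  -- set of points by the set of all coordinate vectors of its members.
  PointSet : ℕ → Set (lsuc (c ⊔ ℓ))
  PointSet n = Pred (Vector Carrier (suc n)) (c ⊔ ℓ)

  -- PG n k is PG(n,qᵏ), embedded in PG(n,q⁶): the points having a coordinate
  -- vector over the subfield of order qᵏ.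
  PG : ∀ n (k : ℕ) → PointSet n
  PG n k x = ¬ (x ≋ 𝟎) × ∃ λ y → x ∼ y × (∀ i → y i ∈ F k)

  points : ∀ {n} → List (Vector Carrier (suc n)) → PointSet n
  points vs x = Any (x ∼_) vs

  image : ∀ {m n} → (Vector Carrier (suc m) → Vector Carrier (suc n)) →
          PointSet m → PointSet n
  image f S y = ∃ λ x → x ∈ S × y ∼ f x

  HasSize : ∀ {n} → ℕ → PointSet n → Set (c ⊔ ℓ)
  HasSize m S = ∃ λ (f : Fin m → _) →
    (∀ i → f i ∈ S) × (∀ i j → f i ∼ f j → i ≡ j) × (∀ x → x ∈ S → ∃ λ i → x ∼ f i)

  -- φ j is X ↦ X^(qʲ).
  φ : ∀ {n} → ℕ → Vector Carrier n → Vector Carrier n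
  φ j x i = x i ^ (q ℕ.^ j)

  Span : ∀ {n} → PointSet n → PointSet n
  Span {n} S x = ∃ λ m → ∃₂ λ (v : Fin m → Vector Carrier (suc n)) (a : Vector Carrier m) →
    (∀ i → v i ∈ S) × x ≋ (λ j → sum (λ i → a i * v i j))

  -- The subspace of PG(n,qᵏ) spanned by S, for S a set of points of PG(n,qᵏ).
  -- Coefficients range over the whole of K, so for S a subspace of PG(n,qʲ) with
  -- j ∣ k this is also the extension of S to PG(n,qᵏ).
  ⟨_⟩[_] : ∀ {n} → PointSet n → ℕ → PointSet n
  ⟨ S ⟩[ k ] = Span S ∩ PG _ k

  -- U is a d-dimensional subspace of PG(n,qᵏ), a basis being given by the columns
  -- of a matrix.
  IsSubspace : ∀ {n} (k d : ℕ) → PointSet n → Set (c ⊔ ℓ)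
  IsSubspace {n} k d U = ∃ λ (M : Matrix (suc n) (suc d)) →
    M Over k × Nonsingular M × U ≐ image (M *ᵥ_) (PG d k)

  -- The lines of the subplane are the lines of PG(2,q³) joining two of its points.
  record IsSubplane (S : PointSet 2) : Set (c ⊔ ℓ) where
    field
      ⊆PG       : S ⊆ PG 2 3
      respects  : ∀ x y → x ∼ y → y ∈ S → x ∈ S
      line-size : ∀ x y → x ∈ S → y ∈ S → ¬ (x ∼ y) →
                  HasSize (suc q) (S ∩ ⟨ points (x ∷ y ∷ []) ⟩[ 3 ])
      meet      : ∀ x y z w → x ∈ S → y ∈ S → z ∈ S → w ∈ S → ¬ (x ∼ y) → ¬ (z ∼ w) →
                  ∃ λ p → p ∈ S × p ∈ ⟨ points (x ∷ y ∷ []) ⟩[ 3 ] ×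
                          p ∈ ⟨ points (z ∷ w ∷ []) ⟩[ 3 ]
      quadrangle : ∃ λ (f : Fin 4 → _) → (∀ i → f i ∈ S) ×
                   (∀ i j k → ¬ (i ≡ j) → ¬ (j ≡ k) → ¬ (i ≡ k) →
                     ¬ (f i ∼ f j) × f k ∉ ⟨ points (f i ∷ f j ∷ []) ⟩[ 3 ])

  -- The quadratic form Σ Aᵢⱼ xᵢ xⱼ; A need not be symmetric, so that every form is
  -- obtained in characteristic 2 as well.
  eval : ∀ {n} → Matrix n n → Vector Carrier n → Carrier
  eval A x = sum (λ i → sum (λ j → A i j * (x i * x j)))

  polar : ∀ {n} → Matrix n n → Vector Carrier n → Vector Carrier n → Carrier
  polar A x y = sum (λ i → sum (λ j → A i j * (x i * y j + y i * x j)))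

  Quadric : ∀ {n} (k : ℕ) → Matrix (suc n) (suc n) → PointSet n
  Quadric k A x = x ∈ PG _ k × eval A x ≈ 0#

  -- There is no singular point. For a form over a subfield, singular points need
  -- not be sought beyond K: finite fields are perfect, so if there is one over some
  -- extension there is one over the field of the coefficients.
  Nondegenerate : ∀ {n} → Matrix (suc n) (suc n) → Set (c ⊔ ℓ)
  Nondegenerate A = ∀ x → ¬ (x ≋ 𝟎) → eval A x ≈ 0# → ¬ (∀ y → polar A x y ≈ 0#)

  IsConic : (k : ℕ) → PointSet 2 → Set (c ⊔ ℓ)
  IsConic k C = ∃ λ (A : Matrix 3 3) → A Over k × Nondegenerate A × C ≐ Quadric k A

  -- C is a non-degenerate conic of the subplane S, in coordinates on S coming from
  -- a homography of PG(2,q³) that takes PG(2,q) to S.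
  IsConicOf : PointSet 2 → PointSet 2 → Set (c ⊔ ℓ)
  IsConicOf S C = ∃₂ λ (M : Matrix 3 3) (A : Matrix 3 3) →
    M Over 3 × Nonsingular M × S ≐ image (M *ᵥ_) (PG 2 1) ×
    A Over 1 × Nondegenerate A × C ≐ image (M *ᵥ_) (Quadric 1 A)

  -- collineation B j is the j-th power of X ↦ B X^q.
  collineation : Matrix 3 3 → ℕ → Vector Carrier 3 → Vector Carrier 3
  collineation B j x = fold x (λ y → B *ᵥ φ 1 y) j

  record IsConjugation (S : PointSet 2) (B : Matrix 3 3) : Set (c ⊔ ℓ) where
    field
      over        : B Over 3
      nonsingular : Nonsingular B
      fixes       : ∀ x → x ∈ S → collineation B 1 x ∼ x
      cube        : ∀ x → x ∈ PG 2 3 → collineation B 3 x ∼ x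
      nontrivial  : ∃ λ x → x ∈ PG 2 3 × ¬ (collineation B 1 x ∼ x)

  moment : (r : ℕ) → Carrier → Vector Carrier (suc r)
  moment r θ i = θ ^ toℕ i

  e-last : (r : ℕ) → Vector Carrier (suc r)
  e-last zero    zero    = 1#
  e-last (suc r) zero    = 0#
  e-last (suc r) (suc i) = e-last r i

  -- An r-dimensional normal rational curve of PG(n,q): the standard one of PG(r,q),
  -- transported by the matrix to the r-space spanned by the columns. The matrix
  -- is kept because the pointset over the field of order q does not determine the
  -- extension when q + 1 < r + 3.
  record NormalRationalCurve (n r : ℕ) : Set (c ⊔ ℓ) where
    field
      matrix      : Matrix (suc n) (suc r)
      over        : matrix Over 1
      nonsingular : Nonsingular matrix

  -- The points over the field of order qᵏ of the (extended) curve.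
  curve : ∀ {n r} (k : ℕ) → NormalRationalCurve n r → PointSet n
  curve {r = r} k N y = (∃ λ θ → θ ∈ F k × y ∼ matrix *ᵥ moment r θ) ⊎ y ∼ matrix *ᵥ e-last r
    where open NormalRationalCurve N

  module Carriers (ℓ∞ : PointSet 2) (B : Matrix 3 3) where

    𝖼 : ℕ → Vector Carrier 3 → Vector Carrier 3
    𝖼 = collineation B

    IsCarrier : PointSet 2
    IsCarrier = (ℓ∞ ∩ image (𝖼 1) ℓ∞) ∪ (ℓ∞ ∩ image (𝖼 2) ℓ∞) ∪ (image (𝖼 1) ℓ∞ ∩ image (𝖼 2) ℓ∞)

  -- X ↦ G X identifies PG(2,q³) with the plane Γ of PG(8,q³), and PG(2,q⁶) with
  -- the extension of Γ.
  module Bose (G : Matrix 9 3) where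

    ι : Vector Carrier 3 → Vector Carrier 9
    ι x = G *ᵥ x

    Γ : PointSet 8
    Γ = image ι (PG 2 3)

    conjugates : PointSet 8 → PointSet 8
    conjugates S = S ∪ image (φ 1) S ∪ image (φ 2) S

    record IsBose : Set (c ⊔ ℓ) where
      field
        over        : G Over 3
        nonsingular : Nonsingular G
        disjoint    : Empty (Γ ∩ PG 8 1)
        spanning    : PG 8 3 ≐ ⟨ conjugates Γ ⟩[ 3 ]

    -- ⟨X, X^q, X^(q²)⟩ in PG(8,qᵏ), for X in Γ: the spread plane ⟦X⟧ for k = 1, the
    -- extended spread plane for k = 3.
    spreadPlane : (k : ℕ) → Vector Carrier 9 → PointSet 8
    spreadPlane k X = ⟨ points (X ∷ φ 1 X ∷ φ 2 X ∷ []) ⟩[ k ]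

    ⟦_⟧ : PointSet 2 → PointSet 8
    ⟦ C ⟧ y = ∃ λ x → x ∈ C × y ∈ spreadPlane 1 (ι x)

    module Scroll (B : Matrix 3 3) where

      scrollPlane : (k : ℕ) → Vector Carrier 3 → PointSet 8
      scrollPlane k x =
        ⟨ points (ι x ∷ φ 1 (ι (collineation B 5 x)) ∷ φ 2 (ι (collineation B 4 x)) ∷ []) ⟩[ k ]

      scroll : (k : ℕ) → PointSet 2 → PointSet 8
      scroll k C y = ∃ λ x → x ∈ C × y ∈ scrollPlane k x

      -- The points over the field of order qᵏ on all nine quadrics.
      Variety : (k : ℕ) → (Fin 9 → Matrix 9 9) → PointSet 8
      Variety k 𝒱 y = y ∈ PG 8 k × (∀ i → eval (𝒱 i) y ≈ 0#)

      -- 𝒱 is a system of nine quadrics of PG(8,q) whose intersection is 𝒱(⟦C⟧).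
      record IsVarietyOf (C C⁺ C⁺⁺ : PointSet 2) (𝒱 : Fin 9 → Matrix 9 9) : Set (c ⊔ ℓ) where
        field
          over       : ∀ i → 𝒱 i Over 1
          pointset   : Variety 1 𝒱 ≐ ⟦ C ⟧
          extension  : Variety 3 𝒱 ≐ scroll 3 C⁺
          extension² : Variety 6 𝒱 ≐ scroll 6 C⁺⁺

    module AtInfinity (ℓ∞ : PointSet 2) where

      g : PointSet 8
      g = image ι ℓ∞

      Σ∞ : PointSet 8
      Σ∞ = ⟨ conjugates g ⟩[ 1 ]

      IsTLine : PointSet 8 → Set (c ⊔ ℓ)
      IsTLine L = IsSubspace 3 1 L × L ⊆ ⟨ Σ∞ ⟩[ 3 ] ×
        ((L ≬ g × L ≬ image (φ 1) g) ⊎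
         (L ≬ g × L ≬ image (φ 2) g) ⊎
         (L ≬ image (φ 1) g × L ≬ image (φ 2) g))

-- Let N be a frame of the subplane in which the conic is {(1, θ, θ²)}, let u · y = 0 be the equation of ℓ∞ in
-- this frame, with u over F_{q³}, and let u′, u″ be the conjugates of u.  Absorbing N into the transversal plane Γ,
-- a point of the extended PG(8,q) becomes a triple (w₀, w₁, w₂) of vectors of length three, one for each conjugate
-- of Γ; it is rational exactly if w₁ and w₂ are the conjugates of w₀.  In these coordinates c_π is the Frobenius
-- map, a scroll-plane consists of the triples (a γ, b γ, c γ) with γ = (1, θ, θ²), and Σ₆ is given by
-- u · w₀ = u′ · w₁ = u″ · w₂ once u is suitably scaled.  So the variety meets Σ₆ where
-- a u(θ) = b u′(θ) = c u″(θ), with u(θ) = u₀ + u₁θ + u₂θ².  As u has no zero over F_q, the rational solutions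
-- form the curve θ ↦ (u′u″(θ), u″u(θ), uu′(θ)) ⊗ (1, θ, θ²) of degree six, which meets infinity at the zeros of
-- u, u′ and u″.  It is a normal rational curve if these quadratics are pairwise coprime.  A common zero of two of
-- them is a carrier on C⁺; then u, u′, u″ are up to scalars l₀l₁, l₁l₂, l₂l₀ with conjugate linear factors lⱼ,
-- the common factor l₀l₁l₂ drops out, and what remains is a cubic curve together with the lines over the zeros
-- of l₀, l₁, l₂, which lie at infinity.

module Submission where

open import Defs
open import Algebra.Bundles using (CommutativeRing; RawRing)
import Algebra.Properties.CommutativeMonoid.Sum as SumProperties
import Algebra.Properties.CommutativeSemiring.Binomial as BinomialTheorem
import Algebra.Properties.CommutativeSemiring.Exp as ExpProperties
import Algebra.Properties.Ring as RingProperties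
import Algebra.Properties.Semiring.Mult as MultProperties
import Algebra.Properties.Semiring.Mult.TCOptimised as MultTC
import Algebra.Properties.Semiring.Sum as SemiringSum
import Algebra.Solver.Ring
open import Algebra.Solver.Ring.AlmostCommutativeRing using (fromCommutativeRing; _-Raw-AlmostCommutative⟶_)
open import Data.Fin.Base as Fin using (Fin; zero; suc; toℕ; fromℕ; inject₁; inject≤; punchIn; _↑ˡ_; _↑ʳ_)
open import Data.Fin.Patterns using (0F; 1F; 2F; 3F; 4F)
open import Data.Fin.Permutation using (Permutation; permutation)
import Data.Fin.Properties as Fin
open import Data.Integer.Base as ℤ using (ℤ)
import Data.Integer.Properties as ℤ
open import Data.List.Base as List using (List)
open import Data.List.Relation.Unary.Any using (here; there)
open import Data.Maybe.Base using (Maybe; just; nothing)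
open import Data.Nat.Base as ℕ using (ℕ; zero; suc; z≤n; s≤s)
import Data.Nat.DivMod as ℕ
open import Data.Nat.Primality using (Prime; euclidsLemma; prime⇒nonTrivial; ¬prime[0]; ¬prime[1])
import Data.Nat.Properties as ℕ
import Data.Nat.Solver as ℕ-Solver
open import Data.Product.Base using (∃; ∃₂; _×_; _,_; proj₁; proj₂)
import Data.Sign.Base as Sign
open import Data.Sum.Base using (_⊎_; inj₁; inj₂; [_,_])
open import Data.Unit.Polymorphic.Base using (⊤; tt)
open import Data.Vec.Functional using (Vector; head; tail; removeAt; insertAt; replicate; _++_)
open import Data.Vec.Functional.Properties using (insertAt-lookup; insertAt-punchIn; lookup-++ˡ; lookup-++ʳ)
open import Function.Base using (_∘_)
open import Function.Bundles using (Inverse)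
open import Level as Level using (Level; _⊔_)
open import Relation.Binary.PropositionalEquality.Core as ≡ using (_≡_)
import Relation.Binary.Reasoning.Setoid as SetoidReasoning
open import Relation.Nullary.Decidable using (Dec; yes; no; map′; _×-dec_; ¬?; decidable-stable)
open import Relation.Nullary.Negation.Core using (¬_; contradiction)
open import Relation.Unary using (_∈_; _∉_; _⊆_; _≐_; _∩_; _∪_; Empty)

-- Two constraints shape the proof. It must be uniform in the characteristic: conics are treated
-- through a quadratic form and its polarisation, never by completing squares, and the quadratics
-- that have to split, for a rational point of the conic and for the zeros of u, are solved inside
-- `K` by counting, as F_{q²} and F_{q⁶} both lie in it. And all vectors have entries in `K`, so
-- rationality is always recovered as invariance under Frobenius; the descent of a Frobenius-stable
-- subspace to a rational vector is what makes u, u′, u″ independent when ℓ∞ misses the subplane.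
-- The bound q ≥ 6 enters through C⁺, of which only C ⊆ C⁺ is known: its equation at (1, θ, θ²) is a
-- quartic in θ, and five zeros in F_q force it to vanish identically. That the sextic spans a
-- 6-space is not read off a determinant. Its matrix acts on functionals on polynomials of degree at
-- most six as multiplication by u′u″, u″u and uu′, and a functional killed by two coprime
-- quadratics is zero. The two cases are separated by one question, whether E lies on C⁺: if so, the
-- other carrier on ℓ∞ does too, and u has no further zeros.

-- A ring solver with integer coefficients

module IntegerSolver {c ℓ : Level} (R : CommutativeRing c ℓ) where

  open import Data.Integer.Base using (+_; -[1+_]; _⊖_; _◃_)
  open CommutativeRing R
  open RingProperties ring
  -- For this version of the multiple `1 · 1#` reduces to `1#`, so the constant `con (ℤ.+ 1)`
  -- denotes the unit itself.
  open MultTC semiring using (×-homo-+; ×1-homo-*; 1+×) renaming (_×_ to _·_)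
  open SetoidReasoning setoid

  private
    ℤ-raw : RawRing _ _
    ℤ-raw = record
      { Carrier = ℤ ; _≈_ = _≡_ ; _+_ = ℤ._+_ ; _*_ = ℤ._*_ ; -_ = ℤ.-_ ; 0# = + 0 ; 1# = + 1 }

    ⟦_⟧ᶻ : ℤ → Carrier
    ⟦ + n ⟧ᶻ      = n · 1#
    ⟦ -[1+ n ] ⟧ᶻ = - (suc n · 1#)

    ⊖-homo : ∀ m n → ⟦ m ⊖ n ⟧ᶻ ≈ m · 1# - n · 1#
    ⊖-homo m zero = sym (trans (+-congˡ -0#≈0#) (+-identityʳ _))
    ⊖-homo zero (suc n) = sym (+-identityˡ _)
    ⊖-homo (suc m) (suc n) = begin
      ⟦ suc m ⊖ suc n ⟧ᶻ                    ≡⟨ ≡.cong ⟦_⟧ᶻ (ℤ.[1+m]⊖[1+n]≡m⊖n m n) ⟩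
      ⟦ m ⊖ n ⟧ᶻ                            ≈⟨ ⊖-homo m n ⟩
      m · 1# - n · 1#                       ≈⟨ +-congʳ (+-identityˡ _) ⟨
      0# + m · 1# - n · 1#                  ≈⟨ +-congʳ (+-congʳ (-‿inverseʳ 1#)) ⟨
      1# - 1# + m · 1# - n · 1#             ≈⟨ +-congʳ (+-assoc _ _ _) ⟩
      1# + (- 1# + m · 1#) - n · 1#         ≈⟨ +-congʳ (+-congˡ (+-comm _ _)) ⟩
      1# + (m · 1# - 1#) - n · 1#           ≈⟨ +-congʳ (+-assoc _ _ _) ⟨
      1# + m · 1# - 1# - n · 1#             ≈⟨ +-assoc _ _ _ ⟩
      1# + m · 1# + (- 1# - n · 1#)         ≈⟨ +-congˡ (-‿+-comm _ _) ⟩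
      1# + m · 1# - (1# + n · 1#)           ≈⟨ +-cong (1+× m 1#) (-‿cong (1+× n 1#)) ⟨
      suc m · 1# - suc n · 1#               ∎

    neg-homo : ∀ i → ⟦ ℤ.- i ⟧ᶻ ≈ - ⟦ i ⟧ᶻ
    neg-homo (+ zero)  = sym -0#≈0#
    neg-homo (+ suc n) = refl
    neg-homo -[1+ n ]  = sym (-‿involutive _)

    +-homo : ∀ i j → ⟦ i ℤ.+ j ⟧ᶻ ≈ ⟦ i ⟧ᶻ + ⟦ j ⟧ᶻ
    +-homo (+ m)    (+ n)    = ×-homo-+ 1# m n
    +-homo (+ m)    -[1+ n ] = ⊖-homo m (suc n)
    +-homo -[1+ m ] (+ n)    = trans (⊖-homo n (suc m)) (+-comm _ _)
    +-homo -[1+ m ] -[1+ n ] = begin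
      - (suc (suc (m ℕ.+ n)) · 1#)          ≡⟨ ≡.cong (λ k → - (suc k · 1#)) (ℕ+-suc m n) ⟨
      - ((suc m ℕ.+ suc n) · 1#)            ≈⟨ -‿cong (×-homo-+ 1# (suc m) (suc n)) ⟩
      - (suc m · 1# + suc n · 1#)           ≈⟨ -‿+-comm _ _ ⟨
      - (suc m · 1#) - suc n · 1#           ∎
      where
      ℕ+-suc : ∀ m n → m ℕ.+ suc n ≡ suc (m ℕ.+ n)
      ℕ+-suc zero    n = ≡.refl
      ℕ+-suc (suc m) n = ≡.cong suc (ℕ+-suc m n)

    ◃⁺ : ∀ n → ⟦ Sign.+ ◃ n ⟧ᶻ ≈ n · 1#
    ◃⁺ zero    = refl
    ◃⁺ (suc n) = refl

    ◃⁻ : ∀ n → ⟦ Sign.- ◃ n ⟧ᶻ ≈ - (n · 1#)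
    ◃⁻ zero    = sym -0#≈0#
    ◃⁻ (suc n) = refl

    *-homo : ∀ i j → ⟦ i ℤ.* j ⟧ᶻ ≈ ⟦ i ⟧ᶻ * ⟦ j ⟧ᶻ
    *-homo (+ m)    (+ n)    = trans (◃⁺ (m ℕ.* n)) (×1-homo-* m n)
    *-homo (+ m)    -[1+ n ] = trans (◃⁻ (m ℕ.* suc n)) (trans (-‿cong (×1-homo-* m (suc n))) (-‿distribʳ-* _ _))
    *-homo -[1+ m ] (+ n)    = trans (◃⁻ (suc m ℕ.* n)) (trans (-‿cong (×1-homo-* (suc m) n)) (-‿distribˡ-* _ _))
    *-homo -[1+ m ] -[1+ n ] = begin
      ⟦ Sign.+ ◃ (suc m ℕ.* suc n) ⟧ᶻ       ≈⟨ ◃⁺ (suc m ℕ.* suc n) ⟩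
      (suc m ℕ.* suc n) · 1#                ≈⟨ ×1-homo-* (suc m) (suc n) ⟩
      (suc m · 1#) * (suc n · 1#)           ≈⟨ -‿involutive _ ⟨
      - - ((suc m · 1#) * (suc n · 1#))     ≈⟨ -‿cong (-‿distribʳ-* _ _) ⟩
      - ((suc m · 1#) * - (suc n · 1#))     ≈⟨ -‿distribˡ-* _ _ ⟩
      - (suc m · 1#) * - (suc n · 1#)       ∎

    morphism : ℤ-raw -Raw-AlmostCommutative⟶ fromCommutativeRing R
    morphism = record
      { ⟦_⟧ = ⟦_⟧ᶻ ; +-homo = +-homo ; *-homo = *-homo ; -‿homo = neg-homo
      ; 0-homo = refl ; 1-homo = refl }

    -- Coefficients are compared as integers. In positive characteristic this overlooks
    -- coincidences, which is harmless: `nothing` claims no inequality.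
    coefficient≟ : ∀ i j → Maybe (⟦ i ⟧ᶻ ≈ ⟦ j ⟧ᶻ)
    coefficient≟ i j with i ℤ.≟ j
    ... | yes ≡.refl = just refl
    ... | no  _      = nothing

  open Algebra.Solver.Ring ℤ-raw (fromCommutativeRing R) morphism coefficient≟ public
    using (solve; _:=_; _:+_; _:*_; _:-_; :-_; con; Polynomial)

-- Binomial coefficients modulo p, and additivity of Frobenius

module BinomialCoefficients where

  open import Data.Nat.Base using (_∸_; _!)
  open import Data.Nat.Combinatorics using (_C_; nCk≡n!/k![n-k]!; k![n∸k]!∣n!)
  open import Data.Nat.Divisibility using (_∣_; ∣⇒≤; m∣m*n)

  ∤k! : ∀ {p} → Prime p → ∀ k → k ℕ.< p → ¬ (p ∣ k !)
  ∤k! pp zero k<p p∣1 with ∣⇒≤ p∣1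
  ... | p≤1 = ℕ.<⇒≱ (ℕ.nonTrivial⇒n>1 _ {{prime⇒nonTrivial pp}}) p≤1
  ∤k! pp (suc k) k<p p∣k! with euclidsLemma (suc k) (k !) pp p∣k!
  ... | inj₁ p∣1+k = ℕ.<⇒≱ k<p (∣⇒≤ p∣1+k)
  ... | inj₂ p∣k!′ = ∤k! pp k (ℕ.<-trans (ℕ.n<1+n k) k<p) p∣k!′

  -- The prime divides p! = (p C k) · k! · (p - k)!, but neither of the two factorials, whose
  -- factors are all smaller than p.
  p∣pCk : ∀ {p} → Prime p → ∀ k → 0 ℕ.< k → k ℕ.< p → p ∣ (p C k)
  p∣pCk {p} pp k 0<k k<p with euclidsLemma (p C k) (k ! ℕ.* (p ∸ k) !) pp p∣product
    where
    instance _ = k ℕ.!* (p ∸ k) !≢0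
    p! : p ! ≡ (p C k) ℕ.* (k ! ℕ.* (p ∸ k) !)
    p! = ≡.trans (≡.sym (ℕ.m/n*n≡m (k![n∸k]!∣n! (ℕ.<⇒≤ k<p))))
                 (≡.cong (ℕ._* (k ! ℕ.* (p ∸ k) !)) (≡.sym (nCk≡n!/k![n-k]! (ℕ.<⇒≤ k<p))))
    p∣p! : ∀ {n} → 0 ℕ.< n → n ∣ n !
    p∣p! {suc n} _ = m∣m*n (n !)
    p∣product : p ∣ (p C k) ℕ.* (k ! ℕ.* (p ∸ k) !)
    p∣product = ≡.subst (p ∣_) p! (p∣p! (ℕ.<-trans 0<k k<p))
  ... | inj₁ p∣ = p∣
  ... | inj₂ p∣k!* with euclidsLemma (k !) ((p ∸ k) !) pp p∣k!*
  ...   | inj₁ p∣k! = contradiction p∣k! (∤k! pp k k<p)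
  ...   | inj₂ p∣! = contradiction p∣! (∤k! pp (p ∸ k) (ℕ.∸-monoʳ-< 0<k (ℕ.<⇒≤ k<p)))

module Frobenius {c ℓ : Level} (R : CommutativeRing c ℓ) (p : ℕ) where

  open import Data.Nat.Base using (_∸_)
  open import Data.Nat.Combinatorics using (_C_; nCn≡1)
  open import Data.Nat.Divisibility using (_∣_; divides)
  open BinomialCoefficients using (p∣pCk)
  open CommutativeRing R hiding (zero)
  open ExpProperties commutativeSemiring
  open MultProperties semiring using (×-homo-1; ×-assocˡ; ×-assoc-*; ×-congʳ) renaming (_×_ to _·_)
  open SumProperties +-commutativeMonoid using (sum; sum-cong-≋; sum-init-last; sum-replicate-zero)
  open SetoidReasoning setoid
  module _ (pp : Prime p) (p×1≈0 : p · 1# ≈ 0#) where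

    multiple≈0 : ∀ {n} x → p ∣ n → n · x ≈ 0#
    multiple≈0 x (divides k ≡.refl) = begin
      (k ℕ.* p) · x         ≈⟨ ×-assocˡ x k p ⟨
      k · (p · x)           ≈⟨ ×-congʳ k (×-congʳ p (*-identityˡ x)) ⟨
      k · (p · (1# * x))    ≈⟨ ×-congʳ k (×-assoc-* p 1# x) ⟨
      k · ((p · 1#) * x)    ≈⟨ ×-congʳ k (trans (*-congʳ p×1≈0) (zeroˡ x)) ⟩
      k · 0#                ≈⟨ ×0 k ⟩
      0#                    ∎
      where
      ×0 : ∀ k → k · 0# ≈ 0#
      ×0 zero    = refl
      ×0 (suc k) = trans (+-identityˡ _) (×0 k)

    ^p-distrib-+ : ∀ x y → (x + y) ^ p ≈ x ^ p + y ^ p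
    ^p-distrib-+ x y = expand p pp multiple≈0
      where
      open BinomialTheorem commutativeSemiring using (theorem; binomial; binomialTerm)
      -- The prime becomes a variable again so that it can be split as 2 + n, which exposes the two
      -- extreme terms of the expansion; the vanishing of its multiples is all that is kept of the
      -- characteristic.
      expand : ∀ p → Prime p → (∀ {n} x → p ∣ n → n · x ≈ 0#) → (x + y) ^ p ≈ x ^ p + y ^ p
      expand zero pp _ = contradiction pp ¬prime[0]
      expand (suc zero) pp _ = contradiction pp ¬prime[1]
      expand (suc n@(suc _)) pp vanish = begin
        (x + y) ^ suc n                                ≈⟨ theorem (suc n) x y ⟩
        term zero + sum (term ∘ suc)                   ≈⟨ +-congˡ (sum-init-last (term ∘ suc)) ⟩
        term zero + (sum (term ∘ suc ∘ inject₁) + term (fromℕ (suc n)))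
          ≈⟨ +-cong bottom (+-cong middle top) ⟩
        y ^ suc n + (0# + x ^ suc n)                   ≈⟨ +-congˡ (+-identityˡ _) ⟩
        y ^ suc n + x ^ suc n                          ≈⟨ +-comm _ _ ⟩
        x ^ suc n + y ^ suc n                          ∎
        where
        term : Fin (suc (suc n)) → Carrier
        term = binomialTerm x y (suc n)
        bottom : term zero ≈ y ^ suc n
        bottom = trans (×-homo-1 _) (*-identityˡ _)
        middle : sum (term ∘ suc ∘ inject₁) ≈ 0#
        middle = trans (sum-cong-≋ (λ i → vanish (binomial x y (suc n) (suc (inject₁ i))) (p∣pCk pp _ (s≤s z≤n)
                   (s≤s (≡.subst (ℕ._< n) (≡.sym (Fin.toℕ-inject₁ i)) (Fin.toℕ<n i))))))
                   (sum-replicate-zero n)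
        last : ∀ m k → k ≡ m → (m C k) · (x ^ k * y ^ (m ∸ k)) ≈ x ^ m
        last m _ ≡.refl = begin
          (m C m) · (x ^ m * y ^ (m ∸ m))  ≡⟨ ≡.cong₂ (λ i j → i · (x ^ m * y ^ j)) (nCn≡1 m) (ℕ.n∸n≡0 m) ⟩
          1 · (x ^ m * 1#)                 ≈⟨ ×-homo-1 _ ⟩
          x ^ m * 1#                       ≈⟨ *-identityʳ _ ⟩
          x ^ m                            ∎
        top : term (fromℕ (suc n)) ≈ x ^ suc n
        top = last (suc n) _ (Fin.toℕ-fromℕ (suc n))

    ^pⁿ-distrib-+ : ∀ n x y → (x + y) ^ (p ℕ.^ n) ≈ x ^ (p ℕ.^ n) + y ^ (p ℕ.^ n)
    ^pⁿ-distrib-+ zero x y =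
      trans (*-identityʳ _) (sym (+-cong (*-identityʳ x) (*-identityʳ y)))
    ^pⁿ-distrib-+ (suc n) x y = begin
      (x + y) ^ (p ℕ.* p ℕ.^ n)                       ≈⟨ ^-assocʳ (x + y) p (p ℕ.^ n) ⟨
      ((x + y) ^ p) ^ (p ℕ.^ n)                       ≈⟨ ^-congˡ (p ℕ.^ n) (^p-distrib-+ x y) ⟩
      (x ^ p + y ^ p) ^ (p ℕ.^ n)                     ≈⟨ ^pⁿ-distrib-+ n _ _ ⟩
      (x ^ p) ^ (p ℕ.^ n) + (y ^ p) ^ (p ℕ.^ n)       ≈⟨ +-cong (^-assocʳ x p _) (^-assocʳ y p _) ⟩
      x ^ (p ℕ.* p ℕ.^ n) + y ^ (p ℕ.* p ℕ.^ n)       ∎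

-- Elementary properties of finite fields

module FiniteFieldProperties {c ℓ : Level} {N : ℕ} (K : FiniteField c ℓ N) where

  open FiniteField K hiding (zero)
  open Inverse enumeration using (to; from; to-cong; strictlyInverseˡ; strictlyInverseʳ)
  open ExpProperties commutativeSemiring
  open IntegerSolver commutativeRing
  open RingProperties ring using (-0#≈0#; -‿involutive; x+x≈x⇒x≈0; +-cancelˡ; -‿distribˡ-*; -‿distribʳ-*; -‿+-comm)
  open MultProperties semiring using (×1-homo-*) renaming (_×_ to _·_)
  open SumProperties +-commutativeMonoid using (sum; sum-cong-≋; sum-replicate; sum-permute; ∑-distrib-+)
  module ∏ = SumProperties *-commutativeMonoid
  open ∏ using () renaming (sum to product)
  open SetoidReasoning setoid

  infix 4 _≟_

  _≟_ : ∀ x y → Dec (x ≈ y)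
  x ≟ y = map′ (λ tx≡ty → trans (sym (strictlyInverseʳ x))
                 (trans (reflexive (≡.cong from tx≡ty)) (strictlyInverseʳ y)))
               to-cong (to x Fin.≟ to y)

  from-injective : ∀ i j → from i ≈ from j → i ≡ j
  from-injective i j eq =
    ≡.trans (≡.sym (strictlyInverseˡ i)) (≡.trans (to-cong eq) (strictlyInverseˡ j))

  x-y≈0⇒x≈y : ∀ {x y} → x - y ≈ 0# → x ≈ y
  x-y≈0⇒x≈y {x} {y} eq = begin
    x            ≈⟨ solve 2 (λ x y → x := (x :- y) :+ y) refl x y ⟩
    (x - y) + y  ≈⟨ +-congʳ eq ⟩
    0# + y       ≈⟨ +-identityˡ y ⟩
    y            ∎

  x≈y⇒x-y≈0 : ∀ {x y} → x ≈ y → x - y ≈ 0#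
  x≈y⇒x-y≈0 {x} {y} eq = trans (+-congʳ eq) (-‿inverseʳ y)

  *-cancelˡ-≉0 : ∀ {a x y} → ¬ (a ≈ 0#) → a * x ≈ a * y → x ≈ y
  *-cancelˡ-≉0 {a} {x} {y} a≉0 eq with inverse a a≉0
  ... | a⁻¹ , aa⁻¹≈1 = begin
    x                ≈⟨ cancel x ⟨
    a⁻¹ * (a * x)    ≈⟨ *-congˡ eq ⟩
    a⁻¹ * (a * y)    ≈⟨ cancel y ⟩
    y                ∎
    where
    cancel : ∀ z → a⁻¹ * (a * z) ≈ z
    cancel z = trans (sym (*-assoc _ _ _)) (trans (*-congʳ (trans (*-comm _ _) aa⁻¹≈1)) (*-identityˡ z))

  xy≈0⇒y≈0 : ∀ {x y} → ¬ (x ≈ 0#) → x * y ≈ 0# → y ≈ 0#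
  xy≈0⇒y≈0 x≉0 eq = *-cancelˡ-≉0 x≉0 (trans eq (sym (zeroʳ _)))

  xy≈0⇒x≈0⊎y≈0 : ∀ {x y} → x * y ≈ 0# → x ≈ 0# ⊎ y ≈ 0#
  xy≈0⇒x≈0⊎y≈0 {x} eq with x ≟ 0#
  ... | yes x≈0 = inj₁ x≈0
  ... | no  x≉0 = inj₂ (xy≈0⇒y≈0 x≉0 eq)

  xy≉0 : ∀ {x y} → ¬ (x ≈ 0#) → ¬ (y ≈ 0#) → ¬ (x * y ≈ 0#)
  xy≉0 x≉0 y≉0 eq = y≉0 (xy≈0⇒y≈0 x≉0 eq)

  x^n≉0 : ∀ {x} n → ¬ (x ≈ 0#) → ¬ (x ^ n ≈ 0#)
  x^n≉0 zero    x≉0 = 1≉0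
  x^n≉0 (suc n) x≉0 = xy≉0 x≉0 (x^n≉0 n x≉0)

  1^n≈1 : ∀ n → 1# ^ n ≈ 1#
  1^n≈1 zero    = refl
  1^n≈1 (suc n) = trans (*-identityˡ _) (1^n≈1 n)

  private
    inhabited⇒suc : ∀ {n} → Fin n → ∃ λ m → n ≡ suc m
    inhabited⇒suc {suc m} _ = m , ≡.refl

    -- Through the enumeration a bijection of the field permutes indices, so sums and products over
    -- all elements are invariant under it.
    bijection : (f g : Carrier → Carrier) → (∀ {x y} → x ≈ y → f x ≈ f y) → (∀ {x y} → x ≈ y → g x ≈ g y) →
                (∀ x → f (g x) ≈ x) → (∀ x → g (f x) ≈ x) → Permutation N N
    bijection f g f-cong g-cong fg gf =
      permutation (λ i → to (f (from i))) (λ i → to (g (from i)))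
        (λ i → ≡.trans (to-cong (trans (f-cong (strictlyInverseʳ _)) (fg _))) (strictlyInverseˡ i))
        (λ i → ≡.trans (to-cong (trans (g-cong (strictlyInverseʳ _)) (gf _))) (strictlyInverseˡ i))

  order≥2 : ∃ λ m → N ≡ suc (suc m)
  order≥2 = two-elements (to 1#) (to 0#) λ eq → 1≉0 (trans (sym (strictlyInverseʳ 1#))
    (trans (reflexive (≡.cong from eq)) (strictlyInverseʳ 0#)))
    where
    two-elements : ∀ {n} (i j : Fin n) → ¬ (i ≡ j) → ∃ λ m → n ≡ suc (suc m)
    two-elements {suc zero}    zero zero i≢j = contradiction ≡.refl i≢j
    two-elements {suc (suc m)} _    _    _   = m , ≡.refl

  -- Translation by 1 permutes the field, so the sum of all x equals the sum of all x + 1, which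
  -- exceeds it by N · 1.
  order·1≈0 : N · 1# ≈ 0#
  order·1≈0 = +-cancelˡ (sum from) _ _ (begin
    sum from + N · 1#                 ≈⟨ +-congˡ (sum-replicate N) ⟨
    sum from + sum (replicate N 1#)   ≈⟨ ∑-distrib-+ from (replicate N 1#) ⟨
    sum (λ i → from i + 1#)           ≈⟨ sum-cong-≋ (λ i → strictlyInverseʳ (from i + 1#)) ⟨
    sum (λ i → from (to (from i + 1#))) ≈⟨ sum-permute from shift ⟨
    sum from                          ≈⟨ +-identityʳ _ ⟨
    sum from + 0#                     ∎)
    where
    shift : Permutation N N
    shift = bijection (_+ 1#) (_- 1#) +-congʳ +-congʳ
      (solve 1 (λ x → (x :- con (ℤ.+ 1)) :+ con (ℤ.+ 1) := x) refl)
      (solve 1 (λ x → (x :+ con (ℤ.+ 1)) :- con (ℤ.+ 1) := x) refl)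

  -- From pⁿ · 1 = 0 the factors p · 1 are split off one at a time; a field has no zero divisors.
  characteristic : ∀ {p} n → N ≡ p ℕ.^ n → p · 1# ≈ 0#
  characteristic {p} n N≡pⁿ = root n (trans (reflexive (≡.cong (_· 1#) (≡.sym N≡pⁿ))) order·1≈0)
    where
    root : ∀ n → (p ℕ.^ n) · 1# ≈ 0# → p · 1# ≈ 0#
    root zero eq = contradiction (trans (sym (+-identityʳ 1#)) eq) 1≉0
    root (suc n) eq with xy≈0⇒x≈0⊎y≈0 (trans (sym (×1-homo-* p (p ℕ.^ n))) eq)
    ... | inj₁ p≈0 = p≈0
    ... | inj₂ pⁿ≈0 = root n pⁿ≈0

  -- In the product over all y of y (1 for y = 0), the substitution y ↦ x y brings
  -- out x for each y ≠ 0; the missing factor x is supplied by y = 0.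
  x^order≈x : ∀ x → x ^ N ≈ x
  x^order≈x x with x ≟ 0#
  ... | yes x≈0 = trans (^-congˡ N x≈0) (trans 0^N≈0 (sym x≈0))
    where
    0^N≈0 : 0# ^ N ≈ 0#
    0^N≈0 = trans (^-congʳ 0# (proj₂ (inhabited⇒suc (to 0#)))) (zeroˡ _)
  ... | no x≉0 with inverse x x≉0
  ...   | x⁻¹ , xx⁻¹≈1 = sym (*-cancelˡ-≉0 P≉0 (begin
    P * x                                           ≈⟨ *-cong (sum-permute-P) (sym (one-special N (strictlyInverseʳ 0#) from-zero)) ⟩
    product (λ i → unit (x * from i)) * product (λ i → special (from i))
      ≈⟨ ∏.∑-distrib-+ (λ i → unit (x * from i)) (λ i → special (from i)) ⟨
    product (λ i → unit (x * from i) * special (from i)) ≈⟨ ∏.sum-cong-≋ (λ i → pointwise (from i)) ⟩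
    product (λ i → x * unit (from i))                ≈⟨ ∏.∑-distrib-+ (λ _ → x) (λ i → unit (from i)) ⟩
    product (replicate N x) * P                      ≈⟨ *-congʳ (∏.sum-replicate N) ⟩
    x ^ N * P                                        ≈⟨ *-comm _ _ ⟩
    P * x ^ N                                        ∎))
    where
    unit special : Carrier → Carrier
    unit y with y ≟ 0#
    ... | yes _ = 1#
    ... | no  _ = y
    special y with y ≟ 0#
    ... | yes _ = x
    ... | no  _ = 1#

    unit-cong : ∀ {y z} → y ≈ z → unit y ≈ unit z
    unit-cong {y} {z} eq with y ≟ 0# | z ≟ 0#
    ... | yes _ | yes _ = refl
    ... | yes p | no np = contradiction (trans (sym eq) p) np
    ... | no np | yes p = contradiction (trans eq p) np
    ... | no _  | no _  = eq

    P : Carrier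
    P = product (λ i → unit (from i))

    P≉0 : ¬ (P ≈ 0#)
    P≉0 = product≉0 (λ i → unit (from i)) (λ i → unit≉0 (from i))
      where
      unit≉0 : ∀ y → ¬ (unit y ≈ 0#)
      unit≉0 y with y ≟ 0#
      ... | yes _ = 1≉0
      ... | no ny = ny
      product≉0 : ∀ {n} (f : Vector Carrier n) → (∀ i → ¬ (f i ≈ 0#)) → ¬ (product f ≈ 0#)
      product≉0 {zero}  f f≉0 = 1≉0
      product≉0 {suc n} f f≉0 = xy≉0 (f≉0 zero) (product≉0 (tail f) (f≉0 ∘ suc))

    sum-permute-P : P ≈ product (λ i → unit (x * from i))
    sum-permute-P = trans (∏.sum-permute (λ i → unit (from i)) scale)
      (∏.sum-cong-≋ (λ i → unit-cong (strictlyInverseʳ (x * from i))))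
      where
      scale : Permutation N N
      scale = bijection (x *_) (x⁻¹ *_) *-congˡ *-congˡ
        (λ y → trans (sym (*-assoc _ _ _)) (trans (*-congʳ xx⁻¹≈1) (*-identityˡ y)))
        (λ y → trans (sym (*-assoc _ _ _)) (trans (*-congʳ (trans (*-comm _ _) xx⁻¹≈1)) (*-identityˡ y)))

    pointwise : ∀ y → unit (x * y) * special y ≈ x * unit y
    pointwise y with y ≟ 0# | x * y ≟ 0#
    ... | yes _   | yes _    = *-comm _ _
    ... | yes y≈0 | no xy≉0′ = contradiction (trans (*-congˡ y≈0) (zeroʳ x)) xy≉0′
    ... | no y≉0  | yes xy≈0 = contradiction xy≈0 (xy≉0 x≉0 y≉0)
    ... | no _    | no _     = *-identityʳ _

    from-zero : ∀ i → from i ≈ 0# → i ≡ to 0#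
    from-zero i eq = ≡.trans (≡.sym (strictlyInverseˡ i)) (to-cong eq)

    special-0 : ∀ {y} → y ≈ 0# → special y ≈ x
    special-0 {y} y≈0 with y ≟ 0#
    ... | yes _  = refl
    ... | no y≉0 = contradiction y≈0 y≉0

    special-≉0 : ∀ {y} → ¬ (y ≈ 0#) → special y ≈ 1#
    special-≉0 {y} y≉0 with y ≟ 0#
    ... | yes y≈0 = contradiction y≈0 y≉0
    ... | no _    = refl

    one-special : ∀ n {f : Fin n → Carrier} {i₀} → f i₀ ≈ 0# → (∀ i → f i ≈ 0# → i ≡ i₀) →
                  product (λ i → special (f i)) ≈ x
    one-special (suc n) {f} {i₀} f₀ unique = begin
      product (special ∘ f)                                ≈⟨ ∏.sum-remove (special ∘ f) ⟩
      special (f i₀) * product (removeAt (special ∘ f) i₀) ≈⟨ *-cong (special-0 f₀) (∏.sum-cong-≋ others) ⟩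
      x * product (replicate n 1#)                         ≈⟨ *-congˡ (∏.sum-replicate-zero n) ⟩
      x * 1#                                               ≈⟨ *-identityʳ x ⟩
      x                                                    ∎
      where
      others : ∀ j → removeAt (special ∘ f) i₀ j ≈ 1#
      others j = special-≉0 (λ eq → Fin.punchInᵢ≢i i₀ j (unique _ eq))

-- Polynomial functions and the number of their roots

module PolynomialFunctions {c ℓ : Level} {N : ℕ} (K : FiniteField c ℓ N) where

  open FiniteField K hiding (zero)
  open FiniteFieldProperties K
  open Inverse enumeration using (to; from; to-cong; strictlyInverseˡ; strictlyInverseʳ)
  open ExpProperties commutativeSemiring
  open IntegerSolver commutativeRing
  open SetoidReasoning setoid

  horner : ∀ {n} → Vector Carrier n → Carrier → Carrier
  horner {zero}  c x = 0#
  horner {suc n} c x = head c + x * horner (tail c) x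

  horner-zero : ∀ {n} (c : Vector Carrier n) x → (∀ i → c i ≈ 0#) → horner c x ≈ 0#
  horner-zero {zero}  c x c≈0 = refl
  horner-zero {suc n} c x c≈0 =
    trans (+-cong (c≈0 zero) (trans (*-congˡ (horner-zero (tail c) x (c≈0 ∘ suc))) (zeroʳ x))) (+-identityˡ 0#)

  -- Synthetic division by x - a.
  quotient : ∀ {n} → Vector Carrier (suc n) → Carrier → Vector Carrier n
  quotient {suc n} c a zero    = horner (tail c) a
  quotient {suc n} c a (suc i) = quotient (tail c) a i

  horner-quotient : ∀ {n} (c : Vector Carrier (suc n)) a x →
                    horner c x - horner c a ≈ (x - a) * horner (quotient c a) x
  horner-quotient {zero} c a x =
    solve 3 (λ c x a → (c :+ x :* con (ℤ.+ 0)) :- (c :+ a :* con (ℤ.+ 0)) := (x :- a) :* con (ℤ.+ 0)) refl (c zero) x a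
  horner-quotient {suc n} c a x = begin
    (c zero + x * g x) - (c zero + a * g a)
      ≈⟨ solve 5 (λ c x a gx ga → (c :+ x :* gx) :- (c :+ a :* ga) := (x :- a) :* ga :+ x :* (gx :- ga)) refl (c zero) x a (g x) (g a) ⟩
    (x - a) * g a + x * (g x - g a)               ≈⟨ +-congˡ (*-congˡ (horner-quotient (tail c) a x)) ⟩
    (x - a) * g a + x * ((x - a) * h)
      ≈⟨ solve 4 (λ x a ga h → (x :- a) :* ga :+ x :* ((x :- a) :* h) := (x :- a) :* (ga :+ x :* h)) refl x a (g a) h ⟩
    (x - a) * (g a + x * h)                       ∎
    where
    g : Carrier → Carrier
    g = horner (tail c)
    h : Carrier
    h = horner (quotient (tail c) a) x

  -- Each coefficient of the quotient is the value at a of a tail of the polynomial. Going down from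
  -- the highest coefficient, every tail contributes only one term that is not yet known to vanish.
  quotient≈0⇒tail≈0 : ∀ {n} (c : Vector Carrier (suc n)) a →
                      (∀ i → quotient c a i ≈ 0#) → ∀ i → tail c i ≈ 0#
  quotient≈0⇒tail≈0 {suc n} c a q≈0 zero = begin
    c (suc zero)                                    ≈⟨ +-identityʳ _ ⟨
    c (suc zero) + 0#                               ≈⟨ +-congˡ (trans (*-congˡ (horner-zero (tail (tail c)) a tail≈0)) (zeroʳ a)) ⟨
    c (suc zero) + a * horner (tail (tail c)) a     ≈⟨ q≈0 zero ⟩
    0#                                              ∎
    where
    tail≈0 = quotient≈0⇒tail≈0 (tail c) a (q≈0 ∘ suc)
  quotient≈0⇒tail≈0 {suc n} c a q≈0 (suc i) = quotient≈0⇒tail≈0 (tail c) a (q≈0 ∘ suc) i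

  -- After division by x minus the first root, the other n - 1 points are roots of the quotient,
  -- which has one coefficient fewer.
  horner-roots : ∀ {n} (c : Vector Carrier n) (a : Fin n → Carrier) → (∀ i j → a i ≈ a j → i ≡ j) →
                 (∀ i → horner c (a i) ≈ 0#) → ∀ i → c i ≈ 0#
  horner-roots {suc n} c a distinct root = coefficient
    where
    tail≈0 : ∀ i → tail c i ≈ 0#
    tail≈0 = quotient≈0⇒tail≈0 c (a zero)
      (horner-roots (quotient c (a zero)) (a ∘ suc) (λ i j eq → Fin.suc-injective (distinct (suc i) (suc j) eq))
        λ i → xy≈0⇒y≈0 (λ eq → case-suc (distinct (suc i) zero (x-y≈0⇒x≈y eq)))
               (trans (sym (horner-quotient c (a zero) (a (suc i)))) (x≈y⇒x-y≈0 (trans (root (suc i)) (sym (root zero))))))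
      where
      case-suc : ∀ {n} {i : Fin n} → ¬ (suc i ≡ zero)
      case-suc ()
    coefficient : ∀ i → c i ≈ 0#
    coefficient zero = trans (sym (trans (+-congˡ (trans (*-congˡ (horner-zero (tail c) (a zero) tail≈0)) (zeroʳ _))) (+-identityʳ _))) (root zero)
    coefficient (suc i) = tail≈0 i

  -- Evidence in Horner form that a function is given by a monic polynomial of this degree. Products
  -- and sums are thus formed on functions, and only `monic-coefficients` extracts a coefficient
  -- vector.
  data Monic : ℕ → (Carrier → Carrier) → Set (c ⊔ ℓ) where
    one  : ∀ {f} → (∀ x → f x ≈ 1#) → Monic 0 f
    step : ∀ {n f g} b → Monic n g → (∀ x → f x ≈ b + x * g x) → Monic (suc n) f

  monic-coefficients : ∀ {n f} → Monic n f →
    ∃ λ (c : Vector Carrier (suc n)) → c (fromℕ n) ≈ 1# × (∀ x → f x ≈ horner c x)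
  monic-coefficients (one f≈1) =
    (λ _ → 1#) , refl , λ x → trans (f≈1 x) (sym (trans (+-congˡ (zeroʳ x)) (+-identityʳ 1#)))
  monic-coefficients {f = f} (step {n} {g = g} b m f≈) with monic-coefficients m
  ... | c , last≈1 , g≈ = c′ , last≈1 , λ x → trans (f≈ x) (+-congˡ (*-congˡ (g≈ x)))
    where
    c′ : Vector Carrier (suc (suc n))
    c′ zero    = b
    c′ (suc i) = c i

  monic-roots : ∀ {n f} → Monic n f → (a : Fin (suc n) → Carrier) → (∀ i j → a i ≈ a j → i ≡ j) →
                ¬ (∀ i → f (a i) ≈ 0#)
  monic-roots {n} m a distinct root with monic-coefficients m
  ... | c , last≈1 , f≈ =
    1≉0 (trans (sym last≈1) (horner-roots c a distinct (λ i → trans (sym (f≈ (a i))) (root i)) (fromℕ n)))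

  monic-cong : ∀ {n f g} → (∀ x → f x ≈ g x) → Monic n f → Monic n g
  monic-cong f≈g (one f≈1) = one λ x → trans (sym (f≈g x)) (f≈1 x)
  monic-cong f≈g (step b m f≈) = step b m λ x → trans (sym (f≈g x)) (f≈ x)

  monic-+-constant : ∀ {n f} b → Monic (suc n) f → Monic (suc n) (λ x → f x + b)
  monic-+-constant b (step a m f≈) =
    step (a + b) m λ x → trans (+-congʳ (f≈ x)) (solve 3 (λ a b y → a :+ y :+ b := a :+ b :+ y) refl a b _)

  monic-^-* : ∀ {n f} r → Monic n f → Monic (r ℕ.+ n) (λ x → x ^ r * f x)
  monic-^-* zero m = monic-cong (λ x → sym (*-identityˡ _)) m
  monic-^-* (suc r) m =
    step 0# (monic-^-* r m) λ x → trans (*-assoc _ _ _) (sym (+-identityˡ _))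

  monic-linear-* : ∀ {n f} a → Monic n f → Monic (suc n) (λ x → (x - a) * f x)
  monic-linear-* a (one f≈1) = step (- a) (one f≈1) λ x → trans (*-congˡ (f≈1 x))
    (trans (solve 2 (λ x a → (x :- a) :* con (ℤ.+ 1) := :- a :+ x :* con (ℤ.+ 1)) refl x a) (sym (+-congˡ (*-congˡ (f≈1 x)))))
  monic-linear-* a (step {g = g} b m f≈) =
    step (- (a * b)) (monic-+-constant b (monic-linear-* a m)) λ x → trans (*-congˡ (f≈ x))
      (solve 4 (λ x a b g → (x :- a) :* (b :+ x :* g) := :- (a :* b) :+ x :* ((x :- a) :* g :+ b)) refl x a b (g x))

  any-element? : ∀ {p} {P : Carrier → Set p} → (∀ {x y} → x ≈ y → P x → P y) → (∀ x → Dec (P x)) → Dec (∃ P)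
  any-element? resp P? = map′ (λ (i , p) → from i , p) (λ (x , p) → to x , resp (sym (strictlyInverseʳ x)) p)
    (Fin.any? (P? ∘ from))

  -- If P S vanishes on K and S has few roots, P has a root outside a given short list.
  cofactor⇒root : ∀ {n e S} (P : Carrier → Carrier) (a : Fin n → Carrier) → Monic e S → n ℕ.+ e ℕ.< N →
                  (∀ x → P x * S x ≈ 0#) → ∃ λ x → P x ≈ 0# × (∀ i → ¬ (x ≈ a i))
  cofactor⇒root {n} {e} {S} P a monic n+e<N PS≈0
    with Fin.any? (λ i → (P (from i) ≟ 0#) ×-dec ¬? (Fin.any? (λ j → from i ≟ a j)))
  ... | yes (i , Px≈0 , fresh) = from i , Px≈0 , λ j eq → fresh (j , eq)
  -- Otherwise S times the product of the x - aᵢ, monic of degree n + e < N, would vanish on all of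
  -- K.
  ... | no none = contradiction product-vanishes
        (monic-roots (product-monic a) (from ∘ λ i → inject≤ i n+e<N) λ i j eq → Fin.inject≤-injective _ _ i j (from-injective _ _ eq))
    where
    ∏S : ∀ {n} → (Fin n → Carrier) → Carrier → Carrier
    ∏S {zero}  a x = S x
    ∏S {suc n} a x = (x - a zero) * ∏S (a ∘ suc) x
    product-monic : ∀ {n} (a : Fin n → Carrier) → Monic (n ℕ.+ e) (∏S a)
    product-monic {zero}  a = monic
    product-monic {suc n} a = monic-linear-* (a zero) (product-monic (a ∘ suc))
    at-S-root : ∀ {n} (a : Fin n → Carrier) {x} → S x ≈ 0# → ∏S a x ≈ 0#
    at-S-root {zero}  a eq = eq
    at-S-root {suc n} a eq = trans (*-congˡ (at-S-root (a ∘ suc) eq)) (zeroʳ _)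
    at-a : ∀ {n} (a : Fin n → Carrier) {x} j → x ≈ a j → ∏S a x ≈ 0#
    at-a a zero    eq = trans (*-congʳ (x≈y⇒x-y≈0 eq)) (zeroˡ _)
    at-a a (suc j) eq = trans (*-congˡ (at-a (a ∘ suc) j eq)) (zeroʳ _)
    product-vanishes : ∀ i → ∏S a (from (inject≤ i n+e<N)) ≈ 0#
    product-vanishes i with xy≈0⇒x≈0⊎y≈0 (PS≈0 x) | Fin.any? (λ j → x ≟ a j)
      where x = from (inject≤ i n+e<N)
    ... | inj₂ Sx≈0 | _             = at-S-root a Sx≈0
    ... | inj₁ Px≈0 | yes (j , x≈a) = at-a a j x≈a
    ... | inj₁ Px≈0 | no fresh      = contradiction (_ , Px≈0 , fresh) none

  -- The sum of the x^(r(m-i)) b^i for i ≤ m, that is, the cofactor of x^r - b in x^(r(m+1)) -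
  -- b^(m+1).
  geometric : ℕ → ℕ → Carrier → Carrier → Carrier
  geometric r zero    b x = 1#
  geometric r (suc m) b x = x ^ r * geometric r m b x + b ^ suc m

  geometric-monic : ∀ r m b → Monic (m ℕ.* suc r) (geometric (suc r) m b)
  geometric-monic r zero    b = one λ _ → refl
  geometric-monic r (suc m) b = monic-+-constant (b ^ suc m) (monic-^-* (suc r) (geometric-monic r m b))

  geometric-* : ∀ r m b x → (x ^ r - b) * geometric r m b x ≈ x ^ (suc m ℕ.* r) - b ^ suc m
  geometric-* r zero b x = trans (*-identityʳ _) (+-cong (^-congʳ x (≡.sym (ℕ.+-identityʳ r))) (-‿cong (sym (*-identityʳ b))))
  geometric-* r (suc m) b x = begin
    (x ^ r - b) * (x ^ r * g + b ^ suc m)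
      ≈⟨ solve 4 (λ y b g d → (y :- b) :* (y :* g :+ d) := y :* ((y :- b) :* g) :+ (y :- b) :* d) refl (x ^ r) b g (b ^ suc m) ⟩
    x ^ r * ((x ^ r - b) * g) + (x ^ r - b) * b ^ suc m
      ≈⟨ +-congʳ (*-congˡ (geometric-* r m b x)) ⟩
    x ^ r * (x ^ (suc m ℕ.* r) - b ^ suc m) + (x ^ r - b) * b ^ suc m
      ≈⟨ solve 4 (λ y z b d → y :* (z :- d) :+ (y :- b) :* d := y :* z :- b :* d) refl (x ^ r) (x ^ (suc m ℕ.* r)) b (b ^ suc m) ⟩
    x ^ r * x ^ (suc m ℕ.* r) - b * b ^ suc m
      ≈⟨ +-congʳ (^-homo-* x r (suc m ℕ.* r)) ⟨
    x ^ (suc (suc m) ℕ.* r) - b ^ suc (suc m)  ∎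
    where g = geometric r m b x

  -- As b^(m+1) = 1, the polynomial x^(r+1) - b divides x^N - x, the cofactor being x times a
  -- geometric sum, of degree N - (r+1). So it has too many roots for n < r + 1 listed elements to
  -- exhaust them.
  power-roots : ∀ {n} r m b → N ≡ suc (suc m ℕ.* suc r) → b ^ suc m ≈ 1# → (a : Fin n → Carrier) → n ℕ.< suc r →
                ∃ λ x → x ^ suc r ≈ b × (∀ i → ¬ (x ≈ a i))
  power-roots {n} r m b N≡ bᵐ≈1 a n<r
    with cofactor⇒root (λ x → x ^ suc r - b) a (monic-^-* 1 (geometric-monic r m b)) bound vanish
    where
    bound : n ℕ.+ suc (m ℕ.* suc r) ℕ.< N
    bound = ≡.subst (n ℕ.+ suc (m ℕ.* suc r) ℕ.<_) (≡.sym (≡.trans N≡ (≡.sym (ℕ.+-suc (suc r) (m ℕ.* suc r)))))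
              (ℕ.+-monoˡ-< (suc (m ℕ.* suc r)) n<r)
    vanish : ∀ x → (x ^ suc r - b) * (x ^ 1 * geometric (suc r) m b x) ≈ 0#
    vanish x = begin
      (x ^ suc r - b) * (x ^ 1 * geometric (suc r) m b x)
        ≈⟨ solve 3 (λ p x g → p :* ((x :* con (ℤ.+ 1)) :* g) := x :* (p :* g)) refl _ x _ ⟩
      x * ((x ^ suc r - b) * geometric (suc r) m b x)       ≈⟨ *-congˡ (geometric-* (suc r) m b x) ⟩
      x * (x ^ (suc m ℕ.* suc r) - b ^ suc m)               ≈⟨ *-congˡ (+-congˡ (-‿cong bᵐ≈1)) ⟩
      x * (x ^ (suc m ℕ.* suc r) - 1#)
        ≈⟨ solve 2 (λ x y → x :* (y :- con (ℤ.+ 1)) := x :* y :- x) refl x _ ⟩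
      x ^ suc (suc m ℕ.* suc r) - x                         ≈⟨ x≈y⇒x-y≈0 (trans (^-congʳ x (≡.sym N≡)) (x^order≈x x)) ⟩
      0#                                                    ∎
  ... | x , eq , fresh = x , x-y≈0⇒x≈y eq , fresh

-- Roots of quadratics through the algebra K[t]/(t² + bt + d)

module QuadraticAlgebra {c ℓ : Level} (R : CommutativeRing c ℓ) (b d : CommutativeRing.Carrier R) where

  open CommutativeRing R hiding (zero)
  open IntegerSolver R
  open MultProperties semiring using () renaming (_×_ to _·_)

  -- R[t]/(t² + bt + d), with (u , v) standing for u + vt.
  quadraticAlgebra : CommutativeRing c ℓ
  quadraticAlgebra = record
    { Carrier = Carrier × Carrier
    ; _≈_ = λ (u , v) (u′ , v′) → u ≈ u′ × v ≈ v′
    ; _+_ = λ (u , v) (u′ , v′) → u + u′ , v + v′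
    ; _*_ = λ (u , v) (u′ , v′) → u * u′ - d * (v * v′) , u * v′ + v * u′ - b * (v * v′)
    ; -_ = λ (u , v) → - u , - v
    ; 0# = 0# , 0#
    ; 1# = 1# , 0#
    ; isCommutativeRing = record
      { isRing = record
        { +-isAbelianGroup = record
          { isGroup = record
            { isMonoid = record
              { isSemigroup = record
                { isMagma = record
                  { isEquivalence = record
                    { refl = refl , refl
                    ; sym = λ (p , q) → sym p , sym q
                    ; trans = λ (p , q) (p′ , q′) → trans p p′ , trans q q′ }
                  ; ∙-cong = λ (p , q) (p′ , q′) → +-cong p p′ , +-cong q q′ }
                ; assoc = λ _ _ _ → +-assoc _ _ _ , +-assoc _ _ _ }
              ; identity = (λ _ → +-identityˡ _ , +-identityˡ _) , (λ _ → +-identityʳ _ , +-identityʳ _) }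
            ; inverse = (λ _ → -‿inverseˡ _ , -‿inverseˡ _) , (λ _ → -‿inverseʳ _ , -‿inverseʳ _)
            ; ⁻¹-cong = λ (p , q) → -‿cong p , -‿cong q }
          ; comm = λ _ _ → +-comm _ _ , +-comm _ _ }
        ; *-cong = λ (p , q) (p′ , q′) →
            +-cong (*-cong p p′) (-‿cong (*-congˡ (*-cong q q′))) ,
            +-cong (+-cong (*-cong p q′) (*-cong q p′)) (-‿cong (*-congˡ (*-cong q q′)))
        ; *-assoc = λ (u , v) (u′ , v′) (u″ , v″) →
            solve 8 (λ b d u v u′ v′ u″ v″ →
              (u :* u′ :- d :* (v :* v′)) :* u″ :- d :* ((u :* v′ :+ v :* u′ :- b :* (v :* v′)) :* v″) :=
              u :* (u′ :* u″ :- d :* (v′ :* v″)) :- d :* (v :* (u′ :* v″ :+ v′ :* u″ :- b :* (v′ :* v″))))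
              refl b d u v u′ v′ u″ v″ ,
            solve 8 (λ b d u v u′ v′ u″ v″ →
              (u :* u′ :- d :* (v :* v′)) :* v″ :+ (u :* v′ :+ v :* u′ :- b :* (v :* v′)) :* u″
                :- b :* ((u :* v′ :+ v :* u′ :- b :* (v :* v′)) :* v″) :=
              u :* (u′ :* v″ :+ v′ :* u″ :- b :* (v′ :* v″)) :+ v :* (u′ :* u″ :- d :* (v′ :* v″))
                :- b :* (v :* (u′ :* v″ :+ v′ :* u″ :- b :* (v′ :* v″))))
              refl b d u v u′ v′ u″ v″
        ; *-identity = (λ (u , v) → one-* d u v , one-*′ u v) , (λ (u , v) → *-one d u v , *-one′ u v)
        ; distrib =
            (λ (u , v) (u′ , v′) (u″ , v″) →
              solve 7 (λ d u v u′ v′ u″ v″ → u :* (u′ :+ u″) :- d :* (v :* (v′ :+ v″)) :=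
                (u :* u′ :- d :* (v :* v′)) :+ (u :* u″ :- d :* (v :* v″))) refl d u v u′ v′ u″ v″ ,
              solve 7 (λ b u v u′ v′ u″ v″ → u :* (v′ :+ v″) :+ v :* (u′ :+ u″) :- b :* (v :* (v′ :+ v″)) :=
                (u :* v′ :+ v :* u′ :- b :* (v :* v′)) :+ (u :* v″ :+ v :* u″ :- b :* (v :* v″))) refl b u v u′ v′ u″ v″) ,
            (λ (u , v) (u′ , v′) (u″ , v″) →
              solve 7 (λ d u v u′ v′ u″ v″ → (u′ :+ u″) :* u :- d :* ((v′ :+ v″) :* v) :=
                (u′ :* u :- d :* (v′ :* v)) :+ (u″ :* u :- d :* (v″ :* v))) refl d u v u′ v′ u″ v″ ,
              solve 7 (λ b u v u′ v′ u″ v″ → (u′ :+ u″) :* v :+ (v′ :+ v″) :* u :- b :* ((v′ :+ v″) :* v) :=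
                (u′ :* v :+ v′ :* u :- b :* (v′ :* v)) :+ (u″ :* v :+ v″ :* u :- b :* (v″ :* v))) refl b u v u′ v′ u″ v″) }
      ; *-comm = λ (u , v) (u′ , v′) →
          +-cong (*-comm u u′) (-‿cong (*-congˡ (*-comm v v′))) ,
          solve 5 (λ b u v u′ v′ → u :* v′ :+ v :* u′ :- b :* (v :* v′) := u′ :* v :+ v′ :* u :- b :* (v′ :* v))
            refl b u v u′ v′ } }
    where
    one-* : ∀ d u v → 1# * u - d * (0# * v) ≈ u
    one-* = solve 3 (λ d u v → con (ℤ.+ 1) :* u :- d :* (con (ℤ.+ 0) :* v) := u) refl
    one-*′ : ∀ u v → 1# * v + 0# * u - b * (0# * v) ≈ v
    one-*′ = solve 3 (λ b u v → con (ℤ.+ 1) :* v :+ con (ℤ.+ 0) :* u :- b :* (con (ℤ.+ 0) :* v) := v) refl b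
    *-one : ∀ d u v → u * 1# - d * (v * 0#) ≈ u
    *-one = solve 3 (λ d u v → u :* con (ℤ.+ 1) :- d :* (v :* con (ℤ.+ 0)) := u) refl
    *-one′ : ∀ u v → u * 0# + v * 1# - b * (v * 0#) ≈ v
    *-one′ = solve 3 (λ b u v → u :* con (ℤ.+ 0) :+ v :* con (ℤ.+ 1) :- b :* (v :* con (ℤ.+ 0)) := v) refl b

  module A = CommutativeRing quadraticAlgebra
  open MultProperties A.semiring using () renaming (_×_ to _·ᴬ_)
  open ExpProperties A.commutativeSemiring using () renaming (_^_ to _^ᴬ_)
  open ExpProperties commutativeSemiring using (_^_)

  scalar : Carrier → A.Carrier
  scalar u = u , 0#

  scalar-· : ∀ n u → n ·ᴬ scalar u A.≈ scalar (n · u)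
  scalar-· zero    u = A.refl
  scalar-· (suc n) u = A.trans (A.+-congˡ {x = scalar u} (scalar-· n u)) (refl , +-identityˡ 0#)

  scalar-^ : ∀ n u → scalar u ^ᴬ n A.≈ scalar (u ^ n)
  scalar-^ zero    u = A.refl
  scalar-^ (suc n) u = A.trans (A.*-congˡ {x = scalar u} (scalar-^ n u))
    ( solve 3 (λ d u v → u :* v :- d :* (con (ℤ.+ 0) :* con (ℤ.+ 0)) := u :* v) refl d u (u ^ n)
    , solve 3 (λ b u v → u :* con (ℤ.+ 0) :+ con (ℤ.+ 0) :* v :- b :* (con (ℤ.+ 0) :* con (ℤ.+ 0)) := con (ℤ.+ 0)) refl b u (u ^ n))

-- Raising to the power pᵉ permutes the two roots of a quadratic whose coefficients it fixes.
module ConjugateRoots {c ℓ : Level} (R : CommutativeRing c ℓ) {p : ℕ} (pp : Prime p) (e : ℕ) where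

  open CommutativeRing R hiding (zero)
  open IntegerSolver R
  open ExpProperties commutativeSemiring
  open MultProperties semiring using () renaming (_×_ to _·_)
  open RingProperties ring using (x+x≈x⇒x≈0)
  open SetoidReasoning setoid

  module _ (p·1≈0 : p · 1# ≈ 0#) (domain : ∀ x y → x * y ≈ 0# → x ≈ 0# ⊎ y ≈ 0#)
           (t b d : Carrier) (b-fixed : b ^ (p ℕ.^ e) ≈ b) (d-fixed : d ^ (p ℕ.^ e) ≈ d)
           (t-root : t * t + b * t + d ≈ 0#) where

    private
      k : ℕ
      k = p ℕ.^ e

      additive : ∀ x y → (x + y) ^ k ≈ x ^ k + y ^ k
      additive = Frobenius.^pⁿ-distrib-+ R p pp p·1≈0 e

      0^k≈0 : 0# ^ k ≈ 0#
      0^k≈0 = x+x≈x⇒x≈0 _ (trans (sym (additive 0# 0#)) (^-congˡ k (+-identityʳ 0#)))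

      -≈0⇒≈ : ∀ {x y} → x - y ≈ 0# → x ≈ y
      -≈0⇒≈ {x} {y} eq = begin
        x            ≈⟨ solve 2 (λ x y → x := (x :- y) :+ y) refl x y ⟩
        (x - y) + y  ≈⟨ +-congʳ eq ⟩
        0# + y       ≈⟨ +-identityˡ y ⟩
        y            ∎

      z : Carrier
      z = t ^ k

      z-root : z * z + b * z + d ≈ 0#
      z-root = begin
        z * z + b * z + d                       ≈⟨ +-cong (+-cong (^-distrib-* t t k) (trans (^-distrib-* b t k) (*-congʳ b-fixed))) d-fixed ⟨
        (t * t) ^ k + (b * t) ^ k + d ^ k       ≈⟨ +-congʳ (additive (t * t) (b * t)) ⟨
        (t * t + b * t) ^ k + d ^ k             ≈⟨ additive (t * t + b * t) d ⟨
        (t * t + b * t + d) ^ k                 ≈⟨ ^-congˡ k t-root ⟩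
        0# ^ k                                  ≈⟨ 0^k≈0 ⟩
        0#                                      ∎

      z^k≈t : z ^ k ≈ t
      z^k≈t with domain (z - t) (z + b + t) (begin
          (z - t) * (z + b + t)
            ≈⟨ solve 4 (λ z t b d → (z :- t) :* (z :+ b :+ t) := (z :* z :+ b :* z :+ d) :- (t :* t :+ b :* t :+ d)) refl z t b d ⟩
          (z * z + b * z + d) - (t * t + b * t + d)
            ≈⟨ +-cong z-root (-‿cong t-root) ⟩
          0# - 0#
            ≈⟨ -‿inverseʳ 0# ⟩
          0# ∎)
      ... | inj₁ z-t≈0 = trans (^-congˡ k (-≈0⇒≈ z-t≈0)) (-≈0⇒≈ z-t≈0)
      -- Here z is the other root: z + b + t = 0, and the k-th power of this relation reads z^k + b
      -- + z = 0.
      ... | inj₂ z+b+t≈0 = -≈0⇒≈ (begin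
        z ^ k - t
          ≈⟨ solve 4 (λ w t b z → w :- t := (w :+ b :+ z) :- (z :+ b :+ t)) refl (z ^ k) t b z ⟩
        (z ^ k + b + z) - (z + b + t)
          ≈⟨ +-cong conjugate-sum (-‿cong z+b+t≈0) ⟩
        0# - 0#
          ≈⟨ -‿inverseʳ 0# ⟩
        0# ∎)
        where
        conjugate-sum : z ^ k + b + z ≈ 0#
        conjugate-sum = begin
          z ^ k + b + t ^ k         ≈⟨ +-congʳ (+-congˡ b-fixed) ⟨
          z ^ k + b ^ k + t ^ k     ≈⟨ +-congʳ (additive z b) ⟨
          (z + b) ^ k + t ^ k       ≈⟨ additive (z + b) t ⟨
          (z + b + t) ^ k           ≈⟨ ^-congˡ k z+b+t≈0 ⟩
          0# ^ k                    ≈⟨ 0^k≈0 ⟩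
          0#                        ∎

    t^[k*k]^j≈t : ∀ j → t ^ ((k ℕ.* k) ℕ.^ j) ≈ t
    t^[k*k]^j≈t zero    = *-identityʳ t
    t^[k*k]^j≈t (suc j) = trans (sym (^-assocʳ t (k ℕ.* k) ((k ℕ.* k) ℕ.^ j)))
      (trans (^-congˡ ((k ℕ.* k) ℕ.^ j) (trans (sym (^-assocʳ t k k)) z^k≈t)) (t^[k*k]^j≈t j))

-- If f = x² + bx + d had no root, K[t]/(f) would be a domain in which t^N = t, so f would divide x^N - x;
-- but the cofactor, of degree N - 2, cannot vanish on all of K.
module QuadraticRoots {c ℓ : Level} {N : ℕ} (K : FiniteField c ℓ N) {p : ℕ} (pp : Prime p) (n : ℕ) (N≡pⁿ : N ≡ p ℕ.^ n) where

  open FiniteField K hiding (zero)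
  open FiniteFieldProperties K
  open PolynomialFunctions K
  open ExpProperties commutativeSemiring
  open IntegerSolver commutativeRing
  open SetoidReasoning setoid

  -- The order of the field has to be a power of k² for k = p^e: raising to the power k may exchange
  -- the two roots, and only its square is sure to fix t.
  module _ (e j : ℕ) (b d : Carrier) (N≡ : N ≡ (p ℕ.^ e ℕ.* p ℕ.^ e) ℕ.^ suc j)
           (b-fixed : b ^ (p ℕ.^ e) ≈ b) (d-fixed : d ^ (p ℕ.^ e) ≈ d) where

    open QuadraticAlgebra commutativeRing b d
    open ExpProperties A.commutativeSemiring using () renaming (_^_ to _^ᴬ_)

    private
      k : ℕ
      k = p ℕ.^ e

      f : Carrier → Carrier
      f x = x * x + b * x + d

      t : A.Carrier
      t = 0# , 1#

      -- The quotient of x^m by f. The remainder has the coordinates of t^m in K[t]/(f) as its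
      -- coefficients, so the powers of t drive the recursion.
      cofactor : ℕ → Carrier → Carrier
      cofactor zero    x = 0#
      cofactor (suc m) x = x * cofactor m x + proj₂ (t ^ᴬ m)

      remainder : ∀ m x → x ^ m ≈ proj₁ (t ^ᴬ m) + proj₂ (t ^ᴬ m) * x + f x * cofactor m x
      remainder zero x = solve 2 (λ x f → con (ℤ.+ 1) := con (ℤ.+ 1) :+ con (ℤ.+ 0) :* x :+ f :* con (ℤ.+ 0)) refl x (f x)
      remainder (suc m) x = trans (*-congˡ (remainder m x))
        (solve 6 (λ x b d u v s →
            x :* (u :+ v :* x :+ (x :* x :+ b :* x :+ d) :* s) :=
            (con (ℤ.+ 0) :* u :- d :* (con (ℤ.+ 1) :* v)) :+ (con (ℤ.+ 0) :* v :+ con (ℤ.+ 1) :* u :- b :* (con (ℤ.+ 1) :* v)) :* x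
              :+ (x :* x :+ b :* x :+ d) :* (x :* s :+ v))
          refl x b d (proj₁ (t ^ᴬ m)) (proj₂ (t ^ᴬ m)) (cofactor m x))

      cofactor-monic : ∀ m → Monic m (cofactor (suc (suc m)))
      cofactor-monic zero = one λ x →
        solve 2 (λ x b → x :* (x :* con (ℤ.+ 0) :+ con (ℤ.+ 0)) :+ (con (ℤ.+ 0) :* con (ℤ.+ 0) :+ con (ℤ.+ 1) :* con (ℤ.+ 1) :- b :* (con (ℤ.+ 1) :* con (ℤ.+ 0))) := con (ℤ.+ 1)) refl x b
      cofactor-monic (suc m) = step (proj₂ (t ^ᴬ suc (suc m))) (cofactor-monic m) λ x → +-comm _ _

      β δ : A.Carrier
      β = scalar b
      δ = scalar d

      t-root : t A.* t A.+ β A.* t A.+ δ A.≈ A.0#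
      t-root =
        solve 2 (λ b d → (con (ℤ.+ 0) :* con (ℤ.+ 0) :- d :* (con (ℤ.+ 1) :* con (ℤ.+ 1))) :+ (b :* con (ℤ.+ 0) :- d :* (con (ℤ.+ 0) :* con (ℤ.+ 1))) :+ d := con (ℤ.+ 0)) refl b d ,
        solve 1 (λ b → (con (ℤ.+ 0) :* con (ℤ.+ 1) :+ con (ℤ.+ 1) :* con (ℤ.+ 0) :- b :* (con (ℤ.+ 1) :* con (ℤ.+ 1))) :+ (b :* con (ℤ.+ 1) :+ con (ℤ.+ 0) :* con (ℤ.+ 0) :- b :* (con (ℤ.+ 0) :* con (ℤ.+ 1))) :+ con (ℤ.+ 0) := con (ℤ.+ 0)) refl b

    module _ (no-root : ∀ x → ¬ (f x ≈ 0#)) where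

      private
        -- The expression is the norm of u + vt. If it vanishes with v ≠ 0, then -u/v is a root of
        -- f.
        norm≈0⇒≈0 : ∀ u v → u * u - b * u * v + d * v * v ≈ 0# → u ≈ 0# × v ≈ 0#
        norm≈0⇒≈0 u v eq with v ≟ 0#
        ... | no v≉0 = let w , vw≈1 = inverse v v≉0 in contradiction (begin
          f (- (u * w))
            ≈⟨ solve 5 (λ u v w b d → (:- (u :* w)) :* (:- (u :* w)) :+ b :* (:- (u :* w)) :+ d
                 := w :* w :* (u :* u :- b :* u :* v :+ d :* v :* v) :+ (v :* w :- con (ℤ.+ 1)) :* (b :* u :* w :- d :* (v :* w :+ con (ℤ.+ 1)))) refl u v w b d ⟩
          w * w * (u * u - b * u * v + d * v * v) + (v * w - 1#) * (b * u * w - d * (v * w + 1#))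
            ≈⟨ +-cong (trans (*-congˡ eq) (zeroʳ _)) (trans (*-congʳ (x≈y⇒x-y≈0 vw≈1)) (zeroˡ _)) ⟩
          0# + 0#  ≈⟨ +-identityˡ 0# ⟩
          0#       ∎) (no-root (- (u * w)))
        ... | yes v≈0 with u ≟ 0#
        ...   | yes u≈0 = u≈0 , v≈0
        ...   | no u≉0 = contradiction (begin
          u * u                             ≈⟨ solve 1 (λ u → u :* u := u :* u :- con (ℤ.+ 0) :+ con (ℤ.+ 0)) refl u ⟩
          u * u - 0# + 0#                   ≈⟨ +-cong (+-congˡ (-‿cong (trans (*-congˡ v≈0) (zeroʳ _)))) (trans (*-congˡ v≈0) (zeroʳ _)) ⟨
          u * u - b * u * v + d * v * v     ≈⟨ eq ⟩
          0#                                ∎) (xy≉0 u≉0 u≉0)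

        -- The norm of u + vt is the determinant of multiplication by it; when this is nonzero,
        -- Cramer's rule shows that the other factor is zero.
        domain : ∀ x y → x A.* y A.≈ A.0# → x A.≈ A.0# ⊎ y A.≈ A.0#
        domain (u , v) (u′ , v′) (eq₁ , eq₂) with u * u - b * u * v + d * v * v ≟ 0#
        ... | yes norm≈0 = inj₁ (norm≈0⇒≈0 u v norm≈0)
        ... | no norm≉0 = inj₂
          ( xy≈0⇒y≈0 norm≉0 (trans
              (solve 6 (λ u v u′ v′ b d → (u :* u :- b :* u :* v :+ d :* v :* v) :* u′ :=
                 (u :- b :* v) :* (u :* u′ :- d :* (v :* v′)) :+ d :* v :* (u :* v′ :+ v :* u′ :- b :* (v :* v′))) refl u v u′ v′ b d)
              (trans (+-cong (trans (*-congˡ eq₁) (zeroʳ _)) (trans (*-congˡ eq₂) (zeroʳ _))) (+-identityˡ 0#)))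
          , xy≈0⇒y≈0 norm≉0 (trans
              (solve 6 (λ u v u′ v′ b d → (u :* u :- b :* u :* v :+ d :* v :* v) :* v′ :=
                 u :* (u :* v′ :+ v :* u′ :- b :* (v :* v′)) :+ (:- v) :* (u :* u′ :- d :* (v :* v′))) refl u v u′ v′ b d)
              (trans (+-cong (trans (*-congˡ eq₂) (zeroʳ _)) (trans (*-congˡ eq₁) (zeroʳ _))) (+-identityˡ 0#))) )

        t^N≈t : t ^ᴬ N A.≈ t
        t^N≈t = ≡.subst (λ m → t ^ᴬ m A.≈ t) (≡.sym N≡) (ConjugateRoots.t^[k*k]^j≈t quadraticAlgebra pp e
          (A.trans (scalar-· p 1#) (characteristic n N≡pⁿ , refl)) domain t β δ
          (A.trans (scalar-^ k b) (b-fixed , refl)) (A.trans (scalar-^ k d) (d-fixed , refl)) t-root (suc j))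

        f*cofactor≈0 : ∀ x → f x * cofactor N x ≈ 0#
        f*cofactor≈0 x = begin
          f x * cofactor N x
            ≈⟨ solve 2 (λ y x → y := (con (ℤ.+ 0) :+ con (ℤ.+ 1) :* x :+ y) :- x) refl (f x * cofactor N x) x ⟩
          (0# + 1# * x + f x * cofactor N x) - x
            ≈⟨ +-congʳ (+-congʳ (+-cong (proj₁ t^N≈t) (*-congʳ (proj₂ t^N≈t)))) ⟨
          (proj₁ (t ^ᴬ N) + proj₂ (t ^ᴬ N) * x + f x * cofactor N x) - x
            ≈⟨ +-congʳ (remainder N x) ⟨
          x ^ N - x
            ≈⟨ x≈y⇒x-y≈0 (x^order≈x x) ⟩
          0# ∎

      cofactor-root : ∃ λ x → f x ≈ 0#
      cofactor-root =
        let m , N≡2+m = order≥2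
            x , fx≈0 , _ = cofactor⇒root {n = 0} f (λ ()) (cofactor-monic m)
              (≡.subst (m ℕ.<_) (≡.sym N≡2+m) (ℕ.m<n⇒m<1+n (ℕ.n<1+n m)))
              (≡.subst (λ m → ∀ x → f x * cofactor m x ≈ 0#) N≡2+m f*cofactor≈0)
        in x , fx≈0

    quadratic-root : ∃ λ x → f x ≈ 0#
    quadratic-root with any-element? {P = λ x → f x ≈ 0#} f-resp (λ x → f x ≟ 0#)
      where
      f-resp : ∀ {x y} → x ≈ y → f x ≈ 0# → f y ≈ 0#
      f-resp x≈y = trans (sym (+-congʳ (+-cong (*-cong x≈y x≈y) (*-congˡ x≈y))))
    ... | yes root = root
    ... | no none  = cofactor-root (λ x fx≈0 → none (x , fx≈0))

module Plane {c ℓ : Level} (q : ℕ) (q-primePower : IsPrimePower q) (6≤q : 6 ℕ.≤ q)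
             (K : FiniteField c ℓ (q ℕ.^ 6)) where

  open FiniteField K hiding (zero)
  open FiniteFieldProperties K
  open PolynomialFunctions K
  open Geometry q K
  open ExpProperties commutativeSemiring
  open IntegerSolver commutativeRing
  open SemiringSum semiring
    using (sum; sum-cong-≋; sum-replicate-zero; sum-remove; ∑-distrib-+; ∑-comm; *-distribˡ-sum; *-distribʳ-sum)
  open SetoidReasoning setoid

  -- The Frobenius maps and the subfields of K

  module Subfields where

    open RingProperties ring using (x+x≈x⇒x≈0; +-cancelˡ)

    private
      p e : ℕ
      p = proj₁ q-primePower
      e = suc (proj₁ (proj₂ q-primePower))
      pp : Prime p
      pp = proj₁ (proj₂ (proj₂ q-primePower))

      q^≡p^ : ∀ k → q ℕ.^ k ≡ p ℕ.^ (e ℕ.* k)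
      q^≡p^ k = ≡.trans (≡.cong (ℕ._^ k) (proj₂ (proj₂ (proj₂ q-primePower)))) (ℕ.^-*-assoc p e k)

    frob : ℕ → Carrier → Carrier
    frob k x = x ^ (q ℕ.^ k)

    frob-cong : ∀ k {x y} → x ≈ y → frob k x ≈ frob k y
    frob-cong k = ^-congˡ (q ℕ.^ k)

    frob-+ : ∀ k x y → frob k (x + y) ≈ frob k x + frob k y
    frob-+ k x y = ≡.subst (λ m → (x + y) ^ m ≈ x ^ m + y ^ m) (≡.sym (q^≡p^ k))
      (Frobenius.^pⁿ-distrib-+ commutativeRing p pp (characteristic {p} (e ℕ.* 6) (q^≡p^ 6)) (e ℕ.* k) x y)

    frob-* : ∀ k x y → frob k (x * y) ≈ frob k x * frob k y
    frob-* k x y = ^-distrib-* x y (q ℕ.^ k)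

    frob-1 : ∀ k → frob k 1# ≈ 1#
    frob-1 k = 1^n≈1 (q ℕ.^ k)

    frob-0 : ∀ k → frob k 0# ≈ 0#
    frob-0 k = x+x≈x⇒x≈0 _ (trans (sym (frob-+ k 0# 0#)) (frob-cong k (+-identityʳ 0#)))

    frob-neg : ∀ k x → frob k (- x) ≈ - frob k x
    frob-neg k x = +-cancelˡ (frob k x) _ _ (begin
      frob k x + frob k (- x)   ≈⟨ frob-+ k x (- x) ⟨
      frob k (x - x)            ≈⟨ frob-cong k (-‿inverseʳ x) ⟩
      frob k 0#                 ≈⟨ frob-0 k ⟩
      0#                        ≈⟨ -‿inverseʳ (frob k x) ⟨
      frob k x - frob k x       ∎)

    frob-≉0 : ∀ k {x} → ¬ (x ≈ 0#) → ¬ (frob k x ≈ 0#)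
    frob-≉0 k = x^n≉0 (q ℕ.^ k)

    frob-∘ : ∀ j k x → frob j (frob k x) ≈ frob (k ℕ.+ j) x
    frob-∘ j k x = trans (^-assocʳ x (q ℕ.^ k) (q ℕ.^ j)) (^-congʳ x (≡.sym (ℕ.^-distribˡ-+-* q k j)))

    frob-6 : ∀ x → frob 6 x ≈ x
    frob-6 = x^order≈x

    frob-0th : ∀ x → frob 0 x ≈ x
    frob-0th = *-identityʳ

    F? : ∀ k x → Dec (x ∈ F k)
    F? k x = frob k x ≟ x

    F-cong : ∀ k {x y} → x ≈ y → x ∈ F k → y ∈ F k
    F-cong k x≈y x∈F = trans (frob-cong k (sym x≈y)) (trans x∈F x≈y)

    F-+ : ∀ k {x y} → x ∈ F k → y ∈ F k → (x + y) ∈ F k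
    F-+ k p q = trans (frob-+ k _ _) (+-cong p q)

    F-* : ∀ k {x y} → x ∈ F k → y ∈ F k → (x * y) ∈ F k
    F-* k p q = trans (frob-* k _ _) (*-cong p q)

    F-neg : ∀ k {x} → x ∈ F k → (- x) ∈ F k
    F-neg k p = trans (frob-neg k _) (-‿cong p)

    F-sub : ∀ k {x y} → x ∈ F k → y ∈ F k → (x - y) ∈ F k
    F-sub k p q = F-+ k p (F-neg k q)

    F-0 : ∀ k → 0# ∈ F k
    F-0 = frob-0

    F-1 : ∀ k → 1# ∈ F k
    F-1 = frob-1

    F-frob : ∀ j k {x} → x ∈ F k → frob j x ∈ F k
    F-frob j k {x} p = trans (frob-∘ k j x)
      (trans (^-congʳ x (≡.cong (q ℕ.^_) (ℕ.+-comm j k))) (trans (sym (frob-∘ j k x)) (frob-cong j p)))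

    F₁⊆F : ∀ k {x} → x ∈ F 1 → x ∈ F k
    F₁⊆F zero    {x} p = frob-0th x
    F₁⊆F (suc k) {x} p = trans (sym (frob-∘ k 1 x)) (trans (frob-cong k p) (F₁⊆F k p))

    F-inverse : ∀ k {x y} → x ∈ F k → x * y ≈ 1# → y ∈ F k
    F-inverse k {x} {y} x∈F xy≈1 = *-cancelˡ-≉0 x≉0 (begin
      x * frob k y           ≈⟨ *-congʳ x∈F ⟨
      frob k x * frob k y    ≈⟨ frob-* k x y ⟨
      frob k (x * y)         ≈⟨ frob-cong k xy≈1 ⟩
      frob k 1#              ≈⟨ frob-1 k ⟩
      1#                     ≈⟨ xy≈1 ⟨
      x * y                  ∎)
      where
      x≉0 : ¬ (x ≈ 0#)
      x≉0 x≈0 = 1≉0 (trans (sym xy≈1) (trans (*-congʳ x≈0) (zeroˡ y)))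

    -- Used for k = 1, j = 2 and for k = 3, j = 0: the quadratic extensions of F_q and of F_{q³} are
    -- contained in K.
    quadratic-root : ∀ k j → (k ℕ.+ k) ℕ.* suc j ≡ 6 → ∀ b d → b ∈ F k → d ∈ F k → ∃ λ x → x * x + b * x + d ≈ 0#
    quadratic-root k j eq b d b∈F d∈F = QuadraticRoots.quadratic-root K pp (e ℕ.* 6) (q^≡p^ 6) (e ℕ.* k) j b d
      (≡.trans (≡.cong (q ℕ.^_) (≡.sym eq)) (≡.trans (≡.sym (ℕ.^-*-assoc q (k ℕ.+ k) (suc j)))
        (≡.cong (ℕ._^ suc j) (≡.trans (ℕ.^-distribˡ-+-* q k k) (≡.cong₂ ℕ._*_ (q^≡p^ k) (q^≡p^ k))))))
      (≡.subst (λ m → b ^ m ≈ b) (q^≡p^ k) b∈F) (≡.subst (λ m → d ^ m ≈ d) (q^≡p^ k) d∈F)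

    private
      s : ℕ
      s = q ℕ.∸ 2

      q≡2+s : q ≡ suc (suc s)
      q≡2+s = ≡.sym (ℕ.m+[n∸m]≡n (ℕ.≤-trans (s≤s (s≤s z≤n)) 6≤q))

      unit-power : ∀ {x} → ¬ (x ≈ 0#) → x ∈ F 1 → x ^ suc s ≈ 1#
      unit-power {x} x≉0 x∈F = *-cancelˡ-≉0 x≉0 (trans
        (^-congʳ x (≡.trans (≡.sym q≡2+s) (≡.sym (ℕ.*-identityʳ q)))) (trans x∈F (sym (*-identityʳ x))))

      unit-power⇒F₁ : ∀ {x} → x ^ suc s ≈ 1# → x ∈ F 1
      unit-power⇒F₁ {x} eq = trans (^-congʳ x (≡.trans (ℕ.*-identityʳ q) q≡2+s)) (trans (*-congˡ eq) (*-identityʳ x))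

      open ℕ-Solver.+-*-Solver using () renaming (solve to solveℕ; _:+_ to _⊕_; _:*_ to _⊗_; _:=_ to _⊜_; con to conℕ)

      -- The factorisation q⁶ - 1 = (q - 1)(q⁴ + q² + 1)(q + 1), shaped for extracting (q+1)-th
      -- roots by `power-roots`.
      order-norm : ∀ q r → q ≡ r ℕ.+ 1 → q ℕ.^ 6 ≡ suc (r ℕ.* suc (q ℕ.* q ℕ.* (q ℕ.* q) ℕ.+ q ℕ.* q) ℕ.* suc q)
      order-norm _ r ≡.refl = solveℕ 1 (λ r → let q = r ⊕ conℕ 1 in
        q ⊗ (q ⊗ (q ⊗ (q ⊗ (q ⊗ (q ⊗ conℕ 1))))) ⊜
        conℕ 1 ⊕ r ⊗ (conℕ 1 ⊕ (q ⊗ q ⊗ (q ⊗ q) ⊕ q ⊗ q)) ⊗ (conℕ 1 ⊕ q)) ≡.refl r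

      -- The factorisation q⁶ - 1 = (1 + q + ... + q⁵)(q - 1), shaped for finding (q-1)-th roots of
      -- unity by `power-roots`.
      order-units : ∀ q r → q ≡ r ℕ.+ 1 → q ℕ.^ 6 ≡ suc (suc (q ℕ.+ q ℕ.* q ℕ.+ q ℕ.* q ℕ.* q ℕ.+ q ℕ.* q ℕ.* q ℕ.* q ℕ.+ q ℕ.* q ℕ.* q ℕ.* q ℕ.* q) ℕ.* r)
      order-units _ r ≡.refl = solveℕ 1 (λ r → let q = r ⊕ conℕ 1 in
        q ⊗ (q ⊗ (q ⊗ (q ⊗ (q ⊗ (q ⊗ conℕ 1))))) ⊜
        conℕ 1 ⊕ (conℕ 1 ⊕ (q ⊕ q ⊗ q ⊕ q ⊗ q ⊗ q ⊕ q ⊗ q ⊗ q ⊗ q ⊕ q ⊗ q ⊗ q ⊗ q ⊗ q)) ⊗ r) ≡.refl r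

      q≡r+1 : q ≡ suc s ℕ.+ 1
      q≡r+1 = ≡.trans q≡2+s (≡.cong suc (ℕ.+-comm 1 s))

    -- What is sought is a (q+1)-th root of b. It exists in K because b^(q-1) = 1, so that b to the
    -- power (q⁶ - 1)/(q + 1) is 1.
    norm-surjective : ∀ {b} → ¬ (b ≈ 0#) → b ∈ F 1 → ∃ λ w → w * frob 1 w ≈ b
    norm-surjective {b} b≉0 b∈F =
      -- The argument T₀ + s(1 + T₀) is the predecessor of (q - 1)(q⁴ + q² + 1), as `power-roots`
      -- counts its exponent from one.
      let w , w^[1+q]≈b , _ = power-roots {n = 0} q (T₀ ℕ.+ s ℕ.* suc T₀) b (order-norm q (suc s) q≡r+1) power (λ ()) (s≤s z≤n)
      in w , trans (*-congˡ (^-congʳ w (ℕ.*-identityʳ q))) w^[1+q]≈b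
      where
      T₀ : ℕ
      T₀ = q ℕ.* q ℕ.* (q ℕ.* q) ℕ.+ q ℕ.* q
      power : b ^ (suc s ℕ.* suc T₀) ≈ 1#
      power = trans (sym (^-assocʳ b (suc s) (suc T₀))) (trans (^-congˡ (suc T₀) (unit-power b≉0 b∈F)) (1^n≈1 (suc T₀)))

    -- They are (q-1)-th roots of unity, of which there are q - 1 ≥ 5; here q ≥ 6 is used in full.
    -- Five is one more than the degree of the quartic that they have to annihilate.
    five-elements : ∃ λ (a : Fin 5 → Carrier) → (∀ i j → a i ≈ a j → i ≡ j) × (∀ i → a i ∈ F 1)
    five-elements = let a , distinct , unit = units 5 (ℕ.s≤s⁻¹ (≡.subst (6 ℕ.≤_) q≡2+s 6≤q))
                    in a , distinct , λ i → unit-power⇒F₁ (unit i)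
      where
      T₁ : ℕ
      T₁ = q ℕ.+ q ℕ.* q ℕ.+ q ℕ.* q ℕ.* q ℕ.+ q ℕ.* q ℕ.* q ℕ.* q ℕ.+ q ℕ.* q ℕ.* q ℕ.* q ℕ.* q
      Units : ℕ → Set _
      Units n = ∃ λ (a : Fin n → Carrier) → (∀ i j → a i ≈ a j → i ≡ j) × (∀ i → a i ^ suc s ≈ 1#)
      extend : ∀ {n} ((a , _) : Units n) → (∃ λ x → x ^ suc s ≈ 1# × (∀ i → ¬ (x ≈ a i))) → Units (suc n)
      extend {n} (a , distinct , unit) (x , x^r≈1 , fresh) = a′ , distinct′ , unit′
        where
        a′ : Fin (suc n) → Carrier
        a′ zero    = x
        a′ (suc i) = a i
        distinct′ : ∀ i j → a′ i ≈ a′ j → i ≡ j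
        distinct′ zero    zero    _  = ≡.refl
        distinct′ zero    (suc j) eq = contradiction eq (fresh j)
        distinct′ (suc i) zero    eq = contradiction (sym eq) (fresh i)
        distinct′ (suc i) (suc j) eq = ≡.cong suc (distinct i j eq)
        unit′ : ∀ i → a′ i ^ suc s ≈ 1#
        unit′ zero    = x^r≈1
        unit′ (suc i) = unit i
      units : ∀ n → n ℕ.≤ suc s → Units n
      units zero    _   = (λ ()) , (λ ()) , λ ()
      units (suc n) n<r = extend units-n (power-roots s T₁ 1# (order-units q (suc s) q≡r+1) (1^n≈1 (suc T₁)) (proj₁ units-n) n<r)
        where
        units-n : Units n
        units-n = units n (ℕ.<⇒≤ n<r)

  -- Linear algebra over K

  module LinearAlgebra where

    ≋-refl : ∀ {n} {x : Vector Carrier n} → x ≋ x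
    ≋-refl i = refl

    ≋-sym : ∀ {n} {x y : Vector Carrier n} → x ≋ y → y ≋ x
    ≋-sym p i = sym (p i)

    ≋-trans : ∀ {n} {x y z : Vector Carrier n} → x ≋ y → y ≋ z → x ≋ z
    ≋-trans p q i = trans (p i) (q i)

    infixl 6 _⊕_
    infixr 7 _⊙_

    _⊕_ : ∀ {n} → Vector Carrier n → Vector Carrier n → Vector Carrier n
    (x ⊕ y) i = x i + y i

    _⊙_ : ∀ {n} → Carrier → Vector Carrier n → Vector Carrier n
    (a ⊙ x) i = a * x i

    ⊕-cong : ∀ {n} {x x′ y y′ : Vector Carrier n} → x ≋ x′ → y ≋ y′ → x ⊕ y ≋ x′ ⊕ y′
    ⊕-cong p q i = +-cong (p i) (q i)

    ⊙-cong : ∀ {n} {a b} {x y : Vector Carrier n} → a ≈ b → x ≋ y → a ⊙ x ≋ b ⊙ y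
    ⊙-cong p q i = *-cong p (q i)

    ⊙-congˡ : ∀ {n} {a b} (x : Vector Carrier n) → a ≈ b → a ⊙ x ≋ b ⊙ x
    ⊙-congˡ x p i = *-congʳ p

    ⊙-congʳ : ∀ {n} a {x y : Vector Carrier n} → x ≋ y → a ⊙ x ≋ a ⊙ y
    ⊙-congʳ a p i = *-congˡ (p i)

    ⊙-assoc : ∀ {n} a b (x : Vector Carrier n) → (a * b) ⊙ x ≋ a ⊙ b ⊙ x
    ⊙-assoc a b x i = *-assoc a b (x i)

    1⊙ : ∀ {n} (x : Vector Carrier n) → 1# ⊙ x ≋ x
    1⊙ x i = *-identityˡ (x i)

    0⊙ : ∀ {n} (x : Vector Carrier n) → 0# ⊙ x ≋ 𝟎
    0⊙ x i = zeroˡ (x i)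

    δ : ∀ {n} → Fin n → Vector Carrier n
    δ zero    zero    = 1#
    δ zero    (suc _) = 0#
    δ (suc _) zero    = 0#
    δ (suc j) (suc i) = δ j i

    sum-δ : ∀ {n} (x : Vector Carrier n) i → sum (λ j → x j * δ j i) ≈ x i
    sum-δ {suc n} x zero = trans
      (+-cong (*-identityʳ _) (trans (sum-cong-≋ {n} (λ j → zeroʳ (x (suc j)))) (sum-replicate-zero n))) (+-identityʳ _)
    sum-δ {suc n} x (suc i) = trans (+-cong (zeroʳ _) (sum-δ (tail x) i)) (+-identityˡ _)

    zero? : ∀ {n} (x : Vector Carrier n) → Dec (x ≋ 𝟎)
    zero? x = Fin.all? (λ i → x i ≟ 0#)

    nonzero-entry : ∀ {n} {x : Vector Carrier n} → ¬ (x ≋ 𝟎) → ∃ λ i → ¬ (x i ≈ 0#)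
    nonzero-entry {n} {x} x≉0 = Fin.¬∀⟶∃¬ n _ (λ i → x i ≟ 0#) x≉0

    record Linear {m n} (f : Vector Carrier m → Vector Carrier n) : Set (c ⊔ ℓ) where
      field
        cong   : ∀ {x y} → x ≋ y → f x ≋ f y
        homo-⊕ : ∀ x y → f (x ⊕ y) ≋ f x ⊕ f y
        homo-⊙ : ∀ a x → f (a ⊙ x) ≋ a ⊙ f x

      homo-𝟎 : f 𝟎 ≋ 𝟎
      homo-𝟎 i = trans (cong {y = 0# ⊙ 𝟎} (λ _ → sym (zeroˡ 0#)) i) (trans (homo-⊙ 0# 𝟎 i) (zeroˡ _))

      homo-sum : ∀ {k} (a : Vector Carrier k) (v : Fin k → Vector Carrier m) →
                 f (λ i → sum (λ j → a j * v j i)) ≋ (λ i → sum (λ j → a j * f (v j) i))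
      homo-sum {zero}  a v = homo-𝟎
      homo-sum {suc k} a v i = trans (homo-⊕ (a zero ⊙ v zero) (λ i → sum (λ j → a (suc j) * v (suc j) i)) i)
        (+-cong (homo-⊙ (a zero) (v zero) i) (homo-sum (tail a) (v ∘ suc) i))

    matrixOf : ∀ {m n} → (Vector Carrier m → Vector Carrier n) → Matrix n m
    matrixOf f i j = f (δ j) i

    matrixOf-*ᵥ : ∀ {m n} {f : Vector Carrier m → Vector Carrier n} → Linear f → ∀ x → matrixOf f *ᵥ x ≋ f x
    matrixOf-*ᵥ {f = f} f-linear x i = begin
      sum (λ j → f (δ j) i * x j)   ≈⟨ sum-cong-≋ (λ j → *-comm (f (δ j) i) (x j)) ⟩
      sum (λ j → x j * f (δ j) i)   ≈⟨ homo-sum x δ i ⟨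
      f (λ i → sum (λ j → x j * δ j i)) i ≈⟨ cong (sum-δ x) i ⟩
      f x i                         ∎
      where open Linear f-linear

    *ᵥ-linear : ∀ {m n} (A : Matrix m n) → Linear (A *ᵥ_)
    *ᵥ-linear A = record
      { cong   = λ x≋y i → sum-cong-≋ (λ j → *-congˡ (x≋y j))
      ; homo-⊕ = λ x y i → trans (sum-cong-≋ (λ j → distribˡ (A i j) (x j) (y j)))
                              (∑-distrib-+ (λ j → A i j * x j) (λ j → A i j * y j))
      ; homo-⊙ = λ a x i → trans (sum-cong-≋ (λ j → x∙yz≈y∙xz (A i j) a (x j)))
                              (sym (*-distribˡ-sum a (λ j → A i j * x j))) }
      where
      x∙yz≈y∙xz : ∀ x y z → x * (y * z) ≈ y * (x * z)
      x∙yz≈y∙xz = solve 3 (λ x y z → x :* (y :* z) := y :* (x :* z)) refl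

    abstract

      -- Gaussian elimination on the first equation. If it is trivial, it is dropped and the first
      -- unknown set to 0; otherwise the pivot unknown is eliminated from the remaining equations.
      -- Either way m equations in m + 1 unknowns remain.
      kernel : ∀ {m} (A : Matrix m (suc m)) → ∃ λ x → ¬ (x ≋ 𝟎) × A *ᵥ x ≋ 𝟎
      kernel {zero} A = (λ _ → 1#) , (λ eq → 1≉0 (eq zero)) , λ ()
      kernel {suc m} A with Fin.any? (λ j → ¬? (A zero j ≟ 0#))
      ... | no none =
        let x′ , x′≉0 , Ax′≈0 = kernel (λ i j → A (suc i) (suc j))
        in x x′ , (λ eq → x′≉0 (eq ∘ suc)) , vanish x′ Ax′≈0
        where
        x : Vector Carrier (suc m) → Vector Carrier (suc (suc m))
        x x′ zero    = 0#
        x x′ (suc i) = x′ i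
        vanish : ∀ x′ → (λ i j → A (suc i) (suc j)) *ᵥ x′ ≋ 𝟎 → A *ᵥ x x′ ≋ 𝟎
        vanish x′ _ zero = trans
          (sum-cong-≋ (λ j → trans (*-congʳ (decidable-stable (A zero j ≟ 0#) (λ A≉0 → none (j , A≉0)))) (zeroˡ (x x′ j))))
          (sum-replicate-zero (suc (suc m)))
        vanish x′ Ax′≈0 (suc i) = trans (+-cong (zeroʳ _) (Ax′≈0 i)) (+-identityˡ 0#)
      ... | yes (j , pivot≉0) =
        let x′ , x′≉0 , A′x′≈0 = kernel A′
            S : Fin (suc m) → Carrier
            S i = sum (λ k → A i (punchIn j k) * x′ k)
            x = insertAt x′ j (- (a⁻¹ * S zero))
            Ax≈ : ∀ i → (A *ᵥ x) i ≈ A i j * - (a⁻¹ * S zero) + S i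
            Ax≈ i = trans (sum-remove {i = j} (λ k → A i k * x k))
              (+-cong (*-congˡ (reflexive (insertAt-lookup x′ j _)))
                      (sum-cong-≋ (λ k → *-congˡ {x = A i (punchIn j k)} (reflexive (insertAt-punchIn x′ j (- (a⁻¹ * S zero)) k)))))
            vanish : A *ᵥ x ≋ 𝟎
            vanish = λ where
              zero → trans (Ax≈ zero) (begin
                A zero j * - (a⁻¹ * S zero) + S zero
                  ≈⟨ solve 3 (λ p r s → p :* (:- (r :* s)) :+ s := (con (ℤ.+ 1) :- p :* r) :* s) refl (A zero j) a⁻¹ (S zero) ⟩
                (1# - A zero j * a⁻¹) * S zero   ≈⟨ *-congʳ (x≈y⇒x-y≈0 (sym aa⁻¹≈1)) ⟩
                0# * S zero                      ≈⟨ zeroˡ _ ⟩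
                0#                               ∎)
              (suc i) → trans (Ax≈ (suc i)) (trans (eliminated x′ i) (A′x′≈0 i))
        in x , (λ x≋0 → x′≉0 (λ k → trans (reflexive (≡.sym (insertAt-punchIn x′ j _ k))) (x≋0 (punchIn j k)))) , vanish
        where
        a⁻¹ : Carrier
        a⁻¹ = proj₁ (inverse (A zero j) pivot≉0)
        aa⁻¹≈1 : A zero j * a⁻¹ ≈ 1#
        aa⁻¹≈1 = proj₂ (inverse (A zero j) pivot≉0)
        A′ : Matrix m (suc m)
        A′ i k = A (suc i) (punchIn j k) - A (suc i) j * (a⁻¹ * A zero (punchIn j k))
        eliminated : ∀ x′ i → A (suc i) j * - (a⁻¹ * sum (λ k → A zero (punchIn j k) * x′ k)) + sum (λ k → A (suc i) (punchIn j k) * x′ k)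
                     ≈ (A′ *ᵥ x′) i
        eliminated x′ i = sym (begin
          sum (λ k → A′ i k * x′ k)
            ≈⟨ sum-cong-≋ (λ k → solve 5 (λ b p r s x → (b :- p :* (r :* s)) :* x := (p :* (:- r)) :* (s :* x) :+ b :* x) refl
                 (A (suc i) (punchIn j k)) (A (suc i) j) a⁻¹ (A zero (punchIn j k)) (x′ k)) ⟩
          sum (λ k → (A (suc i) j * - a⁻¹) * (A zero (punchIn j k) * x′ k) + A (suc i) (punchIn j k) * x′ k)
            ≈⟨ ∑-distrib-+ (λ k → (A (suc i) j * - a⁻¹) * (A zero (punchIn j k) * x′ k)) (λ k → A (suc i) (punchIn j k) * x′ k) ⟩
          sum (λ k → (A (suc i) j * - a⁻¹) * (A zero (punchIn j k) * x′ k)) + S′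
            ≈⟨ +-congʳ (*-distribˡ-sum (A (suc i) j * - a⁻¹) (λ k → A zero (punchIn j k) * x′ k)) ⟨
          (A (suc i) j * - a⁻¹) * S₀ + S′
            ≈⟨ +-congʳ (solve 3 (λ p r s → (p :* (:- r)) :* s := p :* (:- (r :* s))) refl (A (suc i) j) a⁻¹ S₀) ⟩
          A (suc i) j * - (a⁻¹ * S₀) + S′ ∎)
          where
          S₀ S′ : Carrier
          S₀ = sum (λ k → A zero (punchIn j k) * x′ k)
          S′ = sum (λ k → A (suc i) (punchIn j k) * x′ k)

      -- The columns of M together with v are n + 1 vectors in dimension n, hence dependent. The
      -- coefficient of v in the relation cannot be zero, and dividing by it expresses v.
      nonsingular⇒surjective : ∀ {n} (M : Matrix n n) → Nonsingular M → ∀ v → ∃ λ x → M *ᵥ x ≋ v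
      nonsingular⇒surjective {n} M M-nonsingular v =
        let x , x≉0 , v∣Mx≈0 = kernel v∣M
            s≉0 : ¬ (x zero ≈ 0#)
            s≉0 = λ s≈0 → x≉0 λ where
              zero    → s≈0
              (suc i) → M-nonsingular (tail x) (λ i → trans (sym (trans (+-congʳ (trans (*-congˡ s≈0) (zeroʳ (v i)))) (+-identityˡ _))) (v∣Mx≈0 i)) i
            s⁻¹ , ss⁻¹≈1 = inverse (x zero) s≉0
        in (- s⁻¹) ⊙ tail x , λ i → begin
          (M *ᵥ ((- s⁻¹) ⊙ tail x)) i
            ≈⟨ Linear.homo-⊙ (*ᵥ-linear M) (- s⁻¹) (tail x) i ⟩
          - s⁻¹ * (M *ᵥ tail x) i
            ≈⟨ solve 4 (λ r m v s → :- r :* m := :- r :* (v :* s :+ m) :+ v :* (s :* r)) refl s⁻¹ _ (v i) (x zero) ⟩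
          - s⁻¹ * (v i * x zero + (M *ᵥ tail x) i) + v i * (x zero * s⁻¹)
            ≈⟨ +-cong (trans (*-congˡ (v∣Mx≈0 i)) (zeroʳ _)) (*-congˡ ss⁻¹≈1) ⟩
          0# + v i * 1#
            ≈⟨ trans (+-identityˡ _) (*-identityʳ _) ⟩
          v i ∎
        where
        v∣M : Matrix n (suc n)
        v∣M i zero    = v i
        v∣M i (suc j) = M i j

    -- A right inverse W of M is nonsingular, hence onto. Writing x = W y, from M x = 0 follows y =
    -- M W y = 0.
    surjective⇒nonsingular : ∀ {n} (M : Matrix n n) → (∀ v → ∃ λ x → M *ᵥ x ≋ v) → Nonsingular M
    surjective⇒nonsingular {n} M M-surjective x Mx≋0 =
      let y , Wy≋x = nonsingular⇒surjective W W-nonsingular x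
      in ≋-trans (≋-sym Wy≋x) (≋-trans (W.cong (≋-trans (≋-sym (MW y)) (≋-trans (M.cong Wy≋x) Mx≋0))) W.homo-𝟎)
      where
      W : Matrix n n
      W i j = proj₁ (M-surjective (δ j)) i
      module M = Linear (*ᵥ-linear M)
      module W = Linear (*ᵥ-linear W)
      MW : ∀ y → M *ᵥ (W *ᵥ y) ≋ y
      MW y i = begin
        (M *ᵥ (W *ᵥ y)) i
          ≈⟨ M.cong (λ k → sum-cong-≋ (λ j → *-comm (W k j) (y j))) i ⟩
        (M *ᵥ (λ k → sum (λ j → y j * W k j))) i
          ≈⟨ M.homo-sum y (λ j k → W k j) i ⟩
        sum (λ j → y j * (M *ᵥ (λ k → W k j)) i)
          ≈⟨ sum-cong-≋ (λ j → *-congˡ {x = y j} (proj₂ (M-surjective (δ j)) i)) ⟩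
        sum (λ j → y j * δ j i)
          ≈⟨ sum-δ y i ⟩
        y i ∎
      W-nonsingular : Nonsingular W
      W-nonsingular y Wy≋0 = ≋-trans (≋-sym (MW y)) (≋-trans (M.cong Wy≋0) M.homo-𝟎)

    record IsLinearSubspace {n} {p} (T : Vector Carrier n → Set p) : Set (c ⊔ ℓ ⊔ p) where
      field
        resp : ∀ {x y} → x ≋ y → T x → T y
        ∋𝟎   : T 𝟎
        ∋⊕   : ∀ {x y} → T x → T y → T (x ⊕ y)
        ∋⊙   : ∀ a {x} → T x → T (a ⊙ x)

      ∋sum : ∀ {k} (a : Vector Carrier k) (v : Fin k → Vector Carrier n) → (∀ i → T (v i)) → T (λ j → sum (λ i → a i * v i j))
      ∋sum {zero}  a v v∈T = ∋𝟎
      ∋sum {suc k} a v v∈T = ∋⊕ (∋⊙ (a zero) (v∈T zero)) (∋sum (tail a) (v ∘ suc) (v∈T ∘ suc))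

    -- The universal property of the span, through which every span below is translated into
    -- coordinates: T is chosen as the coordinate description.
    Span⊆ : ∀ {n p} {S : PointSet n} {T : Vector Carrier (suc n) → Set p} → IsLinearSubspace T → (∀ {x} → x ∈ S → T x) →
            ∀ {x} → x ∈ Span S → T x
    Span⊆ T-subspace S⊆T (m , v , a , v∈S , x≋) = resp (≋-sym x≋) (∋sum a v (λ i → S⊆T (v∈S i)))
      where open IsLinearSubspace T-subspace

    Span∋ : ∀ {n} {S : PointSet n} {x} → x ∈ S → x ∈ Span S
    Span∋ {x = x} x∈S = 1 , (λ _ → x) , (λ _ → 1#) , (λ _ → x∈S) , λ i → sym (trans (+-identityʳ _) (*-identityˡ _))

    Span-subspace : ∀ {n} {S : PointSet n} → IsLinearSubspace (Span S)
    Span-subspace {n} {S} = record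
      { resp = resp
      ; ∋𝟎   = 0 , (λ ()) , (λ ()) , (λ ()) , λ _ → refl
      ; ∋⊕   = λ (k , v , a , v∈S , x≋) y∈ → resp (⊕-cong (≋-sym x≋) ≋-refl) (prepend k a v v∈S y∈)
      ; ∋⊙   = λ b (m , v , a , v∈S , x≋) → m , v , (b ⊙ a) , v∈S , λ j → trans (*-congˡ (x≋ j))
                 (trans (*-distribˡ-sum b (λ i → a i * v i j)) (sum-cong-≋ (λ i → sym (*-assoc b (a i) (v i j))))) }
      where
      resp : ∀ {x y} → x ≋ y → x ∈ Span S → y ∈ Span S
      resp x≋y (m , v , a , v∈S , x≋) = m , v , a , v∈S , ≋-trans (≋-sym x≋y) x≋
      cons : ∀ a {v y} → v ∈ S → y ∈ Span S → (a ⊙ v ⊕ y) ∈ Span S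
      cons a {v} v∈S (m , w , b , w∈S , y≋) = suc m , w′ , b′ , w′∈S , λ j → +-congˡ (y≋ j)
        where
        w′ : Fin (suc m) → Vector Carrier (suc n)
        w′ zero    = v
        w′ (suc i) = w i
        b′ : Vector Carrier (suc m)
        b′ zero    = a
        b′ (suc i) = b i
        w′∈S : ∀ i → w′ i ∈ S
        w′∈S zero    = v∈S
        w′∈S (suc i) = w∈S i
      prepend : ∀ k (a : Vector Carrier k) v → (∀ i → v i ∈ S) → ∀ {y} → y ∈ Span S →
                ((λ j → sum (λ i → a i * v i j)) ⊕ y) ∈ Span S
      prepend zero    a v v∈S y∈ = resp (λ _ → sym (+-identityˡ _)) y∈
      prepend (suc k) a v v∈S y∈ = resp (λ _ → sym (+-assoc _ _ _))
        (cons (a zero) (v∈S zero) (prepend k (tail a) (v ∘ suc) (v∈S ∘ suc) y∈))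

  -- Rational vectors, projective equivalence, descent, and quadratic forms

  module Projective where

    open Subfields
    open LinearAlgebra

    Rational : ∀ {n} → ℕ → Vector Carrier n → Set ℓ
    Rational k x = ∀ i → x i ∈ F k

    frob-sum : ∀ k {n} (x : Vector Carrier n) → frob k (sum x) ≈ sum (φ k x)
    frob-sum k {zero}  x = frob-0 k
    frob-sum k {suc n} x = trans (frob-+ k (x zero) (sum (tail x))) (+-congˡ (frob-sum k (tail x)))

    φ-cong : ∀ k {n} {x y : Vector Carrier n} → x ≋ y → φ k x ≋ φ k y
    φ-cong k x≋y i = frob-cong k (x≋y i)

    φ-⊙ : ∀ k {n} a (x : Vector Carrier n) → φ k (a ⊙ x) ≋ frob k a ⊙ φ k x
    φ-⊙ k a x i = frob-* k a (x i)

    φ-∘ : ∀ j k {n} (x : Vector Carrier n) → φ j (φ k x) ≋ φ (k ℕ.+ j) x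
    φ-∘ j k x i = frob-∘ j k (x i)

    φ-6 : ∀ {n} (x : Vector Carrier n) → φ 6 x ≋ x
    φ-6 x i = frob-6 (x i)

    φ-≉𝟎 : ∀ k {n} {x : Vector Carrier n} → ¬ (x ≋ 𝟎) → ¬ (φ k x ≋ 𝟎)
    φ-≉𝟎 k x≉0 φx≋0 = let i , xᵢ≉0 = nonzero-entry x≉0 in frob-≉0 k xᵢ≉0 (φx≋0 i)

    φᴹ : ∀ k {m n} → Matrix m n → Matrix m n
    φᴹ k M i j = frob k (M i j)

    φ-*ᵥ : ∀ k {m n} (M : Matrix m n) x → φ k (M *ᵥ x) ≋ φᴹ k M *ᵥ φ k x
    φ-*ᵥ k M x i = trans (frob-sum k (λ j → M i j * x j)) (sum-cong-≋ (λ j → frob-* k (M i j) (x j)))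

    *ᵥ-congˡ : ∀ {m n} {M N : Matrix m n} → (∀ i j → M i j ≈ N i j) → ∀ x → M *ᵥ x ≋ N *ᵥ x
    *ᵥ-congˡ M≈N x i = sum-cong-≋ (λ j → *-congʳ (M≈N i j))

    φ-*ᵥ-over : ∀ k {m n} {M : Matrix m n} → M Over k → ∀ x → φ k (M *ᵥ x) ≋ M *ᵥ φ k x
    φ-*ᵥ-over k {M = M} M-over x = ≋-trans (φ-*ᵥ k M x) (*ᵥ-congˡ M-over (φ k x))

    *ᵥ-rational : ∀ k {m n} {M : Matrix m n} {x} → M Over k → Rational k x → Rational k (M *ᵥ x)
    *ᵥ-rational k {M = M} {x} M-over x-rational = ≋-trans (φ-*ᵥ-over k M-over x) (Linear.cong (*ᵥ-linear M) x-rational)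

    nonsingular-injective : ∀ {m n} {M : Matrix m n} → Nonsingular M → ∀ {x y} → M *ᵥ x ≋ M *ᵥ y → x ≋ y
    nonsingular-injective {M = M} M-nonsingular {x} {y} Mx≋My i = x-y≈0⇒x≈y (trans (+-congˡ (sym (-1*x≈-x (y i))))
      (M-nonsingular (x ⊕ (- 1#) ⊙ y) (λ j → trans (Linear.homo-⊕ (*ᵥ-linear M) x ((- 1#) ⊙ y) j)
        (trans (+-congˡ (trans (Linear.homo-⊙ (*ᵥ-linear M) (- 1#) y j) (-1*x≈-x _))) (x≈y⇒x-y≈0 (Mx≋My j)))) i))
      where
      -1*x≈-x : ∀ x → - 1# * x ≈ - x
      -1*x≈-x = solve 1 (λ x → :- con (ℤ.+ 1) :* x := :- x) refl

    nonsingular-≉𝟎 : ∀ {m n} {M : Matrix m n} → Nonsingular M → ∀ {x} → ¬ (x ≋ 𝟎) → ¬ (M *ᵥ x ≋ 𝟎)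
    nonsingular-≉𝟎 M-nonsingular {x} x≉0 Mx≋0 = x≉0 (M-nonsingular x Mx≋0)

    -- Since φ M x = M φ x and M is injective, x is fixed by φ as soon as M x is.
    rational-preimage : ∀ k {m n} {M : Matrix m n} {x} → M Over k → Nonsingular M → Rational k (M *ᵥ x) → Rational k x
    rational-preimage k {M = M} {x} M-over M-nonsingular Mx-rational =
      nonsingular-injective {M = M} M-nonsingular (≋-trans (≋-sym (φ-*ᵥ-over k M-over x)) Mx-rational)

    ≋⇒∼ : ∀ {n} {x y : Vector Carrier n} → x ≋ y → x ∼ y
    ≋⇒∼ x≋y = 1# , 1≉0 , λ i → trans (x≋y i) (sym (*-identityˡ _))

    ∼-refl : ∀ {n} {x : Vector Carrier n} → x ∼ x
    ∼-refl = ≋⇒∼ ≋-refl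

    ∼-trans : ∀ {n} {x y z : Vector Carrier n} → x ∼ y → y ∼ z → x ∼ z
    ∼-trans (a , a≉0 , x≋) (b , b≉0 , y≋) =
      a * b , xy≉0 a≉0 b≉0 , λ i → trans (x≋ i) (trans (*-congˡ (y≋ i)) (sym (*-assoc a b _)))

    ∼-sym : ∀ {n} {x y : Vector Carrier n} → x ∼ y → y ∼ x
    ∼-sym {x = x} {y} (a , a≉0 , x≋) =
      let b , ab≈1 = inverse a a≉0
      in b , (λ b≈0 → 1≉0 (trans (sym ab≈1) (trans (*-congˡ b≈0) (zeroʳ a)))) , λ i → begin
        y i              ≈⟨ *-identityˡ _ ⟨
        1# * y i         ≈⟨ *-congʳ (trans (*-comm b a) ab≈1) ⟨
        (b * a) * y i    ≈⟨ *-assoc b a (y i) ⟩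
        b * (a * y i)    ≈⟨ *-congˡ (x≋ i) ⟨
        b * x i          ∎

    ⊙-∼ : ∀ {n} {a} {x : Vector Carrier n} → ¬ (a ≈ 0#) → (a ⊙ x) ∼ x
    ⊙-∼ {a = a} a≉0 = a , a≉0 , ≋-refl

    ∼-≉𝟎 : ∀ {n} {x y : Vector Carrier n} → x ∼ y → ¬ (y ≋ 𝟎) → ¬ (x ≋ 𝟎)
    ∼-≉𝟎 (a , a≉0 , x≋) y≉0 x≋0 = y≉0 λ i → xy≈0⇒y≈0 a≉0 (trans (sym (x≋ i)) (x≋0 i))

    ∼-linear : ∀ {m n} {f : Vector Carrier m → Vector Carrier n} → Linear f → ∀ {x y} → x ∼ y → f x ∼ f y
    ∼-linear f-linear (a , a≉0 , x≋) = a , a≉0 , ≋-trans (cong x≋) (homo-⊙ a _)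
      where open Linear f-linear

    ∼-*ᵥ : ∀ {m n} (M : Matrix m n) {x y} → x ∼ y → M *ᵥ x ∼ M *ᵥ y
    ∼-*ᵥ M = ∼-linear (*ᵥ-linear M)

    ∼-φ : ∀ k {n} {x y : Vector Carrier n} → x ∼ y → φ k x ∼ φ k y
    ∼-φ k {y = y} (a , a≉0 , x≋) = frob k a , frob-≉0 k a≉0 , ≋-trans (φ-cong k x≋) (φ-⊙ k a y)

    ∼-subspace : ∀ {n p} {T : Vector Carrier n → Set p} → IsLinearSubspace T → ∀ {x y} → x ∼ y → T y → T x
    ∼-subspace T-subspace (a , _ , x≋) y∈T = resp (≋-sym x≋) (∋⊙ a y∈T)
      where open IsLinearSubspace T-subspace

    PG-resp : ∀ {n} k {x y : Vector Carrier (suc n)} → x ∼ y → y ∈ PG n k → x ∈ PG n k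
    PG-resp k x∼y (y≉0 , z , y∼z , z-rational) = ∼-≉𝟎 x∼y y≉0 , z , ∼-trans x∼y y∼z , z-rational

    rational⇒PG : ∀ {n} k {x : Vector Carrier (suc n)} → ¬ (x ≋ 𝟎) → Rational k x → x ∈ PG n k
    rational⇒PG k x≉0 x-rational = x≉0 , _ , ∼-refl , x-rational

    PG-6 : ∀ {n} {x : Vector Carrier (suc n)} → ¬ (x ≋ 𝟎) → x ∈ PG n 6
    PG-6 x≉0 = rational⇒PG 6 x≉0 (λ i → frob-6 _)

    PG-φ : ∀ {n} j k {x : Vector Carrier (suc n)} → x ∈ PG n k → φ j x ∈ PG n k
    PG-φ j k (x≉0 , y , x∼y , y-rational) = φ-≉𝟎 j x≉0 , φ j y , ∼-φ j x∼y , λ i → F-frob j k (y-rational i)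

    PG-*ᵥ : ∀ k {m n} {M : Matrix (suc m) (suc n)} {x} → M Over k → Nonsingular M → x ∈ PG n k → (M *ᵥ x) ∈ PG m k
    PG-*ᵥ k {M = M} M-over M-nonsingular (x≉0 , y , x∼y , y-rational) =
      nonsingular-≉𝟎 {M = M} M-nonsingular x≉0 , M *ᵥ y , ∼-*ᵥ M x∼y , *ᵥ-rational k {M = M} M-over y-rational

    PG-preimage : ∀ k {m n} {M : Matrix (suc m) (suc n)} {x} → M Over k → Nonsingular M → (M *ᵥ x) ∈ PG m k → x ∈ PG n k
    PG-preimage k {M = M} {x} M-over M-nonsingular (Mx≉0 , y , Mx∼y , y-rational) =
      let a , a≉0 , y≋aMx = ∼-sym Mx∼y
          ax-rational = rational-preimage k {M = M} M-over M-nonsingular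
            (λ i → F-cong k (trans (y≋aMx i) (sym (Linear.homo-⊙ (*ᵥ-linear M) a x i))) (y-rational i))
      in (λ x≋0 → Mx≉0 (≋-trans (Linear.cong (*ᵥ-linear M) x≋0) (Linear.homo-𝟎 (*ᵥ-linear M)))) ,
         a ⊙ x , ∼-sym (⊙-∼ a≉0) , ax-rational

    -- Normalising a coordinate to 1 and subtracting a vector from its Frobenius image
    -- kills that coordinate, so a shortest non-zero vector is rational up to a scalar.
    descent : ∀ {n p} {W : Vector Carrier n → Set p} → IsLinearSubspace W → (∀ {x} → W x → W (φ 1 x)) →
              ∀ {x} → W x → ¬ (x ≋ 𝟎) → ∃ λ y → W y × ¬ (y ≋ 𝟎) × Rational 1 y
    descent {zero} _ _ _ x≉0 = contradiction (λ ()) x≉0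
    descent {suc n} {p} {W} W-subspace φ-stable {x} x∈W x≉0 = by-head (x zero ≟ 0#)
      where
      open IsLinearSubspace W-subspace
      cons-0 : Vector Carrier n → Vector Carrier (suc n)
      cons-0 y zero    = 0#
      cons-0 y (suc i) = y i
      W₀ : Vector Carrier n → Set p
      W₀ y = W (cons-0 y)
      W₀-subspace : IsLinearSubspace W₀
      W₀-subspace = record
        { resp = λ x≋y → resp λ where
                   zero    → refl
                   (suc i) → x≋y i
        ; ∋𝟎 = resp (λ where
                   zero    → refl
                   (suc i) → refl) ∋𝟎
        ; ∋⊕ = λ x∈ y∈ → resp (λ where
                   zero    → +-identityˡ 0#
                   (suc i) → refl) (∋⊕ x∈ y∈)
        ; ∋⊙ = λ a x∈ → resp (λ where
                   zero    → zeroʳ a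
                   (suc i) → refl) (∋⊙ a x∈) }
      with-zero-head : ∀ {x} → x zero ≈ 0# → W x → ¬ (x ≋ 𝟎) → ∃ λ y → W y × ¬ (y ≋ 𝟎) × Rational 1 y
      with-zero-head {x} x₀≈0 x∈W x≉0 =
        let y , y∈ , y≉0 , y-rational = descent W₀-subspace
              (λ {y} y∈ → resp (λ where
                 zero    → frob-0 1
                 (suc i) → refl) (φ-stable y∈))
              {tail x} (resp (λ where
                 zero    → x₀≈0
                 (suc i) → refl) x∈W)
              (λ tail≋0 → x≉0 λ where
                 zero    → x₀≈0
                 (suc i) → tail≋0 i)
        in cons-0 y , y∈ , (λ y≋0 → y≉0 (y≋0 ∘ suc)) , λ where
                 zero    → F-0 1
                 (suc i) → y-rational i
      by-head : Dec (x zero ≈ 0#) → ∃ λ y → W y × ¬ (y ≋ 𝟎) × Rational 1 y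
      by-head (yes x₀≈0) = with-zero-head x₀≈0 x∈W x≉0
      by-head (no x₀≉0) = by-difference (zero? (φ 1 z ⊕ (- 1#) ⊙ z))
        where
        x₀⁻¹ : Carrier
        x₀⁻¹ = proj₁ (inverse (x zero) x₀≉0)
        z : Vector Carrier (suc n)
        z = x₀⁻¹ ⊙ x
        z₀≈1 : z zero ≈ 1#
        z₀≈1 = trans (*-comm _ _) (proj₂ (inverse (x zero) x₀≉0))
        by-difference : Dec (φ 1 z ⊕ (- 1#) ⊙ z ≋ 𝟎) → ∃ λ y → W y × ¬ (y ≋ 𝟎) × Rational 1 y
        by-difference (yes φz-z≋0) = z , ∋⊙ x₀⁻¹ x∈W , (λ z≋0 → 1≉0 (trans (sym z₀≈1) (z≋0 zero))) ,
          λ i → x-y≈0⇒x≈y (trans (solve 2 (λ x y → x :- y := x :+ :- con (ℤ.+ 1) :* y) refl _ _) (φz-z≋0 i))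
        by-difference (no φz-z≉0) = with-zero-head
          (trans (+-cong (trans (frob-cong 1 z₀≈1) (frob-1 1)) (*-congˡ z₀≈1))
                 (solve 0 (con (ℤ.+ 1) :+ :- con (ℤ.+ 1) :* con (ℤ.+ 1) := con (ℤ.+ 0)) refl))
          (∋⊕ (φ-stable (∋⊙ x₀⁻¹ x∈W)) (∋⊙ (- 1#) (∋⊙ x₀⁻¹ x∈W))) φz-z≉0

    private
      ∑∑ : ∀ {n} → (Fin n → Fin n → Carrier) → Carrier
      ∑∑ f = sum (λ i → sum (f i))

      ∑∑-cong : ∀ {n} {f g : Fin n → Fin n → Carrier} → (∀ i j → f i j ≈ g i j) → ∑∑ f ≈ ∑∑ g
      ∑∑-cong f≈g = sum-cong-≋ (λ i → sum-cong-≋ (f≈g i))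

      ∑∑-+ : ∀ {n} (f g : Fin n → Fin n → Carrier) → ∑∑ (λ i j → f i j + g i j) ≈ ∑∑ f + ∑∑ g
      ∑∑-+ f g = trans (sum-cong-≋ (λ i → ∑-distrib-+ (f i) (g i))) (∑-distrib-+ (λ i → sum (f i)) (λ i → sum (g i)))

      ∑∑-* : ∀ {n} a (f : Fin n → Fin n → Carrier) → ∑∑ (λ i j → a * f i j) ≈ a * ∑∑ f
      ∑∑-* a f = trans (sum-cong-≋ (λ i → sym (*-distribˡ-sum a (f i)))) (sym (*-distribˡ-sum a (λ i → sum (f i))))

      ∑∑-F : ∀ k {n} {f : Fin n → Fin n → Carrier} → (∀ i j → f i j ∈ F k) → ∑∑ f ∈ F k
      ∑∑-F k {f = f} f∈F = trans (frob-sum k (λ i → sum (f i)))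
        (sum-cong-≋ (λ i → trans (frob-sum k (f i)) (sum-cong-≋ (f∈F i))))

    module _ {n} (A : Matrix n n) where

      eval-cong : ∀ {x y} → x ≋ y → eval A x ≈ eval A y
      eval-cong x≋y = ∑∑-cong (λ i j → *-congˡ {x = A i j} (*-cong (x≋y i) (x≋y j)))

      eval-⊙ : ∀ a x → eval A (a ⊙ x) ≈ a * a * eval A x
      eval-⊙ a x = trans
        (∑∑-cong (λ i j → solve 4 (λ m a x y → m :* ((a :* x) :* (a :* y)) := a :* a :* (m :* (x :* y))) refl (A i j) a (x i) (x j)))
        (∑∑-* (a * a) (λ i j → A i j * (x i * x j)))

      eval-⊕ : ∀ x y → eval A (x ⊕ y) ≈ eval A x + eval A y + polar A x y
      eval-⊕ x y = begin
        eval A (x ⊕ y)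
          ≈⟨ ∑∑-cong (λ i j → solve 5 (λ m xi xj yi yj → m :* ((xi :+ yi) :* (xj :+ yj)) :=
               m :* (xi :* xj) :+ m :* (yi :* yj) :+ m :* (xi :* yj :+ yi :* xj)) refl (A i j) (x i) (x j) (y i) (y j)) ⟩
        ∑∑ (λ i j → A i j * (x i * x j) + A i j * (y i * y j) + A i j * (x i * y j + y i * x j))
          ≈⟨ ∑∑-+ (λ i j → A i j * (x i * x j) + A i j * (y i * y j)) (λ i j → A i j * (x i * y j + y i * x j)) ⟩
        ∑∑ (λ i j → A i j * (x i * x j) + A i j * (y i * y j)) + polar A x y
          ≈⟨ +-congʳ (∑∑-+ (λ i j → A i j * (x i * x j)) (λ i j → A i j * (y i * y j))) ⟩
        eval A x + eval A y + polar A x y ∎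

      polar-cong : ∀ {x x′ y y′} → x ≋ x′ → y ≋ y′ → polar A x y ≈ polar A x′ y′
      polar-cong p q = ∑∑-cong (λ i j → *-congˡ {x = A i j} (+-cong (*-cong (p i) (q j)) (*-cong (q i) (p j))))

      polar-congʳ : ∀ x {y y′} → y ≋ y′ → polar A x y ≈ polar A x y′
      polar-congʳ x = polar-cong {x} ≋-refl

      polar-sym : ∀ x y → polar A x y ≈ polar A y x
      polar-sym x y = ∑∑-cong (λ i j → *-congˡ {x = A i j} (+-comm _ _))

      polar-⊕ : ∀ x y z → polar A x (y ⊕ z) ≈ polar A x y + polar A x z
      polar-⊕ x y z = trans
        (∑∑-cong (λ i j → solve 7 (λ m xi xj yi yj zi zj → m :* (xi :* (yj :+ zj) :+ (yi :+ zi) :* xj) :=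
           m :* (xi :* yj :+ yi :* xj) :+ m :* (xi :* zj :+ zi :* xj)) refl (A i j) (x i) (x j) (y i) (y j) (z i) (z j)))
        (∑∑-+ (λ i j → A i j * (x i * y j + y i * x j)) (λ i j → A i j * (x i * z j + z i * x j)))

      polar-⊙ : ∀ x a y → polar A x (a ⊙ y) ≈ a * polar A x y
      polar-⊙ x a y = trans
        (∑∑-cong (λ i j → solve 6 (λ m a xi xj yi yj → m :* (xi :* (a :* yj) :+ (a :* yi) :* xj) :=
           a :* (m :* (xi :* yj :+ yi :* xj))) refl (A i j) a (x i) (x j) (y i) (y j)))
        (∑∑-* a (λ i j → A i j * (x i * y j + y i * x j)))

      polar-self : ∀ x → polar A x x ≈ eval A x + eval A x
      polar-self x = trans
        (∑∑-cong (λ i j → distribˡ (A i j) (x i * x j) (x i * x j)))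
        (∑∑-+ (λ i j → A i j * (x i * x j)) (λ i j → A i j * (x i * x j)))

      module _ k (A-over : A Over k) where

        eval-F : ∀ {x} → Rational k x → eval A x ∈ F k
        eval-F x∈F = ∑∑-F k (λ i j → F-* k (A-over i j) (F-* k (x∈F i) (x∈F j)))

        polar-F : ∀ {x y} → Rational k x → Rational k y → polar A x y ∈ F k
        polar-F x∈F y∈F = ∑∑-F k (λ i j → F-* k (A-over i j) (F-+ k (F-* k (x∈F i) (y∈F j)) (F-* k (y∈F i) (x∈F j))))

  -- Rational zeros of ternary quadratic forms in every characteristic

  module Conics where

    open Subfields

    -- The coefficients belong to x², xy, y², xz, yz, z² in this order.
    TernaryZero : (a b c d e f : Carrier) → Set _
    TernaryZero a b c d e f = ∃ λ x → ∃ λ y → ∃ λ z → x ∈ F 1 × y ∈ F 1 × z ∈ F 1 × ¬ (x ≈ 0# × y ≈ 0# × z ≈ 0#) ×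
      x * x * a + y * y * c + z * z * f + x * y * b + x * z * d + y * z * e ≈ 0#

    -- If the form in x and y alone is anisotropic it is a norm form a (x - αy)(x - ᾱy); with
    -- z = 1, completing the "norm" reduces the equation to w w̄ = c₀.
    ternary-zero : ∀ a b c d e f → a ∈ F 1 → b ∈ F 1 → c ∈ F 1 → d ∈ F 1 → e ∈ F 1 → f ∈ F 1 → TernaryZero a b c d e f
    ternary-zero a b c d e f a∈F b∈F c∈F d∈F e∈F f∈F = by-a (a ≟ 0#)
      where
      by-a : Dec (a ≈ 0#) → TernaryZero a b c d e f
      by-a (yes a≈0) = 1# , 0# , 0# , F-1 1 , F-0 1 , F-0 1 , (λ (1≈0 , _) → 1≉0 1≈0) , trans
        (solve 6 (λ a b c d e f → con (ℤ.+ 1) :* con (ℤ.+ 1) :* a :+ con (ℤ.+ 0) :* con (ℤ.+ 0) :* c :+ con (ℤ.+ 0) :* con (ℤ.+ 0) :* f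
           :+ con (ℤ.+ 1) :* con (ℤ.+ 0) :* b :+ con (ℤ.+ 1) :* con (ℤ.+ 0) :* d :+ con (ℤ.+ 0) :* con (ℤ.+ 0) :* e := a) refl a b c d e f) a≈0
      by-a (no a≉0) = by-α (F? 1 α)
        where
        a⁻¹ : Carrier
        a⁻¹ = proj₁ (inverse a a≉0)
        aa⁻¹≈1 : a * a⁻¹ ≈ 1#
        aa⁻¹≈1 = proj₂ (inverse a a≉0)
        a⁻¹∈F : a⁻¹ ∈ F 1
        a⁻¹∈F = F-inverse 1 a∈F aa⁻¹≈1
        β κ : Carrier
        β = b * a⁻¹
        κ = c * a⁻¹
        β∈F : β ∈ F 1
        β∈F = F-* 1 b∈F a⁻¹∈F
        κ∈F : κ ∈ F 1
        κ∈F = F-* 1 c∈F a⁻¹∈F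
        a* : ∀ y → a * (y * a⁻¹) ≈ y
        a* y = trans (solve 3 (λ a y r → a :* (y :* r) := y :* (a :* r)) refl a y a⁻¹) (trans (*-congˡ aa⁻¹≈1) (*-identityʳ y))
        root : ∃ λ x → x * x + β * x + κ ≈ 0#
        root = quadratic-root 1 2 ≡.refl β κ β∈F κ∈F
        α : Carrier
        α = proj₁ root
        α-root : α * α + β * α + κ ≈ 0#
        α-root = proj₂ root
        by-α : Dec (α ∈ F 1) → TernaryZero a b c d e f
        by-α (yes α∈F) = α , 1# , 0# , α∈F , F-1 1 , F-0 1 , (λ (_ , 1≈0 , _) → 1≉0 1≈0) , (begin
          α * α * a + 1# * 1# * c + 0# * 0# * f + α * 1# * b + α * 0# * d + 1# * 0# * e
            ≈⟨ solve 7 (λ α a b c d e f → α :* α :* a :+ con (ℤ.+ 1) :* con (ℤ.+ 1) :* c :+ con (ℤ.+ 0) :* con (ℤ.+ 0) :* f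
                 :+ α :* con (ℤ.+ 1) :* b :+ α :* con (ℤ.+ 0) :* d :+ con (ℤ.+ 1) :* con (ℤ.+ 0) :* e := α :* α :* a :+ b :* α :+ c) refl α a b c d e f ⟩
          α * α * a + b * α + c
            ≈⟨ +-cong (+-congˡ (*-congʳ (a* b))) (a* c) ⟨
          α * α * a + a * β * α + a * κ
            ≈⟨ solve 4 (λ α a β κ → α :* α :* a :+ a :* β :* α :+ a :* κ := a :* (α :* α :+ β :* α :+ κ)) refl α a β κ ⟩
          a * (α * α + β * α + κ)
            ≈⟨ trans (*-congˡ α-root) (zeroʳ a) ⟩
          0# ∎)
        by-α (no α∉F) = x , y , 1# , x∈F , y∈F , F-1 1 , (λ (_ , _ , 1≈0) → 1≉0 1≈0) , zero-at
          where
          ᾱ Δ r : Carrier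
          ᾱ = frob 1 α
          Δ = α - ᾱ
          Δ≉0 : ¬ (Δ ≈ 0#)
          Δ≉0 Δ≈0 = α∉F (sym (x-y≈0⇒x≈y Δ≈0))
          r = proj₁ (inverse Δ Δ≉0)
          Δr≈1 : Δ * r ≈ 1#
          Δr≈1 = proj₂ (inverse Δ Δ≉0)
          ᾱ-root : ᾱ * ᾱ + β * ᾱ + κ ≈ 0#
          ᾱ-root = trans (sym (trans (frob-+ 1 _ _) (+-cong (trans (frob-+ 1 _ _)
            (+-cong (frob-* 1 α α) (trans (frob-* 1 β α) (*-congʳ β∈F)))) κ∈F))) (trans (frob-cong 1 α-root) (frob-0 1))
          trace : α + ᾱ + β ≈ 0#
          trace = xy≈0⇒y≈0 Δ≉0 (begin
            (α - ᾱ) * (α + ᾱ + β)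
              ≈⟨ solve 4 (λ α ᾱ β κ → (α :- ᾱ) :* (α :+ ᾱ :+ β) := (α :* α :+ β :* α :+ κ) :- (ᾱ :* ᾱ :+ β :* ᾱ :+ κ)) refl α ᾱ β κ ⟩
            (α * α + β * α + κ) - (ᾱ * ᾱ + β * ᾱ + κ)
              ≈⟨ +-cong α-root (-‿cong ᾱ-root) ⟩
            0# - 0#  ≈⟨ -‿inverseʳ 0# ⟩
            0#       ∎)
          frob-ᾱ : frob 1 ᾱ ≈ α
          frob-ᾱ = begin
            frob 1 ᾱ
              ≈⟨ solve 4 (λ α ᾱ β z → z := ((ᾱ :+ z :+ β) :- (α :+ ᾱ :+ β)) :+ α) refl α ᾱ β (frob 1 ᾱ) ⟩
            ((ᾱ + frob 1 ᾱ + β) - (α + ᾱ + β)) + α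
              ≈⟨ +-congʳ (+-cong conjugate-trace (-‿cong trace)) ⟩
            (0# - 0#) + α
              ≈⟨ trans (+-congʳ (-‿inverseʳ 0#)) (+-identityˡ α) ⟩
            α ∎
            where
            conjugate-trace : ᾱ + frob 1 ᾱ + β ≈ 0#
            conjugate-trace = trans (sym (trans (frob-+ 1 _ _) (+-cong (frob-+ 1 α ᾱ) β∈F))) (trans (frob-cong 1 trace) (frob-0 1))
          norm : κ ≈ α * ᾱ
          norm = begin
            κ
              ≈⟨ solve 4 (λ α ᾱ β κ → κ := (α :* α :+ β :* α :+ κ) :- α :* (α :+ ᾱ :+ β) :+ α :* ᾱ) refl α ᾱ β κ ⟩
            (α * α + β * α + κ) - α * (α + ᾱ + β) + α * ᾱ
              ≈⟨ +-congʳ (+-cong α-root (-‿cong (trans (*-congˡ trace) (zeroʳ α)))) ⟩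
            0# - 0# + α * ᾱ
              ≈⟨ trans (+-congʳ (-‿inverseʳ 0#)) (+-identityˡ _) ⟩
            α * ᾱ ∎
          frob-Δ : frob 1 Δ ≈ - Δ
          frob-Δ = trans (frob-+ 1 α (- ᾱ)) (trans (+-congˡ (trans (frob-neg 1 ᾱ) (-‿cong frob-ᾱ)))
            (solve 2 (λ α ᾱ → ᾱ :- α := :- (α :- ᾱ)) refl α ᾱ))
          frob-r : frob 1 r ≈ - r
          frob-r = *-cancelˡ-≉0 Δ≉0 (begin
            Δ * frob 1 r           ≈⟨ solve 2 (λ Δ z → Δ :* z := :- (:- Δ :* z)) refl Δ (frob 1 r) ⟩
            - (- Δ * frob 1 r)     ≈⟨ -‿cong (*-congʳ frob-Δ) ⟨
            - (frob 1 Δ * frob 1 r) ≈⟨ -‿cong (frob-* 1 Δ r) ⟨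
            - frob 1 (Δ * r)       ≈⟨ -‿cong (trans (frob-cong 1 Δr≈1) (frob-1 1)) ⟩
            - 1#                   ≈⟨ -‿cong Δr≈1 ⟨
            - (Δ * r)              ≈⟨ solve 2 (λ Δ r → :- (Δ :* r) := Δ :* (:- r)) refl Δ r ⟩
            Δ * - r                ∎)
          -- In the variables w = x - αy and w̄ = x - ᾱy the linear part dx + ey is to be lw + l̄w̄;
          -- the equations l + l̄ = d and lα + l̄ᾱ = -e determine l and l̄.
          l l̄ : Carrier
          l = (- e - d * ᾱ) * r
          l̄ = (e + d * α) * r
          frob-l : frob 1 l ≈ l̄
          frob-l = begin
            frob 1 ((- e - d * ᾱ) * r)
              ≈⟨ frob-* 1 _ r ⟩
            frob 1 (- e - d * ᾱ) * frob 1 r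
              ≈⟨ *-cong (trans (frob-+ 1 _ _) (+-cong (trans (frob-neg 1 e) (-‿cong e∈F))
                   (trans (frob-neg 1 _) (-‿cong (trans (frob-* 1 d ᾱ) (*-cong d∈F frob-ᾱ)))))) frob-r ⟩
            (- e - d * α) * - r
              ≈⟨ solve 4 (λ e d α r → (:- e :- d :* α) :* (:- r) := (e :+ d :* α) :* r) refl e d α r ⟩
            (e + d * α) * r ∎
          frob-l̄ : frob 1 l̄ ≈ l
          frob-l̄ = begin
            frob 1 ((e + d * α) * r)
              ≈⟨ frob-* 1 _ r ⟩
            frob 1 (e + d * α) * frob 1 r
              ≈⟨ *-cong (trans (frob-+ 1 _ _) (+-cong e∈F (trans (frob-* 1 d α) (*-congʳ d∈F)))) frob-r ⟩
            (e + d * ᾱ) * - r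
              ≈⟨ solve 4 (λ e d ᾱ r → (e :+ d :* ᾱ) :* (:- r) := (:- e :- d :* ᾱ) :* r) refl e d ᾱ r ⟩
            (- e - d * ᾱ) * r ∎
          l-trace : l + l̄ ≈ d
          l-trace = trans (solve 5 (λ e d α ᾱ r → (:- e :- d :* ᾱ) :* r :+ (e :+ d :* α) :* r := d :* ((α :- ᾱ) :* r)) refl e d α ᾱ r)
            (trans (*-congˡ Δr≈1) (*-identityʳ d))
          l-α : - (l * α + l̄ * ᾱ) ≈ e
          l-α = trans (solve 5 (λ e d α ᾱ r → :- ((:- e :- d :* ᾱ) :* r :* α :+ (e :+ d :* α) :* r :* ᾱ) := e :* ((α :- ᾱ) :* r)) refl e d α ᾱ r)
            (trans (*-congˡ Δr≈1) (*-identityʳ e))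
          -- With v = w + l̄/a and v̄ = w̄ + l/a the equation a w w̄ + lw + l̄w̄ + f = 0 becomes a(v
          -- v̄ - c₀) = 0.
          c₀ : Carrier
          c₀ = (l * l̄ * a⁻¹ - f) * a⁻¹
          c₀∈F : c₀ ∈ F 1
          c₀∈F = F-* 1 (F-sub 1 (F-* 1 (trans (frob-* 1 l l̄) (trans (*-cong frob-l frob-l̄) (*-comm l̄ l))) a⁻¹∈F) f∈F) a⁻¹∈F
          -- A v with v v̄ = c₀ is only known to lie in K. The last component puts it into F_{q²}:
          -- as c₀ is fixed by Frobenius, v̄ times the conjugate of v̄ is again v v̄. It is needed
          -- for Frobenius to exchange w and w̄.
          norm-c₀ : ∃ λ v → v * frob 1 v ≈ c₀ × frob 1 (frob 1 v) ≈ v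
          norm-c₀ = by-c₀ (c₀ ≟ 0#)
            where
            by-c₀ : Dec (c₀ ≈ 0#) → ∃ λ v → v * frob 1 v ≈ c₀ × frob 1 (frob 1 v) ≈ v
            by-c₀ (yes c₀≈0) = 0# , trans (zeroˡ _) (sym c₀≈0) , trans (frob-cong 1 (frob-0 1)) (frob-0 1)
            by-c₀ (no c₀≉0) =
              let v , vv̄≈c₀ = norm-surjective c₀≉0 c₀∈F
                  v≉0 : ¬ (v ≈ 0#)
                  v≉0 = λ v≈0 → c₀≉0 (trans (sym vv̄≈c₀) (trans (*-congʳ v≈0) (zeroˡ _)))
              in v , vv̄≈c₀ , *-cancelˡ-≉0 (frob-≉0 1 v≉0) (begin
                frob 1 v * frob 1 (frob 1 v)   ≈⟨ frob-* 1 v (frob 1 v) ⟨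
                frob 1 (v * frob 1 v)          ≈⟨ frob-cong 1 vv̄≈c₀ ⟩
                frob 1 c₀                      ≈⟨ c₀∈F ⟩
                c₀                             ≈⟨ vv̄≈c₀ ⟨
                v * frob 1 v                   ≈⟨ *-comm _ _ ⟩
                frob 1 v * v                   ∎)
          v v̄ w w̄ x y : Carrier
          v = proj₁ norm-c₀
          v̄ = frob 1 v
          w = v - l̄ * a⁻¹
          w̄ = v̄ - l * a⁻¹
          -- Solves w = x - αy, w̄ = x - ᾱy for x and y: the difference of the two is (α - ᾱ)y, and
          -- r is the inverse of α - ᾱ.
          y = (w̄ - w) * r
          x = w + α * y
          frob-w : frob 1 w ≈ w̄
          frob-w = trans (frob-+ 1 _ _) (+-congˡ (trans (frob-neg 1 _) (-‿cong (trans (frob-* 1 l̄ a⁻¹) (*-cong frob-l̄ a⁻¹∈F)))))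
          frob-w̄ : frob 1 w̄ ≈ w
          frob-w̄ = trans (frob-+ 1 _ _) (+-cong (proj₂ (proj₂ norm-c₀)) (trans (frob-neg 1 _) (-‿cong (trans (frob-* 1 l a⁻¹) (*-cong frob-l a⁻¹∈F)))))
          Δy : Δ * y ≈ w̄ - w
          Δy = trans (solve 3 (λ Δ u r → Δ :* (u :* r) := u :* (Δ :* r)) refl Δ (w̄ - w) r) (trans (*-congˡ Δr≈1) (*-identityʳ _))
          y∈F : y ∈ F 1
          y∈F = begin
            frob 1 y                   ≈⟨ frob-* 1 _ r ⟩
            frob 1 (w̄ - w) * frob 1 r  ≈⟨ *-cong (trans (frob-+ 1 _ _) (+-cong frob-w̄ (trans (frob-neg 1 w) (-‿cong frob-w)))) frob-r ⟩
            (w - w̄) * - r              ≈⟨ solve 3 (λ w w̄ r → (w :- w̄) :* (:- r) := (w̄ :- w) :* r) refl w w̄ r ⟩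
            y                          ∎
          x≈w̄ : w̄ + ᾱ * y ≈ x
          x≈w̄ = begin
            w̄ + ᾱ * y             ≈⟨ solve 4 (λ w w̄ ᾱ y → w̄ :+ ᾱ :* y := w :+ (w̄ :- w) :+ ᾱ :* y) refl w w̄ ᾱ y ⟩
            w + (w̄ - w) + ᾱ * y   ≈⟨ +-congʳ (+-congˡ Δy) ⟨
            w + (α - ᾱ) * y + ᾱ * y ≈⟨ solve 4 (λ w α ᾱ y → w :+ (α :- ᾱ) :* y :+ ᾱ :* y := w :+ α :* y) refl w α ᾱ y ⟩
            x                     ∎
          x∈F : x ∈ F 1
          x∈F = trans (frob-+ 1 w (α * y)) (trans (+-cong frob-w (trans (frob-* 1 α y) (*-congˡ y∈F))) x≈w̄)
          w≈ : x - α * y ≈ w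
          w≈ = solve 3 (λ w α y → (w :+ α :* y) :- α :* y := w) refl w α y
          w̄≈ : x - ᾱ * y ≈ w̄
          w̄≈ = trans (+-congʳ (sym x≈w̄)) (solve 3 (λ w α y → (w :+ α :* y) :- α :* y := w) refl w̄ ᾱ y)
          b≈ : - (a * (α + ᾱ)) ≈ b
          b≈ = begin
            - (a * (α + ᾱ))                    ≈⟨ solve 4 (λ a α ᾱ β → :- (a :* (α :+ ᾱ)) := a :* β :- a :* (α :+ ᾱ :+ β)) refl a α ᾱ β ⟩
            a * β - a * (α + ᾱ + β)            ≈⟨ +-cong (a* b) (-‿cong (trans (*-congˡ trace) (zeroʳ a))) ⟩
            b - 0#                             ≈⟨ solve 1 (λ b → b :- con (ℤ.+ 0) := b) refl b ⟩
            b                                  ∎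
          c≈ : a * (α * ᾱ) ≈ c
          c≈ = trans (*-congˡ (sym norm)) (a* c)
          zero-at : x * x * a + y * y * c + 1# * 1# * f + x * y * b + x * 1# * d + y * 1# * e ≈ 0#
          zero-at = begin
            x * x * a + y * y * c + 1# * 1# * f + x * y * b + x * 1# * d + y * 1# * e
              ≈⟨ +-cong (+-cong (+-cong (+-congʳ (+-congˡ (*-congˡ c≈))) (*-congˡ b≈)) (*-congˡ l-trace)) (*-congˡ l-α) ⟨
            x * x * a + y * y * (a * (α * ᾱ)) + 1# * 1# * f + x * y * - (a * (α + ᾱ)) + x * 1# * (l + l̄) + y * 1# * - (l * α + l̄ * ᾱ)
              ≈⟨ solve 8 (λ x y a α ᾱ l l̄ f →
                   x :* x :* a :+ y :* y :* (a :* (α :* ᾱ)) :+ con (ℤ.+ 1) :* con (ℤ.+ 1) :* f :+ x :* y :* (:- (a :* (α :+ ᾱ)))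
                     :+ x :* con (ℤ.+ 1) :* (l :+ l̄) :+ y :* con (ℤ.+ 1) :* (:- (l :* α :+ l̄ :* ᾱ)) :=
                   a :* (x :- α :* y) :* (x :- ᾱ :* y) :+ l :* (x :- α :* y) :+ l̄ :* (x :- ᾱ :* y) :+ f) refl x y a α ᾱ l l̄ f ⟩
            a * (x - α * y) * (x - ᾱ * y) + l * (x - α * y) + l̄ * (x - ᾱ * y) + f
              ≈⟨ +-congʳ (+-cong (+-cong (*-cong (*-congˡ w≈) w̄≈) (*-congˡ w≈)) (*-congˡ w̄≈)) ⟩
            a * w * w̄ + l * w + l̄ * w̄ + f
              ≈⟨ solve 7 (λ a a⁻¹ v v̄ l l̄ f →
                   a :* (v :- l̄ :* a⁻¹) :* (v̄ :- l :* a⁻¹) :+ l :* (v :- l̄ :* a⁻¹) :+ l̄ :* (v̄ :- l :* a⁻¹) :+ f :=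
                   a :* (v :* v̄ :- (l :* l̄ :* a⁻¹ :- f) :* a⁻¹)
                     :+ (a :* a⁻¹ :- con (ℤ.+ 1)) :* (l :* l̄ :* a⁻¹ :+ l :* l̄ :* a⁻¹ :- f :- l :* v :- l̄ :* v̄)) refl a a⁻¹ v v̄ l l̄ f ⟩
            a * (v * v̄ - c₀) + (a * a⁻¹ - 1#) * (l * l̄ * a⁻¹ + l * l̄ * a⁻¹ - f - l * v - l̄ * v̄)
              ≈⟨ +-cong (trans (*-congˡ (x≈y⇒x-y≈0 (proj₁ (proj₂ norm-c₀)))) (zeroʳ a)) (trans (*-congʳ (x≈y⇒x-y≈0 aa⁻¹≈1)) (zeroˡ _)) ⟩
            0# + 0#  ≈⟨ +-identityˡ 0# ⟩
            0#       ∎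

  -- Normal form of a conic and its rational parametrisation

  module ConicFrames where

    open import Data.Vec.Functional using ([]; _∷_)
    open Subfields
    open LinearAlgebra
    open Projective
    open Conics

    combination : ∀ {n} → Vector Carrier 3 → (u v w : Vector Carrier n) → Vector Carrier n
    combination y u v w = y 0F ⊙ u ⊕ y 1F ⊙ v ⊕ y 2F ⊙ w

    sum₃ : ∀ (x : Vector Carrier 3) → sum x ≈ x 0F + x 1F + x 2F
    sum₃ x = solve 3 (λ x y z → x :+ (y :+ (z :+ con (ℤ.+ 0))) := x :+ y :+ z) refl (x 0F) (x 1F) (x 2F)

    fromColumns : ∀ {n} → (u v w : Vector Carrier n) → Matrix n 3
    fromColumns u v w i j = (u ∷ v ∷ w ∷ []) j i

    *ᵥ-columns : ∀ {n} (M : Matrix n 3) y → M *ᵥ y ≋ combination y (λ i → M i 0F) (λ i → M i 1F) (λ i → M i 2F)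
    *ᵥ-columns M y i = trans (sum₃ (λ j → M i j * y j)) (+-cong (+-cong (*-comm _ _) (*-comm _ _)) (*-comm _ _))

    δ-combination : ∀ (y : Vector Carrier 3) → combination y (δ 0F) (δ 1F) (δ 2F) ≋ y
    δ-combination y i = trans (sym (sum₃ (λ j → y j * δ j i))) (sum-δ y i)

    δ-rational : ∀ {n} k (j : Fin n) → Rational k (δ j)
    δ-rational k zero    zero    = F-1 k
    δ-rational k zero    (suc i) = F-0 k
    δ-rational k (suc j) zero    = F-0 k
    δ-rational k (suc j) (suc i) = δ-rational k j i

    δ-≉𝟎 : ∀ {n} (j : Fin n) → ¬ (δ j ≋ 𝟎)
    δ-≉𝟎 zero    eq = 1≉0 (eq zero)
    δ-≉𝟎 (suc j) eq = δ-≉𝟎 j (eq ∘ suc)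

    ⊙-rational : ∀ k {n} {a} {x : Vector Carrier n} → a ∈ F k → Rational k x → Rational k (a ⊙ x)
    ⊙-rational k a∈F x∈F i = F-* k a∈F (x∈F i)

    ⊕-rational : ∀ k {n} {x y : Vector Carrier n} → Rational k x → Rational k y → Rational k (x ⊕ y)
    ⊕-rational k x∈F y∈F i = F-+ k (x∈F i) (y∈F i)

    combination-linear : ∀ {m n} {f : Vector Carrier m → Vector Carrier n} → Linear f → ∀ y u v w →
                         f (combination y u v w) ≋ combination y (f u) (f v) (f w)
    combination-linear f-linear y u v w i = trans (homo-⊕ _ _ i) (+-cong (trans (homo-⊕ _ _ i)
      (+-cong (homo-⊙ _ _ i) (homo-⊙ _ _ i))) (homo-⊙ _ _ i))
      where open Linear f-linear

    module _ {n} (A : Matrix n n) where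

      polar-linear : ∀ x → Linear {n} {1} (λ y _ → polar A x y)
      polar-linear x = record
        { cong = λ y≋z _ → polar-congʳ A x y≋z ; homo-⊕ = λ y z _ → polar-⊕ A x y z ; homo-⊙ = λ a y _ → polar-⊙ A x a y }

      polar-combination : ∀ x y u v w → polar A x (combination y u v w) ≈ y 0F * polar A x u + y 1F * polar A x v + y 2F * polar A x w
      polar-combination x y u v w = combination-linear (polar-linear x) y u v w zero

      eval-combination : ∀ y u v w → eval A (combination y u v w) ≈
        y 0F * y 0F * eval A u + y 1F * y 1F * eval A v + y 2F * y 2F * eval A w
          + y 0F * y 1F * polar A u v + y 0F * y 2F * polar A u w + y 1F * y 2F * polar A v w
      eval-combination y u v w = begin
        eval A (y 0F ⊙ u ⊕ y 1F ⊙ v ⊕ y 2F ⊙ w)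
          ≈⟨ eval-⊕ A (y 0F ⊙ u ⊕ y 1F ⊙ v) (y 2F ⊙ w) ⟩
        eval A (y 0F ⊙ u ⊕ y 1F ⊙ v) + eval A (y 2F ⊙ w) + polar A (y 0F ⊙ u ⊕ y 1F ⊙ v) (y 2F ⊙ w)
          ≈⟨ +-cong (+-cong (trans (eval-⊕ A (y 0F ⊙ u) (y 1F ⊙ v)) (+-cong (+-cong (eval-⊙ A (y 0F) u) (eval-⊙ A (y 1F) v)) (polar-⊙⊙ (y 0F) u (y 1F) v)))
               (eval-⊙ A (y 2F) w))
               (trans (polar-sym A _ _) (trans (polar-⊕ A _ _ _)
                 (+-cong (trans (polar-sym A _ _) (polar-⊙⊙ (y 0F) u (y 2F) w)) (trans (polar-sym A _ _) (polar-⊙⊙ (y 1F) v (y 2F) w))))) ⟩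
        (y 0F * y 0F * eval A u + y 1F * y 1F * eval A v + y 0F * y 1F * polar A u v) + y 2F * y 2F * eval A w
          + (y 0F * y 2F * polar A u w + y 1F * y 2F * polar A v w)
          ≈⟨ solve 6 (λ a b c d e f → (a :+ b :+ c) :+ d :+ (e :+ f) := a :+ b :+ d :+ c :+ e :+ f) refl _ _ _ _ _ _ ⟩
        y 0F * y 0F * eval A u + y 1F * y 1F * eval A v + y 2F * y 2F * eval A w
          + y 0F * y 1F * polar A u v + y 0F * y 2F * polar A u w + y 1F * y 2F * polar A v w ∎
        where
        polar-⊙⊙ : ∀ a x b y → polar A (a ⊙ x) (b ⊙ y) ≈ a * b * polar A x y
        polar-⊙⊙ a x b y = trans (polar-⊙ A (a ⊙ x) b y) (trans (*-congˡ (trans (polar-sym A _ _) (trans (polar-⊙ A y a x) (*-congˡ (polar-sym A y x)))))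
          (solve 3 (λ a b p → b :* (a :* p) := a :* b :* p) refl a b _))

      polar-≉0 : ∀ x → ¬ (∀ y → polar A x y ≈ 0#) → ∃ λ j → ¬ (polar A x (δ j) ≈ 0#)
      polar-≉0 x x-regular with Fin.any? (λ j → ¬? (polar A x (δ j) ≟ 0#))
      ... | yes found = found
      ... | no none = contradiction (λ y → begin
        polar A x y
          ≈⟨ polar-congʳ A x (λ i → sym (sum-δ y i)) ⟩
        polar A x (λ i → sum (λ j → y j * δ j i))
          ≈⟨ Linear.homo-sum (polar-linear x) y δ zero ⟩
        sum (λ j → y j * polar A x (δ j))
          ≈⟨ sum-cong-≋ (λ j → *-congˡ {x = y j} (decidable-stable (polar A x (δ j) ≟ 0#) (λ p≉0 → none (j , p≉0)))) ⟩
        sum (λ j → y j * 0#)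
          ≈⟨ sum-cong-≋ (λ j → trans (zeroʳ (y j)) (sym (zeroˡ (y j)))) ⟩
        sum (λ j → 0# * y j)
          ≈⟨ *-distribˡ-sum 0# y ⟨
        0# * sum y
          ≈⟨ zeroˡ _ ⟩
        0# ∎) x-regular

    -- The zeros of y₁² - y₀y₂ are the points (1, θ, θ²) and (0, 0, 1), so this is a frame in which
    -- the conic of A is the standard one.
    StandardForm : Matrix 3 3 → Matrix 3 3 → Set _
    StandardForm A N = ∃ λ d → ¬ (d ≈ 0#) × (∀ y → eval A (N *ᵥ y) ≈ d * (y 1F * y 1F - y 0F * y 2F))

    conic-point : ∀ A → A Over 1 → ∃ λ x → ¬ (x ≋ 𝟎) × Rational 1 x × eval A x ≈ 0#
    conic-point A A-over =
      let x , y , z , x∈F , y∈F , z∈F , ≉0 , zero-at = ternary-zero _ _ _ _ _ _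
            (E 0F) (P 0F 1F) (E 1F) (P 0F 2F) (P 1F 2F) (E 2F)
          v = x ∷ y ∷ z ∷ []
      in v , (λ v≋0 → ≉0 (v≋0 0F , v≋0 1F , v≋0 2F)) , (λ { 0F → x∈F ; 1F → y∈F ; 2F → z∈F }) ,
         trans (eval-cong A (≋-sym (δ-combination v))) (trans (eval-combination A v (δ 0F) (δ 1F) (δ 2F)) zero-at)
      where
      E : ∀ j → eval A (δ j) ∈ F 1
      E j = eval-F A 1 A-over (δ-rational 1 j)
      P : ∀ i j → polar A (δ i) (δ j) ∈ F 1
      P i j = polar-F A 1 A-over (δ-rational 1 i) (δ-rational 1 j)

    -- A hyperbolic pair v, w (v a point of the conic) and a vector orthogonal to both.
    standard-frame : ∀ A → A Over 1 → Nondegenerate A → ∃ λ N → N Over 1 × Nonsingular N × StandardForm A N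
    standard-frame A A-over A-nondegenerate =
      N , N-over , N-nonsingular , d , d≉0 , λ y → trans (eval-cong A (N*ᵥ y)) (form y)
      where
      point = conic-point A A-over
      v : Vector Carrier 3
      v = proj₁ point
      v∈F : Rational 1 v
      v∈F = proj₁ (proj₂ (proj₂ point))
      Ev≈0 : eval A v ≈ 0#
      Ev≈0 = proj₂ (proj₂ (proj₂ point))
      regular : ∃ λ j → ¬ (polar A v (δ j) ≈ 0#)
      regular = polar-≉0 A v (A-nondegenerate v (proj₁ (proj₂ point)) Ev≈0)
      j : Fin 3
      j = proj₁ regular
      s : Carrier
      s = proj₁ (inverse _ (proj₂ regular))
      s-inverse : polar A v (δ j) * s ≈ 1#
      s-inverse = proj₂ (inverse _ (proj₂ regular))
      s∈F : s ∈ F 1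
      s∈F = F-inverse 1 (polar-F A 1 A-over v∈F (δ-rational 1 j)) s-inverse
      w₀ w n : Vector Carrier 3
      w₀ = s ⊙ δ j
      w₀∈F : Rational 1 w₀
      w₀∈F = ⊙-rational 1 {x = δ j} s∈F (δ-rational 1 j)
      Pvw₀≈1 : polar A v w₀ ≈ 1#
      Pvw₀≈1 = trans (polar-⊙ A v s (δ j)) (trans (*-comm _ _) s-inverse)
      Pvv≈0 : polar A v v ≈ 0#
      Pvv≈0 = trans (polar-self A v) (trans (+-cong Ev≈0 Ev≈0) (+-identityˡ 0#))
      -- Subtracting this multiple of v makes w a zero of the form, without division by 2, and keeps
      -- the polar product with v equal to 1, since v is orthogonal to itself.
      w = w₀ ⊕ (- eval A w₀) ⊙ v
      w∈F : Rational 1 w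
      w∈F = ⊕-rational 1 {x = w₀} {(- eval A w₀) ⊙ v} w₀∈F (⊙-rational 1 {x = v} (F-neg 1 (eval-F A 1 A-over w₀∈F)) v∈F)
      Pvw≈1 : polar A v w ≈ 1#
      Pvw≈1 = trans (polar-⊕ A v w₀ ((- eval A w₀) ⊙ v)) (trans (+-cong Pvw₀≈1 (trans (polar-⊙ A v _ v) (trans (*-congˡ Pvv≈0) (zeroʳ _)))) (+-identityʳ 1#))
      Ew≈0 : eval A w ≈ 0#
      Ew≈0 = begin
        eval A w
          ≈⟨ eval-⊕ A w₀ ((- eval A w₀) ⊙ v) ⟩
        eval A w₀ + eval A ((- eval A w₀) ⊙ v) + polar A w₀ ((- eval A w₀) ⊙ v)
          ≈⟨ +-cong (+-congˡ (trans (eval-⊙ A _ v) (trans (*-congˡ Ev≈0) (zeroʳ _))))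
               (trans (polar-⊙ A w₀ _ v) (*-congˡ (trans (polar-sym A w₀ v) Pvw₀≈1))) ⟩
        eval A w₀ + 0# + - eval A w₀ * 1#
          ≈⟨ solve 1 (λ e → e :+ con (ℤ.+ 0) :+ :- e :* con (ℤ.+ 1) := con (ℤ.+ 0)) refl (eval A w₀) ⟩
        0# ∎
      Pww≈0 : polar A w w ≈ 0#
      Pww≈0 = trans (polar-self A w) (trans (+-cong Ew≈0 Ew≈0) (+-identityˡ 0#))
      f g : Vector Carrier 3
      f i = polar A v (δ i)
      g i = polar A w (δ i)
      f∈F : Rational 1 f
      f∈F i = polar-F A 1 A-over v∈F (δ-rational 1 i)
      g∈F : Rational 1 g
      g∈F i = polar-F A 1 A-over w∈F (δ-rational 1 i)
      -- The vector product of the functionals `polar A v` and `polar A w`, which is therefore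
      -- annihilated by both.
      n = (f 1F * g 2F - f 2F * g 1F) ∷ (f 2F * g 0F - f 0F * g 2F) ∷ (f 0F * g 1F - f 1F * g 0F) ∷ []
      n∈F : Rational 1 n
      n∈F 0F = F-sub 1 (F-* 1 (f∈F 1F) (g∈F 2F)) (F-* 1 (f∈F 2F) (g∈F 1F))
      n∈F 1F = F-sub 1 (F-* 1 (f∈F 2F) (g∈F 0F)) (F-* 1 (f∈F 0F) (g∈F 2F))
      n∈F 2F = F-sub 1 (F-* 1 (f∈F 0F) (g∈F 1F)) (F-* 1 (f∈F 1F) (g∈F 0F))
      polar-coordinates : ∀ x y → polar A x y ≈ y 0F * polar A x (δ 0F) + y 1F * polar A x (δ 1F) + y 2F * polar A x (δ 2F)
      polar-coordinates x y = trans (polar-congʳ A x (≋-sym (δ-combination y))) (polar-combination A x y (δ 0F) (δ 1F) (δ 2F))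
      Pvn≈0 : polar A v n ≈ 0#
      Pvn≈0 = trans (polar-coordinates v n)
        (solve 6 (λ f₀ f₁ f₂ g₀ g₁ g₂ → (f₁ :* g₂ :- f₂ :* g₁) :* f₀ :+ (f₂ :* g₀ :- f₀ :* g₂) :* f₁ :+ (f₀ :* g₁ :- f₁ :* g₀) :* f₂ := con (ℤ.+ 0))
           refl (f 0F) (f 1F) (f 2F) (g 0F) (g 1F) (g 2F))
      Pwn≈0 : polar A w n ≈ 0#
      Pwn≈0 = trans (polar-coordinates w n)
        (solve 6 (λ f₀ f₁ f₂ g₀ g₁ g₂ → (f₁ :* g₂ :- f₂ :* g₁) :* g₀ :+ (f₂ :* g₀ :- f₀ :* g₂) :* g₁ :+ (f₀ :* g₁ :- f₁ :* g₀) :* g₂ := con (ℤ.+ 0))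
           refl (f 0F) (f 1F) (f 2F) (g 0F) (g 1F) (g 2F))
      -- By Lagrange's identity P(v,w)P(w,v) - P(v,v)P(w,w), here equal to 1, is the scalar product
      -- of w × v with n.
      n≉0 : ¬ (n ≋ 𝟎)
      n≉0 n≋0 = 1≉0 (begin
        1#
          ≈⟨ solve 0 (con (ℤ.+ 1) := con (ℤ.+ 1) :* con (ℤ.+ 1) :- con (ℤ.+ 0) :* con (ℤ.+ 0)) refl ⟩
        1# * 1# - 0# * 0#
          ≈⟨ +-cong (*-cong Pvw≈1 (trans (polar-sym A w v) Pvw≈1)) (-‿cong (*-cong Pvv≈0 Pww≈0)) ⟨
        polar A v w * polar A w v - polar A v v * polar A w w
          ≈⟨ +-cong (*-cong (polar-coordinates v w) (polar-coordinates w v)) (-‿cong (*-cong (polar-coordinates v v) (polar-coordinates w w))) ⟩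
        (w 0F * f 0F + w 1F * f 1F + w 2F * f 2F) * (v 0F * g 0F + v 1F * g 1F + v 2F * g 2F)
          - (v 0F * f 0F + v 1F * f 1F + v 2F * f 2F) * (w 0F * g 0F + w 1F * g 1F + w 2F * g 2F)
          ≈⟨ solve 12 (λ f₀ f₁ f₂ g₀ g₁ g₂ v₀ v₁ v₂ w₀ w₁ w₂ →
               (w₀ :* f₀ :+ w₁ :* f₁ :+ w₂ :* f₂) :* (v₀ :* g₀ :+ v₁ :* g₁ :+ v₂ :* g₂)
                 :- (v₀ :* f₀ :+ v₁ :* f₁ :+ v₂ :* f₂) :* (w₀ :* g₀ :+ w₁ :* g₁ :+ w₂ :* g₂) :=
               (w₁ :* v₂ :- w₂ :* v₁) :* (f₁ :* g₂ :- f₂ :* g₁) :+ (w₂ :* v₀ :- w₀ :* v₂) :* (f₂ :* g₀ :- f₀ :* g₂)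
                 :+ (w₀ :* v₁ :- w₁ :* v₀) :* (f₀ :* g₁ :- f₁ :* g₀))
               refl (f 0F) (f 1F) (f 2F) (g 0F) (g 1F) (g 2F) (v 0F) (v 1F) (v 2F) (w 0F) (w 1F) (w 2F) ⟩
        (w 1F * v 2F - w 2F * v 1F) * n 0F + (w 2F * v 0F - w 0F * v 2F) * n 1F + (w 0F * v 1F - w 1F * v 0F) * n 2F
          ≈⟨ +-cong (+-cong (trans (*-congˡ (n≋0 0F)) (zeroʳ _)) (trans (*-congˡ (n≋0 1F)) (zeroʳ _))) (trans (*-congˡ (n≋0 2F)) (zeroʳ _)) ⟩
        0# + 0# + 0#
          ≈⟨ trans (+-congʳ (+-identityˡ 0#)) (+-identityˡ 0#) ⟩
        0# ∎)
      independent : ∀ y → combination y v n w ≋ 𝟎 → y ≋ 𝟎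
      independent y eq = λ { 0F → y₀≈0 ; 1F → y₁≈0 ; 2F → y₂≈0 }
        where
        polar-eq : ∀ x → y 0F * polar A x v + y 1F * polar A x n + y 2F * polar A x w ≈ 0#
        polar-eq x = trans (sym (polar-combination A x y v n w)) (trans (polar-congʳ A x eq) (Linear.homo-𝟎 (polar-linear A x) zero))
        y₀≈0 : y 0F ≈ 0#
        y₀≈0 = trans (sym (trans (+-cong (+-cong (*-congˡ (trans (polar-sym A w v) Pvw≈1)) (*-congˡ Pwn≈0)) (*-congˡ Pww≈0))
          (solve 3 (λ a b c → a :* con (ℤ.+ 1) :+ b :* con (ℤ.+ 0) :+ c :* con (ℤ.+ 0) := a) refl (y 0F) (y 1F) (y 2F)))) (polar-eq w)
        y₂≈0 : y 2F ≈ 0#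
        y₂≈0 = trans (sym (trans (+-cong (+-cong (*-congˡ Pvv≈0) (*-congˡ Pvn≈0)) (*-congˡ Pvw≈1))
          (solve 3 (λ a b c → a :* con (ℤ.+ 0) :+ b :* con (ℤ.+ 0) :+ c :* con (ℤ.+ 1) := c) refl (y 0F) (y 1F) (y 2F)))) (polar-eq v)
        y₁≈0 : y 1F ≈ 0#
        y₁≈0 = let i , nᵢ≉0 = nonzero-entry n≉0 in xy≈0⇒y≈0 nᵢ≉0 (begin
          n i * y 1F
            ≈⟨ solve 4 (λ a b vi wi → b := con (ℤ.+ 0) :* vi :+ b :+ con (ℤ.+ 0) :* wi) refl (y 0F) (n i * y 1F) (v i) (w i) ⟩
          0# * v i + n i * y 1F + 0# * w i
            ≈⟨ +-cong (+-cong (*-congʳ y₀≈0) (*-comm _ _)) (*-congʳ y₂≈0) ⟨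
          combination y v n w i
            ≈⟨ eq i ⟩
          0# ∎)
      d : Carrier
      d = eval A n
      -- If the form vanished at n, then also P(n,n) = 0, and n would be orthogonal to the basis v,
      -- n, w: a singular point.
      d≉0 : ¬ (d ≈ 0#)
      d≉0 d≈0 = A-nondegenerate n n≉0 d≈0 λ y →
        let x , Vx≋y = nonsingular⇒surjective (fromColumns v n w)
              (λ x eq → independent x (≋-trans (≋-sym (*ᵥ-columns (fromColumns v n w) x)) eq)) y
        in begin
          polar A n y
            ≈⟨ polar-congʳ A n (≋-trans (≋-sym Vx≋y) (*ᵥ-columns (fromColumns v n w) x)) ⟩
          polar A n (combination x v n w)
            ≈⟨ polar-combination A n x v n w ⟩
          x 0F * polar A n v + x 1F * polar A n n + x 2F * polar A n w
            ≈⟨ +-cong (+-cong (*-congˡ (trans (polar-sym A n v) Pvn≈0)) (*-congˡ (trans (polar-self A n) (+-cong d≈0 d≈0))))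
                 (*-congˡ (trans (polar-sym A n w) Pwn≈0)) ⟩
          x 0F * 0# + x 1F * (0# + 0#) + x 2F * 0#
            ≈⟨ solve 3 (λ a b c → a :* con (ℤ.+ 0) :+ b :* (con (ℤ.+ 0) :+ con (ℤ.+ 0)) :+ c :* con (ℤ.+ 0) := con (ℤ.+ 0)) refl (x 0F) (x 1F) (x 2F) ⟩
          0# ∎
      N : Matrix 3 3
      -- The factor -d turns the mixed term y₀y₂ P(v,w) into -d y₀y₂, matching d y₁².
      N = fromColumns ((- d) ⊙ v) n w
      N*ᵥ : ∀ y → N *ᵥ y ≋ combination y ((- d) ⊙ v) n w
      N*ᵥ = *ᵥ-columns N
      N-over : N Over 1
      N-over i 0F = F-* 1 (F-neg 1 (eval-F A 1 A-over n∈F)) (v∈F i)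
      N-over i 1F = n∈F i
      N-over i 2F = w∈F i
      N-nonsingular : Nonsingular N
      N-nonsingular y Ny≋0 = λ { 0F → xy≈0⇒y≈0 -d≉0 (y′≋0 0F) ; 1F → y′≋0 1F ; 2F → y′≋0 2F }
        where
        y′ : Vector Carrier 3
        y′ = (- d * y 0F) ∷ y 1F ∷ y 2F ∷ []
        -d≉0 : ¬ (- d ≈ 0#)
        -d≉0 eq = d≉0 (trans (solve 1 (λ d → d := con (ℤ.+ 0) :- :- d) refl d) (trans (+-congˡ (-‿cong eq)) (-‿inverseʳ 0#)))
        y′≋0 : y′ ≋ 𝟎
        y′≋0 = independent y′ (λ i → trans (+-congʳ (+-congʳ (solve 3 (λ d y v → (:- d :* y) :* v := y :* (:- d :* v)) refl d (y 0F) (v i))))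
          (trans (sym (N*ᵥ y i)) (Ny≋0 i)))
      form : ∀ y → eval A (combination y ((- d) ⊙ v) n w) ≈ d * (y 1F * y 1F - y 0F * y 2F)
      form y = begin
        eval A (combination y ((- d) ⊙ v) n w)
          ≈⟨ eval-combination A y ((- d) ⊙ v) n w ⟩
        y 0F * y 0F * eval A ((- d) ⊙ v) + y 1F * y 1F * d + y 2F * y 2F * eval A w
          + y 0F * y 1F * polar A ((- d) ⊙ v) n + y 0F * y 2F * polar A ((- d) ⊙ v) w + y 1F * y 2F * polar A n w
          ≈⟨ +-cong (+-cong (+-cong (+-cong (+-congʳ (*-congˡ (trans (eval-⊙ A (- d) v) (*-congˡ Ev≈0)))) (*-congˡ Ew≈0))
               (*-congˡ (polar-⊙ˡ n Pvn≈0))) (*-congˡ (polar-⊙ˡ w Pvw≈1))) (*-congˡ (trans (polar-sym A n w) Pwn≈0)) ⟩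
        y 0F * y 0F * (- d * - d * 0#) + y 1F * y 1F * d + y 2F * y 2F * 0#
          + y 0F * y 1F * (- d * 0#) + y 0F * y 2F * (- d * 1#) + y 1F * y 2F * 0#
          ≈⟨ solve 4 (λ d a b c → a :* a :* (:- d :* (:- d) :* con (ℤ.+ 0)) :+ b :* b :* d :+ c :* c :* con (ℤ.+ 0)
               :+ a :* b :* (:- d :* con (ℤ.+ 0)) :+ a :* c :* (:- d :* con (ℤ.+ 1)) :+ b :* c :* con (ℤ.+ 0) := d :* (b :* b :- a :* c))
               refl d (y 0F) (y 1F) (y 2F) ⟩
        d * (y 1F * y 1F - y 0F * y 2F) ∎
        where
        polar-⊙ˡ : ∀ x {p} → polar A v x ≈ p → polar A ((- d) ⊙ v) x ≈ - d * p
        polar-⊙ˡ x eq = trans (polar-sym A ((- d) ⊙ v) x) (trans (polar-⊙ A x (- d) v) (*-congˡ (trans (polar-sym A x v) eq)))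

    -- At (1, θ, θ²) the form is a quartic in θ, which has five zeros in F_q and is therefore zero.
    -- Its coefficients leave only E(v)(y₁² - y₀y₂) of the form. This is why C determines C⁺ and
    -- C⁺⁺.
    standard-form-extends : ∀ A N → Nondegenerate A → Nonsingular N → (∀ θ → θ ∈ F 1 → eval A (N *ᵥ moment 2 θ) ≈ 0#) → StandardForm A N
    standard-form-extends A N A-nondegenerate N-nonsingular vanish = E v , E-v≉0 , λ y → trans (eval-cong A (*ᵥ-columns N y)) (form y)
      where
      u v w : Vector Carrier 3
      u i = N i 0F
      v i = N i 1F
      w i = N i 2F
      E : Vector Carrier 3 → Carrier
      E = eval A
      P : Vector Carrier 3 → Vector Carrier 3 → Carrier
      P = polar A
      quartic : Vector Carrier 5
      quartic = E u ∷ P u v ∷ (E v + P u w) ∷ P v w ∷ E w ∷ []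
      quartic-root : ∀ θ → θ ∈ F 1 → horner quartic θ ≈ 0#
      quartic-root θ θ∈F = trans
        (sym (trans (eval-combination A (moment 2 θ) u v w)
          (solve 7 (λ t eu ev ew uv uw vw → let o = con (ℤ.+ 1) ; t² = t :* (t :* o) ; t¹ = t :* o in
             o :* o :* eu :+ t¹ :* t¹ :* ev :+ t² :* t² :* ew :+ o :* t¹ :* uv :+ o :* t² :* uw :+ t¹ :* t² :* vw :=
             eu :+ t :* (uv :+ t :* (ev :+ uw :+ t :* (vw :+ t :* (ew :+ t :* con (ℤ.+ 0)))))) refl θ (E u) (E v) (E w) (P u v) (P u w) (P v w))))
        (trans (eval-cong A (≋-sym (*ᵥ-columns N (moment 2 θ)))) (vanish θ θ∈F))
      quartic≈0 : ∀ i → quartic i ≈ 0#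
      quartic≈0 = let a , distinct , a∈F = five-elements in horner-roots quartic a distinct (λ i → quartic-root (a i) (a∈F i))
      Puw≈ : P u w ≈ - E v
      Puw≈ = trans (solve 2 (λ e p → p := (e :+ p) :- e) refl (E v) (P u w)) (trans (+-congʳ (quartic≈0 2F)) (+-identityˡ _))
      form : ∀ y → E (combination y u v w) ≈ E v * (y 1F * y 1F - y 0F * y 2F)
      form y = begin
        E (combination y u v w)
          ≈⟨ eval-combination A y u v w ⟩
        y 0F * y 0F * E u + y 1F * y 1F * E v + y 2F * y 2F * E w + y 0F * y 1F * P u v + y 0F * y 2F * P u w + y 1F * y 2F * P v w
          ≈⟨ +-cong (+-cong (+-cong (+-cong (+-congʳ (*-congˡ (quartic≈0 0F))) (*-congˡ (quartic≈0 4F))) (*-congˡ (quartic≈0 1F))) (*-congˡ Puw≈)) (*-congˡ (quartic≈0 3F)) ⟩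
        y 0F * y 0F * 0# + y 1F * y 1F * E v + y 2F * y 2F * 0# + y 0F * y 1F * 0# + y 0F * y 2F * - E v + y 1F * y 2F * 0#
          ≈⟨ solve 4 (λ e a b c → a :* a :* con (ℤ.+ 0) :+ b :* b :* e :+ c :* c :* con (ℤ.+ 0) :+ a :* b :* con (ℤ.+ 0) :+ a :* c :* (:- e) :+ b :* c :* con (ℤ.+ 0)
               := e :* (b :* b :- a :* c)) refl (E v) (y 0F) (y 1F) (y 2F) ⟩
        E v * (y 1F * y 1F - y 0F * y 2F) ∎
      -- Otherwise the first column u of N is a zero of the form orthogonal to all three columns,
      -- hence a singular point.
      E-v≉0 : ¬ (E v ≈ 0#)
      E-v≉0 Ev≈0 = A-nondegenerate u u≉0 (quartic≈0 0F) λ y →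
        let x , Nx≋y = nonsingular⇒surjective N N-nonsingular y
        in begin
          P u y
            ≈⟨ polar-congʳ A u (≋-trans (≋-sym Nx≋y) (*ᵥ-columns N x)) ⟩
          P u (combination x u v w)
            ≈⟨ polar-combination A u x u v w ⟩
          x 0F * P u u + x 1F * P u v + x 2F * P u w
            ≈⟨ +-cong (+-cong (*-congˡ (trans (polar-self A u) (+-cong (quartic≈0 0F) (quartic≈0 0F)))) (*-congˡ (quartic≈0 1F))) (*-congˡ (trans Puw≈ (-‿cong Ev≈0))) ⟩
          x 0F * (0# + 0#) + x 1F * 0# + x 2F * - 0#
            ≈⟨ solve 3 (λ a b c → a :* (con (ℤ.+ 0) :+ con (ℤ.+ 0)) :+ b :* con (ℤ.+ 0) :+ c :* (:- con (ℤ.+ 0)) := con (ℤ.+ 0)) refl (x 0F) (x 1F) (x 2F) ⟩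
          0# ∎
        where
        u≉0 : ¬ (u ≋ 𝟎)
        u≉0 u≋0 = δ-≉𝟎 {3} 0F (N-nonsingular (δ 0F) (≋-trans (*ᵥ-columns N (δ 0F))
          (λ i → trans (solve 3 (λ a b c → con (ℤ.+ 1) :* a :+ con (ℤ.+ 0) :* b :+ con (ℤ.+ 0) :* c := a) refl (u i) (v i) (w i)) (u≋0 i))))

    -- The parameter nothing is θ = ∞.
    veronese : ∀ r → Maybe Carrier → Vector Carrier (suc r)
    veronese r (just θ) = moment r θ
    veronese r nothing  = e-last r

    Parameter : ℕ → Maybe Carrier → Set ℓ
    Parameter k (just θ) = θ ∈ F k
    Parameter k nothing  = ⊤

    ^-F : ∀ k n {x} → x ∈ F k → (x ^ n) ∈ F k
    ^-F k zero    x∈F = F-1 k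
    ^-F k (suc n) x∈F = F-* k x∈F (^-F k n x∈F)

    e-last-rational : ∀ k r → Rational k (e-last r)
    e-last-rational k zero    zero    = F-1 k
    e-last-rational k (suc r) zero    = F-0 k
    e-last-rational k (suc r) (suc i) = e-last-rational k r i

    veronese-rational : ∀ k r τ → Parameter k τ → Rational k (veronese r τ)
    veronese-rational k r (just θ) θ∈F i = ^-F k (Fin.toℕ i) θ∈F
    veronese-rational k r nothing  _   i = e-last-rational k r i

    veronese-≉𝟎 : ∀ r τ → ¬ (veronese r τ ≋ 𝟎)
    veronese-≉𝟎 r (just θ) eq = 1≉0 (eq zero)
    veronese-≉𝟎 r nothing  eq = e-last-≉𝟎 r eq
      where
      e-last-≉𝟎 : ∀ r → ¬ (e-last r ≋ 𝟎)
      e-last-≉𝟎 zero    eq = 1≉0 (eq zero)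
      e-last-≉𝟎 (suc r) eq = e-last-≉𝟎 r (eq ∘ suc)

    veronese-on-conic : ∀ τ → let y = veronese 2 τ in y 1F * y 1F ≈ y 0F * y 2F
    veronese-on-conic (just θ) = solve 1 (λ t → let o = con (ℤ.+ 1) in (t :* o) :* (t :* o) := o :* (t :* (t :* o))) refl θ
    veronese-on-conic nothing  = solve 0 (con (ℤ.+ 0) :* con (ℤ.+ 0) := con (ℤ.+ 0) :* con (ℤ.+ 1)) refl

    -- For a rational representative z the parameter is z₁/z₀; if z₀ = 0, the equation forces z₁ = 0
    -- and the point is that at ∞. Working with z keeps the parameter in the subfield.
    conic⇒veronese : ∀ k {y} → y ∈ PG 2 k → y 1F * y 1F ≈ y 0F * y 2F → ∃ λ τ → Parameter k τ × y ∼ veronese 2 τ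
    conic⇒veronese k {y} (y≉0 , z , y∼z@(a , a≉0 , y≋az) , z∈F) y-on-conic = by-z₀ (z 0F ≟ 0#)
      where
      z-on-conic : z 1F * z 1F ≈ z 0F * z 2F
      z-on-conic = *-cancelˡ-≉0 (xy≉0 a≉0 a≉0) (begin
        a * a * (z 1F * z 1F)       ≈⟨ solve 3 (λ a x y → a :* a :* (x :* y) := (a :* x) :* (a :* y)) refl a _ _ ⟩
        (a * z 1F) * (a * z 1F)     ≈⟨ *-cong (y≋az 1F) (y≋az 1F) ⟨
        y 1F * y 1F                 ≈⟨ y-on-conic ⟩
        y 0F * y 2F                 ≈⟨ *-cong (y≋az 0F) (y≋az 2F) ⟩
        (a * z 0F) * (a * z 2F)     ≈⟨ solve 3 (λ a x y → (a :* x) :* (a :* y) := a :* a :* (x :* y)) refl a _ _ ⟩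
        a * a * (z 0F * z 2F)       ∎)
      by-z₀ : Dec (z 0F ≈ 0#) → ∃ λ τ → Parameter k τ × y ∼ veronese 2 τ
      by-z₀ (yes z₀≈0) = nothing , tt , ∼-trans y∼z (z 2F , z₂≉0 , λ
        { 0F → trans z₀≈0 (sym (zeroʳ _)) ; 1F → trans z₁≈0 (sym (zeroʳ _)) ; 2F → sym (*-identityʳ _) })
        where
        z₁≈0 : z 1F ≈ 0#
        z₁≈0 = [ (λ eq → eq) , (λ eq → eq) ] (xy≈0⇒x≈0⊎y≈0 (trans z-on-conic (trans (*-congʳ z₀≈0) (zeroˡ _))))
        z₂≉0 : ¬ (z 2F ≈ 0#)
        z₂≉0 z₂≈0 = y≉0 λ i → trans (y≋az i) (trans (*-congˡ (z≋0 i)) (zeroʳ a))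
          where
          z≋0 : z ≋ 𝟎
          z≋0 0F = z₀≈0
          z≋0 1F = z₁≈0
          z≋0 2F = z₂≈0
      by-z₀ (no z₀≉0) = just (z 1F * r) , F-* k (z∈F 1F) (F-inverse k (z∈F 0F) z₀r≈1) , ∼-trans y∼z (z 0F , z₀≉0 , λ
        { 0F → sym (*-identityʳ _)
        ; 1F → sym (trans (solve 3 (λ a b r → a :* ((b :* r) :* con (ℤ.+ 1)) := b :* (a :* r)) refl (z 0F) (z 1F) r) (trans (*-congˡ z₀r≈1) (*-identityʳ _)))
        ; 2F → sym (begin
            z 0F * ((z 1F * r) * ((z 1F * r) * 1#))   ≈⟨ solve 3 (λ a b r → a :* ((b :* r) :* ((b :* r) :* con (ℤ.+ 1))) := (a :* r) :* r :* (b :* b)) refl (z 0F) (z 1F) r ⟩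
            z 0F * r * r * (z 1F * z 1F)              ≈⟨ *-congˡ z-on-conic ⟩
            z 0F * r * r * (z 0F * z 2F)              ≈⟨ solve 3 (λ a c r → a :* r :* r :* (a :* c) := (a :* r) :* (a :* r) :* c) refl (z 0F) (z 2F) r ⟩
            (z 0F * r) * (z 0F * r) * z 2F            ≈⟨ *-congʳ (trans (*-cong z₀r≈1 z₀r≈1) (*-identityʳ 1#)) ⟩
            1# * z 2F                                 ≈⟨ *-identityˡ _ ⟩
            z 2F                                      ∎) })
        where
        r : Carrier
        r = proj₁ (inverse (z 0F) z₀≉0)
        z₀r≈1 : z 0F * r ≈ 1#
        z₀r≈1 = proj₂ (inverse (z 0F) z₀≉0)

  -- Quadratics as operators on moment sequences; independence of u, u′, u″

  module QuadraticForms where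

    open import Data.Vec.Functional using ([]; _∷_)
    open Subfields
    open LinearAlgebra
    open Projective
    open ConicFrames

    dot : Vector Carrier 3 → Vector Carrier 3 → Carrier
    dot u y = u 0F * y 0F + u 1F * y 1F + u 2F * y 2F

    dot-cong : ∀ {u v x y} → u ≋ v → x ≋ y → dot u x ≈ dot v y
    dot-cong p q = +-cong (+-cong (*-cong (p 0F) (q 0F)) (*-cong (p 1F) (q 1F))) (*-cong (p 2F) (q 2F))

    dot-congˡ : ∀ {u v} y → u ≋ v → dot u y ≈ dot v y
    dot-congˡ y p = dot-cong {x = y} p ≋-refl

    dot-congʳ : ∀ u {x y} → x ≋ y → dot u x ≈ dot u y
    dot-congʳ u = dot-cong {u} ≋-refl

    dot-linear : ∀ u → Linear {3} {1} (λ y _ → dot u y)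
    dot-linear u = record
      { cong   = λ {x} {y} x≋y _ → dot-congʳ u {x} {y} x≋y
      ; homo-⊕ = λ x y _ → solve 9 (λ a b c x₀ x₁ x₂ y₀ y₁ y₂ →
          a :* (x₀ :+ y₀) :+ b :* (x₁ :+ y₁) :+ c :* (x₂ :+ y₂) := (a :* x₀ :+ b :* x₁ :+ c :* x₂) :+ (a :* y₀ :+ b :* y₁ :+ c :* y₂))
          refl (u 0F) (u 1F) (u 2F) (x 0F) (x 1F) (x 2F) (y 0F) (y 1F) (y 2F)
      ; homo-⊙ = λ a y _ → dot-⊙ u a y }
      where
      dot-⊙ : ∀ u a y → dot u (a ⊙ y) ≈ a * dot u y
      dot-⊙ u a y = solve 7 (λ k a b c y₀ y₁ y₂ → a :* (k :* y₀) :+ b :* (k :* y₁) :+ c :* (k :* y₂) := k :* (a :* y₀ :+ b :* y₁ :+ c :* y₂))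
        refl a (u 0F) (u 1F) (u 2F) (y 0F) (y 1F) (y 2F)

    dot-⊙ : ∀ u a y → dot u (a ⊙ y) ≈ a * dot u y
    dot-⊙ u a y = Linear.homo-⊙ (dot-linear u) a y zero

    dot-⊕ : ∀ u x y → dot u (x ⊕ y) ≈ dot u x + dot u y
    dot-⊕ u x y = Linear.homo-⊕ (dot-linear u) x y zero

    dot-⊙ˡ : ∀ a u y → dot (a ⊙ u) y ≈ a * dot u y
    dot-⊙ˡ a u y = solve 7 (λ k a b c y₀ y₁ y₂ → (k :* a) :* y₀ :+ (k :* b) :* y₁ :+ (k :* c) :* y₂ := k :* (a :* y₀ :+ b :* y₁ :+ c :* y₂))
        refl a (u 0F) (u 1F) (u 2F) (y 0F) (y 1F) (y 2F)

    dot-𝟎 : ∀ u → dot u 𝟎 ≈ 0#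
    dot-𝟎 u = Linear.homo-𝟎 (dot-linear u) zero

    dot-kernel : ∀ u → IsLinearSubspace (λ y → dot u y ≈ 0#)
    dot-kernel u = record
      { resp = λ {x} {y} x≋y p → trans (sym (dot-congʳ u {x} {y} x≋y)) p
      ; ∋𝟎   = dot-𝟎 u
      ; ∋⊕   = λ {x} {y} p q → trans (dot-⊕ u x y) (trans (+-cong p q) (+-identityˡ 0#))
      ; ∋⊙   = λ a {x} p → trans (dot-⊙ u a x) (trans (*-congˡ p) (zeroʳ a)) }

    frob-dot : ∀ k u y → frob k (dot u y) ≈ dot (φ k u) (φ k y)
    frob-dot k u y = trans (frob-+ k _ _) (+-cong (trans (frob-+ k _ _) (+-cong (frob-* k _ _) (frob-* k _ _))) (frob-* k _ _))

    dot-∼ : ∀ u {x y} → x ∼ y → dot u y ≈ 0# → dot u x ≈ 0#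
    dot-∼ u {y = y} (a , _ , x≋ay) uy≈0 = trans (dot-congʳ u x≋ay) (trans (dot-⊙ u a y) (trans (*-congˡ uy≈0) (zeroʳ a)))

    dot-F : ∀ k {u y} → Rational k u → Rational k y → dot u y ∈ F k
    dot-F k u∈F y∈F = F-+ k (F-+ k (F-* k (u∈F 0F) (y∈F 0F)) (F-* k (u∈F 1F) (y∈F 1F))) (F-* k (u∈F 2F) (y∈F 2F))

    infixr 7 _⊛_

    -- If m is the sequence of values of a linear functional on 1, t, t², …, then a ⊛ m is
    -- that of the functional p ↦ m (a p), where a is the polynomial a₀ + a₁t + a₂t².
    _⊛_ : Vector Carrier 3 → ∀ {n} → Vector Carrier (2 ℕ.+ n) → Vector Carrier n
    (a ⊛ m) i = a 0F * m (inject₁ (inject₁ i)) + a 1F * m (suc (inject₁ i)) + a 2F * m (suc (suc i))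

    ⊛-cong : ∀ {a b n} {m m′ : Vector Carrier (2 ℕ.+ n)} → a ≋ b → m ≋ m′ → a ⊛ m ≋ b ⊛ m′
    ⊛-cong p q i = +-cong (+-cong (*-cong (p 0F) (q _)) (*-cong (p 1F) (q _))) (*-cong (p 2F) (q _))

    ⊛-linear : ∀ a {n} → Linear {2 ℕ.+ n} {n} (a ⊛_)
    ⊛-linear a = record
      { cong   = λ m≋m′ → ⊛-cong {a} {a} ≋-refl m≋m′
      ; homo-⊕ = λ x y i → solve 9 (λ a b c x₀ x₁ x₂ y₀ y₁ y₂ →
          a :* (x₀ :+ y₀) :+ b :* (x₁ :+ y₁) :+ c :* (x₂ :+ y₂) := (a :* x₀ :+ b :* x₁ :+ c :* x₂) :+ (a :* y₀ :+ b :* y₁ :+ c :* y₂))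
          refl (a 0F) (a 1F) (a 2F) _ _ _ _ _ _
      ; homo-⊙ = λ k y i → solve 7 (λ k a b c y₀ y₁ y₂ → a :* (k :* y₀) :+ b :* (k :* y₁) :+ c :* (k :* y₂) := k :* (a :* y₀ :+ b :* y₁ :+ c :* y₂))
          refl k (a 0F) (a 1F) (a 2F) _ _ _ }

    φ-⊛ : ∀ k a {n} (m : Vector Carrier (2 ℕ.+ n)) → φ k (a ⊛ m) ≋ φ k a ⊛ φ k m
    φ-⊛ k a m i = trans (frob-+ k _ _) (+-cong (trans (frob-+ k _ _) (+-cong (frob-* k _ _) (frob-* k _ _))) (frob-* k _ _))

    ⊛-comm : ∀ a b {n} (m : Vector Carrier (4 ℕ.+ n)) → a ⊛ b ⊛ m ≋ b ⊛ a ⊛ m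
    ⊛-comm a b m i = solve 11 (λ a₀ a₁ a₂ b₀ b₁ b₂ m₀ m₁ m₂ m₃ m₄ →
      a₀ :* (b₀ :* m₀ :+ b₁ :* m₁ :+ b₂ :* m₂) :+ a₁ :* (b₀ :* m₁ :+ b₁ :* m₂ :+ b₂ :* m₃) :+ a₂ :* (b₀ :* m₂ :+ b₁ :* m₃ :+ b₂ :* m₄) :=
      b₀ :* (a₀ :* m₀ :+ a₁ :* m₁ :+ a₂ :* m₂) :+ b₁ :* (a₀ :* m₁ :+ a₁ :* m₂ :+ a₂ :* m₃) :+ b₂ :* (a₀ :* m₂ :+ a₁ :* m₃ :+ a₂ :* m₄))
      refl (a 0F) (a 1F) (a 2F) (b 0F) (b 1F) (b 2F) (m _) (m _) (m _) (m _) (m _)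

    e-last-inject₁ : ∀ r (i : Fin (suc r)) → e-last (suc r) (inject₁ i) ≈ 0#
    e-last-inject₁ r       zero    = refl
    e-last-inject₁ (suc r) (suc i) = e-last-inject₁ r i

    -- The vector at θ is the functional of evaluation at θ, and that at ∞ takes the leading
    -- coefficient. Both are multiplicative, so multiplying by a scales them by the value of a at θ,
    -- or by a₂.
    ⊛-veronese : ∀ a r τ → a ⊛ veronese (2 ℕ.+ r) τ ≋ dot a (veronese 2 τ) ⊙ veronese r τ
    ⊛-veronese a r (just θ) i = trans
      (+-cong (+-cong (*-congˡ (^-congʳ θ (≡.trans (Fin.toℕ-inject₁ (inject₁ i)) (Fin.toℕ-inject₁ i))))
                      (*-congˡ (*-congˡ (^-congʳ θ (Fin.toℕ-inject₁ i))))) refl)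
      (solve 5 (λ a b c t p → a :* p :+ b :* (t :* p) :+ c :* (t :* (t :* p)) :=
         (a :* con (ℤ.+ 1) :+ b :* (t :* con (ℤ.+ 1)) :+ c :* (t :* (t :* con (ℤ.+ 1)))) :* p) refl (a 0F) (a 1F) (a 2F) θ (θ ^ Fin.toℕ i))
    ⊛-veronese a r nothing i = trans
      (+-cong (+-cong (*-congˡ (e-last-inject₁ (suc r) (inject₁ i))) (*-congˡ (e-last-inject₁ r i))) refl)
      (solve 4 (λ a b c p → a :* con (ℤ.+ 0) :+ b :* con (ℤ.+ 0) :+ c :* p :=
         (a :* con (ℤ.+ 0) :+ b :* con (ℤ.+ 0) :+ c :* con (ℤ.+ 1)) :* p) refl (a 0F) (a 1F) (a 2F) (e-last r i))

    record Splits (a : Vector Carrier 3) : Set (c ⊔ ℓ) where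
      field
        α β   : Carrier
        a₂≉0  : ¬ (a 2F ≈ 0#)
        a₀≈   : a 0F ≈ a 2F * (α * β)
        a₁≈   : a 1F ≈ a 2F * (- (α + β))

      factorisation : ∀ θ → dot a (veronese 2 (just θ)) ≈ a 2F * ((θ - α) * (θ - β))
      factorisation θ = trans (+-congʳ (+-cong (*-congʳ a₀≈) (*-congʳ a₁≈)))
        (solve 4 (λ k α β t → k :* (α :* β) :* con (ℤ.+ 1) :+ k :* (:- (α :+ β)) :* (t :* con (ℤ.+ 1)) :+ k :* (t :* (t :* con (ℤ.+ 1))) :=
           k :* ((t :- α) :* (t :- β))) refl (a 2F) α β θ)

      root-α : dot a (veronese 2 (just α)) ≈ 0#
      root-α = trans (factorisation α) (solve 3 (λ k α β → k :* ((α :- α) :* (α :- β)) := con (ℤ.+ 0)) refl (a 2F) α β)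

      root-β : dot a (veronese 2 (just β)) ≈ 0#
      root-β = trans (factorisation β) (solve 3 (λ k α β → k :* ((β :- α) :* (β :- β)) := con (ℤ.+ 0)) refl (a 2F) α β)

      roots : ∀ θ → dot a (veronese 2 (just θ)) ≈ 0# → θ ≈ α ⊎ θ ≈ β
      roots θ eq with xy≈0⇒x≈0⊎y≈0 (xy≈0⇒y≈0 a₂≉0 (trans (sym (factorisation θ)) eq))
      ... | inj₁ θ-α≈0 = inj₁ (x-y≈0⇒x≈y θ-α≈0)
      ... | inj₂ θ-β≈0 = inj₂ (x-y≈0⇒x≈y θ-β≈0)

      ∞-not-root : ¬ (dot a (veronese 2 nothing) ≈ 0#)
      ∞-not-root eq = a₂≉0 (trans (solve 3 (λ a b c → c := a :* con (ℤ.+ 0) :+ b :* con (ℤ.+ 0) :+ c :* con (ℤ.+ 1)) refl (a 0F) (a 1F) (a 2F)) eq)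

    Coprime : Vector Carrier 3 → Vector Carrier 3 → Set _
    Coprime a b = ∀ τ → dot a (veronese 2 τ) ≈ 0# → ¬ (dot b (veronese 2 τ) ≈ 0#)

    -- By the first equation the differences mᵢ₊₁ - α mᵢ form a geometric progression of ratio β;
    -- by the second this progression is a multiple of b(β) ≠ 0, and so is m itself with b(α).
    coprime⇒injective₄ : ∀ a b → Splits a → Coprime a b → (m : Vector Carrier 4) → a ⊛ m ≋ 𝟎 → b ⊛ m ≋ 𝟎 → m ≋ 𝟎
    coprime⇒injective₄ a b a-splits a-b-coprime m am≋0 bm≋0 = λ { 0F → m₀≈0 ; 1F → m₁≈0 ; 2F → m₂≈0 ; 3F → m₃≈0 }
      where
      open Splits a-splits
      recurrence : ∀ x y z → a 0F * x + a 1F * y + a 2F * z ≈ 0# → z - α * y ≈ β * (y - α * x)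
      recurrence x y z eq = x-y≈0⇒x≈y (xy≈0⇒y≈0 a₂≉0 (trans
        (solve 6 (λ k α β x y z → k :* ((z :- α :* y) :- β :* (y :- α :* x)) := k :* (α :* β) :* x :+ k :* (:- (α :+ β)) :* y :+ k :* z) refl (a 2F) α β x y z)
        (trans (sym (+-congʳ (+-cong (*-congʳ a₀≈) (*-congʳ a₁≈)))) eq)))
      d₀ : Carrier
      d₀ = m 1F - α * m 0F
      d₁ : m 2F - α * m 1F ≈ β * d₀
      d₁ = recurrence (m 0F) (m 1F) (m 2F) (am≋0 0F)
      d₂ : m 3F - α * m 2F ≈ β * (β * d₀)
      d₂ = trans (recurrence (m 1F) (m 2F) (m 3F) (am≋0 1F)) (*-congˡ d₁)
      d₀≈0 : d₀ ≈ 0#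
      d₀≈0 = xy≈0⇒y≈0 (a-b-coprime (just β) root-β) (begin
        (b 0F * 1# + b 1F * (β * 1#) + b 2F * (β * (β * 1#))) * d₀
          ≈⟨ solve 5 (λ p q r β d → (p :* con (ℤ.+ 1) :+ q :* (β :* con (ℤ.+ 1)) :+ r :* (β :* (β :* con (ℤ.+ 1)))) :* d :=
               p :* d :+ q :* (β :* d) :+ r :* (β :* (β :* d))) refl (b 0F) (b 1F) (b 2F) β d₀ ⟩
        b 0F * d₀ + b 1F * (β * d₀) + b 2F * (β * (β * d₀))
          ≈⟨ +-cong (+-congˡ (*-congˡ d₁)) (*-congˡ d₂) ⟨
        b 0F * d₀ + b 1F * (m 2F - α * m 1F) + b 2F * (m 3F - α * m 2F)
          ≈⟨ solve 8 (λ p q r α m₀ m₁ m₂ m₃ → p :* (m₁ :- α :* m₀) :+ q :* (m₂ :- α :* m₁) :+ r :* (m₃ :- α :* m₂) :=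
               (p :* m₁ :+ q :* m₂ :+ r :* m₃) :- α :* (p :* m₀ :+ q :* m₁ :+ r :* m₂)) refl (b 0F) (b 1F) (b 2F) α (m 0F) (m 1F) (m 2F) (m 3F) ⟩
        (b ⊛ m) 1F - α * (b ⊛ m) 0F
          ≈⟨ +-cong (bm≋0 1F) (-‿cong (*-congˡ (bm≋0 0F))) ⟩
        0# - α * 0#
          ≈⟨ solve 1 (λ α → con (ℤ.+ 0) :- α :* con (ℤ.+ 0) := con (ℤ.+ 0)) refl α ⟩
        0# ∎)
      m₁≈αm₀ : m 1F ≈ α * m 0F
      m₁≈αm₀ = x-y≈0⇒x≈y d₀≈0
      m₂≈αm₁ : m 2F ≈ α * m 1F
      m₂≈αm₁ = x-y≈0⇒x≈y (trans d₁ (trans (*-congˡ d₀≈0) (zeroʳ β)))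
      m₃≈αm₂ : m 3F ≈ α * m 2F
      m₃≈αm₂ = x-y≈0⇒x≈y (trans d₂ (trans (*-congˡ (trans (*-congˡ d₀≈0) (zeroʳ β))) (zeroʳ β)))
      m₀≈0 : m 0F ≈ 0#
      m₀≈0 = xy≈0⇒y≈0 (a-b-coprime (just α) root-α) (begin
        (b 0F * 1# + b 1F * (α * 1#) + b 2F * (α * (α * 1#))) * m 0F
          ≈⟨ solve 5 (λ p q r α d → (p :* con (ℤ.+ 1) :+ q :* (α :* con (ℤ.+ 1)) :+ r :* (α :* (α :* con (ℤ.+ 1)))) :* d :=
               p :* d :+ q :* (α :* d) :+ r :* (α :* (α :* d))) refl (b 0F) (b 1F) (b 2F) α (m 0F) ⟩
        b 0F * m 0F + b 1F * (α * m 0F) + b 2F * (α * (α * m 0F))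
          ≈⟨ +-cong (+-congˡ (*-congˡ m₁≈αm₀)) (*-congˡ (trans m₂≈αm₁ (*-congˡ m₁≈αm₀))) ⟨
        (b ⊛ m) 0F
          ≈⟨ bm≋0 0F ⟩
        0# ∎)
      m₁≈0 : m 1F ≈ 0#
      m₁≈0 = trans m₁≈αm₀ (trans (*-congˡ m₀≈0) (zeroʳ α))
      m₂≈0 : m 2F ≈ 0#
      m₂≈0 = trans m₂≈αm₁ (trans (*-congˡ m₁≈0) (zeroʳ α))
      m₃≈0 : m 3F ≈ 0#
      m₃≈0 = trans m₃≈αm₂ (trans (*-congˡ m₂≈0) (zeroʳ α))

    -- Both conditions speak of consecutive entries, so each window of four entries satisfies the
    -- hypotheses of the case of length four.
    coprime⇒injective : ∀ n a b → Splits a → Coprime a b → (m : Vector Carrier (4 ℕ.+ n)) → a ⊛ m ≋ 𝟎 → b ⊛ m ≋ 𝟎 → m ≋ 𝟎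
    coprime⇒injective zero a b a-splits coprime m am≋0 bm≋0 = coprime⇒injective₄ a b a-splits coprime m am≋0 bm≋0
    coprime⇒injective (suc n) a b a-splits coprime m am≋0 bm≋0 zero = coprime⇒injective₄ a b a-splits coprime
      (m 0F ∷ m 1F ∷ m 2F ∷ m 3F ∷ []) (λ { 0F → am≋0 0F ; 1F → am≋0 1F }) (λ { 0F → bm≋0 0F ; 1F → bm≋0 1F }) 0F
    coprime⇒injective (suc n) a b a-splits coprime m am≋0 bm≋0 (suc i) =
      coprime⇒injective n a b a-splits coprime (tail m) (λ i → am≋0 (suc i)) (λ i → bm≋0 (suc i)) i

    Splits-φ : ∀ k {a} → Splits a → Splits (φ k a)
    Splits-φ k {a} a-splits = record
      { α = frob k α ; β = frob k β ; a₂≉0 = frob-≉0 k a₂≉0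
      ; a₀≈ = trans (frob-cong k a₀≈) (trans (frob-* k _ _) (*-congˡ (frob-* k α β)))
      ; a₁≈ = trans (frob-cong k a₁≈) (trans (frob-* k _ _) (*-congˡ (trans (frob-neg k _) (-‿cong (frob-+ k α β))))) }
      where open Splits a-splits

    veronese-φ : ∀ k r θ → veronese r (just (frob k θ)) ≋ φ k (veronese r (just θ))
    veronese-φ k r θ i = trans (^-assocʳ θ (q ℕ.^ k) (Fin.toℕ i))
      (trans (^-congʳ θ (ℕ.*-comm (q ℕ.^ k) (Fin.toℕ i))) (sym (^-assocʳ θ (Fin.toℕ i) (q ℕ.^ k))))

    veronese-cong : ∀ r {θ η} → θ ≈ η → veronese r (just θ) ≋ veronese r (just η)
    veronese-cong r θ≈η i = ^-congˡ (Fin.toℕ i) θ≈η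

    veronese-injective : ∀ {θ η} → veronese 2 (just θ) ∼ veronese 2 (just η) → θ ≈ η
    veronese-injective {θ} {η} (a , _ , eq) = begin
      θ             ≈⟨ *-identityʳ θ ⟨
      θ * 1#        ≈⟨ eq 1F ⟩
      a * (η * 1#)  ≈⟨ *-cong a≈1 (*-identityʳ η) ⟩
      1# * η        ≈⟨ *-identityˡ η ⟩
      η             ∎
      where
      a≈1 : a ≈ 1#
      a≈1 = sym (trans (eq 0F) (*-identityʳ a))

    -- A form over F₃ that no vector over F₁ annihilates; its conjugates are u, φ 1 u and φ 2 u.
    module Regular (u : Vector Carrier 3) (u∈F : Rational 3 u)
                   (u-regular : ∀ y → Rational 1 y → ¬ (y ≋ 𝟎) → ¬ (dot u y ≈ 0#)) where

      -- The common kernel of u, u′, u″ is mapped to itself by Frobenius, as u has entries in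
      -- F_{q³}. If it were nonzero it would contain a nonzero rational vector, at which u does not
      -- vanish.
      moore : ∀ y → dot u y ≈ 0# → dot (φ 1 u) y ≈ 0# → dot (φ 2 u) y ≈ 0# → y ≋ 𝟎
      moore y uy≈0 u′y≈0 u″y≈0 = decidable-stable (zero? y) λ y≉0 →
        let z , (uz≈0 , _) , z≉0 , z∈F = descent W-subspace (λ {x} → W-stable {x}) {y} (uy≈0 , u′y≈0 , u″y≈0) y≉0
        in u-regular z z∈F z≉0 uz≈0
        where
        W : Vector Carrier 3 → Set ℓ
        W y = dot u y ≈ 0# × dot (φ 1 u) y ≈ 0# × dot (φ 2 u) y ≈ 0#
        W-subspace : IsLinearSubspace W
        W-subspace = record
          { resp = λ {x} {y} x≋y (p , q , r) → resp u {x} {y} x≋y p , resp (φ 1 u) {x} {y} x≋y q , resp (φ 2 u) {x} {y} x≋y r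
          ; ∋𝟎   = dot-𝟎 u , dot-𝟎 (φ 1 u) , dot-𝟎 (φ 2 u)
          ; ∋⊕   = λ {x} {y} (p , q , r) (p′ , q′ , r′) → ∋⊕ u {x} {y} p p′ , ∋⊕ (φ 1 u) {x} {y} q q′ , ∋⊕ (φ 2 u) {x} {y} r r′
          ; ∋⊙   = λ a {x} (p , q , r) → ∋⊙ u a {x} p , ∋⊙ (φ 1 u) a {x} q , ∋⊙ (φ 2 u) a {x} r }
          where
          open module Kernel u = IsLinearSubspace (dot-kernel u)
        conjugate : ∀ v w y → φ 1 v ≋ w → dot v y ≈ 0# → dot w (φ 1 y) ≈ 0#
        conjugate v w y φv≋w eq = trans (dot-congˡ (φ 1 y) (≋-sym φv≋w)) (trans (sym (frob-dot 1 v y)) (trans (frob-cong 1 eq) (frob-0 1)))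
        W-stable : ∀ {y} → W y → W (φ 1 y)
        W-stable {y} (p , q , r) =
          conjugate (φ 2 u) u y (≋-trans (φ-∘ 1 2 u) u∈F) r , conjugate u (φ 1 u) y ≋-refl p , conjugate (φ 1 u) (φ 2 u) y (φ-∘ 1 1 u) q

      frob-dot-u : ∀ y → frob 1 (dot (φ 2 u) y) ≈ dot u (φ 1 y)
      frob-dot-u y = trans (frob-dot 1 (φ 2 u) y) (dot-congˡ (φ 1 y) (≋-trans (φ-∘ 1 2 u) u∈F))

      frob-dot-u′ : ∀ y → frob 1 (dot u y) ≈ dot (φ 1 u) (φ 1 y)
      frob-dot-u′ y = frob-dot 1 u y

      frob-dot-u″ : ∀ y → frob 1 (dot (φ 1 u) y) ≈ dot (φ 2 u) (φ 1 y)
      frob-dot-u″ y = trans (frob-dot 1 (φ 1 u) y) (dot-congˡ (φ 1 y) (φ-∘ 1 1 u))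

  -- The decomposition of the ambient space into three conjugate parts

  module ConjugateSum where

    open Subfields
    open LinearAlgebra
    open Projective
    open ConicFrames
    open QuadraticForms

    curve∋veronese : ∀ {n r} k (N : NormalRationalCurve n r) τ → Parameter k τ →
                     ∀ {v} → v ∼ NormalRationalCurve.matrix N *ᵥ veronese r τ → v ∈ curve k N
    curve∋veronese k N (just θ) θ∈F eq = inj₁ (θ , θ∈F , eq)
    curve∋veronese k N nothing  _   eq = inj₂ eq

    curve⇒veronese : ∀ {n r} k (N : NormalRationalCurve n r) {v} → v ∈ curve k N →
                     ∃ λ τ → Parameter k τ × v ∼ NormalRationalCurve.matrix N *ᵥ veronese r τ
    curve⇒veronese k N (inj₁ (θ , θ∈F , eq)) = just θ , θ∈F , eq
    curve⇒veronese k N (inj₂ eq)             = nothing , tt , eq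

    curve⊆PG : ∀ {n r} k (N : NormalRationalCurve n r) {v} → v ∈ curve k N → v ∈ PG n k
    curve⊆PG {r = r} k N v∈ =
      let τ , τ∈F , eq = curve⇒veronese k N v∈
      in PG-resp k eq (PG-*ᵥ k {M = matrix} (λ i j → F₁⊆F k (over i j)) nonsingular
           (rational⇒PG k (veronese-≉𝟎 r τ) (veronese-rational k r τ τ∈F)))
      where open NormalRationalCurve N

    φ-curve : ∀ {n r} j (N : NormalRationalCurve n r) θ →
              NormalRationalCurve.matrix N *ᵥ veronese r (just (frob j θ)) ≋ φ j (NormalRationalCurve.matrix N *ᵥ veronese r (just θ))
    φ-curve {r = r} j N θ = ≋-trans (Linear.cong (*ᵥ-linear matrix) (veronese-φ j r θ))
      (≋-sym (φ-*ᵥ-over j {M = matrix} (λ i k → F₁⊆F j (over i k)) (veronese r (just θ))))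
      where open NormalRationalCurve N

    linear-∘ : ∀ {l m n} {f : Vector Carrier m → Vector Carrier n} {g : Vector Carrier l → Vector Carrier m} →
               Linear f → Linear g → Linear (λ x → f (g x))
    linear-∘ f-linear g-linear = record
      { cong   = λ x≋y → f.cong (g.cong x≋y)
      ; homo-⊕ = λ x y → ≋-trans (f.cong (g.homo-⊕ x y)) (f.homo-⊕ _ _)
      ; homo-⊙ = λ a x → ≋-trans (f.cong (g.homo-⊙ a x)) (f.homo-⊙ a _) }
      where
      module f = Linear f-linear
      module g = Linear g-linear

    linear-⊕ : ∀ {m n} {f g : Vector Carrier m → Vector Carrier n} → Linear f → Linear g → Linear (λ x → f x ⊕ g x)
    linear-⊕ f-linear g-linear = record
      { cong   = λ x≋y → ⊕-cong (f.cong x≋y) (g.cong x≋y)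
      ; homo-⊕ = λ x y i → trans (+-cong (f.homo-⊕ x y i) (g.homo-⊕ x y i)) (solve 4 (λ a b c d → (a :+ b) :+ (c :+ d) := (a :+ c) :+ (b :+ d)) refl _ _ _ _)
      ; homo-⊙ = λ a x i → trans (+-cong (f.homo-⊙ a x i) (g.homo-⊙ a x i)) (sym (distribˡ a _ _)) }
      where
      module f = Linear f-linear
      module g = Linear g-linear

    linear-⊙ : ∀ {m n} b {f : Vector Carrier m → Vector Carrier n} → Linear f → Linear (λ x → b ⊙ f x)
    linear-⊙ b f-linear = record
      { cong   = λ x≋y → ⊙-cong refl (f.cong x≋y)
      ; homo-⊕ = λ x y i → trans (*-congˡ (f.homo-⊕ x y i)) (distribˡ b _ _)
      ; homo-⊙ = λ a x i → trans (*-congˡ (f.homo-⊙ a x i)) (solve 3 (λ a b y → b :* (a :* y) := a :* (b :* y)) refl a b _) }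
      where module f = Linear f-linear

    nonsingular-∼ : ∀ {m n} {M : Matrix m n} → Nonsingular M → ∀ x y → M *ᵥ x ∼ M *ᵥ y → x ∼ y
    nonsingular-∼ {M = M} M-nonsingular x y (a , a≉0 , eq) =
      a , a≉0 , nonsingular-injective {M = M} M-nonsingular {x} {a ⊙ y} (≋-trans eq (≋-sym (Linear.homo-⊙ (*ᵥ-linear M) a y)))

    module Join (G : Matrix 9 3) (G-over : G Over 3) where

      -- In the coordinates (w₀, w₁, w₂) the points of PG(8,q) are those with wⱼ = φ j w₀.
      join : (w₀ w₁ w₂ : Vector Carrier 3) → Vector Carrier 9
      join w₀ w₁ w₂ = G *ᵥ w₀ ⊕ φᴹ 1 G *ᵥ w₁ ⊕ φᴹ 2 G *ᵥ w₂

      join-cong : ∀ {w₀ w₁ w₂ w₀′ w₁′ w₂′} → w₀ ≋ w₀′ → w₁ ≋ w₁′ → w₂ ≋ w₂′ → join w₀ w₁ w₂ ≋ join w₀′ w₁′ w₂′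
      join-cong p q r = ⊕-cong (⊕-cong (Linear.cong (*ᵥ-linear G) p) (Linear.cong (*ᵥ-linear (φᴹ 1 G)) q)) (Linear.cong (*ᵥ-linear (φᴹ 2 G)) r)

      join-linear : ∀ {n} {f g h : Vector Carrier n → Vector Carrier 3} → Linear f → Linear g → Linear h →
                    Linear (λ x → join (f x) (g x) (h x))
      join-linear f g h = linear-⊕ (linear-⊕ (linear-∘ (*ᵥ-linear G) f) (linear-∘ (*ᵥ-linear (φᴹ 1 G)) g)) (linear-∘ (*ᵥ-linear (φᴹ 2 G)) h)

      join-⊙ : ∀ a w₀ w₁ w₂ → join (a ⊙ w₀) (a ⊙ w₁) (a ⊙ w₂) ≋ a ⊙ join w₀ w₁ w₂
      join-⊙ a w₀ w₁ w₂ i = trans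
        (+-cong (+-cong (Linear.homo-⊙ (*ᵥ-linear G) a w₀ i) (Linear.homo-⊙ (*ᵥ-linear (φᴹ 1 G)) a w₁ i)) (Linear.homo-⊙ (*ᵥ-linear (φᴹ 2 G)) a w₂ i))
        (solve 4 (λ a x y z → a :* x :+ a :* y :+ a :* z := a :* (x :+ y :+ z)) refl a _ _ _)

      join-⊕ : ∀ w₀ w₁ w₂ w₀′ w₁′ w₂′ → join (w₀ ⊕ w₀′) (w₁ ⊕ w₁′) (w₂ ⊕ w₂′) ≋ join w₀ w₁ w₂ ⊕ join w₀′ w₁′ w₂′
      join-⊕ w₀ w₁ w₂ w₀′ w₁′ w₂′ i = trans
        (+-cong (+-cong (Linear.homo-⊕ (*ᵥ-linear G) w₀ w₀′ i) (Linear.homo-⊕ (*ᵥ-linear (φᴹ 1 G)) w₁ w₁′ i)) (Linear.homo-⊕ (*ᵥ-linear (φᴹ 2 G)) w₂ w₂′ i))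
        (solve 6 (λ a b c d e f → (a :+ b) :+ (c :+ d) :+ (e :+ f) := (a :+ c :+ e) :+ (b :+ d :+ f)) refl _ _ _ _ _ _)

      join-𝟎 : join 𝟎 𝟎 𝟎 ≋ 𝟎
      join-𝟎 i = trans (+-cong (+-cong (Linear.homo-𝟎 (*ᵥ-linear G) i) (Linear.homo-𝟎 (*ᵥ-linear (φᴹ 1 G)) i)) (Linear.homo-𝟎 (*ᵥ-linear (φᴹ 2 G)) i))
        (trans (+-congʳ (+-identityˡ 0#)) (+-identityˡ 0#))

      join-first : ∀ w → G *ᵥ w ≋ join w 𝟎 𝟎
      join-first w i = sym (trans (+-cong (+-congˡ (Linear.homo-𝟎 (*ᵥ-linear (φᴹ 1 G)) i)) (Linear.homo-𝟎 (*ᵥ-linear (φᴹ 2 G)) i))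
        (trans (+-identityʳ _) (+-identityʳ _)))

      -- As G has entries in F_{q³}, Frobenius permutes its three conjugates cyclically, and the
      -- components move along with them.
      φ-join : ∀ w₀ w₁ w₂ → φ 1 (join w₀ w₁ w₂) ≋ join (φ 1 w₂) (φ 1 w₀) (φ 1 w₁)
      φ-join w₀ w₁ w₂ i = begin
        frob 1 (x + y + z)
          ≈⟨ trans (frob-+ 1 _ z) (+-congʳ (frob-+ 1 x y)) ⟩
        frob 1 x + frob 1 y + frob 1 z
          ≈⟨ +-cong (+-cong (φ-*ᵥ 1 G w₀ i)
               (trans (φ-*ᵥ 1 (φᴹ 1 G) w₁ i) (*ᵥ-congˡ (λ i j → frob-∘ 1 1 (G i j)) (φ 1 w₁) i)))
               (trans (φ-*ᵥ 1 (φᴹ 2 G) w₂ i) (*ᵥ-congˡ {M = φᴹ 1 (φᴹ 2 G)} {N = G} (λ i j → trans (frob-∘ 1 2 (G i j)) (G-over i j)) (φ 1 w₂) i)) ⟩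
        (φᴹ 1 G *ᵥ φ 1 w₀) i + (φᴹ 2 G *ᵥ φ 1 w₁) i + (G *ᵥ φ 1 w₂) i
          ≈⟨ solve 3 (λ x y z → x :+ y :+ z := z :+ x :+ y) refl _ _ _ ⟩
        join (φ 1 w₂) (φ 1 w₀) (φ 1 w₁) i ∎
        where
        x y z : Carrier
        x = (G *ᵥ w₀) i
        y = (φᴹ 1 G *ᵥ w₁) i
        z = (φᴹ 2 G *ᵥ w₂) i

      φ2-join : ∀ w₀ w₁ w₂ → φ 2 (join w₀ w₁ w₂) ≋ join (φ 2 w₁) (φ 2 w₂) (φ 2 w₀)
      φ2-join w₀ w₁ w₂ = ≋-trans (≋-sym (φ-∘ 1 1 (join w₀ w₁ w₂))) (≋-trans (φ-cong 1 (φ-join w₀ w₁ w₂)) (≋-trans (φ-join (φ 1 w₂) (φ 1 w₀) (φ 1 w₁))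
        (join-cong (φ-∘ 1 1 w₁) (φ-∘ 1 1 w₂) (φ-∘ 1 1 w₀))))

      φ-𝟎 : ∀ k {n} → φ k (𝟎 {n}) ≋ 𝟎
      φ-𝟎 k i = frob-0 k

      module Basis (join-surjective : ∀ v → ∃ λ w₀ → ∃ λ w₁ → ∃ λ w₂ → v ≋ join w₀ w₁ w₂) where

        private
          part₀ part₁ part₂ : Vector Carrier 9 → Vector Carrier 3
          part₀ x i = x (i ↑ˡ 6)
          part₁ x i = x (3 ↑ʳ (i ↑ˡ 3))
          part₂ x i = x (3 ↑ʳ (3 ↑ʳ i))

          glue : (w₀ w₁ w₂ : Vector Carrier 3) → Vector Carrier 9
          glue w₀ w₁ w₂ = w₀ ++ (w₁ ++ w₂)

          part₀-glue : ∀ w₀ w₁ w₂ → part₀ (glue w₀ w₁ w₂) ≋ w₀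
          part₀-glue w₀ w₁ w₂ i = reflexive (lookup-++ˡ w₀ (w₁ ++ w₂) i)
          part₁-glue : ∀ w₀ w₁ w₂ → part₁ (glue w₀ w₁ w₂) ≋ w₁
          part₁-glue w₀ w₁ w₂ i = reflexive (≡.trans (lookup-++ʳ w₀ (w₁ ++ w₂) (i ↑ˡ 3)) (lookup-++ˡ w₁ w₂ i))
          part₂-glue : ∀ w₀ w₁ w₂ → part₂ (glue w₀ w₁ w₂) ≋ w₂
          part₂-glue w₀ w₁ w₂ i = reflexive (≡.trans (lookup-++ʳ w₀ (w₁ ++ w₂) (3 ↑ʳ i)) (lookup-++ʳ w₁ w₂ i))

          join₉ : Vector Carrier 9 → Vector Carrier 9
          join₉ x = join (part₀ x) (part₁ x) (part₂ x)

          reindex-linear : ∀ {m n} (f : Fin n → Fin m) → Linear (λ x i → x (f i))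
          reindex-linear f = record { cong = λ x≋y i → x≋y (f i) ; homo-⊕ = λ _ _ _ → refl ; homo-⊙ = λ _ _ _ → refl }

          join₉-linear : Linear join₉
          join₉-linear = join-linear (reindex-linear (_↑ˡ 6)) (reindex-linear (λ i → 3 ↑ʳ (i ↑ˡ 3))) (reindex-linear (λ i → 3 ↑ʳ (3 ↑ʳ i)))

          join₉-glue : ∀ w₀ w₁ w₂ → join₉ (glue w₀ w₁ w₂) ≋ join w₀ w₁ w₂
          join₉-glue w₀ w₁ w₂ = join-cong (part₀-glue w₀ w₁ w₂) (part₁-glue w₀ w₁ w₂) (part₂-glue w₀ w₁ w₂)

          join₉-nonsingular : Nonsingular (matrixOf join₉)
          join₉-nonsingular = surjective⇒nonsingular (matrixOf join₉) λ v →
            let w₀ , w₁ , w₂ , v≋ = join-surjective v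
            in glue w₀ w₁ w₂ , ≋-trans (matrixOf-*ᵥ join₉-linear (glue w₀ w₁ w₂)) (≋-trans (join₉-glue w₀ w₁ w₂) (≋-sym v≋))

        -- A matter of dimension: glued into one vector, the components give a linear map of K⁹ to
        -- itself, which is onto and hence injective.
        join-injective : ∀ w₀ w₁ w₂ w₀′ w₁′ w₂′ → join w₀ w₁ w₂ ≋ join w₀′ w₁′ w₂′ → w₀ ≋ w₀′ × w₁ ≋ w₁′ × w₂ ≋ w₂′
        join-injective w₀ w₁ w₂ w₀′ w₁′ w₂′ eq =
          ≋-trans (≋-sym (part₀-glue w₀ w₁ w₂)) (≋-trans (λ i → glue≋ (i ↑ˡ 6)) (part₀-glue w₀′ w₁′ w₂′)) ,
          ≋-trans (≋-sym (part₁-glue w₀ w₁ w₂)) (≋-trans (λ i → glue≋ (3 ↑ʳ (i ↑ˡ 3))) (part₁-glue w₀′ w₁′ w₂′)) ,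
          ≋-trans (≋-sym (part₂-glue w₀ w₁ w₂)) (≋-trans (λ i → glue≋ (3 ↑ʳ (3 ↑ʳ i))) (part₂-glue w₀′ w₁′ w₂′))
          where
          glue≋ : glue w₀ w₁ w₂ ≋ glue w₀′ w₁′ w₂′
          glue≋ = nonsingular-injective {M = matrixOf join₉} join₉-nonsingular
            (≋-trans (matrixOf-*ᵥ join₉-linear (glue w₀ w₁ w₂)) (≋-trans (join₉-glue w₀ w₁ w₂) (≋-trans eq
              (≋-sym (≋-trans (matrixOf-*ᵥ join₉-linear (glue w₀′ w₁′ w₂′)) (join₉-glue w₀′ w₁′ w₂′))))))

        join≋𝟎 : ∀ w₀ w₁ w₂ → join w₀ w₁ w₂ ≋ 𝟎 → w₀ ≋ 𝟎 × w₁ ≋ 𝟎 × w₂ ≋ 𝟎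
        join≋𝟎 w₀ w₁ w₂ eq = join-injective w₀ w₁ w₂ 𝟎 𝟎 𝟎 (≋-trans eq (≋-sym join-𝟎))

        -- The three component maps are permuted by Frobenius in step with the conjugates of G, so
        -- the combined matrix is fixed by it, that is, has entries in F_q. A common kernel of zero
        -- makes its columns independent.
        conjugateCurve : ∀ {r} (f₀ f₁ f₂ : Vector Carrier (suc r) → Vector Carrier 3) → Linear f₀ → Linear f₁ → Linear f₂ →
          (∀ m → φ 1 (f₀ m) ≋ f₁ (φ 1 m)) → (∀ m → φ 1 (f₁ m) ≋ f₂ (φ 1 m)) → (∀ m → φ 1 (f₂ m) ≋ f₀ (φ 1 m)) →
          (∀ m → f₀ m ≋ 𝟎 → f₁ m ≋ 𝟎 → f₂ m ≋ 𝟎 → m ≋ 𝟎) →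
          ∃ λ (N : NormalRationalCurve 8 r) → ∀ m → NormalRationalCurve.matrix N *ᵥ m ≋ join (f₀ m) (f₁ m) (f₂ m)
        conjugateCurve {r} f₀ f₁ f₂ f₀-linear f₁-linear f₂-linear φf₀ φf₁ φf₂ injective =
          record { matrix = matrixOf F₀₁₂ ; over = F-over ; nonsingular = F-nonsingular } , F-matrix
          where
          F₀₁₂ : Vector Carrier (suc r) → Vector Carrier 9
          F₀₁₂ m = join (f₀ m) (f₁ m) (f₂ m)
          F-linear : Linear F₀₁₂
          F-linear = join-linear f₀-linear f₁-linear f₂-linear
          F-matrix : ∀ m → matrixOf F₀₁₂ *ᵥ m ≋ F₀₁₂ m
          F-matrix = matrixOf-*ᵥ F-linear
          F-over : matrixOf F₀₁₂ Over 1
          F-over i j = trans (φ-join (f₀ (δ j)) (f₁ (δ j)) (f₂ (δ j)) i) (trans (join-cong (φf₂ (δ j)) (φf₀ (δ j)) (φf₁ (δ j)) i)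
            (Linear.cong F-linear (δ-rational 1 j) i))
          F-nonsingular : Nonsingular (matrixOf F₀₁₂)
          F-nonsingular m eq =
            let p , q , r = join≋𝟎 (f₀ m) (f₁ m) (f₂ m) (≋-trans (≋-sym (F-matrix m)) eq)
            in injective m p q r

    -- At most one of x, y, z vanishes. Then the equations ax = by = cz are independent, and their
    -- solutions are the multiples of (yz, zx, xy), which is nonzero.
    proportional : ∀ x y z a b c → ¬ (x ≈ 0# × y ≈ 0#) → ¬ (y ≈ 0# × z ≈ 0#) → ¬ (z ≈ 0# × x ≈ 0#) →
                   a * x ≈ b * y → b * y ≈ c * z → ¬ (a ≈ 0# × b ≈ 0# × c ≈ 0#) →
                   ∃ λ t → ¬ (t ≈ 0#) × a ≈ t * (y * z) × b ≈ t * (z * x) × c ≈ t * (x * y)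
    proportional x y z a b c ¬xy ¬yz ¬zx ax≈by by≈cz abc≉0 = by-zeros (x ≟ 0#) (y ≟ 0#) (z ≟ 0#)
      where
      degenerate : ∀ x y z a b c → ¬ (x ≈ 0# × y ≈ 0#) → ¬ (z ≈ 0# × x ≈ 0#) →
                   a * x ≈ b * y → b * y ≈ c * z → ¬ (a ≈ 0# × b ≈ 0# × c ≈ 0#) → x ≈ 0# →
                   ∃ λ t → ¬ (t ≈ 0#) × a ≈ t * (y * z) × b ≈ t * (z * x) × c ≈ t * (x * y)
      degenerate x y z a b c ¬xy ¬zx ax≈by by≈cz abc≉0 x≈0 =
        let y≉0 = λ y≈0 → ¬xy (x≈0 , y≈0)
            z≉0 = λ z≈0 → ¬zx (z≈0 , x≈0)
            by≈0 = trans (sym ax≈by) (trans (*-congˡ x≈0) (zeroʳ a))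
            b≈0 = xy≈0⇒y≈0 y≉0 (trans (*-comm y b) by≈0)
            c≈0 = xy≈0⇒y≈0 z≉0 (trans (*-comm z c) (trans (sym by≈cz) by≈0))
            a≉0 = λ a≈0 → abc≉0 (a≈0 , b≈0 , c≈0)
            r , yzr≈1 = inverse (y * z) (xy≉0 y≉0 z≉0)
            r≉0 = λ r≈0 → 1≉0 (trans (sym yzr≈1) (trans (*-congˡ r≈0) (zeroʳ (y * z))))
        in a * r , xy≉0 a≉0 r≉0 ,
           sym (trans (solve 3 (λ a r yz → a :* r :* yz := a :* (yz :* r)) refl a r (y * z)) (trans (*-congˡ yzr≈1) (*-identityʳ a))) ,
           trans b≈0 (sym (trans (*-congˡ (trans (*-congˡ x≈0) (zeroʳ z))) (zeroʳ _))) ,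
           trans c≈0 (sym (trans (*-congˡ (trans (*-congʳ x≈0) (zeroˡ y))) (zeroʳ _)))
      by-zeros : Dec (x ≈ 0#) → Dec (y ≈ 0#) → Dec (z ≈ 0#) → ∃ λ t → ¬ (t ≈ 0#) × a ≈ t * (y * z) × b ≈ t * (z * x) × c ≈ t * (x * y)
      by-zeros (yes x≈0) _ _ = degenerate x y z a b c ¬xy ¬zx ax≈by by≈cz abc≉0 x≈0
      by-zeros (no _) (yes y≈0) _ =
        let t , t≉0 , b≈ , c≈ , a≈ = degenerate y z x b c a ¬yz ¬xy by≈cz (trans (sym by≈cz) (sym ax≈by)) (λ (b≈0 , c≈0 , a≈0) → abc≉0 (a≈0 , b≈0 , c≈0)) y≈0
        in t , t≉0 , a≈ , b≈ , c≈
      by-zeros (no _) (no _) (yes z≈0) =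
        let t , t≉0 , c≈ , a≈ , b≈ = degenerate z x y c a b ¬zx ¬yz (trans (sym by≈cz) (sym ax≈by)) ax≈by (λ (c≈0 , a≈0 , b≈0) → abc≉0 (a≈0 , b≈0 , c≈0)) z≈0
        in t , t≉0 , a≈ , b≈ , c≈
      by-zeros (no x≉0) (no y≉0) (no z≉0) =
        let r , xyzr≈1 = inverse (x * (y * z)) (xy≉0 x≉0 (xy≉0 y≉0 z≉0))
            r≉0 : ¬ (r ≈ 0#)
            r≉0 = λ r≈0 → 1≉0 (trans (sym xyzr≈1) (trans (*-congˡ r≈0) (zeroʳ _)))
            s≉0 : ¬ (a * x ≈ 0#)
            s≉0 = λ s≈0 → abc≉0
              ( xy≈0⇒y≈0 x≉0 (trans (*-comm x a) s≈0)
              , xy≈0⇒y≈0 y≉0 (trans (*-comm y b) (trans (sym ax≈by) s≈0))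
              , xy≈0⇒y≈0 z≉0 (trans (*-comm z c) (trans (sym by≈cz) (trans (sym ax≈by) s≈0))) )
            s*1 : a * x * (x * (y * z) * r) ≈ a * x
            s*1 = trans (*-congˡ xyzr≈1) (*-identityʳ _)
        -- The factor t is the common value of ax, by, cz divided by xyz.
        in a * x * r , xy≉0 s≉0 r≉0 ,
           *-cancelˡ-≉0 x≉0 (trans (*-comm x a) (trans (sym s*1) (solve 5 (λ a r x y z → a :* x :* (x :* (y :* z) :* r) := x :* (a :* x :* r :* (y :* z))) refl a r x y z))) ,
           *-cancelˡ-≉0 y≉0 (trans (*-comm y b) (trans (sym ax≈by) (trans (sym s*1) (solve 5 (λ a r x y z → a :* x :* (x :* (y :* z) :* r) := y :* (a :* x :* r :* (z :* x))) refl a r x y z)))) ,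
           *-cancelˡ-≉0 z≉0 (trans (*-comm z c) (trans (sym by≈cz) (trans (sym ax≈by) (trans (sym s*1) (solve 5 (λ a r x y z → a :* x :* (x :* (y :* z) :* r) := z :* (a :* x :* r :* (x :* y))) refl a r x y z)))))

  -- The section of the variety: the sextic and the twisted cubic

  module Sections where

    open Subfields
    open LinearAlgebra
    open Projective
    open ConicFrames
    open QuadraticForms
    open ConjugateSum

    module Section (u : Vector Carrier 3) (u∈F : Rational 3 u)
                   (u-regular : ∀ y → Rational 1 y → ¬ (y ≋ 𝟎) → ¬ (dot u y ≈ 0#))
                   (G : Matrix 9 3) (G-over : G Over 3)
                   (join-surjective : ∀ v → ∃ λ w₀ → ∃ λ w₁ → ∃ λ w₂ → v ≋ Join.join G G-over w₀ w₁ w₂) where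

      open Regular u u∈F u-regular
      open Join G G-over
      open Basis join-surjective

      u′ u″ : Vector Carrier 3
      u′ = φ 1 u
      u″ = φ 2 u

      φu″≋u : φ 1 u″ ≋ u
      φu″≋u = ≋-trans (φ-∘ 1 2 u) u∈F

      γ : Maybe Carrier → Vector Carrier 3
      γ = veronese 2

      x y z : Maybe Carrier → Carrier
      x τ = dot u (γ τ)
      y τ = dot u′ (γ τ)
      z τ = dot u″ (γ τ)

      abstract

        -- The leading coefficient is the value of u at the rational vector (0, 0, 1), hence
        -- nonzero. The roots may be conjugate over F_{q³}, but they lie in K.
        u-splits : Splits u
        u-splits = record
          { α = α ; β = β ; a₂≉0 = u₂≉0
          ; a₀≈ = sym (begin
              u 2F * (α * (- s - α))
                ≈⟨ solve 4 (λ k α s t → k :* (α :* (:- s :- α)) := k :* t :- k :* (α :* α :+ s :* α :+ t)) refl (u 2F) α s t ⟩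
              u 2F * t - u 2F * (α * α + s * α + t)
                ≈⟨ +-cong (u₂* (u 0F)) (-‿cong (trans (*-congˡ α-root) (zeroʳ _))) ⟩
              u 0F - 0#
                ≈⟨ solve 1 (λ a → a :- con (ℤ.+ 0) := a) refl (u 0F) ⟩
              u 0F ∎)
          ; a₁≈ = sym (trans (*-congˡ (solve 2 (λ α s → :- (α :+ (:- s :- α)) := s) refl α s)) (u₂* (u 1F))) }
          where
          u₂≉0 : ¬ (u 2F ≈ 0#)
          u₂≉0 u₂≈0 = u-regular (e-last 2) (e-last-rational 1 2) (veronese-≉𝟎 2 nothing)
            (trans (solve 3 (λ a b c → a :* con (ℤ.+ 0) :+ b :* con (ℤ.+ 0) :+ c :* con (ℤ.+ 1) := c) refl (u 0F) (u 1F) (u 2F)) u₂≈0)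
          r s t α β : Carrier
          r = proj₁ (inverse (u 2F) u₂≉0)
          s = u 1F * r
          t = u 0F * r
          r∈F : r ∈ F 3
          r∈F = F-inverse 3 (u∈F 2F) (proj₂ (inverse (u 2F) u₂≉0))
          u₂* : ∀ a → u 2F * (a * r) ≈ a
          u₂* a = trans (solve 3 (λ k a r → k :* (a :* r) := a :* (k :* r)) refl (u 2F) a r) (trans (*-congˡ (proj₂ (inverse (u 2F) u₂≉0))) (*-identityʳ a))
          root : ∃ λ x → x * x + s * x + t ≈ 0#
          root = quadratic-root 3 0 ≡.refl s t (F-* 3 (u∈F 1F) r∈F) (F-* 3 (u∈F 0F) r∈F)
          α = proj₁ root
          β = - s - α
          α-root : α * α + s * α + t ≈ 0#
          α-root = proj₂ root

      -- The extension of Σ∞ in the coordinates (w₀, w₁, w₂) and, for suitably scaled u, that of Σ₆.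
      AtInfinity⁺ : Vector Carrier 9 → Set _
      AtInfinity⁺ v = ∃ λ w₀ → ∃ λ w₁ → ∃ λ w₂ → v ≋ join w₀ w₁ w₂ × dot u w₀ ≈ 0# × dot u′ w₁ ≈ 0# × dot u″ w₂ ≈ 0#

      Balanced : Vector Carrier 9 → Set _
      Balanced v = ∃ λ w₀ → ∃ λ w₁ → ∃ λ w₂ → v ≋ join w₀ w₁ w₂ × dot u w₀ ≈ dot u′ w₁ × dot u′ w₁ ≈ dot u″ w₂

      AtInfinity⁺-subspace : IsLinearSubspace AtInfinity⁺
      AtInfinity⁺-subspace = record
        { resp = λ v≋v′ (w₀ , w₁ , w₂ , eq , rest) → w₀ , w₁ , w₂ , ≋-trans (≋-sym v≋v′) eq , rest
        ; ∋𝟎   = 𝟎 , 𝟎 , 𝟎 , ≋-sym join-𝟎 , dot-𝟎 u , dot-𝟎 u′ , dot-𝟎 u″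
        ; ∋⊕   = λ (w₀ , w₁ , w₂ , eq , p , q , r) (w₀′ , w₁′ , w₂′ , eq′ , p′ , q′ , r′) →
            w₀ ⊕ w₀′ , w₁ ⊕ w₁′ , w₂ ⊕ w₂′ , ≋-trans (⊕-cong eq eq′) (≋-sym (join-⊕ w₀ w₁ w₂ w₀′ w₁′ w₂′)) ,
            Ker.∋⊕ u {w₀} {w₀′} p p′ , Ker.∋⊕ u′ {w₁} {w₁′} q q′ , Ker.∋⊕ u″ {w₂} {w₂′} r r′
        ; ∋⊙   = λ a (w₀ , w₁ , w₂ , eq , p , q , r) →
            a ⊙ w₀ , a ⊙ w₁ , a ⊙ w₂ , ≋-trans (⊙-cong refl eq) (≋-sym (join-⊙ a w₀ w₁ w₂)) ,
            Ker.∋⊙ u a {w₀} p , Ker.∋⊙ u′ a {w₁} q , Ker.∋⊙ u″ a {w₂} r }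
        where
        module Ker u = IsLinearSubspace (dot-kernel u)

      at-infinity : ∀ w₀ w₁ w₂ {v} → v ≋ join w₀ w₁ w₂ → AtInfinity⁺ v → dot u w₀ ≈ 0# × dot u′ w₁ ≈ 0# × dot u″ w₂ ≈ 0#
      at-infinity w₀ w₁ w₂ v≋ (w₀′ , w₁′ , w₂′ , v≋′ , p , q , r) =
        let e₀ , e₁ , e₂ = join-injective w₀ w₁ w₂ w₀′ w₁′ w₂′ (≋-trans (≋-sym v≋) v≋′)
        in trans (dot-congʳ u e₀) p , trans (dot-congʳ u′ e₁) q , trans (dot-congʳ u″ e₂) r

      balanced : ∀ w₀ w₁ w₂ {v} → v ≋ join w₀ w₁ w₂ → Balanced v → dot u w₀ ≈ dot u′ w₁ × dot u′ w₁ ≈ dot u″ w₂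
      balanced w₀ w₁ w₂ v≋ (w₀′ , w₁′ , w₂′ , v≋′ , p , q) =
        let e₀ , e₁ , e₂ = join-injective w₀ w₁ w₂ w₀′ w₁′ w₂′ (≋-trans (≋-sym v≋) v≋′)
        in trans (dot-congʳ u e₀) (trans p (sym (dot-congʳ u′ e₁))) , trans (dot-congʳ u′ e₁) (trans q (sym (dot-congʳ u″ e₂)))

      AtInfinity⁺-φ : ∀ {v} → AtInfinity⁺ v → AtInfinity⁺ (φ 1 v)
      AtInfinity⁺-φ (w₀ , w₁ , w₂ , v≋ , p , q , r) = φ 1 w₂ , φ 1 w₀ , φ 1 w₁ ,
        ≋-trans (φ-cong 1 v≋) (φ-join w₀ w₁ w₂) , trans (sym (frob-dot-u w₂)) (0→0 r) , trans (sym (frob-dot-u′ w₀)) (0→0 p) , trans (sym (frob-dot-u″ w₁)) (0→0 q)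
        where
        0→0 : ∀ {a} → a ≈ 0# → frob 1 a ≈ 0#
        0→0 a≈0 = trans (frob-cong 1 a≈0) (frob-0 1)

      AtInfinity⁺-φ^ : ∀ k {v} → AtInfinity⁺ v → AtInfinity⁺ (φ k v)
      AtInfinity⁺-φ^ zero    v∈ = IsLinearSubspace.resp AtInfinity⁺-subspace (λ i → sym (frob-0th _)) v∈
      AtInfinity⁺-φ^ (suc k) {v} v∈ = IsLinearSubspace.resp AtInfinity⁺-subspace
        (≋-trans (φ-∘ 1 k v) (λ i → ^-congʳ (v i) (≡.cong (q ℕ.^_) (ℕ.+-comm k 1)))) (AtInfinity⁺-φ (AtInfinity⁺-φ^ k v∈))

      -- For fixed τ these points form a scroll-plane.
      tensor : Maybe Carrier → Carrier → Carrier → Carrier → Vector Carrier 9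
      tensor τ a b c = join (a ⊙ γ τ) (b ⊙ γ τ) (c ⊙ γ τ)

      tensor-cong : ∀ τ {a b c a′ b′ c′} → a ≈ a′ → b ≈ b′ → c ≈ c′ → tensor τ a b c ≋ tensor τ a′ b′ c′
      tensor-cong τ p q r = join-cong (⊙-congˡ (γ τ) p) (⊙-congˡ (γ τ) q) (⊙-congˡ (γ τ) r)

      tensor-⊙ : ∀ τ t a b c → tensor τ (t * a) (t * b) (t * c) ≋ t ⊙ tensor τ a b c
      tensor-⊙ τ t a b c = ≋-trans (join-cong (⊙-assoc t a (γ τ)) (⊙-assoc t b (γ τ)) (⊙-assoc t c (γ τ)))
        (join-⊙ t (a ⊙ γ τ) (b ⊙ γ τ) (c ⊙ γ τ))

      tensor-≉0 : ∀ τ {a b c v} → v ≋ tensor τ a b c → ¬ (v ≋ 𝟎) → ¬ (a ≈ 0# × b ≈ 0# × c ≈ 0#)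
      tensor-≉0 τ {v = v} v≋ v≉0 (a≈0 , b≈0 , c≈0) = v≉0 (≋-trans v≋ (≋-trans (tensor-cong τ a≈0 b≈0 c≈0)
        (≋-trans (join-cong (0⊙ (γ τ)) (0⊙ (γ τ)) (0⊙ (γ τ))) join-𝟎)))

      γ-entry : ∀ τ → ∃ λ i → ¬ (γ τ i ≈ 0#)
      γ-entry τ = nonzero-entry (veronese-≉𝟎 2 τ)

      tensor-injective : ∀ τ a b c a′ b′ c′ → tensor τ a b c ≋ tensor τ a′ b′ c′ → a ≈ a′ × b ≈ b′ × c ≈ c′
      tensor-injective τ a b c a′ b′ c′ eq =
        let p , q , r = join-injective (a ⊙ γ τ) (b ⊙ γ τ) (c ⊙ γ τ) (a′ ⊙ γ τ) (b′ ⊙ γ τ) (c′ ⊙ γ τ) eq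
        in cancel p , cancel q , cancel r
        where
        cancel : ∀ {a b} → a ⊙ γ τ ≋ b ⊙ γ τ → a ≈ b
        cancel {a} {b} eq = let i , γᵢ≉0 = γ-entry τ in *-cancelˡ-≉0 γᵢ≉0 (trans (*-comm _ a) (trans (eq i) (*-comm b _)))

      -- A point of a scroll-plane together with the equations of the 6-space: on `tensor τ a b c`
      -- the three conjugate forms take the values ax, by, cz.
      VarietySection : ℕ → Vector Carrier 9 → Set _
      VarietySection k v = v ∈ PG 8 k × ∃ λ τ → Parameter k τ × ∃ λ a → ∃ λ b → ∃ λ c → v ≋ tensor τ a b c × a * x τ ≈ b * y τ × b * y τ ≈ c * z τ

      tensor-at-infinity : ∀ τ a b c {v} → v ≋ tensor τ a b c → AtInfinity⁺ v → a * x τ ≈ 0# × b * y τ ≈ 0# × c * z τ ≈ 0#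
      tensor-at-infinity τ a b c v≋ v∈ =
        let p , q , r = at-infinity (a ⊙ γ τ) (b ⊙ γ τ) (c ⊙ γ τ) v≋ v∈
        in trans (sym (dot-⊙ u a (γ τ))) p , trans (sym (dot-⊙ u′ b (γ τ))) q , trans (sym (dot-⊙ u″ c (γ τ))) r

      tensor⇒at-infinity : ∀ τ a b c {v} → v ≋ tensor τ a b c → a * x τ ≈ 0# → b * y τ ≈ 0# → c * z τ ≈ 0# → AtInfinity⁺ v
      tensor⇒at-infinity τ a b c v≋ p q r = a ⊙ γ τ , b ⊙ γ τ , c ⊙ γ τ , v≋ ,
        trans (dot-⊙ u a (γ τ)) p , trans (dot-⊙ u′ b (γ τ)) q , trans (dot-⊙ u″ c (γ τ)) r

      φ-tensor : ∀ θ a b c → φ 1 (tensor (just θ) a b c) ≋ tensor (just (frob 1 θ)) (frob 1 c) (frob 1 a) (frob 1 b)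
      φ-tensor θ a b c = ≋-trans (φ-join (a ⊙ γ (just θ)) (b ⊙ γ (just θ)) (c ⊙ γ (just θ))) (join-cong (φ-entry c) (φ-entry a) (φ-entry b))
        where
        φ-entry : ∀ a → φ 1 (a ⊙ γ (just θ)) ≋ frob 1 a ⊙ γ (just (frob 1 θ))
        φ-entry a = ≋-trans (φ-⊙ 1 a (γ (just θ))) (⊙-congʳ (frob 1 a) (≋-sym (veronese-φ 1 2 θ)))

      -- The triples with a x = b y = c z are spanned by (y z, z x, x y).
      module Sextic (coprime₀₁ : Coprime u u′) (coprime₁₂ : Coprime u′ u″) (coprime₂₀ : Coprime u″ u) where

        -- On the moment sequence of θ these are γ scaled by u′u″, u″u and uu′ at θ; so they carry
        -- the rational normal curve of degree six to the curve spanned by (yz, zx, xy).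
        f₀ f₁ f₂ : Vector Carrier 7 → Vector Carrier 3
        f₀ m = u′ ⊛ u″ ⊛ m
        f₁ m = u″ ⊛ u ⊛ m
        f₂ m = u ⊛ u′ ⊛ m

        private
          ⊛⊛-linear : ∀ a b → Linear {7} {3} (λ m → a ⊛ b ⊛ m)
          ⊛⊛-linear a b = linear-∘ (⊛-linear a) (⊛-linear b)

          φ-⊛⊛ : ∀ a b {a′ b′} (m : Vector Carrier 7) → φ 1 a ≋ a′ → φ 1 b ≋ b′ → φ 1 (a ⊛ b ⊛ m) ≋ a′ ⊛ b′ ⊛ φ 1 m
          φ-⊛⊛ a b m p q = ≋-trans (φ-⊛ 1 a (b ⊛ m)) (⊛-cong p (≋-trans (φ-⊛ 1 b m) (⊛-cong {m = φ 1 m} q ≋-refl)))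

          -- The sequence u′ ⊛ m is killed by the coprime u″ and u, hence zero; likewise u″ ⊛ m is
          -- killed by u and u′. So m is killed by the coprime u′ and u″.
          injective : ∀ m → f₀ m ≋ 𝟎 → f₁ m ≋ 𝟎 → f₂ m ≋ 𝟎 → m ≋ 𝟎
          injective m p q r = coprime⇒injective 3 u′ u″ (Splits-φ 1 u-splits) coprime₁₂ m
            (coprime⇒injective 1 u″ u (Splits-φ 2 u-splits) coprime₂₀ (u′ ⊛ m) (≋-trans (⊛-comm u″ u′ m) p) r)
            (coprime⇒injective 1 u u′ u-splits coprime₀₁ (u″ ⊛ m) (≋-trans (⊛-comm u u″ m) q) p)

          curve-N₆ = conjugateCurve f₀ f₁ f₂ (⊛⊛-linear u′ u″) (⊛⊛-linear u″ u) (⊛⊛-linear u u′)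
            (λ m → φ-⊛⊛ u′ u″ m (φ-∘ 1 1 u) φu″≋u) (λ m → φ-⊛⊛ u″ u m φu″≋u ≋-refl) (λ m → φ-⊛⊛ u u′ m ≋-refl (φ-∘ 1 1 u)) injective

        N₆ : NormalRationalCurve 8 6
        N₆ = proj₁ curve-N₆

        open NormalRationalCurve N₆ using (matrix)

        N₆-veronese : ∀ τ → matrix *ᵥ veronese 6 τ ≋ tensor τ (y τ * z τ) (z τ * x τ) (x τ * y τ)
        N₆-veronese τ = ≋-trans (proj₂ curve-N₆ (veronese 6 τ)) (join-cong (entry u′ u″) (entry u″ u) (entry u u′))
          where
          entry : ∀ a b → a ⊛ b ⊛ veronese 6 τ ≋ (dot a (γ τ) * dot b (γ τ)) ⊙ γ τ
          entry a b i = begin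
            (a ⊛ b ⊛ veronese 6 τ) i                      ≈⟨ ⊛-cong {a} {a} ≋-refl (⊛-veronese b 4 τ) i ⟩
            (a ⊛ (dot b (γ τ) ⊙ veronese 4 τ)) i          ≈⟨ Linear.homo-⊙ (⊛-linear a) (dot b (γ τ)) (veronese 4 τ) i ⟩
            dot b (γ τ) * (a ⊛ veronese 4 τ) i            ≈⟨ *-congˡ (⊛-veronese a 2 τ i) ⟩
            dot b (γ τ) * (dot a (γ τ) * γ τ i)           ≈⟨ solve 3 (λ a b c → b :* (a :* c) := (a :* b) :* c) refl (dot a (γ τ)) (dot b (γ τ)) (γ τ i) ⟩
            dot a (γ τ) * dot b (γ τ) * γ τ i             ∎

        section⇒curve : ∀ k {v} → VarietySection k v → v ∈ curve k N₆
        section⇒curve k ((v≉0 , _) , τ , τ∈F , a , b , c , v≋ , ax≈by , by≈cz) =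
          let t , t≉0 , a≈ , b≈ , c≈ = proportional (x τ) (y τ) (z τ) a b c (λ (p , q) → coprime₀₁ τ p q) (λ (p , q) → coprime₁₂ τ p q)
                (λ (p , q) → coprime₂₀ τ p q) ax≈by by≈cz (tensor-≉0 τ v≋ v≉0)
          in curve∋veronese k N₆ τ τ∈F (t , t≉0 , ≋-trans v≋ (≋-trans (tensor-cong τ a≈ b≈ c≈)
               (≋-trans (tensor-⊙ τ t _ _ _) (⊙-congʳ t (≋-sym (N₆-veronese τ))))))

        curve⇒tensor : ∀ τ {v} → v ∼ matrix *ᵥ veronese 6 τ →
          ∃ λ s → ¬ (s ≈ 0#) × v ≋ tensor τ (s * (y τ * z τ)) (s * (z τ * x τ)) (s * (x τ * y τ))
        curve⇒tensor τ (s , s≉0 , v≋) = s , s≉0 , ≋-trans v≋ (≋-trans (⊙-congʳ s (N₆-veronese τ)) (≋-sym (tensor-⊙ τ s _ _ _)))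

        curve⇒section : ∀ k {v} → v ∈ curve k N₆ → VarietySection k v
        curve⇒section k v∈ =
          let τ , τ∈F , v∼ = curve⇒veronese k N₆ v∈
              s , s≉0 , v≋ = curve⇒tensor τ v∼
          in curve⊆PG k N₆ v∈ , τ , τ∈F , _ , _ , _ , v≋ ,
             solve 4 (λ s x y z → s :* (y :* z) :* x := s :* (z :* x) :* y) refl s (x τ) (y τ) (z τ) ,
             solve 4 (λ s x y z → s :* (z :* x) :* y := s :* (x :* y) :* z) refl s (x τ) (y τ) (z τ)

        -- At a zero of u the products zx and xy vanish while yz does not, by coprimality. So this
        -- point of the curve has only its first component and lies in Γ.
        root⇒point : ∀ θ → x (just θ) ≈ 0# → G *ᵥ γ (just θ) ∼ matrix *ᵥ veronese 6 (just θ)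
        root⇒point θ xθ≈0 = ∼-sym (y τ * z τ , xy≉0 (coprime₀₁ τ xθ≈0) (λ zθ≈0 → coprime₂₀ τ zθ≈0 xθ≈0) ,
          ≋-trans (N₆-veronese τ) (≋-trans (tensor-cong τ (sym (*-identityʳ _)) (vanish (trans (*-congˡ xθ≈0) (zeroʳ _))) (vanish (trans (*-congʳ xθ≈0) (zeroˡ _))))
            (≋-trans (tensor-⊙ τ (y τ * z τ) 1# 0# 0#) (⊙-congʳ (y τ * z τ)
              (≋-trans (join-cong (1⊙ (γ τ)) (0⊙ (γ τ)) (0⊙ (γ τ))) (≋-sym (join-first (γ τ))))))))
          where
          τ : Maybe Carrier
          τ = just θ
          vanish : ∀ {a b} → a ≈ 0# → a ≈ b * 0#
          vanish {b = b} a≈0 = trans a≈0 (sym (zeroʳ b))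

        φ-point : ∀ j θ → x (just θ) ≈ 0# → φ j (G *ᵥ γ (just θ)) ∼ matrix *ᵥ veronese 6 (just (frob j θ))
        φ-point j θ xθ≈0 = ∼-trans (∼-φ j (root⇒point θ xθ≈0)) (≋⇒∼ (≋-sym (φ-curve j N₆ θ)))

        -- On the curve the form u takes the value xyz at the first component, up to a nonzero
        -- factor.
        at-infinity⇒root : ∀ τ {v} → v ∼ matrix *ᵥ veronese 6 τ → AtInfinity⁺ v → x τ ≈ 0# ⊎ y τ ≈ 0# ⊎ z τ ≈ 0#
        at-infinity⇒root τ v∼ v∈∞ =
          let s , s≉0 , v≋ = curve⇒tensor τ v∼
              syzx≈0 , _ = tensor-at-infinity τ _ _ _ v≋ v∈∞
          in by-factor (xy≈0⇒x≈0⊎y≈0 (xy≈0⇒y≈0 s≉0 (trans (sym (*-assoc s (y τ * z τ) (x τ))) syzx≈0)))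
          where
          by-factor : y τ * z τ ≈ 0# ⊎ x τ ≈ 0# → x τ ≈ 0# ⊎ y τ ≈ 0# ⊎ z τ ≈ 0#
          by-factor (inj₂ xτ≈0) = inj₁ xτ≈0
          by-factor (inj₁ yz≈0) = [ (λ yτ≈0 → inj₂ (inj₁ yτ≈0)) , (λ zτ≈0 → inj₂ (inj₂ zτ≈0)) ] (xy≈0⇒x≈0⊎y≈0 yz≈0)

        root⇒at-infinity : ∀ θ → x (just θ) ≈ 0# → ∀ j → AtInfinity⁺ (φ j (G *ᵥ γ (just θ)))
        root⇒at-infinity θ xθ≈0 j = AtInfinity⁺-φ^ j (γ (just θ) , 𝟎 , 𝟎 , join-first (γ (just θ)) , xθ≈0 , dot-𝟎 u′ , dot-𝟎 u″)

        open Splits u-splits using (α; β; root-α; root-β; roots; ∞-not-root)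

        module _ {P Q : Vector Carrier 9} (P≋ : P ≋ G *ᵥ γ (just α)) (Q≋ : Q ≋ G *ᵥ γ (just β)) where

          private
            sixPoints : List (Vector Carrier 9)
            sixPoints = P List.∷ φ 1 P List.∷ φ 2 P List.∷ Q List.∷ φ 1 Q List.∷ φ 2 Q List.∷ List.[]

            φ-point-∼ : ∀ j θ {R v} → R ≋ G *ᵥ γ (just θ) → x (just θ) ≈ 0# → v ∼ φ j R → v ∼ matrix *ᵥ veronese 6 (just (frob j θ))
            φ-point-∼ j θ R≋ xθ≈0 v∼ = ∼-trans v∼ (∼-trans (≋⇒∼ (φ-cong j R≋)) (φ-point j θ xθ≈0))

            ∼-φ-point : ∀ j θ η {R v} → R ≋ G *ᵥ γ (just θ) → x (just θ) ≈ 0# → η ≈ frob j θ → v ∼ matrix *ᵥ veronese 6 (just η) → v ∼ φ j R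
            ∼-φ-point j θ η R≋ xθ≈0 η≈ v∼ = ∼-trans v∼ (∼-trans (≋⇒∼ (Linear.cong (*ᵥ-linear matrix) (veronese-cong 6 η≈)))
              (∼-trans (∼-sym (φ-point j θ xθ≈0)) (≋⇒∼ (φ-cong j (≋-sym R≋)))))

            φ0 : ∀ (R : Vector Carrier 9) → R ∼ φ 0 R
            φ0 R = ≋⇒∼ (λ i → sym (frob-0th (R i)))

          point⇒curve∩∞ : ∀ k θ → θ ∈ F k → x (just θ) ≈ 0# → ∀ {R v} → R ≋ G *ᵥ γ (just θ) → ∀ j → v ∼ φ j R → v ∈ curve k N₆ × AtInfinity⁺ v
          point⇒curve∩∞ k θ θ∈F xθ≈0 R≋ j v∼ =
            curve∋veronese k N₆ (just (frob j θ)) (F-frob j k θ∈F) (φ-point-∼ j θ R≋ xθ≈0 v∼) ,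
            ∼-subspace AtInfinity⁺-subspace (∼-trans v∼ (≋⇒∼ (φ-cong j R≋))) (root⇒at-infinity θ xθ≈0 j)

          points⇒curve∩∞ : ∀ k → α ∈ F k → β ∈ F k → ∀ {v} → v ∈ points sixPoints → v ∈ curve k N₆ × AtInfinity⁺ v
          points⇒curve∩∞ k α∈F β∈F (here v∼)                                       = point⇒curve∩∞ k α α∈F root-α P≋ 0 (∼-trans v∼ (φ0 P))
          points⇒curve∩∞ k α∈F β∈F (there (here v∼))                               = point⇒curve∩∞ k α α∈F root-α P≋ 1 v∼
          points⇒curve∩∞ k α∈F β∈F (there (there (here v∼)))                       = point⇒curve∩∞ k α α∈F root-α P≋ 2 v∼
          points⇒curve∩∞ k α∈F β∈F (there (there (there (here v∼))))               = point⇒curve∩∞ k β β∈F root-β Q≋ 0 (∼-trans v∼ (φ0 Q))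
          points⇒curve∩∞ k α∈F β∈F (there (there (there (there (here v∼)))))       = point⇒curve∩∞ k β β∈F root-β Q≋ 1 v∼
          points⇒curve∩∞ k α∈F β∈F (there (there (there (there (there (here v∼)))))) = point⇒curve∩∞ k β β∈F root-β Q≋ 2 v∼

          curve∩∞⇒points : ∀ k {v} → v ∈ curve k N₆ → AtInfinity⁺ v → v ∈ points sixPoints
          curve∩∞⇒points k v∈ v∈∞ =
            let τ , _ , v∼ = curve⇒veronese k N₆ v∈
            in at-parameter τ v∼ (at-infinity⇒root τ v∼ v∈∞)
            where
            at-parameter : ∀ τ {v} → v ∼ matrix *ᵥ veronese 6 τ → x τ ≈ 0# ⊎ y τ ≈ 0# ⊎ z τ ≈ 0# → v ∈ points sixPoints
            at-parameter nothing v∼ (inj₁ x≈0) = contradiction x≈0 ∞-not-root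
            at-parameter nothing v∼ (inj₂ (inj₁ y≈0)) = contradiction y≈0 (Splits.∞-not-root (Splits-φ 1 u-splits))
            at-parameter nothing v∼ (inj₂ (inj₂ z≈0)) = contradiction z≈0 (Splits.∞-not-root (Splits-φ 2 u-splits))
            at-parameter (just θ) {v} v∼ (inj₁ x≈0) = at-root (roots θ x≈0)
              where
              at-root : θ ≈ α ⊎ θ ≈ β → v ∈ points sixPoints
              at-root (inj₁ θ≈) = here (∼-trans (∼-φ-point 0 α θ P≋ root-α (trans θ≈ (sym (frob-0th α))) v∼) (∼-sym (φ0 P)))
              at-root (inj₂ θ≈) = there (there (there (here (∼-trans (∼-φ-point 0 β θ Q≋ root-β (trans θ≈ (sym (frob-0th β))) v∼) (∼-sym (φ0 Q))))))
            at-parameter (just θ) {v} v∼ (inj₂ (inj₁ y≈0)) = at-root (Splits.roots (Splits-φ 1 u-splits) θ y≈0)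
              where
              at-root : θ ≈ frob 1 α ⊎ θ ≈ frob 1 β → v ∈ points sixPoints
              at-root (inj₁ θ≈) = there (here (∼-φ-point 1 α θ P≋ root-α θ≈ v∼))
              at-root (inj₂ θ≈) = there (there (there (there (here (∼-φ-point 1 β θ Q≋ root-β θ≈ v∼)))))
            at-parameter (just θ) {v} v∼ (inj₂ (inj₂ z≈0)) = at-root (Splits.roots (Splits-φ 2 u-splits) θ z≈0)
              where
              at-root : θ ≈ frob 2 α ⊎ θ ≈ frob 2 β → v ∈ points sixPoints
              at-root (inj₁ θ≈) = there (there (here (∼-φ-point 2 α θ P≋ root-α θ≈ v∼)))
              at-root (inj₂ θ≈) = there (there (there (there (there (here (∼-φ-point 2 β θ Q≋ root-β θ≈ v∼))))))

      -- With lⱼ = θ - ρⱼ, the forms x, y, z are l₀l₁, l₁l₂, l₂l₀ up to scalars, so (y z, z x, x y) is divisible by l₀l₁l₂.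
      module Cubic (ρ₀ : Carrier) (ρ₀∈F : ρ₀ ∈ F 3) (ρ₀∉F₁ : ¬ (ρ₀ ∈ F 1))
                   (root₀ : x (just ρ₀) ≈ 0#) (root₁ : x (just (frob 1 ρ₀)) ≈ 0#) where

        ρ₁ ρ₂ k₀ k₁ k₂ : Carrier
        ρ₁ = frob 1 ρ₀
        ρ₂ = frob 2 ρ₀
        k₀ = u 2F
        k₁ = u′ 2F
        k₂ = u″ 2F

        frob-ρ₁ : frob 1 ρ₁ ≈ ρ₂
        frob-ρ₁ = frob-∘ 1 1 ρ₀

        frob-ρ₂ : frob 1 ρ₂ ≈ ρ₀
        frob-ρ₂ = trans (frob-∘ 1 2 ρ₀) ρ₀∈F

        ρ₀≉ρ₁ : ¬ (ρ₀ ≈ ρ₁)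
        ρ₀≉ρ₁ eq = ρ₀∉F₁ (sym eq)

        ρ₂≉ρ₀ : ¬ (ρ₂ ≈ ρ₀)
        ρ₂≉ρ₀ eq = ρ₀∉F₁ (trans (frob-cong 1 (sym eq)) frob-ρ₂)

        ρ₁≉ρ₂ : ¬ (ρ₁ ≈ ρ₂)
        ρ₁≉ρ₂ eq = ρ₂≉ρ₀ (trans (sym frob-ρ₁) (trans (frob-cong 1 eq) frob-ρ₂))

        private
          -- Two distinct roots of a quadratic are its roots α, β in one order or the other, which
          -- sum and product do not see.
          symmetric : ρ₀ * ρ₁ ≈ Splits.α u-splits * Splits.β u-splits × ρ₀ + ρ₁ ≈ Splits.α u-splits + Splits.β u-splits
          symmetric = by-roots (roots ρ₀ root₀) (roots ρ₁ root₁)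
            where
            open Splits u-splits
            by-roots : ρ₀ ≈ α ⊎ ρ₀ ≈ β → ρ₁ ≈ α ⊎ ρ₁ ≈ β → ρ₀ * ρ₁ ≈ α * β × ρ₀ + ρ₁ ≈ α + β
            by-roots (inj₁ p) (inj₁ q) = contradiction (trans p (sym q)) ρ₀≉ρ₁
            by-roots (inj₂ p) (inj₂ q) = contradiction (trans p (sym q)) ρ₀≉ρ₁
            by-roots (inj₁ p) (inj₂ q) = *-cong p q , +-cong p q
            by-roots (inj₂ p) (inj₁ q) = trans (*-cong p q) (*-comm β α) , trans (+-cong p q) (+-comm β α)

        splits : Splits u
        splits = record
          { α = ρ₀ ; β = ρ₁ ; a₂≉0 = a₂≉0
          ; a₀≈ = trans a₀≈ (*-congˡ (sym (proj₁ symmetric))) ; a₁≈ = trans a₁≈ (*-congˡ (-‿cong (sym (proj₂ symmetric)))) }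
          where open Splits u-splits

        k₀≉0 : ¬ (k₀ ≈ 0#)
        k₀≉0 = Splits.a₂≉0 splits

        k₁≉0 : ¬ (k₁ ≈ 0#)
        k₁≉0 = frob-≉0 1 k₀≉0

        k₂≉0 : ¬ (k₂ ≈ 0#)
        k₂≉0 = frob-≉0 2 k₀≉0

        linear : Carrier → Maybe Carrier → Carrier
        linear ρ (just θ) = θ - ρ
        linear ρ nothing  = 1#

        l₀ l₁ l₂ : Maybe Carrier → Carrier
        l₀ = linear ρ₀
        l₁ = linear ρ₁
        l₂ = linear ρ₂

        private
          at-∞ : ∀ a b c → a * 0# + b * 0# + c * 1# ≈ c * (1# * 1#)
          at-∞ = solve 3 (λ a b c → a :* con (ℤ.+ 0) :+ b :* con (ℤ.+ 0) :+ c :* con (ℤ.+ 1) := c :* (con (ℤ.+ 1) :* con (ℤ.+ 1))) refl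

        x≈ : ∀ τ → x τ ≈ k₀ * (l₀ τ * l₁ τ)
        x≈ (just θ) = Splits.factorisation splits θ
        x≈ nothing  = at-∞ (u 0F) (u 1F) (u 2F)

        y≈ : ∀ τ → y τ ≈ k₁ * (l₁ τ * l₂ τ)
        y≈ (just θ) = trans (Splits.factorisation (Splits-φ 1 splits) θ) (*-congˡ (*-congˡ (+-congˡ (-‿cong frob-ρ₁))))
        y≈ nothing  = at-∞ (u′ 0F) (u′ 1F) (u′ 2F)

        z≈ : ∀ τ → z τ ≈ k₂ * (l₂ τ * l₀ τ)
        z≈ (just θ) = trans (Splits.factorisation (Splits-φ 2 splits) θ) (*-congˡ (*-congˡ (+-congˡ (-‿cong (trans (frob-∘ 2 1 ρ₀) ρ₀∈F)))))
        z≈ nothing  = at-∞ (u″ 0F) (u″ 1F) (u″ 2F)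

        -- The counterpart of `⊛` for the linear polynomial t - ρ.
        _◁_ : Carrier → Vector Carrier 4 → Vector Carrier 3
        (ρ ◁ m) i = m (suc i) - ρ * m (inject₁ i)

        ◁-veronese : ∀ ρ τ → ρ ◁ veronese 3 τ ≋ linear ρ τ ⊙ γ τ
        ◁-veronese ρ (just θ) i = trans (+-congˡ (-‿cong (*-congˡ (^-congʳ θ (Fin.toℕ-inject₁ i)))))
          (solve 3 (λ t ρ p → t :* p :- ρ :* p := (t :- ρ) :* p) refl θ ρ (θ ^ Fin.toℕ i))
        ◁-veronese ρ nothing i = trans (+-congˡ (-‿cong (*-congˡ (e-last-inject₁ 2 i))))
          (solve 2 (λ ρ p → p :- ρ :* con (ℤ.+ 0) := con (ℤ.+ 1) :* p) refl ρ (e-last 2 i))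

        private
          ◁-linear : ∀ ρ → Linear (ρ ◁_)
          ◁-linear ρ = record
            { cong   = λ m≋m′ i → +-cong (m≋m′ _) (-‿cong (*-congˡ (m≋m′ _)))
            ; homo-⊕ = λ m m′ i → solve 5 (λ ρ a b c d → (a :+ c) :- ρ :* (b :+ d) := (a :- ρ :* b) :+ (c :- ρ :* d)) refl ρ _ _ _ _
            ; homo-⊙ = λ t m i → solve 4 (λ t ρ a b → t :* a :- ρ :* (t :* b) := t :* (a :- ρ :* b)) refl t ρ _ _ }

          -- On the moment sequence of θ these scale γ by k₁k₂l₂, k₂k₀l₀ and k₀k₁l₁, which is (yz,
          -- zx, xy) divided by l₀l₁l₂.
          g₀ g₁ g₂ : Vector Carrier 4 → Vector Carrier 3
          g₀ m = (k₁ * k₂) ⊙ (ρ₂ ◁ m)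
          g₁ m = (k₂ * k₀) ⊙ (ρ₀ ◁ m)
          g₂ m = (k₀ * k₁) ⊙ (ρ₁ ◁ m)

          φ-g : ∀ {s t s′ t′ ρ ρ′} m → frob 1 s ≈ s′ → frob 1 t ≈ t′ → frob 1 ρ ≈ ρ′ → φ 1 ((s * t) ⊙ (ρ ◁ m)) ≋ (s′ * t′) ⊙ (ρ′ ◁ φ 1 m)
          φ-g m p q r i = trans (frob-* 1 _ _) (*-cong (trans (frob-* 1 _ _) (*-cong p q))
            (trans (frob-+ 1 _ _) (+-congˡ (trans (frob-neg 1 _) (-‿cong (trans (frob-* 1 _ _) (*-congʳ r)))))))

          frob-k₁ : frob 1 k₁ ≈ k₂
          frob-k₁ = frob-∘ 1 1 k₀
          frob-k₂ : frob 1 k₂ ≈ k₀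
          frob-k₂ = φu″≋u 2F

          -- The hypotheses say that mᵢ₊₁ equals both ρ₂mᵢ and ρ₀mᵢ. As ρ₂ ≠ ρ₀, this gives mᵢ = 0
          -- and then mᵢ₊₁ = 0.
          injective : ∀ m → g₀ m ≋ 𝟎 → g₁ m ≋ 𝟎 → g₂ m ≋ 𝟎 → m ≋ 𝟎
          injective m p q _ = λ { zero → init≈0 0F ; (suc i) → trans (solve 2 (λ a b → a := (a :- b) :+ b) refl (m (suc i)) (ρ₀ * m (inject₁ i)))
                (trans (+-cong (eq₀ i) (trans (*-congˡ (init≈0 i)) (zeroʳ ρ₀))) (+-identityˡ 0#)) }
            where
            eq₂ : ρ₂ ◁ m ≋ 𝟎
            eq₂ i = xy≈0⇒y≈0 (xy≉0 k₁≉0 k₂≉0) (p i)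
            eq₀ : ρ₀ ◁ m ≋ 𝟎
            eq₀ i = xy≈0⇒y≈0 (xy≉0 k₂≉0 k₀≉0) (q i)
            init≈0 : ∀ i → m (inject₁ i) ≈ 0#
            init≈0 i = xy≈0⇒y≈0 {ρ₂ - ρ₀} (λ eq → ρ₂≉ρ₀ (x-y≈0⇒x≈y eq)) (trans
              (solve 4 (λ r s a b → (r :- s) :* a := (b :- s :* a) :- (b :- r :* a)) refl ρ₂ ρ₀ (m (inject₁ i)) (m (suc i)))
              (trans (+-cong (eq₀ i) (-‿cong (eq₂ i))) (-‿inverseʳ 0#)))

          curve-N₃ = conjugateCurve g₀ g₁ g₂ (linear-⊙ (k₁ * k₂) (◁-linear ρ₂)) (linear-⊙ (k₂ * k₀) (◁-linear ρ₀)) (linear-⊙ (k₀ * k₁) (◁-linear ρ₁))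
            (λ m → φ-g m frob-k₁ frob-k₂ frob-ρ₂) (λ m → φ-g m frob-k₂ refl refl) (λ m → φ-g m refl frob-k₁ frob-ρ₁) injective

        N₃ : NormalRationalCurve 8 3
        N₃ = proj₁ curve-N₃

        open NormalRationalCurve N₃ using (matrix)

        N₃-veronese : ∀ τ → matrix *ᵥ veronese 3 τ ≋ tensor τ (k₁ * k₂ * l₂ τ) (k₂ * k₀ * l₀ τ) (k₀ * k₁ * l₁ τ)
        N₃-veronese τ = ≋-trans (proj₂ curve-N₃ (veronese 3 τ)) (join-cong (entry (k₁ * k₂) ρ₂) (entry (k₂ * k₀) ρ₀) (entry (k₀ * k₁) ρ₁))
          where
          entry : ∀ k ρ → k ⊙ (ρ ◁ veronese 3 τ) ≋ (k * linear ρ τ) ⊙ γ τ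
          entry k ρ i = trans (*-congˡ (◁-veronese ρ τ i)) (sym (*-assoc k _ _))

        curve⇒tensor : ∀ τ {v} → v ∼ matrix *ᵥ veronese 3 τ →
          ∃ λ s → ¬ (s ≈ 0#) × v ≋ tensor τ (s * (k₁ * k₂ * l₂ τ)) (s * (k₂ * k₀ * l₀ τ)) (s * (k₀ * k₁ * l₁ τ))
        curve⇒tensor τ (s , s≉0 , v≋) = s , s≉0 , ≋-trans v≋ (≋-trans (⊙-congʳ s (N₃-veronese τ)) (≋-sym (tensor-⊙ τ s _ _ _)))

        value : ∀ s τ → Carrier
        value s τ = s * (k₀ * (k₁ * k₂)) * (l₀ τ * (l₁ τ * l₂ τ))

        ax≈value : ∀ s τ → s * (k₁ * k₂ * l₂ τ) * x τ ≈ value s τ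
        ax≈value s τ = trans (*-congˡ (x≈ τ)) (solve 7 (λ s p q r a b c → s :* (q :* r :* c) :* (p :* (a :* b)) := s :* (p :* (q :* r)) :* (a :* (b :* c)))
          refl s k₀ k₁ k₂ (l₀ τ) (l₁ τ) (l₂ τ))

        by≈value : ∀ s τ → s * (k₂ * k₀ * l₀ τ) * y τ ≈ value s τ
        by≈value s τ = trans (*-congˡ (y≈ τ)) (solve 7 (λ s p q r a b c → s :* (r :* p :* a) :* (q :* (b :* c)) := s :* (p :* (q :* r)) :* (a :* (b :* c)))
          refl s k₀ k₁ k₂ (l₀ τ) (l₁ τ) (l₂ τ))

        cz≈value : ∀ s τ → s * (k₀ * k₁ * l₁ τ) * z τ ≈ value s τ
        cz≈value s τ = trans (*-congˡ (z≈ τ)) (solve 7 (λ s p q r a b c → s :* (p :* q :* b) :* (r :* (c :* a)) := s :* (p :* (q :* r)) :* (a :* (b :* c)))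
          refl s k₀ k₁ k₂ (l₀ τ) (l₁ τ) (l₂ τ))

        curve⇒section : ∀ k {v} → v ∈ curve k N₃ → VarietySection k v
        curve⇒section k v∈ =
          let τ , τ∈F , v∼ = curve⇒veronese k N₃ v∈
              s , s≉0 , v≋ = curve⇒tensor τ v∼
          in curve⊆PG k N₃ v∈ , τ , τ∈F , _ , _ , _ , v≋ ,
             trans (ax≈value s τ) (sym (by≈value s τ)) , trans (by≈value s τ) (sym (cz≈value s τ))

        -- For a parameter in F_q no lⱼ vanishes, since ρ₀ and its conjugates lie outside F_q, and
        -- the factor l₀l₁l₂ can be cancelled. Over F_{q³} it cannot: there the section also
        -- contains the lines over the ρⱼ.
        section⇒curve : ∀ {v} → VarietySection 1 v → v ∈ curve 1 N₃
        section⇒curve ((v≉0 , _) , τ , τ∈F , a , b , c , v≋ , ax≈by , by≈cz) =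
          let t , t≉0 , a≈ , b≈ , c≈ = proportional (x τ) (y τ) (z τ) a b c (λ (p , _) → x≉0 p) (λ (p , _) → y≉0 p)
                (λ (_ , p) → x≉0 p) ax≈by by≈cz (tensor-≉0 τ v≋ v≉0)
              s = t * (l₀ τ * (l₁ τ * l₂ τ))
          in curve∋veronese 1 N₃ τ τ∈F (s , xy≉0 t≉0 (xy≉0 l₀≉0 (xy≉0 l₁≉0 l₂≉0)) , ≋-trans v≋ (≋-trans (tensor-cong τ
               (trans a≈ (trans (*-congˡ (*-cong (y≈ τ) (z≈ τ))) (solve 6 (λ t q r a b c → t :* ((q :* (b :* c)) :* (r :* (c :* a))) := t :* (a :* (b :* c)) :* (q :* r :* c))
                 refl t k₁ k₂ (l₀ τ) (l₁ τ) (l₂ τ))))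
               (trans b≈ (trans (*-congˡ (*-cong (z≈ τ) (x≈ τ))) (solve 6 (λ t p r a b c → t :* ((r :* (c :* a)) :* (p :* (a :* b))) := t :* (a :* (b :* c)) :* (r :* p :* a))
                 refl t k₀ k₂ (l₀ τ) (l₁ τ) (l₂ τ))))
               (trans c≈ (trans (*-congˡ (*-cong (x≈ τ) (y≈ τ))) (solve 6 (λ t p q a b c → t :* ((p :* (a :* b)) :* (q :* (b :* c))) := t :* (a :* (b :* c)) :* (p :* q :* b))
                 refl t k₀ k₁ (l₀ τ) (l₁ τ) (l₂ τ)))))
               (≋-trans (tensor-⊙ τ s _ _ _) (⊙-congʳ s (≋-sym (N₃-veronese τ))))))
          where
          linear≉0 : ∀ {ρ} τ → Parameter 1 τ → ¬ (ρ ∈ F 1) → ¬ (linear ρ τ ≈ 0#)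
          linear≉0 (just θ) θ∈F ρ∉F eq = ρ∉F (F-cong 1 (x-y≈0⇒x≈y eq) θ∈F)
          linear≉0 nothing  _   _   eq = 1≉0 eq
          l₀≉0 : ¬ (l₀ τ ≈ 0#)
          l₀≉0 = linear≉0 τ τ∈F ρ₀∉F₁
          l₁≉0 : ¬ (l₁ τ ≈ 0#)
          l₁≉0 = linear≉0 τ τ∈F (λ ρ₁∈F → ρ₁≉ρ₂ (trans (sym ρ₁∈F) frob-ρ₁))
          l₂≉0 : ¬ (l₂ τ ≈ 0#)
          l₂≉0 = linear≉0 τ τ∈F (λ ρ₂∈F → ρ₂≉ρ₀ (trans (sym ρ₂∈F) frob-ρ₂))
          x≉0 : ¬ (x τ ≈ 0#)
          x≉0 eq = xy≉0 k₀≉0 (xy≉0 l₀≉0 l₁≉0) (trans (sym (x≈ τ)) eq)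
          y≉0 : ¬ (y τ ≈ 0#)
          y≉0 eq = xy≉0 k₁≉0 (xy≉0 l₁≉0 l₂≉0) (trans (sym (y≈ τ)) eq)

        linear-root : ∀ {ρ} τ → linear ρ τ ≈ 0# → ∃ λ θ → τ ≡ just θ × θ ≈ ρ
        linear-root (just θ) eq = θ , ≡.refl , x-y≈0⇒x≈y eq
        linear-root nothing  eq = contradiction eq 1≉0

        τ₀ τ₁ τ₂ : Maybe Carrier
        τ₀ = just ρ₀
        τ₁ = just ρ₁
        τ₂ = just ρ₂

        tensor-parameter : ∀ {θ η} a b c → θ ≈ η → tensor (just θ) a b c ≋ tensor (just η) a b c
        tensor-parameter a b c θ≈η = join-cong (⊙-congʳ a (veronese-cong 2 θ≈η)) (⊙-congʳ b (veronese-cong 2 θ≈η)) (⊙-congʳ c (veronese-cong 2 θ≈η))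

        -- At ρ₀ both x and z vanish but y does not, so lying at infinity leaves a and c free and
        -- forces b = 0. The other two lines arise by cyclic permutation.
        OnLine₀ OnLine₁ OnLine₂ : Vector Carrier 9 → Set _
        OnLine₀ v = ∃ λ a → ∃ λ c → v ≋ tensor τ₀ a 0# c
        OnLine₁ v = ∃ λ a → ∃ λ b → v ≋ tensor τ₁ a b 0#
        OnLine₂ v = ∃ λ b → ∃ λ c → v ≋ tensor τ₂ 0# b c

        φ-OnLine₀ : ∀ {v} → OnLine₀ v → OnLine₁ (φ 1 v)
        φ-OnLine₀ (a , c , v≋) = _ , _ , ≋-trans (φ-cong 1 v≋) (≋-trans (φ-tensor ρ₀ a 0# c) (tensor-cong τ₁ refl refl (frob-0 1)))

        φ-OnLine₁ : ∀ {v} → OnLine₁ v → OnLine₂ (φ 1 v)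
        φ-OnLine₁ (a , b , v≋) = _ , _ , ≋-trans (φ-cong 1 v≋) (≋-trans (φ-tensor ρ₁ a b 0#)
          (≋-trans (tensor-parameter _ _ _ frob-ρ₁) (tensor-cong τ₂ (frob-0 1) refl refl)))

        φ-OnLine₂ : ∀ {v} → OnLine₂ v → OnLine₀ (φ 1 v)
        φ-OnLine₂ (b , c , v≋) = _ , _ , ≋-trans (φ-cong 1 v≋) (≋-trans (φ-tensor ρ₂ 0# b c)
          (≋-trans (tensor-parameter _ _ _ frob-ρ₂) (tensor-cong τ₀ refl (frob-0 1) refl)))

        OnLine₀-resp : ∀ {v w} → v ≋ w → OnLine₀ v → OnLine₀ w
        OnLine₀-resp v≋w (a , c , v≋) = a , c , ≋-trans (≋-sym v≋w) v≋

        OnLine₀-∼ : ∀ {v w} → v ∼ w → OnLine₀ w → OnLine₀ v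
        OnLine₀-∼ (t , _ , v≋tw) (a , c , w≋) = t * a , t * c , ≋-trans v≋tw (≋-trans (⊙-congʳ t w≋)
          (≋-trans (≋-sym (tensor-⊙ τ₀ t a 0# c)) (tensor-cong τ₀ refl (zeroʳ t) refl)))

        OnLine₁-∼ : ∀ {v w} → v ∼ w → OnLine₁ w → OnLine₁ v
        OnLine₁-∼ (t , _ , v≋tw) (a , b , w≋) = t * a , t * b , ≋-trans v≋tw (≋-trans (⊙-congʳ t w≋)
          (≋-trans (≋-sym (tensor-⊙ τ₁ t a b 0#)) (tensor-cong τ₁ refl refl (zeroʳ t))))

        OnLine₂-∼ : ∀ {v w} → v ∼ w → OnLine₂ w → OnLine₂ v
        OnLine₂-∼ (t , _ , v≋tw) (b , c , w≋) = t * b , t * c , ≋-trans v≋tw (≋-trans (⊙-congʳ t w≋)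
          (≋-trans (≋-sym (tensor-⊙ τ₂ t 0# b c)) (tensor-cong τ₂ (zeroʳ t) refl refl)))

        OnLine₀-φ³ : ∀ {v} → OnLine₀ v → OnLine₀ (φ 3 v)
        OnLine₀-φ³ {v} v∈ = OnLine₀-resp (≋-trans (φ-cong 1 (φ-∘ 1 1 v)) (φ-∘ 1 2 v)) (φ-OnLine₂ (φ-OnLine₁ (φ-OnLine₀ v∈)))

        -- Since φ 6 is the identity, φ 5 undoes φ 1. It is reached by completing the cycle with two
        -- steps and going once more around it.
        OnLine₁⇒₀ : ∀ {v} → OnLine₁ v → OnLine₀ (φ 5 v)
        OnLine₁⇒₀ {v} v∈ = OnLine₀-resp (≋-trans (φ-cong 3 (φ-∘ 1 1 v)) (φ-∘ 3 2 v)) (OnLine₀-φ³ (φ-OnLine₂ (φ-OnLine₁ v∈)))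

        OnLine₂⇒₀ : ∀ {v} → OnLine₂ v → OnLine₀ (φ 4 v)
        OnLine₂⇒₀ {v} v∈ = OnLine₀-resp (φ-∘ 3 1 v) (OnLine₀-φ³ (φ-OnLine₂ v∈))

        private
          l-self : ∀ ρ → linear ρ (just ρ) ≈ 0#
          l-self ρ = -‿inverseʳ ρ

        xρ₀≈0 : x τ₀ ≈ 0#
        xρ₀≈0 = root₀
        zρ₀≈0 : z τ₀ ≈ 0#
        zρ₀≈0 = trans (z≈ τ₀) (trans (*-congˡ (trans (*-congˡ (l-self ρ₀)) (zeroʳ _))) (zeroʳ k₂))
        yρ₀≉0 : ¬ (y τ₀ ≈ 0#)
        yρ₀≉0 eq = xy≉0 k₁≉0 (xy≉0 (λ e → ρ₀≉ρ₁ (x-y≈0⇒x≈y e)) (λ e → ρ₂≉ρ₀ (sym (x-y≈0⇒x≈y e)))) (trans (sym (y≈ τ₀)) eq)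
        zρ₁≉0 : ¬ (z τ₁ ≈ 0#)
        zρ₁≉0 eq = xy≉0 k₂≉0 (xy≉0 (λ e → ρ₁≉ρ₂ (x-y≈0⇒x≈y e)) (λ e → ρ₀≉ρ₁ (sym (x-y≈0⇒x≈y e)))) (trans (sym (z≈ τ₁)) eq)
        xρ₂≉0 : ¬ (x τ₂ ≈ 0#)
        xρ₂≉0 eq = xy≉0 k₀≉0 (xy≉0 (λ e → ρ₂≉ρ₀ (x-y≈0⇒x≈y e)) (λ e → ρ₁≉ρ₂ (sym (x-y≈0⇒x≈y e)))) (trans (sym (x≈ τ₂)) eq)

        -- At infinity ax = by = cz = 0. Were all lⱼ nonzero, so would be x, y, z, and the point
        -- would be the zero vector; at a zero of lⱼ exactly one of x, y, z survives and kills its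
        -- coefficient.
        section∩∞⇒OnLine : ∀ {k v} → VarietySection k v → AtInfinity⁺ v → OnLine₀ v ⊎ OnLine₁ v ⊎ OnLine₂ v
        section∩∞⇒OnLine {v = v} ((v≉0 , _) , τ , _ , a , b , c , v≋ , _) v∈∞ = by-linear (l₀ τ ≟ 0#) (l₁ τ ≟ 0#) (l₂ τ ≟ 0#)
          where
          products = tensor-at-infinity τ a b c v≋ v∈∞
          cancel : ∀ {a x} → a * x ≈ 0# → ¬ (x ≈ 0#) → a ≈ 0#
          cancel ax≈0 x≉0 = xy≈0⇒y≈0 x≉0 (trans (*-comm _ _) ax≈0)
          at-root : ∀ {θ ρ} → θ ≈ ρ → τ ≡ just θ → v ≋ tensor (just ρ) a b c
          at-root θ≈ρ ≡.refl = ≋-trans v≋ (tensor-parameter a b c θ≈ρ)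
          on-line₀ : (∃ λ θ → τ ≡ just θ × θ ≈ ρ₀) → OnLine₀ v
          on-line₀ (θ , τ≡ , θ≈) = let eq = at-root θ≈ τ≡ ; _ , p , _ = tensor-at-infinity τ₀ a b c eq v∈∞
            in a , c , ≋-trans eq (tensor-cong τ₀ refl (cancel p yρ₀≉0) refl)
          on-line₁ : (∃ λ θ → τ ≡ just θ × θ ≈ ρ₁) → OnLine₁ v
          on-line₁ (θ , τ≡ , θ≈) = let eq = at-root θ≈ τ≡ ; _ , _ , p = tensor-at-infinity τ₁ a b c eq v∈∞
            in a , b , ≋-trans eq (tensor-cong τ₁ refl refl (cancel p zρ₁≉0))
          on-line₂ : (∃ λ θ → τ ≡ just θ × θ ≈ ρ₂) → OnLine₂ v
          on-line₂ (θ , τ≡ , θ≈) = let eq = at-root θ≈ τ≡ ; p , _ = tensor-at-infinity τ₂ a b c eq v∈∞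
            in b , c , ≋-trans eq (tensor-cong τ₂ (cancel p xρ₂≉0) refl refl)
          by-linear : Dec (l₀ τ ≈ 0#) → Dec (l₁ τ ≈ 0#) → Dec (l₂ τ ≈ 0#) → OnLine₀ v ⊎ OnLine₁ v ⊎ OnLine₂ v
          by-linear (yes p) _ _ = inj₁ (on-line₀ (linear-root τ p))
          by-linear (no _) (yes p) _ = inj₂ (inj₁ (on-line₁ (linear-root τ p)))
          by-linear (no _) (no _) (yes p) = inj₂ (inj₂ (on-line₂ (linear-root τ p)))
          by-linear (no l₀≉0) (no l₁≉0) (no l₂≉0) = contradiction
            ( cancel (proj₁ products) (λ eq → xy≉0 k₀≉0 (xy≉0 l₀≉0 l₁≉0) (trans (sym (x≈ τ)) eq))
            , cancel (proj₁ (proj₂ products)) (λ eq → xy≉0 k₁≉0 (xy≉0 l₁≉0 l₂≉0) (trans (sym (y≈ τ)) eq))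
            , cancel (proj₂ (proj₂ products)) (λ eq → xy≉0 k₂≉0 (xy≉0 l₂≉0 l₀≉0) (trans (sym (z≈ τ)) eq)) ) (tensor-≉0 τ v≋ v≉0)

        OnLine₀⇒∞ : ∀ {v} → OnLine₀ v → AtInfinity⁺ v
        OnLine₀⇒∞ (a , c , v≋) = tensor⇒at-infinity τ₀ a 0# c v≋ (trans (*-congˡ xρ₀≈0) (zeroʳ a)) (zeroˡ _) (trans (*-congˡ zρ₀≈0) (zeroʳ c))

        private
          ∞⇒section : ∀ {θ v} a b c → v ∈ PG 8 3 → θ ∈ F 3 → v ≋ tensor (just θ) a b c → AtInfinity⁺ v → VarietySection 3 v
          ∞⇒section {θ} a b c v∈PG θ∈F v≋ v∈∞ =
            let p , q , r = tensor-at-infinity (just θ) a b c v≋ v∈∞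
            in v∈PG , just θ , θ∈F , a , b , c , v≋ , trans p (sym q) , trans q (sym r)

        OnLine₀⇒section : ∀ {v} → v ∈ PG 8 3 → OnLine₀ v → VarietySection 3 v × AtInfinity⁺ v
        OnLine₀⇒section v∈PG l@(a , c , v≋) = ∞⇒section a 0# c v∈PG ρ₀∈F v≋ (OnLine₀⇒∞ l) , OnLine₀⇒∞ l

        OnLine₁⇒∞ : ∀ {v} → OnLine₁ v → AtInfinity⁺ v
        OnLine₁⇒∞ {v} l = IsLinearSubspace.resp AtInfinity⁺-subspace (≋-trans (φ-∘ 1 5 v) (φ-6 v)) (AtInfinity⁺-φ (OnLine₀⇒∞ (OnLine₁⇒₀ l)))

        OnLine₁⇒section : ∀ {v} → v ∈ PG 8 3 → OnLine₁ v → VarietySection 3 v × AtInfinity⁺ v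
        OnLine₁⇒section v∈PG l@(a , b , v≋) = ∞⇒section a b 0# v∈PG (F-frob 1 3 ρ₀∈F) v≋ (OnLine₁⇒∞ l) , OnLine₁⇒∞ l

        OnLine₂⇒∞ : ∀ {v} → OnLine₂ v → AtInfinity⁺ v
        OnLine₂⇒∞ {v} l = IsLinearSubspace.resp AtInfinity⁺-subspace (≋-trans (φ-∘ 2 4 v) (φ-6 v)) (AtInfinity⁺-φ^ 2 (OnLine₀⇒∞ (OnLine₂⇒₀ l)))

        OnLine₂⇒section : ∀ {v} → v ∈ PG 8 3 → OnLine₂ v → VarietySection 3 v × AtInfinity⁺ v
        OnLine₂⇒section v∈PG l@(b , c , v≋) = ∞⇒section 0# b c v∈PG (F-frob 2 3 ρ₀∈F) v≋ (OnLine₂⇒∞ l) , OnLine₂⇒∞ l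

        R : Vector Carrier 9
        R = matrix *ᵥ veronese 3 τ₀

        -- The middle component carries the factor l₀, which vanishes at ρ₀.
        R-tensor : R ≋ tensor τ₀ (k₁ * k₂ * l₂ τ₀) 0# (k₀ * k₁ * l₁ τ₀)
        R-tensor = ≋-trans (N₃-veronese τ₀) (tensor-cong τ₀ refl (trans (*-congˡ (l-self ρ₀)) (zeroʳ _)) refl)

        R-OnLine : OnLine₀ R
        R-OnLine = _ , _ , R-tensor

        R∈curve : R ∈ curve 3 N₃
        R∈curve = curve∋veronese 3 N₃ τ₀ ρ₀∈F ∼-refl

        φR⇒curve∩∞ : ∀ j {v} → v ∼ φ j R → v ∈ curve 3 N₃ × AtInfinity⁺ v
        φR⇒curve∩∞ j v∼ = curve∋veronese 3 N₃ (just (frob j ρ₀)) (F-frob j 3 ρ₀∈F) (∼-trans v∼ (≋⇒∼ (≋-sym (φ-curve j N₃ ρ₀)))) ,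
          ∼-subspace AtInfinity⁺-subspace v∼ (AtInfinity⁺-φ^ j (OnLine₀⇒∞ R-OnLine))

        linear-product≈0 : ∀ τ {v} → v ∼ matrix *ᵥ veronese 3 τ → AtInfinity⁺ v → l₀ τ * (l₁ τ * l₂ τ) ≈ 0#
        linear-product≈0 τ v∼ v∈∞ =
          let s , s≉0 , v≋ = curve⇒tensor τ v∼
          in xy≈0⇒y≈0 (xy≉0 s≉0 (xy≉0 k₀≉0 (xy≉0 k₁≉0 k₂≉0))) (trans (sym (ax≈value s τ))
               (proj₁ (tensor-at-infinity τ (s * (k₁ * k₂ * l₂ τ)) (s * (k₂ * k₀ * l₀ τ)) (s * (k₀ * k₁ * l₁ τ)) v≋ v∈∞)))

        root⇒φR : ∀ j τ {v} → v ∼ matrix *ᵥ veronese 3 τ → (∃ λ θ → τ ≡ just θ × θ ≈ frob j ρ₀) → v ∼ φ j R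
        root⇒φR j τ v∼ (θ , ≡.refl , θ≈) = ∼-trans v∼ (≋⇒∼ (≋-trans (Linear.cong (*ᵥ-linear matrix) (veronese-cong 3 θ≈)) (φ-curve j N₃ ρ₀)))

        module _ {R′ : Vector Carrier 9} (R′≋ : R′ ≋ R) where

          private
            R-conjugates : List (Vector Carrier 9)
            R-conjugates = R′ List.∷ φ 1 R′ List.∷ φ 2 R′ List.∷ List.[]

            φ0 : ∀ (R : Vector Carrier 9) → R ∼ φ 0 R
            φ0 R = ≋⇒∼ (λ i → sym (frob-0th (R i)))

            ∼φR : ∀ j {v} → v ∼ φ j R′ → v ∼ φ j R
            ∼φR j v∼ = ∼-trans v∼ (≋⇒∼ (φ-cong j R′≋))

            ∼φR′ : ∀ j {v} → v ∼ φ j R → v ∼ φ j R′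
            ∼φR′ j v∼ = ∼-trans v∼ (≋⇒∼ (φ-cong j (≋-sym R′≋)))

          points⇒curve∩∞ : ∀ {v} → v ∈ points R-conjugates → v ∈ curve 3 N₃ × AtInfinity⁺ v
          points⇒curve∩∞ (here v∼)                 = φR⇒curve∩∞ 0 (∼φR 0 (∼-trans v∼ (φ0 R′)))
          points⇒curve∩∞ (there (here v∼))         = φR⇒curve∩∞ 1 (∼φR 1 v∼)
          points⇒curve∩∞ (there (there (here v∼))) = φR⇒curve∩∞ 2 (∼φR 2 v∼)

          curve∩∞⇒points : ∀ {k v} → v ∈ curve k N₃ → AtInfinity⁺ v → v ∈ points R-conjugates
          curve∩∞⇒points {k} v∈ v∈∞ =
            let τ , _ , v∼ = curve⇒veronese k N₃ v∈
            in by-factor τ v∼ (xy≈0⇒x≈0⊎y≈0 (linear-product≈0 τ v∼ v∈∞))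
            where
            by-factor : ∀ τ {v} → v ∼ matrix *ᵥ veronese 3 τ → l₀ τ ≈ 0# ⊎ l₁ τ * l₂ τ ≈ 0# → v ∈ points R-conjugates
            by-factor τ v∼ (inj₁ p) =
              let θ , τ≡ , θ≈ = linear-root τ p
              in here (∼-trans (∼φR′ 0 (root⇒φR 0 τ v∼ (θ , τ≡ , trans θ≈ (sym (frob-0th ρ₀))))) (∼-sym (φ0 R′)))
            by-factor τ {v} v∼ (inj₂ p) = second (xy≈0⇒x≈0⊎y≈0 p)
              where
              second : l₁ τ ≈ 0# ⊎ l₂ τ ≈ 0# → v ∈ points R-conjugates
              second (inj₁ p) = there (here (∼φR′ 1 (root⇒φR 1 τ v∼ (linear-root τ p))))
              second (inj₂ p) = there (there (here (∼φR′ 2 (root⇒φR 2 τ v∼ (linear-root τ p)))))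

        -- The outer components of R are nonzero multiples of γ(ρ₀), so γ(ρ₀) would be proportional
        -- both to w and to its conjugate φ 2 w. Then γ(ρ₂) and γ(ρ₀) would coincide, contrary to ρ₂
        -- ≠ ρ₀.
        R∉conjugate-span : ∀ w a b c → ¬ (R ≋ join (a ⊙ w) (b ⊙ φ 1 w) (c ⊙ φ 2 w))
        R∉conjugate-span w a b c eq =
          let p , _ , r = join-injective (A ⊙ γ τ₀) (0# ⊙ γ τ₀) (C ⊙ γ τ₀) (a ⊙ w) (b ⊙ φ 1 w) (c ⊙ φ 2 w) (≋-trans (≋-sym R-tensor) eq)
              γ∼w = ∼-from A≉0 p
              γ∼φ2w = ∼-from C≉0 r
          in ρ₂≉ρ₀ (veronese-injective (∼-trans (≋⇒∼ (veronese-φ 2 2 ρ₀)) (∼-trans (∼-φ 2 γ∼w) (∼-sym γ∼φ2w))))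
          where
          A C : Carrier
          A = k₁ * k₂ * l₂ τ₀
          C = k₀ * k₁ * l₁ τ₀
          A≉0 : ¬ (A ≈ 0#)
          A≉0 = xy≉0 (xy≉0 k₁≉0 k₂≉0) (λ e → ρ₂≉ρ₀ (sym (x-y≈0⇒x≈y e)))
          C≉0 : ¬ (C ≈ 0#)
          C≉0 = xy≉0 (xy≉0 k₀≉0 k₁≉0) (λ e → ρ₀≉ρ₁ (x-y≈0⇒x≈y e))
          ∼-from : ∀ {s t w} → ¬ (s ≈ 0#) → s ⊙ γ τ₀ ≋ t ⊙ w → γ τ₀ ∼ w
          ∼-from {s} {t} {w} s≉0 eq = ∼-trans (∼-sym (⊙-∼ s≉0)) (t , t≉0 , eq)
            where
            t≉0 : ¬ (t ≈ 0#)
            t≉0 t≈0 = let i , γᵢ≉0 = γ-entry τ₀ in xy≉0 s≉0 γᵢ≉0 (trans (eq i) (trans (*-congʳ t≈0) (zeroˡ _)))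

  -- Frames for the conic, the conjugation and the line at infinity

  module Coordinates where

    open import Data.Vec.Functional using ([]; _∷_)
    open Subfields
    open LinearAlgebra
    open Projective
    open ConicFrames
    open QuadraticForms
    open ConjugateSum

    record ParametrisedBy (k : ℕ) (N : Matrix 3 3) (C : PointSet 2) : Set (c ⊔ ℓ) where
      field
        parameter : ∀ {x} → x ∈ C → ∃ λ τ → Parameter k τ × x ∼ N *ᵥ veronese 2 τ
        point     : ∀ τ {x} → Parameter k τ → x ∼ N *ᵥ veronese 2 τ → x ∈ C

    eval-∼ : ∀ {n} (A : Matrix n n) {x y} → x ∼ y → eval A y ≈ 0# → eval A x ≈ 0#
    eval-∼ A {x} {y} (a , _ , x≋ay) Ey≈0 = trans (eval-cong A x≋ay) (trans (eval-⊙ A a y) (trans (*-congˡ Ey≈0) (zeroʳ (a * a))))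

    standardForm⇒parametrised : ∀ k A N → N Over k → Nonsingular N → StandardForm A N → ParametrisedBy k N (Quadric k A)
    standardForm⇒parametrised k A N N-over N-nonsingular (d , d≉0 , form) = record
      { parameter = λ {x} (x∈PG , Ex≈0) →
          let y , Ny≋x = nonsingular⇒surjective N N-nonsingular x
              y∈PG = PG-preimage k {M = N} {x = y} N-over N-nonsingular (PG-resp k {y = x} (≋⇒∼ Ny≋x) x∈PG)
              y-on-conic = x-y≈0⇒x≈y (xy≈0⇒y≈0 d≉0 (trans (sym (form y)) (trans (eval-cong A Ny≋x) Ex≈0)))
              τ , τ∈F , y∼ = conic⇒veronese k {y} y∈PG y-on-conic
          in τ , τ∈F , ∼-trans (≋⇒∼ (≋-sym Ny≋x)) (∼-*ᵥ N {y} y∼)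
      ; point = λ τ τ∈F x∼ →
          PG-resp k x∼ (PG-*ᵥ k {M = N} N-over N-nonsingular (rational⇒PG k (veronese-≉𝟎 2 τ) (veronese-rational k 2 τ τ∈F))) ,
          eval-∼ A x∼ (trans (form (veronese 2 τ)) (trans (*-congˡ (x≈y⇒x-y≈0 (veronese-on-conic τ))) (zeroʳ d))) }

    parametrised-≐ : ∀ {k N C D} → C ≐ D → ParametrisedBy k N D → ParametrisedBy k N C
    parametrised-≐ (C⊆D , D⊆C) p = record { parameter = λ x∈C → parameter (C⊆D x∈C) ; point = λ τ τ∈F x∼ → D⊆C (point τ τ∈F x∼) }
      where open ParametrisedBy p

    record Frame (π C : PointSet 2) : Set (c ⊔ ℓ) where
      field
        N             : Matrix 3 3
        over          : N Over 3
        nonsingular   : Nonsingular N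
        rational∈π    : ∀ y → Rational 1 y → ¬ (y ≋ 𝟎) → N *ᵥ y ∈ π
        parametrised  : ParametrisedBy 1 N C

    -- The homography M takes PG(2,q) to the subplane, and P normalises the form inside PG(2,q); the
    -- frame is their product.
    conicOf⇒frame : ∀ {π C} → IsConicOf π C → Frame π C
    conicOf⇒frame {π} {C} (M , A , M-over , M-nonsingular , (_ , ⊆π) , A-over , A-nondegenerate , C⊆ , ⊆C) = record
      { N = N
      ; over = λ i j → *ᵥ-rational 3 {M = M} M-over (*ᵥ-rational 3 {M = P} (λ i j → F₁⊆F 3 (P-over i j)) (δ-rational 3 j)) i
      ; nonsingular = λ y Ny≋0 → P-nonsingular y (M-nonsingular (P *ᵥ y) (≋-trans (≋-sym (N≋ y)) Ny≋0))
      ; rational∈π = λ y y∈F y≉0 → ⊆π (P *ᵥ y , rational⇒PG 1 (nonsingular-≉𝟎 {M = P} P-nonsingular y≉0) (*ᵥ-rational 1 {M = P} P-over y∈F) , ≋⇒∼ (N≋ y))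
      ; parametrised = record
        { parameter = λ x∈C →
            let y , y∈ , x∼My = C⊆ x∈C
                τ , τ∈F , y∼ = parameter y∈
            in τ , τ∈F , ∼-trans x∼My (∼-trans (∼-*ᵥ M y∼) (≋⇒∼ (≋-sym (N≋ (veronese 2 τ)))))
        ; point = λ τ τ∈F x∼ → ⊆C (P *ᵥ veronese 2 τ , point τ τ∈F ∼-refl , ∼-trans x∼ (≋⇒∼ (N≋ (veronese 2 τ)))) } }
      where
      frame = standard-frame A A-over A-nondegenerate
      P : Matrix 3 3
      P = proj₁ frame
      P-over : P Over 1
      P-over = proj₁ (proj₂ frame)
      P-nonsingular : Nonsingular P
      P-nonsingular = proj₁ (proj₂ (proj₂ frame))
      open ParametrisedBy (standardForm⇒parametrised 1 A P P-over P-nonsingular (proj₂ (proj₂ (proj₂ frame))))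
      N : Matrix 3 3
      N = matrixOf (λ y → M *ᵥ (P *ᵥ y))
      N≋ : ∀ y → N *ᵥ y ≋ M *ᵥ (P *ᵥ y)
      N≋ = matrixOf-*ᵥ (linear-∘ (*ᵥ-linear M) (*ᵥ-linear P))

    -- The form of the larger conic vanishes at all points of C, in particular at those with finite
    -- parameter in F_q, and is thereby brought to standard form by the same frame.
    conic-extends : ∀ k {π C C⁺} (frame : Frame π C) → let open Frame frame in N Over k → IsConic k C⁺ → C ⊆ C⁺ → ParametrisedBy k N C⁺
    conic-extends k frame N-over (A , _ , A-nondegenerate , C⁺≐) C⊆C⁺ =
      parametrised-≐ C⁺≐ (standardForm⇒parametrised k A N N-over nonsingular
        (standard-form-extends A N A-nondegenerate nonsingular λ θ θ∈F →
          proj₂ (proj₁ C⁺≐ (C⊆C⁺ (ParametrisedBy.point parametrised (just θ) θ∈F ∼-refl)))))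
      where open Frame frame

    -- A semilinear map fixing the points given by the three columns of N and by their sum scales
    -- all four vectors by the same factor, because the columns are independent. By semilinearity it
    -- is then Frobenius in the frame, up to this factor.
    conjugation-frame : ∀ B N → Nonsingular N → (∀ y → Rational 1 y → ¬ (y ≋ 𝟎) → B *ᵥ φ 1 (N *ᵥ y) ∼ N *ᵥ y) →
                        ∀ y → B *ᵥ φ 1 (N *ᵥ y) ∼ N *ᵥ φ 1 y
    conjugation-frame B N N-nonsingular fixes y = s , proj₁ (proj₂ fix-𝟏) , λ i → begin
      f (N *ᵥ y) i
        ≈⟨ f-cong (λ i → sum-columns y i) i ⟩
      f (combination y (n 0F) (n 1F) (n 2F)) i
        ≈⟨ f-combination y i ⟩
      frob 1 (y 0F) * f (n 0F) i + frob 1 (y 1F) * f (n 1F) i + frob 1 (y 2F) * f (n 2F) i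
        ≈⟨ +-cong (+-cong (*-congˡ (f-n 0F i)) (*-congˡ (f-n 1F i))) (*-congˡ (f-n 2F i)) ⟩
      frob 1 (y 0F) * (s * n 0F i) + frob 1 (y 1F) * (s * n 1F i) + frob 1 (y 2F) * (s * n 2F i)
        ≈⟨ solve 7 (λ s a b c x y z → a :* (s :* x) :+ b :* (s :* y) :+ c :* (s :* z) := s :* (a :* x :+ b :* y :+ c :* z)) refl s _ _ _ _ _ _ ⟩
      s * combination (φ 1 y) (n 0F) (n 1F) (n 2F) i
        ≈⟨ *-congˡ (sum-columns (φ 1 y) i) ⟨
      s * (N *ᵥ φ 1 y) i ∎
      where
      n : Fin 3 → Vector Carrier 3
      n j i = N i j
      f : Vector Carrier 3 → Vector Carrier 3
      f x = B *ᵥ φ 1 x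
      f-cong : ∀ {x x′} → x ≋ x′ → f x ≋ f x′
      f-cong eq = Linear.cong (*ᵥ-linear B) (φ-cong 1 eq)
      sum-columns : ∀ y → N *ᵥ y ≋ combination y (n 0F) (n 1F) (n 2F)
      sum-columns = *ᵥ-columns N
      φ-combination : ∀ y → φ 1 (combination y (n 0F) (n 1F) (n 2F)) ≋ combination (φ 1 y) (φ 1 (n 0F)) (φ 1 (n 1F)) (φ 1 (n 2F))
      φ-combination y i = trans (frob-+ 1 (y 0F * n 0F i + y 1F * n 1F i) (y 2F * n 2F i))
        (+-cong (trans (frob-+ 1 (y 0F * n 0F i) (y 1F * n 1F i)) (+-cong (frob-* 1 _ _) (frob-* 1 _ _))) (frob-* 1 _ _))
      f-combination : ∀ y → f (combination y (n 0F) (n 1F) (n 2F)) ≋ combination (φ 1 y) (f (n 0F)) (f (n 1F)) (f (n 2F))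
      f-combination y = ≋-trans (Linear.cong (*ᵥ-linear B) (φ-combination y))
        (combination-linear (*ᵥ-linear B) (φ 1 y) (φ 1 (n 0F)) (φ 1 (n 1F)) (φ 1 (n 2F)))
      N-δ : ∀ j → N *ᵥ δ j ≋ n j
      N-δ j i = trans (sum-columns (δ j) i) (column j)
        where
        column : ∀ j → combination (δ j) (n 0F) (n 1F) (n 2F) i ≈ n j i
        column 0F = solve 3 (λ x y z → con (ℤ.+ 1) :* x :+ con (ℤ.+ 0) :* y :+ con (ℤ.+ 0) :* z := x) refl _ _ _
        column 1F = solve 3 (λ x y z → con (ℤ.+ 0) :* x :+ con (ℤ.+ 1) :* y :+ con (ℤ.+ 0) :* z := y) refl _ _ _
        column 2F = solve 3 (λ x y z → con (ℤ.+ 0) :* x :+ con (ℤ.+ 0) :* y :+ con (ℤ.+ 1) :* z := z) refl _ _ _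
      𝟏 : Vector Carrier 3
      𝟏 _ = 1#
      fix-𝟏 = fixes 𝟏 (λ _ → F-1 1) (λ eq → 1≉0 (eq 0F))
      s : Carrier
      s = proj₁ fix-𝟏
      fix-n : ∀ j → f (n j) ∼ n j
      fix-n j = ∼-trans (≋⇒∼ (f-cong (≋-sym (N-δ j)))) (∼-trans (fixes (δ j) (δ-rational 1 j) (δ-≉𝟎 j)) (≋⇒∼ (N-δ j)))
      t : Vector Carrier 3
      t j = proj₁ (fix-n j)
      t≋s : t ≋ s ⊙ 𝟏
      t≋s = nonsingular-injective {M = N} N-nonsingular λ i → begin
        (N *ᵥ t) i
          ≈⟨ sum-columns t i ⟩
        t 0F * n 0F i + t 1F * n 1F i + t 2F * n 2F i
          ≈⟨ +-cong (+-cong (fn 0F i) (fn 1F i)) (fn 2F i) ⟨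
        f (n 0F) i + f (n 1F) i + f (n 2F) i
          ≈⟨ +-cong (+-cong (frob1* _) (frob1* _)) (frob1* _) ⟨
        frob 1 1# * f (n 0F) i + frob 1 1# * f (n 1F) i + frob 1 1# * f (n 2F) i
          ≈⟨ f-combination 𝟏 i ⟨
        f (combination 𝟏 (n 0F) (n 1F) (n 2F)) i
          ≈⟨ f-cong (sum-columns 𝟏) i ⟨
        f (N *ᵥ 𝟏) i
          ≈⟨ proj₂ (proj₂ fix-𝟏) i ⟩
        s * (N *ᵥ 𝟏) i
          ≈⟨ Linear.homo-⊙ (*ᵥ-linear N) s 𝟏 i ⟨
        (N *ᵥ (s ⊙ 𝟏)) i ∎
        where
        fn : ∀ j → f (n j) ≋ t j ⊙ n j
        fn j = proj₂ (proj₂ (fix-n j))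
        frob1* : ∀ a → frob 1 1# * a ≈ a
        frob1* a = trans (*-congʳ (frob-1 1)) (*-identityˡ a)
      f-n : ∀ j → f (n j) ≋ s ⊙ n j
      f-n j i = trans (proj₂ (proj₂ (fix-n j)) i) (*-congʳ (trans (t≋s j) (*-identityʳ s)))

    collineation-∼ : ∀ B {x y} j → x ∼ y → collineation B j x ∼ collineation B j y
    collineation-∼ B zero    x∼y = x∼y
    collineation-∼ B (suc j) x∼y = ∼-*ᵥ B (∼-φ 1 (collineation-∼ B j x∼y))

    collineation-frame : ∀ B (N : Matrix 3 3) → (∀ y → B *ᵥ φ 1 (N *ᵥ y) ∼ N *ᵥ φ 1 y) → ∀ j y → collineation B j (N *ᵥ y) ∼ N *ᵥ φ j y
    collineation-frame B N frame zero    y = ≋⇒∼ (Linear.cong (*ᵥ-linear N) (λ i → sym (frob-0th (y i))))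
    collineation-frame B N frame (suc j) y = ∼-trans (∼-*ᵥ B (∼-φ 1 (collineation-frame B N frame j y)))
      (∼-trans (frame (φ j y)) (≋⇒∼ (Linear.cong (*ᵥ-linear N) (λ i → trans (frob-∘ 1 j (y i)) (reflexive (≡.cong (λ k → frob k (y i)) (ℕ.+-comm j 1)))))))

    -- The line {N y : u · y = 0}; u is the vector product of two coordinate vectors.
    record LineEquation (ℓ∞ : PointSet 2) (N : Matrix 3 3) : Set (c ⊔ ℓ) where
      field
        u          : Vector Carrier 3
        u-rational : Rational 3 u
        b₀ b₁      : Vector Carrier 3
        b₀-rational : Rational 3 b₀
        b₁-rational : Rational 3 b₁
        ub₀≈0      : dot u b₀ ≈ 0#
        ub₁≈0      : dot u b₁ ≈ 0#
        b-independent : ∀ s t → s ⊙ b₀ ⊕ t ⊙ b₁ ≋ 𝟎 → s ≈ 0# × t ≈ 0#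
        b-spans    : ∀ y → dot u y ≈ 0# → ∃ λ s → ∃ λ t → y ≋ s ⊙ b₀ ⊕ t ⊙ b₁
        ∈line      : ∀ y → N *ᵥ y ∈ PG 2 3 → dot u y ≈ 0# → N *ᵥ y ∈ ℓ∞
        line⊆PG    : ∀ {x} → x ∈ ℓ∞ → x ∈ PG 2 3
        line-resp  : ∀ {x x′} → x ∼ x′ → x′ ∈ ℓ∞ → x ∈ ℓ∞
        line-equation : ∀ y → N *ᵥ y ∈ ℓ∞ → dot u y ≈ 0#

      line-equation-∼ : ∀ {x} y → x ∼ N *ᵥ y → x ∈ ℓ∞ → dot u y ≈ 0#
      line-equation-∼ y x∼Ny x∈ℓ∞ = line-equation y (line-resp (∼-sym x∼Ny) x∈ℓ∞)

    lineEquation : ∀ {ℓ∞ N} → IsSubspace 3 1 ℓ∞ → N Over 3 → Nonsingular N → LineEquation ℓ∞ N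
    lineEquation {ℓ∞} {N} (L , L-over , L-nonsingular , ⊆image , image⊆) N-over N-nonsingular = record
      { u = u ; u-rational = u-rational ; b₀ = b 0F ; b₁ = b 1F ; b₀-rational = b-rational 0F ; b₁-rational = b-rational 1F
      ; ub₀≈0 = solve 6 (λ a₀ a₁ a₂ b₀ b₁ b₂ → (a₁ :* b₂ :- a₂ :* b₁) :* a₀ :+ (a₂ :* b₀ :- a₀ :* b₂) :* a₁ :+ (a₀ :* b₁ :- a₁ :* b₀) :* a₂ := con (ℤ.+ 0)) refl _ _ _ _ _ _
      ; ub₁≈0 = solve 6 (λ a₀ a₁ a₂ b₀ b₁ b₂ → (a₁ :* b₂ :- a₂ :* b₁) :* b₀ :+ (a₂ :* b₀ :- a₀ :* b₂) :* b₁ :+ (a₀ :* b₁ :- a₁ :* b₀) :* b₂ := con (ℤ.+ 0)) refl _ _ _ _ _ _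
      ; b-independent = independent
      ; b-spans = spans
      ; ∈line = λ y Ny∈PG uy≈0 →
          let s , t , y≋ = spans y uy≈0
              Ny≋ = ≋-trans (Linear.cong (*ᵥ-linear N) y≋) (≋-sym (L≋ s t))
          in image⊆ (s ∷ t ∷ [] , PG-preimage 3 {M = L} L-over L-nonsingular (PG-resp 3 (≋⇒∼ (≋-sym Ny≋)) Ny∈PG) , ≋⇒∼ Ny≋)
      ; line⊆PG = λ x∈ → let p , p∈PG , x∼Lp = ⊆image x∈ in PG-resp 3 x∼Lp (PG-*ᵥ 3 {M = L} L-over L-nonsingular p∈PG)
      ; line-resp = λ x∼x′ x′∈ → let p , p∈PG , x′∼Lp = ⊆image x′∈ in image⊆ (p , p∈PG , ∼-trans x∼x′ x′∼Lp)
      ; line-equation = λ y Ny∈ →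
          let p , _ , a , _ , Ny≋aLp = ⊆image Ny∈
              y≋ = nonsingular-injective {M = N} N-nonsingular {y} {a ⊙ (p 0F ⊙ b 0F ⊕ p 1F ⊙ b 1F)} (≋-trans Ny≋aLp (≋-trans (⊙-congʳ a (≋-trans (Linear.cong (*ᵥ-linear L) (η p)) (L≋ (p 0F) (p 1F))))
                     (≋-sym (Linear.homo-⊙ (*ᵥ-linear N) a (p 0F ⊙ b 0F ⊕ p 1F ⊙ b 1F)))))
          in trans (dot-congʳ u {y} {a ⊙ (p 0F ⊙ b 0F ⊕ p 1F ⊙ b 1F)} y≋) (solve 9 (λ a s t a₀ a₁ a₂ b₀ b₁ b₂ →
               (a₁ :* b₂ :- a₂ :* b₁) :* (a :* (s :* a₀ :+ t :* b₀)) :+ (a₂ :* b₀ :- a₀ :* b₂) :* (a :* (s :* a₁ :+ t :* b₁))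
                 :+ (a₀ :* b₁ :- a₁ :* b₀) :* (a :* (s :* a₂ :+ t :* b₂)) := con (ℤ.+ 0)) refl a (p 0F) (p 1F) _ _ _ _ _ _) }
      where
      preimage : ∀ j → ∃ λ y → N *ᵥ y ≋ L *ᵥ δ j
      preimage j = nonsingular⇒surjective N N-nonsingular (L *ᵥ δ j)
      b : Fin 2 → Vector Carrier 3
      b j = proj₁ (preimage j)
      b-rational : ∀ j → Rational 3 (b j)
      b-rational j = rational-preimage 3 {M = N} N-over N-nonsingular
        (λ i → F-cong 3 (sym (proj₂ (preimage j) i)) (*ᵥ-rational 3 {M = L} L-over (δ-rational 3 j) i))
      η : ∀ (p : Vector Carrier 2) → p ≋ (p 0F ∷ p 1F ∷ [])
      η p = λ { 0F → refl ; 1F → refl }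
      L≋ : ∀ s t → L *ᵥ (s ∷ t ∷ []) ≋ N *ᵥ (s ⊙ b 0F ⊕ t ⊙ b 1F)
      L≋ s t i = begin
        (L *ᵥ (s ∷ t ∷ [])) i
          ≈⟨ Linear.cong (*ᵥ-linear L) δ-coordinates i ⟩
        (L *ᵥ (s ⊙ δ 0F ⊕ t ⊙ δ 1F)) i
          ≈⟨ pair (*ᵥ-linear L) (δ 0F) (δ 1F) i ⟩
        s * (L *ᵥ δ 0F) i + t * (L *ᵥ δ 1F) i
          ≈⟨ +-cong (*-congˡ (proj₂ (preimage 0F) i)) (*-congˡ (proj₂ (preimage 1F) i)) ⟨
        s * (N *ᵥ b 0F) i + t * (N *ᵥ b 1F) i
          ≈⟨ pair (*ᵥ-linear N) (b 0F) (b 1F) i ⟨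
        (N *ᵥ (s ⊙ b 0F ⊕ t ⊙ b 1F)) i ∎
        where
        δ-coordinates : (s ∷ t ∷ []) ≋ s ⊙ δ 0F ⊕ t ⊙ δ 1F
        δ-coordinates 0F = solve 2 (λ s t → s := s :* con (ℤ.+ 1) :+ t :* con (ℤ.+ 0)) refl s t
        δ-coordinates 1F = solve 2 (λ s t → t := s :* con (ℤ.+ 0) :+ t :* con (ℤ.+ 1)) refl s t
        pair : ∀ {m n} {f : Vector Carrier m → Vector Carrier n} → Linear f → ∀ x y → f (s ⊙ x ⊕ t ⊙ y) ≋ s ⊙ f x ⊕ t ⊙ f y
        pair f-linear x y i = trans (Linear.homo-⊕ f-linear _ _ i) (+-cong (Linear.homo-⊙ f-linear s x i) (Linear.homo-⊙ f-linear t y i))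
      independent : ∀ s t → s ⊙ b 0F ⊕ t ⊙ b 1F ≋ 𝟎 → s ≈ 0# × t ≈ 0#
      independent s t eq =
        let st≋0 = L-nonsingular (s ∷ t ∷ []) (≋-trans (L≋ s t) (≋-trans (Linear.cong (*ᵥ-linear N) eq) (Linear.homo-𝟎 (*ᵥ-linear N))))
        in st≋0 0F , st≋0 1F
      a₀ a₁ a₂ c₀ c₁ c₂ : Carrier
      a₀ = b 0F 0F
      a₁ = b 0F 1F
      a₂ = b 0F 2F
      c₀ = b 1F 0F
      c₁ = b 1F 1F
      c₂ = b 1F 2F
      u : Vector Carrier 3
      u = (a₁ * c₂ - a₂ * c₁) ∷ (a₂ * c₀ - a₀ * c₂) ∷ (a₀ * c₁ - a₁ * c₀) ∷ []
      u-rational : Rational 3 u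
      u-rational 0F = F-sub 3 (F-* 3 (b-rational 0F 1F) (b-rational 1F 2F)) (F-* 3 (b-rational 0F 2F) (b-rational 1F 1F))
      u-rational 1F = F-sub 3 (F-* 3 (b-rational 0F 2F) (b-rational 1F 0F)) (F-* 3 (b-rational 0F 0F) (b-rational 1F 2F))
      u-rational 2F = F-sub 3 (F-* 3 (b-rational 0F 0F) (b-rational 1F 1F)) (F-* 3 (b-rational 0F 1F) (b-rational 1F 0F))
      -- The determinants of (y, b₁, z) and of (b₀, y, z); since u is the vector product of b₀ and
      -- b₁, the determinant of (b₀, b₁, z) is `dot u z`.
      ⟦_,_⟧₀ ⟦_,_⟧₁ : Vector Carrier 3 → Vector Carrier 3 → Carrier
      ⟦ y , z ⟧₀ = y 0F * (c₁ * z 2F - c₂ * z 1F) + y 1F * (c₂ * z 0F - c₀ * z 2F) + y 2F * (c₀ * z 1F - c₁ * z 0F)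
      ⟦ y , z ⟧₁ = a₀ * (y 1F * z 2F - y 2F * z 1F) + a₁ * (y 2F * z 0F - y 0F * z 2F) + a₂ * (y 0F * z 1F - y 1F * z 0F)
      cramer : ∀ y z → dot u z ⊙ y ≋ ⟦ y , z ⟧₀ ⊙ b 0F ⊕ ⟦ y , z ⟧₁ ⊙ b 1F ⊕ dot u y ⊙ z
      cramer y z 0F = solve 12 (λ a₀ a₁ a₂ c₀ c₁ c₂ y₀ y₁ y₂ z₀ z₁ z₂ →
        ((a₁ :* c₂ :- a₂ :* c₁) :* z₀ :+ (a₂ :* c₀ :- a₀ :* c₂) :* z₁ :+ (a₀ :* c₁ :- a₁ :* c₀) :* z₂) :* y₀ :=
        (y₀ :* (c₁ :* z₂ :- c₂ :* z₁) :+ y₁ :* (c₂ :* z₀ :- c₀ :* z₂) :+ y₂ :* (c₀ :* z₁ :- c₁ :* z₀)) :* a₀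
        :+ (a₀ :* (y₁ :* z₂ :- y₂ :* z₁) :+ a₁ :* (y₂ :* z₀ :- y₀ :* z₂) :+ a₂ :* (y₀ :* z₁ :- y₁ :* z₀)) :* c₀
        :+ ((a₁ :* c₂ :- a₂ :* c₁) :* y₀ :+ (a₂ :* c₀ :- a₀ :* c₂) :* y₁ :+ (a₀ :* c₁ :- a₁ :* c₀) :* y₂) :* z₀)
        refl a₀ a₁ a₂ c₀ c₁ c₂ (y 0F) (y 1F) (y 2F) (z 0F) (z 1F) (z 2F)
      cramer y z 1F = solve 12 (λ a₀ a₁ a₂ c₀ c₁ c₂ y₀ y₁ y₂ z₀ z₁ z₂ →
        ((a₁ :* c₂ :- a₂ :* c₁) :* z₀ :+ (a₂ :* c₀ :- a₀ :* c₂) :* z₁ :+ (a₀ :* c₁ :- a₁ :* c₀) :* z₂) :* y₁ :=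
        (y₀ :* (c₁ :* z₂ :- c₂ :* z₁) :+ y₁ :* (c₂ :* z₀ :- c₀ :* z₂) :+ y₂ :* (c₀ :* z₁ :- c₁ :* z₀)) :* a₁
        :+ (a₀ :* (y₁ :* z₂ :- y₂ :* z₁) :+ a₁ :* (y₂ :* z₀ :- y₀ :* z₂) :+ a₂ :* (y₀ :* z₁ :- y₁ :* z₀)) :* c₁
        :+ ((a₁ :* c₂ :- a₂ :* c₁) :* y₀ :+ (a₂ :* c₀ :- a₀ :* c₂) :* y₁ :+ (a₀ :* c₁ :- a₁ :* c₀) :* y₂) :* z₁)
        refl a₀ a₁ a₂ c₀ c₁ c₂ (y 0F) (y 1F) (y 2F) (z 0F) (z 1F) (z 2F)
      cramer y z 2F = solve 12 (λ a₀ a₁ a₂ c₀ c₁ c₂ y₀ y₁ y₂ z₀ z₁ z₂ →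
        ((a₁ :* c₂ :- a₂ :* c₁) :* z₀ :+ (a₂ :* c₀ :- a₀ :* c₂) :* z₁ :+ (a₀ :* c₁ :- a₁ :* c₀) :* z₂) :* y₂ :=
        (y₀ :* (c₁ :* z₂ :- c₂ :* z₁) :+ y₁ :* (c₂ :* z₀ :- c₀ :* z₂) :+ y₂ :* (c₀ :* z₁ :- c₁ :* z₀)) :* a₂
        :+ (a₀ :* (y₁ :* z₂ :- y₂ :* z₁) :+ a₁ :* (y₂ :* z₀ :- y₀ :* z₂) :+ a₂ :* (y₀ :* z₁ :- y₁ :* z₀)) :* c₂
        :+ ((a₁ :* c₂ :- a₂ :* c₁) :* y₀ :+ (a₂ :* c₀ :- a₀ :* c₂) :* y₁ :+ (a₀ :* c₁ :- a₁ :* c₀) :* y₂) :* z₂)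
        refl a₀ a₁ a₂ c₀ c₁ c₂ (y 0F) (y 1F) (y 2F) (z 0F) (z 1F) (z 2F)
      -- With u = 0 Cramer's identity becomes a relation between b₀ and b₁, so the determinant of
      -- (b₀, y, z) vanishes for all y and z. Taking unit vectors for these gives b₀ = 0.
      u≉0 : ¬ (u ≋ 𝟎)
      u≉0 u≋0 = δ-≉𝟎 {2} 0F (L-nonsingular (δ 0F) (≋-trans (≋-sym (proj₂ (preimage 0F))) (≋-trans (Linear.cong (*ᵥ-linear N) b₀≋0) (Linear.homo-𝟎 (*ᵥ-linear N)))))
        where
        u· : ∀ y → dot u y ≈ 0#
        u· y = trans (dot-cong {x = y} u≋0 ≋-refl) (solve 3 (λ a b c → con (ℤ.+ 0) :* a :+ con (ℤ.+ 0) :* b :+ con (ℤ.+ 0) :* c := con (ℤ.+ 0)) refl _ _ _)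
        minor : ∀ y z → ⟦ y , z ⟧₁ ≈ 0#
        minor y z = proj₂ (independent ⟦ y , z ⟧₀ ⟦ y , z ⟧₁ (λ i → begin
          ⟦ y , z ⟧₀ * b 0F i + ⟦ y , z ⟧₁ * b 1F i
            ≈⟨ +-identityʳ _ ⟨
          ⟦ y , z ⟧₀ * b 0F i + ⟦ y , z ⟧₁ * b 1F i + 0#
            ≈⟨ +-congˡ (trans (*-congʳ (u· y)) (zeroˡ (z i))) ⟨
          ⟦ y , z ⟧₀ * b 0F i + ⟦ y , z ⟧₁ * b 1F i + dot u y * z i
            ≈⟨ cramer y z i ⟨
          dot u z * y i
            ≈⟨ trans (*-congʳ (u· z)) (zeroˡ (y i)) ⟩
          0# ∎))
        b₀≋0 : b 0F ≋ 𝟎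
        b₀≋0 0F = trans (solve 3 (λ a b c → let o = con (ℤ.+ 1) ; n = con (ℤ.+ 0) in
          a := a :* (o :* o :- n :* n) :+ b :* (n :* n :- n :* o) :+ c :* (n :* n :- o :* n)) refl a₀ a₁ a₂) (minor (δ 1F) (δ 2F))
        b₀≋0 1F = trans (solve 3 (λ a b c → let o = con (ℤ.+ 1) ; n = con (ℤ.+ 0) in
          b := a :* (n :* n :- o :* n) :+ b :* (o :* o :- n :* n) :+ c :* (n :* n :- n :* o)) refl a₀ a₁ a₂) (minor (δ 2F) (δ 0F))
        b₀≋0 2F = trans (solve 3 (λ a b c → let o = con (ℤ.+ 1) ; n = con (ℤ.+ 0) in
          c := a :* (n :* n :- n :* o) :+ b :* (n :* n :- o :* n) :+ c :* (o :* o :- n :* n)) refl a₀ a₁ a₂) (minor (δ 0F) (δ 1F))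
      -- Cramer's identity with z the unit vector at a nonzero entry of u, divided by that entry.
      spans : ∀ y → dot u y ≈ 0# → ∃ λ s → ∃ λ t → y ≋ s ⊙ b 0F ⊕ t ⊙ b 1F
      spans y uy≈0 =
        let j , uⱼ≉0 = nonzero-entry u≉0
            r , uⱼr≈1 = inverse (u j) uⱼ≉0
            u·δ = dot-δ j
        in r * ⟦ y , δ j ⟧₀ , r * ⟦ y , δ j ⟧₁ , λ i → begin
          y i
            ≈⟨ *-identityˡ (y i) ⟨
          1# * y i
            ≈⟨ *-congʳ (trans (*-comm r (u j)) uⱼr≈1) ⟨
          (r * u j) * y i
            ≈⟨ trans (*-assoc r (u j) (y i)) (*-congˡ (*-congʳ (sym u·δ))) ⟩
          r * (dot u (δ j) * y i)
            ≈⟨ *-congˡ (trans (cramer y (δ j) i) (+-congˡ (trans (*-congʳ uy≈0) (zeroˡ (δ j i))))) ⟩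
          r * (⟦ y , δ j ⟧₀ * b 0F i + ⟦ y , δ j ⟧₁ * b 1F i + 0#)
            ≈⟨ solve 5 (λ r p q x y → r :* (p :* x :+ q :* y :+ con (ℤ.+ 0)) := r :* p :* x :+ r :* q :* y) refl r _ _ _ _ ⟩
          r * ⟦ y , δ j ⟧₀ * b 0F i + r * ⟦ y , δ j ⟧₁ * b 1F i ∎
        where
        dot-δ : ∀ j → dot u (δ j) ≈ u j
        dot-δ 0F = solve 3 (λ a b c → a :* con (ℤ.+ 1) :+ b :* con (ℤ.+ 0) :+ c :* con (ℤ.+ 0) := a) refl (u 0F) (u 1F) (u 2F)
        dot-δ 1F = solve 3 (λ a b c → a :* con (ℤ.+ 0) :+ b :* con (ℤ.+ 1) :+ c :* con (ℤ.+ 0) := b) refl (u 0F) (u 1F) (u 2F)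
        dot-δ 2F = solve 3 (λ a b c → a :* con (ℤ.+ 0) :+ b :* con (ℤ.+ 0) :+ c :* con (ℤ.+ 1) := c) refl (u 0F) (u 1F) (u 2F)

  -- Σ∞ and Σ₆ in the coordinates of the conjugate decomposition

  module Ambient where

    open import Data.Vec.Functional using ([]; _∷_)
    open Subfields
    open LinearAlgebra
    open Projective
    open ConicFrames
    open QuadraticForms
    open ConjugateSum
    open Sections
    open Coordinates

    prependColumn : ∀ {m n} → Vector Carrier n → (Fin m → Vector Carrier n) → Matrix n (suc m)
    prependColumn w k i zero    = w i
    prependColumn w k i (suc j) = k j i

    *ᵥ-prependColumn : ∀ {l m n} (M : Matrix l n) {f : Vector Carrier m → Vector Carrier l} → Linear f →
      (w : Vector Carrier n) (k : Fin m → Vector Carrier n) → (∀ j → f (δ j) ≋ M *ᵥ k j) →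
      ∀ x → M *ᵥ (prependColumn w k *ᵥ x) ≋ x zero ⊙ (M *ᵥ w) ⊕ f (tail x)
    *ᵥ-prependColumn {m = m} M {f} f-linear w k f-δ x i = begin
      (M *ᵥ (prependColumn w k *ᵥ x)) i
        ≈⟨ M.cong (λ i → +-cong (*-comm (w i) (x zero)) (sum-cong-≋ (λ j → *-comm (k j i) (x (suc j))))) i ⟩
      (M *ᵥ (x zero ⊙ w ⊕ kx)) i
        ≈⟨ M.homo-⊕ (x zero ⊙ w) kx i ⟩
      (M *ᵥ (x zero ⊙ w)) i + (M *ᵥ kx) i
        ≈⟨ +-cong (M.homo-⊙ (x zero) w i) (M.homo-sum (tail x) k i) ⟩
      x zero * (M *ᵥ w) i + sum (λ j → x (suc j) * (M *ᵥ k j) i)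
        ≈⟨ +-congˡ (sum-cong-≋ (λ j → *-congˡ {x = x (suc j)} (f-δ j i))) ⟨
      x zero * (M *ᵥ w) i + sum (λ j → x (suc j) * f (δ j) i)
        ≈⟨ +-congˡ (f.homo-sum (tail x) δ i) ⟨
      x zero * (M *ᵥ w) i + f (λ i → sum (λ j → x (suc j) * δ j i)) i
        ≈⟨ +-congˡ (f.cong (sum-δ (tail x)) i) ⟩
      x zero * (M *ᵥ w) i + f (tail x) i ∎
      where
      module M = Linear (*ᵥ-linear M)
      module f = Linear f-linear
      kx : Vector Carrier _
      kx i = sum (λ j → x (suc j) * k j i)

    frob-≈0 : ∀ k {a} → frob k a ≈ 0# → a ≈ 0#
    frob-≈0 k {a} eq = decidable-stable (a ≟ 0#) (λ a≉0 → frob-≉0 k a≉0 eq)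

    record Model : Set (Level.suc (c ⊔ ℓ)) where
      field
        N             : Matrix 3 3
        N-over        : N Over 3
        N-nonsingular : Nonsingular N
        ℓ∞            : PointSet 2
        rational∉ℓ∞   : ∀ y → Rational 1 y → ¬ (y ≋ 𝟎) → ¬ (N *ᵥ y ∈ ℓ∞)
        G             : Matrix 9 3
        G-Bose        : Bose.IsBose G

    module Representation (model : Model) where

      open Model model
      open Bose G
      open AtInfinity ℓ∞
      module IsBose-G = IsBose G-Bose

      -- The frame is absorbed into G, so that Γ has coordinates adapted to the conic.
      H : Matrix 9 3
      H = matrixOf (λ y → G *ᵥ (N *ᵥ y))

      H≋ : ∀ y → H *ᵥ y ≋ G *ᵥ (N *ᵥ y)
      H≋ = matrixOf-*ᵥ (linear-∘ (*ᵥ-linear G) (*ᵥ-linear N))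

      H-over : H Over 3
      H-over i j = *ᵥ-rational 3 {M = G} IsBose-G.over (*ᵥ-rational 3 {M = N} N-over (δ-rational 3 j)) i

      open Join H H-over

      e₀ e₁ e₂ : Vector Carrier 3 → Vector Carrier 9
      e₀ w = join w 𝟎 𝟎
      e₁ w = join 𝟎 w 𝟎
      e₂ w = join 𝟎 𝟎 w

      private
        identity-linear : ∀ {n} → Linear {n} {n} (λ x → x)
        identity-linear = record { cong = λ p → p ; homo-⊕ = λ _ _ → ≋-refl ; homo-⊙ = λ _ _ → ≋-refl }

        zero-linear : ∀ {m n} → Linear {m} {n} (λ _ → 𝟎)
        zero-linear = record { cong = λ _ → ≋-refl ; homo-⊕ = λ _ _ _ → sym (+-identityˡ 0#) ; homo-⊙ = λ a _ _ → sym (zeroʳ a) }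

      e₀-linear : Linear e₀
      e₀-linear = join-linear identity-linear zero-linear zero-linear

      e₁-linear : Linear e₁
      e₁-linear = join-linear zero-linear identity-linear zero-linear

      e₂-linear : Linear e₂
      e₂-linear = join-linear zero-linear zero-linear identity-linear

      φ-e₀ : ∀ w → φ 1 (e₀ w) ≋ e₁ (φ 1 w)
      φ-e₀ w = ≋-trans (φ-join w 𝟎 𝟎) (join-cong (φ-𝟎 1) (≋-refl {x = φ 1 w}) (φ-𝟎 1))

      φ2-e₀ : ∀ w → φ 2 (e₀ w) ≋ e₂ (φ 2 w)
      φ2-e₀ w = ≋-trans (φ2-join w 𝟎 𝟎) (join-cong (φ-𝟎 2) (φ-𝟎 2) (≋-refl {x = φ 2 w}))

      join≋e : ∀ w₀ w₁ w₂ → join w₀ w₁ w₂ ≋ e₀ w₀ ⊕ e₁ w₁ ⊕ e₂ w₂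
      join≋e w₀ w₁ w₂ = ≋-trans (join-cong (λ i → solve 1 (λ x → x := x :+ con (ℤ.+ 0) :+ con (ℤ.+ 0)) refl (w₀ i))
          (λ i → solve 1 (λ x → x := con (ℤ.+ 0) :+ x :+ con (ℤ.+ 0)) refl (w₁ i))
          (λ i → solve 1 (λ x → x := con (ℤ.+ 0) :+ con (ℤ.+ 0) :+ x) refl (w₂ i)))
        (≋-trans (join-⊕ (w₀ ⊕ 𝟎) (𝟎 ⊕ w₁) (𝟎 ⊕ 𝟎) 𝟎 𝟎 w₂) (λ i → +-congʳ (join-⊕ w₀ 𝟎 𝟎 𝟎 w₁ 𝟎 i)))

      ι-N : ∀ y → ι (N *ᵥ y) ≋ e₀ y
      ι-N y = ≋-trans (≋-sym (H≋ y)) (join-first y)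

      ι-∼ : ∀ {x} y → x ∼ N *ᵥ y → ι x ∼ e₀ y
      ι-∼ y x∼ = ∼-trans (∼-*ᵥ G x∼) (≋⇒∼ (ι-N y))

      φι-∼ : ∀ {x} y → x ∼ N *ᵥ y → φ 1 (ι x) ∼ e₁ (φ 1 y)
      φι-∼ y x∼ = ∼-trans (∼-φ 1 (ι-∼ y x∼)) (≋⇒∼ (φ-e₀ y))

      φ2ι-∼ : ∀ {x} y → x ∼ N *ᵥ y → φ 2 (ι x) ∼ e₂ (φ 2 y)
      φ2ι-∼ y x∼ = ∼-trans (∼-φ 2 (ι-∼ y x∼)) (≋⇒∼ (φ2-e₀ y))

      preimage : ∀ x → ∃ λ y → x ≋ N *ᵥ y
      preimage x = let y , Ny≋x = nonsingular⇒surjective N N-nonsingular x in y , ≋-sym Ny≋x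

      InRange : Vector Carrier 9 → Set _
      InRange v = ∃ λ w₀ → ∃ λ w₁ → ∃ λ w₂ → v ≋ join w₀ w₁ w₂

      InRange-subspace : IsLinearSubspace InRange
      InRange-subspace = record
        { resp = λ v≋v′ (w₀ , w₁ , w₂ , eq) → w₀ , w₁ , w₂ , ≋-trans (≋-sym v≋v′) eq
        ; ∋𝟎   = 𝟎 , 𝟎 , 𝟎 , ≋-sym join-𝟎
        ; ∋⊕   = λ (w₀ , w₁ , w₂ , eq) (w₀′ , w₁′ , w₂′ , eq′) →
            w₀ ⊕ w₀′ , w₁ ⊕ w₁′ , w₂ ⊕ w₂′ , ≋-trans (⊕-cong eq eq′) (≋-sym (join-⊕ w₀ w₁ w₂ w₀′ w₁′ w₂′))
        ; ∋⊙   = λ a (w₀ , w₁ , w₂ , eq) → a ⊙ w₀ , a ⊙ w₁ , a ⊙ w₂ , ≋-trans (⊙-congʳ a eq) (≋-sym (join-⊙ a w₀ w₁ w₂)) }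

      -- A point x of S has the form N y up to a scalar. Its image in Γ then has only a first
      -- component y, and the two conjugates have only a second component φ y and a third φ² y.
      conjugates⊆ : ∀ {p} {S : PointSet 2} {T : Vector Carrier 9 → Set p} → IsLinearSubspace T →
                    (∀ {x} y → x ∈ S → x ∼ N *ᵥ y → T (e₀ y) × T (e₁ (φ 1 y)) × T (e₂ (φ 2 y))) →
                    ∀ {v} → v ∈ Span (conjugates (image ι S)) → T v
      conjugates⊆ {S = S} {T} T-subspace S⊆T = Span⊆ {S = conjugates (image ι S)} T-subspace λ
        { (inj₁ (x , x∈S , v∼)) → let y , x≋ = preimage x
                                  in ∼-subspace T-subspace (∼-trans v∼ (ι-∼ y (≋⇒∼ x≋))) (proj₁ (S⊆T y x∈S (≋⇒∼ x≋)))
        ; (inj₂ (inj₁ (X , (x , x∈S , X∼) , v∼))) → let y , x≋ = preimage x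
                                  in ∼-subspace T-subspace (∼-trans v∼ (∼-trans (∼-φ 1 X∼) (φι-∼ y (≋⇒∼ x≋)))) (proj₁ (proj₂ (S⊆T y x∈S (≋⇒∼ x≋))))
        ; (inj₂ (inj₂ (X , (x , x∈S , X∼) , v∼))) → let y , x≋ = preimage x
                                  in ∼-subspace T-subspace (∼-trans v∼ (∼-trans (∼-φ 2 X∼) (φ2ι-∼ y (≋⇒∼ x≋)))) (proj₂ (proj₂ (S⊆T y x∈S (≋⇒∼ x≋)))) }

      -- The unit vectors are points of PG(8,q³), which by hypothesis is spanned by Γ and its
      -- conjugates.
      join-surjective : ∀ v → InRange v
      join-surjective v = IsLinearSubspace.resp InRange-subspace (sum-δ v) (IsLinearSubspace.∋sum InRange-subspace v δ λ j →
        conjugates⊆ {S = PG 2 3} InRange-subspace (λ y _ _ → (y , 𝟎 , 𝟎 , ≋-refl) , (𝟎 , φ 1 y , 𝟎 , ≋-refl) , (𝟎 , 𝟎 , φ 2 y , ≋-refl))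
          (proj₁ (proj₁ IsBose-G.spanning (rational⇒PG 3 (δ-≉𝟎 j) (δ-rational 3 j)))))

      open Basis join-surjective

      -- A rational zero of u would be a point of the subplane on ℓ∞, but the subplane is exterior.
      u-regular : ∀ (line : LineEquation ℓ∞ N) y → Rational 1 y → ¬ (y ≋ 𝟎) → ¬ (dot (LineEquation.u line) y ≈ 0#)
      u-regular line y y∈F y≉0 uy≈0 = rational∉ℓ∞ y y∈F y≉0 (∈line y
        (PG-*ᵥ 3 {M = N} N-over N-nonsingular (rational⇒PG 3 y≉0 (λ i → F₁⊆F 3 (y∈F i)))) uy≈0)
        where open LineEquation line

      rescale : ∀ s → s ∈ F 3 → ¬ (s ≈ 0#) → LineEquation ℓ∞ N → LineEquation ℓ∞ N
      rescale s s∈F s≉0 line = record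
        { u = s ⊙ u ; u-rational = ⊙-rational 3 {x = u} s∈F u-rational ; b₀ = b₀ ; b₁ = b₁ ; b₀-rational = b₀-rational ; b₁-rational = b₁-rational
        ; ub₀≈0 = scaled b₀ ub₀≈0 ; ub₁≈0 = scaled b₁ ub₁≈0
        ; b-independent = b-independent
        ; b-spans = λ y eq → b-spans y (unscaled y eq)
        ; ∈line = λ y Ny∈PG eq → ∈line y Ny∈PG (unscaled y eq)
        ; line⊆PG = line⊆PG ; line-resp = line-resp
        ; line-equation = λ y Ny∈ → scaled y (line-equation y Ny∈) }
        where
        open LineEquation line
        scaled : ∀ y → dot u y ≈ 0# → dot (s ⊙ u) y ≈ 0#
        scaled y eq = trans (dot-⊙ˡ s u y) (trans (*-congˡ eq) (zeroʳ s))
        unscaled : ∀ y → dot (s ⊙ u) y ≈ 0# → dot u y ≈ 0#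
        unscaled y eq = xy≈0⇒y≈0 s≉0 (trans (sym (dot-⊙ˡ s u y)) eq)

      module OnLine (line : LineEquation ℓ∞ N) where

        open LineEquation line
        open Section u u-rational (u-regular line) H H-over join-surjective hiding (x; y; z; γ)
        open Regular u u-rational (u-regular line)

        -- The statement for u, applied to φ 5 w and transported back by φ 1, which is inverse to φ
        -- 5.
        kernel-spans₁ : ∀ w → dot u′ w ≈ 0# → ∃ λ s → ∃ λ t → w ≋ s ⊙ φ 1 b₀ ⊕ t ⊙ φ 1 b₁
        kernel-spans₁ w u′w≈0 =
          let s , t , eq = b-spans (φ 5 w) (frob-≈0 1 (trans (frob-dot-u′ (φ 5 w)) (trans (dot-congʳ u′ (≋-trans (φ-∘ 1 5 w) (φ-6 w))) u′w≈0)))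
          in frob 1 s , frob 1 t , ≋-trans (≋-sym (≋-trans (φ-∘ 1 5 w) (φ-6 w))) (≋-trans (φ-cong 1 eq)
               (λ i → trans (frob-+ 1 (s * b₀ i) (t * b₁ i)) (+-cong (frob-* 1 s (b₀ i)) (frob-* 1 t (b₁ i)))))

        kernel-spans₂ : ∀ w → dot u″ w ≈ 0# → ∃ λ s → ∃ λ t → w ≋ s ⊙ φ 2 b₀ ⊕ t ⊙ φ 2 b₁
        kernel-spans₂ w u″w≈0 =
          let s , t , eq = b-spans (φ 4 w) (frob-≈0 2 (trans (frob-dot 2 u (φ 4 w)) (trans (dot-congʳ u″ (≋-trans (φ-∘ 2 4 w) (φ-6 w))) u″w≈0)))
          in frob 2 s , frob 2 t , ≋-trans (≋-sym (≋-trans (φ-∘ 2 4 w) (φ-6 w))) (≋-trans (φ-cong 2 eq)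
               (λ i → trans (frob-+ 2 (s * b₀ i) (t * b₁ i)) (+-cong (frob-* 2 s (b₀ i)) (frob-* 2 t (b₁ i)))))

        -- The six listed vectors, the basis b₀, b₁ of the line and its conjugates, span the
        -- extension of Σ∞, so inclusions need be checked on them only.
        AtInfinity⁺-least : ∀ {p} {T : Vector Carrier 9 → Set p} → IsLinearSubspace T →
          T (e₀ b₀) → T (e₀ b₁) → T (e₁ (φ 1 b₀)) → T (e₁ (φ 1 b₁)) → T (e₂ (φ 2 b₀)) → T (e₂ (φ 2 b₁)) → ∀ {v} → AtInfinity⁺ v → T v
        AtInfinity⁺-least {T = T} T-subspace t₀₀ t₀₁ t₁₀ t₁₁ t₂₀ t₂₁ (w₀ , w₁ , w₂ , v≋ , p , q , r) =
          let s₀ , s₁ , w₀≋ = b-spans w₀ p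
              s₂ , s₃ , w₁≋ = kernel-spans₁ w₁ q
              s₄ , s₅ , w₂≋ = kernel-spans₂ w₂ r
          in resp (≋-sym (≋-trans v≋ (join≋e w₀ w₁ w₂)))
               (∋⊕ (∋⊕ (pair e₀-linear s₀ s₁ w₀≋ t₀₀ t₀₁) (pair e₁-linear s₂ s₃ w₁≋ t₁₀ t₁₁)) (pair e₂-linear s₄ s₅ w₂≋ t₂₀ t₂₁))
          where
          open IsLinearSubspace T-subspace
          pair : ∀ {e : Vector Carrier 3 → Vector Carrier 9} → Linear e → ∀ s t {w a b} → w ≋ s ⊙ a ⊕ t ⊙ b → T (e a) → T (e b) → T (e w)
          pair e-linear s t {a = a} {b} w≋ ta tb = resp (≋-sym (≋-trans (Linear.cong e-linear w≋) (≋-trans (Linear.homo-⊕ e-linear (s ⊙ a) (t ⊙ b))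
            (⊕-cong (Linear.homo-⊙ e-linear s a) (Linear.homo-⊙ e-linear t b))))) (∋⊕ (∋⊙ s ta) (∋⊙ t tb))

        dot-φ₁ : ∀ y → dot u y ≈ 0# → dot u′ (φ 1 y) ≈ 0#
        dot-φ₁ y eq = trans (sym (frob-dot 1 u y)) (trans (frob-cong 1 eq) (frob-0 1))

        dot-φ₂ : ∀ y → dot u y ≈ 0# → dot u″ (φ 2 y) ≈ 0#
        dot-φ₂ y eq = trans (sym (frob-dot 2 u y)) (trans (frob-cong 2 eq) (frob-0 2))

        Span-g⊆ : ∀ {v} → v ∈ Span (conjugates g) → AtInfinity⁺ v
        Span-g⊆ = conjugates⊆ {S = ℓ∞} AtInfinity⁺-subspace λ y x∈ x∼ →
          let uy≈0 = line-equation-∼ y x∼ x∈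
          in (y , 𝟎 , 𝟎 , ≋-refl , uy≈0 , dot-𝟎 u′ , dot-𝟎 u″) ,
             (𝟎 , φ 1 y , 𝟎 , ≋-refl , dot-𝟎 u , dot-φ₁ y uy≈0 , dot-𝟎 u″) ,
             (𝟎 , 𝟎 , φ 2 y , ≋-refl , dot-𝟎 u , dot-𝟎 u′ , dot-φ₂ y uy≈0)

        N-b∈ℓ∞ : ∀ b → Rational 3 b → ¬ (b ≋ 𝟎) → dot u b ≈ 0# → N *ᵥ b ∈ ℓ∞
        N-b∈ℓ∞ b b-rational b≉0 ub≈0 = ∈line b (PG-*ᵥ 3 {M = N} N-over N-nonsingular (rational⇒PG 3 b≉0 b-rational)) ub≈0

        b₀≉0 : ¬ (b₀ ≋ 𝟎)
        b₀≉0 b₀≋0 = 1≉0 (proj₁ (b-independent 1# 0# λ i → trans (+-cong (trans (*-congˡ (b₀≋0 i)) (zeroʳ 1#)) (zeroˡ (b₁ i))) (+-identityˡ 0#)))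

        b₁≉0 : ¬ (b₁ ≋ 𝟎)
        b₁≉0 b₁≋0 = 1≉0 (proj₂ (b-independent 0# 1# λ i → trans (+-cong (zeroˡ (b₀ i)) (trans (*-congˡ (b₁≋0 i)) (zeroʳ 1#))) (+-identityˡ 0#)))

        ι-b∈g : ∀ b → Rational 3 b → ¬ (b ≋ 𝟎) → dot u b ≈ 0# → e₀ b ∈ g
        ι-b∈g b b-rational b≉0 ub≈0 = N *ᵥ b , N-b∈ℓ∞ b b-rational b≉0 ub≈0 , ≋⇒∼ (≋-sym (ι-N b))

        generators : ∀ b → Rational 3 b → ¬ (b ≋ 𝟎) → dot u b ≈ 0# →
          e₀ b ∈ Span (conjugates g) × e₁ (φ 1 b) ∈ Span (conjugates g) × e₂ (φ 2 b) ∈ Span (conjugates g)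
        generators b b-rational b≉0 ub≈0 =
          Span∋ {S = conjugates g} (inj₁ ∈g) ,
          Span∋ {S = conjugates g} (inj₂ (inj₁ (e₀ b , ∈g , ≋⇒∼ (≋-sym (φ-e₀ b))))) ,
          Span∋ {S = conjugates g} (inj₂ (inj₂ (e₀ b , ∈g , ≋⇒∼ (≋-sym (φ2-e₀ b)))))
          where ∈g = ι-b∈g b b-rational b≉0 ub≈0

        ⊆Span-g : ∀ {v} → AtInfinity⁺ v → v ∈ Span (conjugates g)
        ⊆Span-g = let p₀ , p₁ , p₂ = generators b₀ b₀-rational b₀≉0 ub₀≈0
                      r₀ , r₁ , r₂ = generators b₁ b₁-rational b₁≉0 ub₁≈0
                  in AtInfinity⁺-least (Span-subspace {S = conjugates g}) p₀ r₀ p₁ r₁ p₂ r₂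

        -- The matrix with rows u, u′, u″ has trivial kernel by `moore` and is therefore onto.
        moore-nonsingular : ∀ t → ∃ λ a → dot u a ≈ t 0F × dot u′ a ≈ t 1F × dot u″ a ≈ t 2F
        moore-nonsingular t =
          let a , Ua≋t = nonsingular⇒surjective U (λ a Ua≋0 → moore a
                (trans (row u a) (Ua≋0 0F)) (trans (row u′ a) (Ua≋0 1F)) (trans (row u″ a) (Ua≋0 2F))) t
          in a , trans (row u a) (Ua≋t 0F) , trans (row u′ a) (Ua≋t 1F) , trans (row u″ a) (Ua≋t 2F)
          where
          U : Matrix 3 3
          U = u ∷ u′ ∷ u″ ∷ []
          row : ∀ v a → dot v a ≈ sum (λ i → v i * a i)
          row v a = sym (sum₃ (λ i → v i * a i))

        -- The point with coordinates (a b, (a b)^q, (a b)^(q²)) is rational for a over F₃. Letting a run over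
        -- the entries of u, whose Moore matrix is nonsingular, separates its three conjugate parts.
        separate : ∀ b → Rational 3 b → ¬ (b ≋ 𝟎) → dot u b ≈ 0# →
          e₀ b ∈ Span Σ∞ × e₁ (φ 1 b) ∈ Span Σ∞ × e₂ (φ 2 b) ∈ Span Σ∞
        separate b b-rational b≉0 ub≈0 =
          part 1# 0# 0# (join-cong (1⊙ b) (0⊙ (φ 1 b)) (0⊙ (φ 2 b))) ,
          part 0# 1# 0# (join-cong (0⊙ b) (1⊙ (φ 1 b)) (0⊙ (φ 2 b))) ,
          part 0# 0# 1# (join-cong (0⊙ b) (0⊙ (φ 1 b)) (1⊙ (φ 2 b)))
          where
          T : Carrier → Carrier → Carrier → Vector Carrier 9
          T x y z = join (x ⊙ b) (y ⊙ φ 1 b) (z ⊙ φ 2 b)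
          T-combination : ∀ a → combination a (T (u 0F) (u′ 0F) (u″ 0F)) (T (u 1F) (u′ 1F) (u″ 1F)) (T (u 2F) (u′ 2F) (u″ 2F)) ≋ T (dot u a) (dot u′ a) (dot u″ a)
          T-combination a = ≋-sym (≋-trans (join-cong (expand u b) (expand u′ (φ 1 b)) (expand u″ (φ 2 b)))
            (≋-trans (join-⊕ (a 0F ⊙ u 0F ⊙ b ⊕ a 1F ⊙ u 1F ⊙ b) (a 0F ⊙ u′ 0F ⊙ φ 1 b ⊕ a 1F ⊙ u′ 1F ⊙ φ 1 b) (a 0F ⊙ u″ 0F ⊙ φ 2 b ⊕ a 1F ⊙ u″ 1F ⊙ φ 2 b) (a 2F ⊙ u 2F ⊙ b) (a 2F ⊙ u′ 2F ⊙ φ 1 b) (a 2F ⊙ u″ 2F ⊙ φ 2 b))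
              (⊕-cong (≋-trans (join-⊕ (a 0F ⊙ u 0F ⊙ b) (a 0F ⊙ u′ 0F ⊙ φ 1 b) (a 0F ⊙ u″ 0F ⊙ φ 2 b) (a 1F ⊙ u 1F ⊙ b) (a 1F ⊙ u′ 1F ⊙ φ 1 b) (a 1F ⊙ u″ 1F ⊙ φ 2 b))
                (⊕-cong (join-⊙ (a 0F) (u 0F ⊙ b) (u′ 0F ⊙ φ 1 b) (u″ 0F ⊙ φ 2 b)) (join-⊙ (a 1F) (u 1F ⊙ b) (u′ 1F ⊙ φ 1 b) (u″ 1F ⊙ φ 2 b))))
                (join-⊙ (a 2F) (u 2F ⊙ b) (u′ 2F ⊙ φ 1 b) (u″ 2F ⊙ φ 2 b)))))
            where
            expand : ∀ (u b : Vector Carrier 3) → dot u a ⊙ b ≋ a 0F ⊙ u 0F ⊙ b ⊕ a 1F ⊙ u 1F ⊙ b ⊕ a 2F ⊙ u 2F ⊙ b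
            expand u b i = solve 7 (λ u₀ u₁ u₂ a₀ a₁ a₂ b → (u₀ :* a₀ :+ u₁ :* a₁ :+ u₂ :* a₂) :* b := a₀ :* (u₀ :* b) :+ a₁ :* (u₁ :* b) :+ a₂ :* (u₂ :* b))
              refl (u 0F) (u 1F) (u 2F) (a 0F) (a 1F) (a 2F) (b i)
          T∈Σ∞ : ∀ j → T (u j) (u′ j) (u″ j) ∈ Σ∞
          T∈Σ∞ j = ⊆Span-g (u j ⊙ b , u′ j ⊙ φ 1 b , u″ j ⊙ φ 2 b , ≋-refl ,
              scaled u b ub≈0 , scaled u′ (φ 1 b) (dot-φ₁ b ub≈0) , scaled u″ (φ 2 b) (dot-φ₂ b ub≈0)) ,
            rational⇒PG 1 T≉0 T-rational
            where
            scaled : ∀ u b {a} → dot u b ≈ 0# → dot u (a ⊙ b) ≈ 0#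
            scaled u b {a} eq = trans (dot-⊙ u a b) (trans (*-congˡ eq) (zeroʳ a))
            uⱼ≉0 : ¬ (u j ≈ 0#)
            uⱼ≉0 uⱼ≈0 = u-regular line (δ j) (δ-rational 1 j) (δ-≉𝟎 j) (trans (dot-δ j) uⱼ≈0)
              where
              dot-δ : ∀ j → dot u (δ j) ≈ u j
              dot-δ j = trans (sym (sum₃ (λ i → u i * δ j i))) (trans (sum-cong-≋ (λ i → *-congˡ {x = u i} (δ-sym i j))) (sum-δ u j))
                where
                δ-sym : ∀ {n} (i j : Fin n) → δ j i ≈ δ i j
                δ-sym zero    zero    = refl
                δ-sym zero    (suc j) = refl
                δ-sym (suc i) zero    = refl
                δ-sym (suc i) (suc j) = δ-sym i j
            T≉0 : ¬ (T (u j) (u′ j) (u″ j) ≋ 𝟎)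
            T≉0 T≋0 = b≉0 (λ i → xy≈0⇒y≈0 uⱼ≉0 (proj₁ (join≋𝟎 (u j ⊙ b) (u′ j ⊙ φ 1 b) (u″ j ⊙ φ 2 b) T≋0) i))
            T-rational : Rational 1 (T (u j) (u′ j) (u″ j))
            T-rational = ≋-trans (φ-join (u j ⊙ b) (u′ j ⊙ φ 1 b) (u″ j ⊙ φ 2 b)) (join-cong
              (≋-trans (φ-⊙ 1 (u″ j) (φ 2 b)) (⊙-cong (trans (frob-∘ 1 2 (u j)) (u-rational j)) (≋-trans (φ-∘ 1 2 b) b-rational)))
              (φ-⊙ 1 (u j) b)
              (≋-trans (φ-⊙ 1 (u′ j) (φ 1 b)) (⊙-cong (frob-∘ 1 1 (u j)) (φ-∘ 1 1 b))))
          open IsLinearSubspace (Span-subspace {S = Σ∞})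
          part : ∀ r s t {v} → T r s t ≋ v → v ∈ Span Σ∞
          part r s t T≋v =
            let a , p , p′ , p″ = moore-nonsingular (r ∷ s ∷ t ∷ [])
            in resp (≋-trans (T-combination a) (≋-trans (join-cong (⊙-congˡ b p) (⊙-congˡ (φ 1 b) p′) (⊙-congˡ (φ 2 b) p″)) T≋v))
                 (∋⊕ (∋⊕ (∋⊙ (a 0F) (Span∋ {S = Σ∞} (T∈Σ∞ 0F))) (∋⊙ (a 1F) (Span∋ {S = Σ∞} (T∈Σ∞ 1F)))) (∋⊙ (a 2F) (Span∋ {S = Σ∞} (T∈Σ∞ 2F))))

        -- Membership in Σ∞ demands rationality over F_q, so it is not evident that Σ∞ spans as much
        -- as the conjugates of g do; `separate` produces the six generators from rational points.
        ⊆Span-Σ∞ : ∀ {v} → AtInfinity⁺ v → v ∈ Span Σ∞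
        ⊆Span-Σ∞ = let p₀ , p₁ , p₂ = separate b₀ b₀-rational b₀≉0 ub₀≈0
                       r₀ , r₁ , r₂ = separate b₁ b₁-rational b₁≉0 ub₁≈0
                   in AtInfinity⁺-least (Span-subspace {S = Σ∞}) p₀ r₀ p₁ r₁ p₂ r₂

        Span-Σ∞⊆ : ∀ {v} → v ∈ Span Σ∞ → AtInfinity⁺ v
        Span-Σ∞⊆ = Span⊆ {S = Σ∞} AtInfinity⁺-subspace (λ v∈ → Span-g⊆ (proj₁ v∈))

        private
          InImage : ∀ {m n} → (Vector Carrier m → Vector Carrier n) → Vector Carrier n → Set _
          InImage f v = ∃ λ d → v ≋ f d

          InImage-subspace : ∀ {m n} {f : Vector Carrier m → Vector Carrier n} → Linear f → IsLinearSubspace (InImage f)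
          InImage-subspace f-linear = record
            { resp = λ v≋v′ (d , eq) → d , ≋-trans (≋-sym v≋v′) eq
            ; ∋𝟎   = 𝟎 , ≋-sym homo-𝟎
            ; ∋⊕   = λ (d , eq) (d′ , eq′) → d ⊕ d′ , ≋-trans (⊕-cong eq eq′) (≋-sym (homo-⊕ d d′))
            ; ∋⊙   = λ a (d , eq) → a ⊙ d , ≋-trans (⊙-congʳ a eq) (≋-sym (homo-⊙ a d)) }
            where open Linear f-linear

          pair : Fin 6 → Fin 6 → Vector Carrier 3 → Vector Carrier 3 → Vector Carrier 6 → Vector Carrier 3
          pair i j a b d = d i ⊙ a ⊕ d j ⊙ b

          pair-linear : ∀ i j a b → Linear (pair i j a b)
          pair-linear i j a b = record
            { cong   = λ p → ⊕-cong (⊙-congˡ a (p i)) (⊙-congˡ b (p j))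
            ; homo-⊕ = λ x y k → solve 6 (λ x₁ x₂ y₁ y₂ a b → (x₁ :+ y₁) :* a :+ (x₂ :+ y₂) :* b := (x₁ :* a :+ x₂ :* b) :+ (y₁ :* a :+ y₂ :* b)) refl (x i) (x j) (y i) (y j) (a k) (b k)
            ; homo-⊙ = λ t x k → solve 5 (λ t x₁ x₂ a b → (t :* x₁) :* a :+ (t :* x₂) :* b := t :* (x₁ :* a :+ x₂ :* b)) refl t (x i) (x j) (a k) (b k) }

          5F : Fin 6
          5F = suc 4F

          p₀ p₁ p₂ : Vector Carrier 6 → Vector Carrier 3
          p₀ = pair 0F 1F b₀ b₁
          p₁ = pair 2F 3F (φ 1 b₀) (φ 1 b₁)
          p₂ = pair 4F 5F (φ 2 b₀) (φ 2 b₁)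

          -- Coordinates on the extension of Σ∞: an injective linear map from K⁶ onto it, which
          -- shows that its vector dimension is 6.
          D : Vector Carrier 6 → Vector Carrier 9
          D d = join (p₀ d) (p₁ d) (p₂ d)

          D-linear : Linear D
          D-linear = join-linear (pair-linear 0F 1F b₀ b₁) (pair-linear 2F 3F (φ 1 b₀) (φ 1 b₁)) (pair-linear 4F 5F (φ 2 b₀) (φ 2 b₁))

          D-at-infinity : ∀ d → AtInfinity⁺ (D d)
          D-at-infinity d = p₀ d , p₁ d , p₂ d , ≋-refl , zero-on u b₀ b₁ (d 0F) (d 1F) ub₀≈0 ub₁≈0 ,
            zero-on u′ (φ 1 b₀) (φ 1 b₁) (d 2F) (d 3F) (dot-φ₁ b₀ ub₀≈0) (dot-φ₁ b₁ ub₁≈0) ,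
            zero-on u″ (φ 2 b₀) (φ 2 b₁) (d 4F) (d 5F) (dot-φ₂ b₀ ub₀≈0) (dot-φ₂ b₁ ub₁≈0)
            where
            zero-on : ∀ u a b s t → dot u a ≈ 0# → dot u b ≈ 0# → dot u (s ⊙ a ⊕ t ⊙ b) ≈ 0#
            zero-on u a b s t p q = ∋⊕ {s ⊙ a} {t ⊙ b} (∋⊙ s {a} p) (∋⊙ t {b} q)
              where open IsLinearSubspace (dot-kernel u)

          at-infinity⇒D : ∀ {v} → AtInfinity⁺ v → InImage D v
          at-infinity⇒D = AtInfinity⁺-least (InImage-subspace D-linear)
            (unit 0F (join-cong (first b₀ b₁) (none (φ 1 b₀) (φ 1 b₁)) (none (φ 2 b₀) (φ 2 b₁))))
            (unit 1F (join-cong (second b₀ b₁) (none (φ 1 b₀) (φ 1 b₁)) (none (φ 2 b₀) (φ 2 b₁))))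
            (unit 2F (join-cong (none b₀ b₁) (first (φ 1 b₀) (φ 1 b₁)) (none (φ 2 b₀) (φ 2 b₁))))
            (unit 3F (join-cong (none b₀ b₁) (second (φ 1 b₀) (φ 1 b₁)) (none (φ 2 b₀) (φ 2 b₁))))
            (unit 4F (join-cong (none b₀ b₁) (none (φ 1 b₀) (φ 1 b₁)) (first (φ 2 b₀) (φ 2 b₁))))
            (unit 5F (join-cong (none b₀ b₁) (none (φ 1 b₀) (φ 1 b₁)) (second (φ 2 b₀) (φ 2 b₁))))
            where
            unit : ∀ i {v} → D (δ i) ≋ v → InImage D v
            unit i eq = δ i , ≋-sym eq
            first : ∀ (a b : Vector Carrier 3) → 1# ⊙ a ⊕ 0# ⊙ b ≋ a
            first a b i = trans (+-cong (*-identityˡ _) (zeroˡ _)) (+-identityʳ _)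
            second : ∀ (a b : Vector Carrier 3) → 0# ⊙ a ⊕ 1# ⊙ b ≋ b
            second a b i = trans (+-cong (zeroˡ _) (*-identityˡ _)) (+-identityˡ _)
            none : ∀ (a b : Vector Carrier 3) → 0# ⊙ a ⊕ 0# ⊙ b ≋ 𝟎
            none a b i = trans (+-cong (zeroˡ _) (zeroˡ _)) (+-identityˡ _)

          φ-independent : ∀ j k → j ℕ.+ k ≡ 6 → ∀ s t → s ⊙ φ j b₀ ⊕ t ⊙ φ j b₁ ≋ 𝟎 → s ≈ 0# × t ≈ 0#
          φ-independent j k j+k≡6 s t eq =
            let p , r = b-independent (frob k s) (frob k t) (λ i → begin
                  frob k s * b₀ i + frob k t * b₁ i
                    ≈⟨ +-cong (*-congˡ (back b₀ i)) (*-congˡ (back b₁ i)) ⟨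
                  frob k s * frob k (φ j b₀ i) + frob k t * frob k (φ j b₁ i)
                    ≈⟨ +-cong (frob-* k s (φ j b₀ i)) (frob-* k t (φ j b₁ i)) ⟨
                  frob k (s * φ j b₀ i) + frob k (t * φ j b₁ i)
                    ≈⟨ frob-+ k (s * φ j b₀ i) (t * φ j b₁ i) ⟨
                  frob k (s * φ j b₀ i + t * φ j b₁ i)
                    ≈⟨ trans (frob-cong k (eq i)) (frob-0 k) ⟩
                  0# ∎)
            in frob-≈0 k p , frob-≈0 k r
            where
            back : ∀ (b : Vector Carrier 3) i → frob k (φ j b i) ≈ b i
            back b i = trans (frob-∘ k j (b i)) (trans (reflexive (≡.cong (λ m → frob m (b i)) j+k≡6)) (frob-6 (b i)))

          D-injective : ∀ d → D d ≋ 𝟎 → d ≋ 𝟎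
          D-injective d eq = entry
            where
            parts = join≋𝟎 (p₀ d) (p₁ d) (p₂ d) eq
            d₀₁ = b-independent (d 0F) (d 1F) (proj₁ parts)
            d₂₃ = φ-independent 1 5 ≡.refl (d 2F) (d 3F) (proj₁ (proj₂ parts))
            d₄₅ = φ-independent 2 4 ≡.refl (d 4F) (d 5F) (proj₂ (proj₂ parts))
            entry : d ≋ 𝟎
            entry 0F = proj₁ d₀₁
            entry 1F = proj₂ d₀₁
            entry 2F = proj₁ d₂₃
            entry 3F = proj₂ d₂₃
            entry 4F = proj₁ d₄₅
            entry (suc 4F) = proj₂ d₄₅

        -- `Balanced` for the rescaled form s ⊙ u, written out since the coordinates in use here are
        -- those of the unscaled u.
        BalancedBy : Carrier → Vector Carrier 9 → Set _
        BalancedBy s v = ∃ λ w₀ → ∃ λ w₁ → ∃ λ w₂ → v ≋ join w₀ w₁ w₂ ×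
          dot (s ⊙ u) w₀ ≈ dot (φ 1 (s ⊙ u)) w₁ × dot (φ 1 (s ⊙ u)) w₁ ≈ dot (φ 2 (s ⊙ u)) w₂

        -- Σ∞ has codimension 1 in Σ₆, so the three conjugate forms, which vanish on Σ∞, are proportional on Σ₆;
        -- they are made equal there by scaling u with respect to a rational point of Σ₆ outside Σ∞.
        module HyperplaneOf (Σ₆ : PointSet 8) (Σ₆-subspace : IsSubspace 1 6 Σ₆) (Σ∞⊆Σ₆ : Σ∞ ⊆ Σ₆) where

          private
            M : Matrix 9 7
            M = proj₁ Σ₆-subspace
            M-over : M Over 1
            M-over = proj₁ (proj₂ Σ₆-subspace)
            M-nonsingular : Nonsingular M
            M-nonsingular = proj₁ (proj₂ (proj₂ Σ₆-subspace))
            Σ₆≐ : Σ₆ ≐ image (M *ᵥ_) (PG 6 1)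
            Σ₆≐ = proj₂ (proj₂ (proj₂ Σ₆-subspace))
            module M = Linear (*ᵥ-linear M)
            open IsLinearSubspace (Span-subspace {S = Σ₆})

            Mδ∈Σ₆ : ∀ j → M *ᵥ δ j ∈ Σ₆
            Mδ∈Σ₆ j = proj₂ Σ₆≐ (δ j , rational⇒PG 1 (δ-≉𝟎 j) (δ-rational 1 j) , ∼-refl)

            M∈Span : ∀ x → M *ᵥ x ∈ Span Σ₆
            M∈Span x = resp (≋-trans (≋-sym (M.homo-sum x δ)) (M.cong (sum-δ x))) (∋sum x (λ j → M *ᵥ δ j) (λ j → Span∋ {S = Σ₆} (Mδ∈Σ₆ j)))

            Span⇒M : ∀ {v} → v ∈ Span Σ₆ → InImage (M *ᵥ_) v
            Span⇒M = Span⊆ {S = Σ₆} (InImage-subspace (*ᵥ-linear M)) λ v∈ →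
              let x , _ , v∼ = proj₁ Σ₆≐ v∈ in ∼-subspace (InImage-subspace (*ᵥ-linear M)) v∼ (x , ≋-refl)

            ∞⇒Span : ∀ {v} → AtInfinity⁺ v → v ∈ Span Σ₆
            ∞⇒Span v∈ = Span⊆ {S = Σ∞} (Span-subspace {S = Σ₆}) (λ v∈Σ∞ → Span∋ {S = Σ₆} (Σ∞⊆Σ₆ v∈Σ∞)) (⊆Span-Σ∞ v∈)

            column : Fin 7 → Vector Carrier 3
            column j = proj₁ (join-surjective (M *ᵥ δ j))

            -- The columns of M are fixed by Frobenius, which permutes the three components
            -- cyclically; so each component is the conjugate of the preceding one, and three steps
            -- lead back.
            column-join : ∀ j → M *ᵥ δ j ≋ join (column j) (φ 1 (column j)) (φ 2 (column j)) × Rational 3 (column j)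
            column-join j =
              let w₀ , w₁ , w₂ , eq = join-surjective (M *ᵥ δ j)
                  φw₂≋w₀ , φw₀≋w₁ , φw₁≋w₂ = join-injective (φ 1 w₂) (φ 1 w₀) (φ 1 w₁) w₀ w₁ w₂
                    (≋-trans (≋-sym (φ-join w₀ w₁ w₂)) (≋-trans (φ-cong 1 (≋-sym eq)) (≋-trans (*ᵥ-rational 1 {M = M} M-over (δ-rational 1 j)) eq)))
                  φ2w₀≋w₂ = ≋-trans (≋-sym (φ-∘ 1 1 w₀)) (≋-trans (φ-cong 1 φw₀≋w₁) φw₁≋w₂)
              in ≋-trans eq (join-cong (≋-refl {x = w₀}) (≋-sym φw₀≋w₁) (≋-sym φ2w₀≋w₂)) ,
                 ≋-trans (≋-sym (φ-∘ 1 2 w₀)) (≋-trans (φ-cong 1 φ2w₀≋w₂) φw₂≋w₀)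

            -- If all seven columns of M were at infinity, they would lie in the image of K⁶ under D
            -- and be dependent.
            outside : ∃ λ j → ¬ (dot u (column j) ≈ 0#)
            outside = by-search (Fin.any? (λ j → ¬? (dot u (column j) ≟ 0#)))
              where
              by-search : Dec (∃ λ j → ¬ (dot u (column j) ≈ 0#)) → ∃ λ j → ¬ (dot u (column j) ≈ 0#)
              by-search (yes found) = found
              by-search (no none) = contradiction x≋0 (proj₁ (proj₂ dependence))
                where
                d : ∀ j → InImage D (M *ᵥ δ j)
                d j = at-infinity⇒D (column j , φ 1 (column j) , φ 2 (column j) , proj₁ (column-join j) , u0 , dot-φ₁ (column j) u0 , dot-φ₂ (column j) u0)
                  where
                  u0 : dot u (column j) ≈ 0#
                  u0 = decidable-stable (dot u (column j) ≟ 0#) (λ ≉0 → none (j , ≉0))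
                dependence = kernel (λ i j → proj₁ (d j) i)
                x : Vector Carrier 7
                x = proj₁ dependence
                x≋0 : x ≋ 𝟎
                x≋0 = M-nonsingular x λ i → begin
                  (M *ᵥ x) i
                    ≈⟨ M.cong (sum-δ x) i ⟨
                  (M *ᵥ (λ i → sum (λ j → x j * δ j i))) i
                    ≈⟨ M.homo-sum x δ i ⟩
                  sum (λ j → x j * (M *ᵥ δ j) i)
                    ≈⟨ sum-cong-≋ (λ j → *-congˡ {x = x j} (proj₂ (d j) i)) ⟩
                  sum (λ j → x j * D (proj₁ (d j)) i)
                    ≈⟨ Linear.homo-sum D-linear x (λ j → proj₁ (d j)) i ⟨
                  D (λ i → sum (λ j → x j * proj₁ (d j) i)) i
                    ≈⟨ Linear.cong D-linear (λ i → trans (sum-cong-≋ (λ j → *-comm (x j) (proj₁ (d j) i))) (proj₂ (proj₂ dependence) i)) i ⟩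
                  D 𝟎 i
                    ≈⟨ Linear.homo-𝟎 D-linear i ⟩
                  0# ∎

            o : Fin 7
            o = proj₁ outside
            w : Vector Carrier 3
            w = column o
            s-inverse = inverse (dot u w) (proj₂ outside)

          -- The inverse of u · w for a rational point of Σ₆ with first component w outside Σ∞. Then
          -- su has value 1 at w, and so have its conjugates at the conjugates of w.
          s : Carrier
          s = proj₁ s-inverse

          s∈F : s ∈ F 3
          s∈F = F-inverse 3 (dot-F 3 {u} {w} u-rational (proj₂ (column-join o))) (proj₂ s-inverse)

          s≉0 : ¬ (s ≈ 0#)
          s≉0 s≈0 = 1≉0 (trans (sym (proj₂ s-inverse)) (trans (*-congˡ s≈0) (zeroʳ _)))

          private
            û : Vector Carrier 3
            û = s ⊙ u

            ûw≈1 : dot û w ≈ 1#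
            ûw≈1 = trans (dot-⊙ˡ s u w) (trans (*-comm s _) (proj₂ s-inverse))

            û-φ : ∀ k → dot (φ k û) (φ k w) ≈ 1#
            û-φ k = trans (sym (frob-dot k û w)) (trans (frob-cong k ûw≈1) (frob-1 k))

            φû-⊙ : ∀ k y → dot (φ k û) y ≈ frob k s * dot (φ k u) y
            φû-⊙ k y = trans (dot-congˡ y (φ-⊙ k s u)) (dot-⊙ˡ (frob k s) (φ k u) y)

            vector-o : Vector Carrier 9
            vector-o = M *ᵥ δ o

            BalancedBy-subspace : IsLinearSubspace (BalancedBy s)
            BalancedBy-subspace = record
              { resp = λ v≋v′ (w₀ , w₁ , w₂ , eq , rest) → w₀ , w₁ , w₂ , ≋-trans (≋-sym v≋v′) eq , rest
              ; ∋𝟎   = 𝟎 , 𝟎 , 𝟎 , ≋-sym join-𝟎 , trans (dot-𝟎 û) (sym (dot-𝟎 (φ 1 û))) , trans (dot-𝟎 (φ 1 û)) (sym (dot-𝟎 (φ 2 û)))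
              ; ∋⊕   = λ (w₀ , w₁ , w₂ , eq , p , q) (w₀′ , w₁′ , w₂′ , eq′ , p′ , q′) →
                  w₀ ⊕ w₀′ , w₁ ⊕ w₁′ , w₂ ⊕ w₂′ , ≋-trans (⊕-cong eq eq′) (≋-sym (join-⊕ w₀ w₁ w₂ w₀′ w₁′ w₂′)) ,
                  trans (dot-⊕ û w₀ w₀′) (trans (+-cong p p′) (sym (dot-⊕ (φ 1 û) w₁ w₁′))) ,
                  trans (dot-⊕ (φ 1 û) w₁ w₁′) (trans (+-cong q q′) (sym (dot-⊕ (φ 2 û) w₂ w₂′)))
              ; ∋⊙   = λ a (w₀ , w₁ , w₂ , eq , p , q) →
                  a ⊙ w₀ , a ⊙ w₁ , a ⊙ w₂ , ≋-trans (⊙-congʳ a eq) (≋-sym (join-⊙ a w₀ w₁ w₂)) ,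
                  trans (dot-⊙ û a w₀) (trans (*-congˡ p) (sym (dot-⊙ (φ 1 û) a w₁))) ,
                  trans (dot-⊙ (φ 1 û) a w₁) (trans (*-congˡ q) (sym (dot-⊙ (φ 2 û) a w₂))) }

            ∞⇒balanced : ∀ {v} → AtInfinity⁺ v → BalancedBy s v
            ∞⇒balanced (w₀ , w₁ , w₂ , eq , p , q , r) = w₀ , w₁ , w₂ , eq ,
              trans û₀ (sym û₁) , trans û₁ (sym (trans (φû-⊙ 2 w₂) (trans (*-congˡ r) (zeroʳ _))))
              where
              û₀ : dot û w₀ ≈ 0#
              û₀ = trans (dot-⊙ˡ s u w₀) (trans (*-congˡ p) (zeroʳ s))
              û₁ : dot (φ 1 û) w₁ ≈ 0#
              û₁ = trans (φû-⊙ 1 w₁) (trans (*-congˡ q) (zeroʳ _))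

            o-balanced : BalancedBy s vector-o
            o-balanced = w , φ 1 w , φ 2 w , proj₁ (column-join o) , trans ûw≈1 (sym (û-φ 1)) , trans (û-φ 1) (sym (û-φ 2))

            abstract
              k : ∀ i → InImage (M *ᵥ_) (D (δ i))
              k i = Span⇒M (∞⇒Span (D-at-infinity (δ i)))

            -- In the coordinates given by M: a rational vector outside Σ∞ followed by the six
            -- coordinate directions of Σ∞. Once shown nonsingular, it writes every point of Σ₆ as a
            -- multiple of the former plus a point at infinity.
            basis : Matrix 7 7
            basis = prependColumn (δ o) (λ j → proj₁ (k j))

            M-basis : ∀ x → M *ᵥ (basis *ᵥ x) ≋ x zero ⊙ vector-o ⊕ D (tail x)
            M-basis = *ᵥ-prependColumn M D-linear (δ o) (λ j → proj₁ (k j)) (λ j → proj₂ (k j))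

            -- Applying u to the first component of a relation removes the part at infinity and
            -- leaves x₀ times u · w ≠ 0. The rest follows from injectivity of D.
            basis-nonsingular : Nonsingular basis
            basis-nonsingular x basis≋0 = entry
              where
              relation : x zero ⊙ vector-o ⊕ D (tail x) ≋ 𝟎
              relation = ≋-trans (≋-sym (M-basis x)) (≋-trans (M.cong basis≋0) M.homo-𝟎)
              relation-join : join (x zero ⊙ w ⊕ p₀ (tail x)) (x zero ⊙ φ 1 w ⊕ p₁ (tail x)) (x zero ⊙ φ 2 w ⊕ p₂ (tail x)) ≋ 𝟎
              relation-join = ≋-trans (join-⊕ (x zero ⊙ w) (x zero ⊙ φ 1 w) (x zero ⊙ φ 2 w) (p₀ (tail x)) (p₁ (tail x)) (p₂ (tail x)))
                (≋-trans (⊕-cong (≋-trans (join-⊙ (x zero) w (φ 1 w) (φ 2 w)) (⊙-congʳ (x zero) (≋-sym (proj₁ (column-join o))))) (≋-refl {x = D (tail x)})) relation)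
              x₀≈0 : x zero ≈ 0#
              x₀≈0 = xy≈0⇒y≈0 (proj₂ outside) (begin
                dot u w * x zero
                  ≈⟨ trans (*-comm _ _) (sym (+-identityʳ _)) ⟩
                x zero * dot u w + 0#
                  ≈⟨ +-cong (dot-⊙ u (x zero) w) (proj₁ (at-infinity (p₀ (tail x)) (p₁ (tail x)) (p₂ (tail x)) ≋-refl (D-at-infinity (tail x)))) ⟨
                dot u (x zero ⊙ w) + dot u (p₀ (tail x))
                  ≈⟨ dot-⊕ u (x zero ⊙ w) (p₀ (tail x)) ⟨
                dot u (x zero ⊙ w ⊕ p₀ (tail x))
                  ≈⟨ dot-congʳ u (proj₁ (join≋𝟎 (x zero ⊙ w ⊕ p₀ (tail x)) (x zero ⊙ φ 1 w ⊕ p₁ (tail x)) (x zero ⊙ φ 2 w ⊕ p₂ (tail x)) relation-join)) ⟩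
                dot u 𝟎
                  ≈⟨ dot-𝟎 u ⟩
                0# ∎)
              entry : x ≋ 𝟎
              entry zero    = x₀≈0
              entry (suc i) = D-injective (tail x) (λ i → trans (sym (trans (+-congʳ (trans (*-congʳ x₀≈0) (zeroˡ _))) (+-identityˡ _))) (relation i)) i

          Span⇒balanced : ∀ {v} → v ∈ Span Σ₆ → BalancedBy s v
          Span⇒balanced {v} v∈ =
            let c , v≋Mc = Span⇒M v∈
                x , basis-x≋c = nonsingular⇒surjective basis basis-nonsingular c
            in B.resp (≋-sym (≋-trans v≋Mc (≋-trans (M.cong (≋-sym basis-x≋c)) (M-basis x))))
                 (B.∋⊕ (B.∋⊙ (x zero) o-balanced) (∞⇒balanced (D-at-infinity (tail x))))
            where module B = IsLinearSubspace BalancedBy-subspace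

          -- Let κ be the common value of the three forms. Subtracting κ times the chosen rational
          -- vector, where all three are 1, leaves a point at infinity.
          balanced⇒Span : ∀ {v} → BalancedBy s v → v ∈ Span Σ₆
          balanced⇒Span {v} (w₀ , w₁ , w₂ , v≋ , p , q) = resp (λ i → solve 2 (λ a b → (a :+ :- con (ℤ.+ 1) :* b) :+ b := a) refl (v i) (κ * vector-o i))
            (∋⊕ (∞⇒Span difference) (∋⊙ κ (M∈Span (δ o))))
            where
            κ : Carrier
            κ = dot û w₀
            difference : AtInfinity⁺ (v ⊕ (- 1#) ⊙ κ ⊙ vector-o)
            difference = w₀ ⊕ (- 1#) ⊙ κ ⊙ w , w₁ ⊕ (- 1#) ⊙ κ ⊙ φ 1 w , w₂ ⊕ (- 1#) ⊙ κ ⊙ φ 2 w ,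
              ≋-trans (⊕-cong v≋ (⊙-congʳ (- 1#) (⊙-congʳ κ (proj₁ (column-join o)))))
                (≋-sym (≋-trans (join-⊕ w₀ w₁ w₂ ((- 1#) ⊙ κ ⊙ w) ((- 1#) ⊙ κ ⊙ φ 1 w) ((- 1#) ⊙ κ ⊙ φ 2 w))
                  (⊕-cong (≋-refl {x = join w₀ w₁ w₂}) (≋-trans (join-⊙ (- 1#) (κ ⊙ w) (κ ⊙ φ 1 w) (κ ⊙ φ 2 w)) (⊙-congʳ (- 1#) (join-⊙ κ w (φ 1 w) (φ 2 w))))))) ,
              unscale s≉0 (dot-⊙ˡ s u (w₀ ⊕ (- 1#) ⊙ κ ⊙ w)) (vanish û w₀ w refl ûw≈1) ,
              unscale (frob-≉0 1 s≉0) (φû-⊙ 1 (w₁ ⊕ (- 1#) ⊙ κ ⊙ φ 1 w)) (vanish (φ 1 û) w₁ (φ 1 w) (sym p) (û-φ 1)) ,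
              unscale (frob-≉0 2 s≉0) (φû-⊙ 2 (w₂ ⊕ (- 1#) ⊙ κ ⊙ φ 2 w)) (vanish (φ 2 û) w₂ (φ 2 w) (sym (trans p q)) (û-φ 2))
              where
              unscale : ∀ {s a b} → ¬ (s ≈ 0#) → b ≈ s * a → b ≈ 0# → a ≈ 0#
              unscale s≉0 b≈sa b≈0 = xy≈0⇒y≈0 s≉0 (trans (sym b≈sa) b≈0)
              vanish : ∀ f x y → dot f x ≈ κ → dot f y ≈ 1# → dot f (x ⊕ (- 1#) ⊙ κ ⊙ y) ≈ 0#
              vanish f x y fx≈κ fy≈1 = trans (dot-⊕ f x ((- 1#) ⊙ κ ⊙ y)) (trans (+-cong fx≈κ (trans (dot-⊙ f (- 1#) (κ ⊙ y)) (*-congˡ (trans (dot-⊙ f κ y) (*-congˡ fy≈1)))))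
                (solve 1 (λ κ → κ :+ :- con (ℤ.+ 1) :* (κ :* con (ℤ.+ 1)) := con (ℤ.+ 0)) refl κ))

          Span∩PG⊆Σ₆ : ∀ {v} → v ∈ Span Σ₆ → v ∈ PG 8 1 → v ∈ Σ₆
          Span∩PG⊆Σ₆ v∈Span v∈PG =
            let x , v≋Mx = Span⇒M v∈Span
            in proj₂ Σ₆≐ (x , PG-preimage 1 {M = M} M-over M-nonsingular (PG-resp 1 (≋⇒∼ (≋-sym v≋Mx)) v∈PG) , ≋⇒∼ v≋Mx)

          Σ₆⊆PG : ∀ {v} → v ∈ Σ₆ → v ∈ PG 8 1
          Σ₆⊆PG v∈ = let _ , p∈PG , v∼ = proj₁ Σ₆≐ v∈ in PG-resp 1 v∼ (PG-*ᵥ 1 {M = M} M-over M-nonsingular p∈PG)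

  -- Carriers, scroll-planes, and the two cases

  module Core where

    open import Data.List.Base using ([]; _∷_)
    open Subfields
    open LinearAlgebra
    open Projective
    open ConicFrames
    open QuadraticForms
    open ConjugateSum
    open Sections
    open Coordinates
    open Ambient

    Span-points₂ : ∀ {n} {p₀ p₁ P₀ P₁ : Vector Carrier (suc n)} → p₀ ∼ P₀ → p₁ ∼ P₁ → ∀ {v} →
                   v ∈ Span (points (p₀ ∷ p₁ ∷ [])) → ∃ λ a → ∃ λ b → v ≋ a ⊙ P₀ ⊕ b ⊙ P₁
    Span-points₂ {p₀ = p₀} {p₁} {P₀} {P₁} p₀∼ p₁∼ = Span⊆ {S = points (p₀ ∷ p₁ ∷ [])} T-subspace λ
      { (here v∼)         → ∼-subspace T-subspace (∼-trans v∼ p₀∼) (1# , 0# , λ i → solve 2 (λ x y → x := con (ℤ.+ 1) :* x :+ con (ℤ.+ 0) :* y) refl (P₀ i) (P₁ i))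
      ; (there (here v∼)) → ∼-subspace T-subspace (∼-trans v∼ p₁∼) (0# , 1# , λ i → solve 2 (λ x y → y := con (ℤ.+ 0) :* x :+ con (ℤ.+ 1) :* y) refl (P₀ i) (P₁ i)) }
      where
      T-subspace : IsLinearSubspace (λ v → ∃ λ a → ∃ λ b → v ≋ a ⊙ P₀ ⊕ b ⊙ P₁)
      T-subspace = record
        { resp = λ v≋v′ (a , b , eq) → a , b , ≋-trans (≋-sym v≋v′) eq
        ; ∋𝟎   = 0# , 0# , λ i → solve 2 (λ x y → con (ℤ.+ 0) := con (ℤ.+ 0) :* x :+ con (ℤ.+ 0) :* y) refl (P₀ i) (P₁ i)
        ; ∋⊕   = λ (a , b , eq) (a′ , b′ , eq′) → a + a′ , b + b′ , λ i → trans (+-cong (eq i) (eq′ i))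
            (solve 6 (λ a b a′ b′ x y → (a :* x :+ b :* y) :+ (a′ :* x :+ b′ :* y) := (a :+ a′) :* x :+ (b :+ b′) :* y) refl a b a′ b′ (P₀ i) (P₁ i))
        ; ∋⊙   = λ t (a , b , eq) → t * a , t * b , λ i → trans (*-congˡ (eq i))
            (solve 5 (λ t a b x y → t :* (a :* x :+ b :* y) := t :* a :* x :+ t :* b :* y) refl t a b (P₀ i) (P₁ i)) }

    Span-points₃ : ∀ {n} {p₀ p₁ p₂ P₀ P₁ P₂ : Vector Carrier (suc n)} → p₀ ∼ P₀ → p₁ ∼ P₁ → p₂ ∼ P₂ → ∀ {v} →
                   v ∈ Span (points (p₀ ∷ p₁ ∷ p₂ ∷ [])) → ∃ λ a → ∃ λ b → ∃ λ d → v ≋ a ⊙ P₀ ⊕ b ⊙ P₁ ⊕ d ⊙ P₂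
    Span-points₃ {p₀ = p₀} {p₁} {p₂} {P₀} {P₁} {P₂} p₀∼ p₁∼ p₂∼ = Span⊆ {S = points (p₀ ∷ p₁ ∷ p₂ ∷ [])} T-subspace λ
      { (here v∼)                 → ∼-subspace T-subspace (∼-trans v∼ p₀∼) (1# , 0# , 0# , λ i → solve 3 (λ x y z → x := con (ℤ.+ 1) :* x :+ con (ℤ.+ 0) :* y :+ con (ℤ.+ 0) :* z) refl (P₀ i) (P₁ i) (P₂ i))
      ; (there (here v∼))         → ∼-subspace T-subspace (∼-trans v∼ p₁∼) (0# , 1# , 0# , λ i → solve 3 (λ x y z → y := con (ℤ.+ 0) :* x :+ con (ℤ.+ 1) :* y :+ con (ℤ.+ 0) :* z) refl (P₀ i) (P₁ i) (P₂ i))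
      ; (there (there (here v∼))) → ∼-subspace T-subspace (∼-trans v∼ p₂∼) (0# , 0# , 1# , λ i → solve 3 (λ x y z → z := con (ℤ.+ 0) :* x :+ con (ℤ.+ 0) :* y :+ con (ℤ.+ 1) :* z) refl (P₀ i) (P₁ i) (P₂ i)) }
      where
      T-subspace : IsLinearSubspace (λ v → ∃ λ a → ∃ λ b → ∃ λ d → v ≋ a ⊙ P₀ ⊕ b ⊙ P₁ ⊕ d ⊙ P₂)
      T-subspace = record
        { resp = λ v≋v′ (a , b , d , eq) → a , b , d , ≋-trans (≋-sym v≋v′) eq
        ; ∋𝟎   = 0# , 0# , 0# , λ i → solve 3 (λ x y z → con (ℤ.+ 0) := con (ℤ.+ 0) :* x :+ con (ℤ.+ 0) :* y :+ con (ℤ.+ 0) :* z) refl (P₀ i) (P₁ i) (P₂ i)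
        ; ∋⊕   = λ (a , b , d , eq) (a′ , b′ , d′ , eq′) → a + a′ , b + b′ , d + d′ , λ i → trans (+-cong (eq i) (eq′ i))
            (solve 9 (λ a b d a′ b′ d′ x y z → (a :* x :+ b :* y :+ d :* z) :+ (a′ :* x :+ b′ :* y :+ d′ :* z) := (a :+ a′) :* x :+ (b :+ b′) :* y :+ (d :+ d′) :* z)
              refl a b d a′ b′ d′ (P₀ i) (P₁ i) (P₂ i))
        ; ∋⊙   = λ t (a , b , d , eq) → t * a , t * b , t * d , λ i → trans (*-congˡ (eq i))
            (solve 7 (λ t a b d x y z → t :* (a :* x :+ b :* y :+ d :* z) := t :* a :* x :+ t :* b :* y :+ t :* d :* z) refl t a b d (P₀ i) (P₁ i) (P₂ i)) }

    points₂⊆Span : ∀ {n} {p₀ p₁ P₀ P₁ : Vector Carrier (suc n)} → p₀ ∼ P₀ → p₁ ∼ P₁ → ∀ a b {v} → v ≋ a ⊙ P₀ ⊕ b ⊙ P₁ →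
                   v ∈ Span (points (p₀ ∷ p₁ ∷ []))
    points₂⊆Span {p₀ = p₀} {p₁} p₀∼ p₁∼ a b v≋ = resp (≋-sym v≋) (∋⊕ (∋⊙ a (Span∋ {S = S} (here (∼-sym p₀∼)))) (∋⊙ b (Span∋ {S = S} (there (here (∼-sym p₁∼))))))
      where
      S = points (p₀ ∷ p₁ ∷ [])
      open IsLinearSubspace (Span-subspace {S = S})

    points₃⊆Span : ∀ {n} {p₀ p₁ p₂ P₀ P₁ P₂ : Vector Carrier (suc n)} → p₀ ∼ P₀ → p₁ ∼ P₁ → p₂ ∼ P₂ → ∀ a b d {v} →
                   v ≋ a ⊙ P₀ ⊕ b ⊙ P₁ ⊕ d ⊙ P₂ → v ∈ Span (points (p₀ ∷ p₁ ∷ p₂ ∷ []))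
    points₃⊆Span {p₀ = p₀} {p₁} {p₂} p₀∼ p₁∼ p₂∼ a b d v≋ = resp (≋-sym v≋)
      (∋⊕ (∋⊕ (∋⊙ a (Span∋ {S = S} (here (∼-sym p₀∼)))) (∋⊙ b (Span∋ {S = S} (there (here (∼-sym p₁∼)))))) (∋⊙ d (Span∋ {S = S} (there (there (here (∼-sym p₂∼)))))))
      where
      S = points (p₀ ∷ p₁ ∷ p₂ ∷ [])
      open IsLinearSubspace (Span-subspace {S = S})

    record ConicModel : Set (Level.suc (c ⊔ ℓ)) where
      field
        model : Model
      open Model model public
      field
        line             : LineEquation ℓ∞ N
        B                : Matrix 3 3
        B-frame          : ∀ y → B *ᵥ φ 1 (N *ᵥ y) ∼ N *ᵥ φ 1 y
        C C⁺ C⁺⁺         : PointSet 2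
        C-parametrised   : ParametrisedBy 1 N C
        C⁺-parametrised  : ParametrisedBy 3 N C⁺
        C⁺⁺-parametrised : ParametrisedBy 6 N C⁺⁺

    module Configuration (conicModel : ConicModel) where

      open ConicModel conicModel
      open Bose G
      open Scroll B
      open AtInfinity ℓ∞
      open Carriers ℓ∞ B
      open Representation model
      open LineEquation line
      open OnLine line
      open Join H H-over
      open Basis join-surjective
      open Section u u-rational (u-regular line) H H-over join-surjective
      open Regular u u-rational (u-regular line)

      𝖼-∼ : ∀ j {x} y → x ∼ N *ᵥ y → 𝖼 j x ∼ N *ᵥ φ j y
      𝖼-∼ j y x∼ = ∼-trans (collineation-∼ B j x∼) (collineation-frame B N B-frame j y)

      tensor≋e : ∀ τ a b d → tensor τ a b d ≋ a ⊙ e₀ (γ τ) ⊕ b ⊙ e₁ (γ τ) ⊕ d ⊙ e₂ (γ τ)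
      tensor≋e τ a b d = ≋-trans (join≋e (a ⊙ γ τ) (b ⊙ γ τ) (d ⊙ γ τ))
        (⊕-cong (⊕-cong (Linear.homo-⊙ e₀-linear a (γ τ)) (Linear.homo-⊙ e₁-linear b (γ τ))) (Linear.homo-⊙ e₂-linear d (γ τ)))

      InScroll : ℕ → Vector Carrier 9 → Set _
      InScroll k v = v ∈ PG 8 k × ∃ λ τ → Parameter k τ × ∃ λ a → ∃ λ b → ∃ λ d → v ≋ tensor τ a b d

      module _ {k} (C : PointSet 2) (C-parametrised : ParametrisedBy k N C) where

        open ParametrisedBy C-parametrised

        private
          -- In the frame 𝖼 is Frobenius, so the exponents 5 and 1 add up to 6 and cancel: the
          -- second generator of the scroll-plane is γ τ in the second component. For the third they
          -- are 4 and 2.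
          p₁∼ : ∀ {x} τ → x ∼ N *ᵥ γ τ → φ 1 (ι (𝖼 5 x)) ∼ e₁ (γ τ)
          p₁∼ τ x∼ = ∼-trans (φι-∼ (φ 5 (γ τ)) (𝖼-∼ 5 (γ τ) x∼)) (≋⇒∼ (Linear.cong e₁-linear (≋-trans (φ-∘ 1 5 (γ τ)) (φ-6 (γ τ)))))

          p₂∼ : ∀ {x} τ → x ∼ N *ᵥ γ τ → φ 2 (ι (𝖼 4 x)) ∼ e₂ (γ τ)
          p₂∼ τ x∼ = ∼-trans (φ2ι-∼ (φ 4 (γ τ)) (𝖼-∼ 4 (γ τ) x∼)) (≋⇒∼ (Linear.cong e₂-linear (≋-trans (φ-∘ 2 4 (γ τ)) (φ-6 (γ τ)))))

        scroll⇒tensor : ∀ {v} → v ∈ scroll k C → InScroll k v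
        scroll⇒tensor (x , x∈C , v∈Span , v∈PG) =
          let τ , τ∈F , x∼ = parameter x∈C
              a , b , d , v≋ = Span-points₃ (ι-∼ (γ τ) x∼) (p₁∼ τ x∼) (p₂∼ τ x∼) v∈Span
          in v∈PG , τ , τ∈F , a , b , d , ≋-trans v≋ (≋-sym (tensor≋e τ a b d))

        tensor⇒scroll : ∀ {v} → InScroll k v → v ∈ scroll k C
        tensor⇒scroll (v∈PG , τ , τ∈F , a , b , d , v≋) =
          N *ᵥ γ τ , point τ τ∈F ∼-refl ,
          points₃⊆Span (ι-∼ (γ τ) ∼-refl) (p₁∼ τ ∼-refl) (p₂∼ τ ∼-refl) a b d (≋-trans v≋ (tensor≋e τ a b d)) , v∈PG

      -- For a parameter in F_q the vector γ τ is fixed by Frobenius, so the spread plane has the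
      -- same tensor coordinates as a scroll-plane.
      spread⇒tensor : ∀ {v} → v ∈ ⟦ C ⟧ → InScroll 1 v
      spread⇒tensor (x , x∈C , v∈Span , v∈PG) =
        let τ , τ∈F , x∼ = ParametrisedBy.parameter C-parametrised x∈C
            γ-rational = veronese-rational 1 2 τ τ∈F
            a , b , d , v≋ = Span-points₃ (ι-∼ (γ τ) x∼) (∼-trans (φι-∼ (γ τ) x∼) (≋⇒∼ (Linear.cong e₁-linear γ-rational)))
              (∼-trans (φ2ι-∼ (γ τ) x∼) (≋⇒∼ (Linear.cong e₂-linear (λ i → F₁⊆F 2 (γ-rational i))))) v∈Span
        in v∈PG , τ , τ∈F , a , b , d , ≋-trans v≋ (≋-sym (tensor≋e τ a b d))

      tensor⇒spread : ∀ {v} → InScroll 1 v → v ∈ ⟦ C ⟧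
      tensor⇒spread (v∈PG , τ , τ∈F , a , b , d , v≋) =
        let γ-rational = veronese-rational 1 2 τ τ∈F
        in N *ᵥ γ τ , ParametrisedBy.point C-parametrised τ τ∈F ∼-refl ,
           points₃⊆Span (ι-∼ (γ τ) ∼-refl) (∼-trans (φι-∼ (γ τ) ∼-refl) (≋⇒∼ (Linear.cong e₁-linear γ-rational)))
             (∼-trans (φ2ι-∼ (γ τ) ∼-refl) (≋⇒∼ (Linear.cong e₂-linear (λ i → F₁⊆F 2 (γ-rational i)))))
             a b d (≋-trans v≋ (tensor≋e τ a b d)) , v∈PG

      Σ∞-extension : ∀ {k v} → v ∈ ⟨ Σ∞ ⟩[ k ] → AtInfinity⁺ v
      Σ∞-extension (v∈Span , _) = Span-Σ∞⊆ v∈Span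

      module Carrier (E : Vector Carrier 3) (E∈ℓ∞ : E ∈ ℓ∞) (𝖼E∈ℓ∞ : 𝖼 1 E ∈ ℓ∞) where

        e : Vector Carrier 3
        e = proj₁ (preimage E)

        E∼Ne : E ∼ N *ᵥ e
        E∼Ne = ≋⇒∼ (proj₂ (preimage E))

        ue≈0 : dot u e ≈ 0#
        ue≈0 = line-equation-∼ e E∼Ne E∈ℓ∞

        uφe≈0 : dot u (φ 1 e) ≈ 0#
        uφe≈0 = line-equation-∼ (φ 1 e) (𝖼-∼ 1 e E∼Ne) 𝖼E∈ℓ∞

        e∈PG : e ∈ PG 2 3
        e∈PG = PG-preimage 3 {M = N} N-over N-nonsingular (PG-resp 3 (∼-sym E∼Ne) (line⊆PG E∈ℓ∞))

        e≉0 : ¬ (e ≋ 𝟎)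
        e≉0 = proj₁ e∈PG

        φ³-∼ : ∀ {n} {x : Vector Carrier (suc n)} → x ∈ PG n 3 → φ 3 x ∼ x
        φ³-∼ (_ , y , x∼y , y-rational) = ∼-trans (∼-φ 3 x∼y) (∼-trans (≋⇒∼ y-rational) (∼-sym x∼y))

        -- Raising u · φ e = 0 to the power q² gives u″ · φ³ e = 0, and φ³ e is the same point as e.
        u″e≈0 : dot u″ e ≈ 0#
        u″e≈0 = dot-∼ u″ {y = φ 3 e} (∼-sym (φ³-∼ e∈PG)) (begin
          dot u″ (φ 3 e)          ≈⟨ dot-congʳ u″ (φ-∘ 2 1 e) ⟨
          dot u″ (φ 2 (φ 1 e))    ≈⟨ frob-dot 2 u (φ 1 e) ⟨
          frob 2 (dot u (φ 1 e))  ≈⟨ trans (frob-cong 2 uφe≈0) (frob-0 2) ⟩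
          0#                      ∎)

        -- The combination (u′e)y - (u′y)e is annihilated by all three conjugate forms, hence zero
        -- by `moore`; the coefficients u′e and u′y are nonzero for the same reason.
        pair₂₀ : ∀ y → ¬ (y ≋ 𝟎) → dot u″ y ≈ 0# → dot u y ≈ 0# → y ∼ e
        pair₂₀ y y≉0 u″y≈0 uy≈0 = ∼-trans (∼-sym (⊙-∼ u′e≉0)) (dot u′ y , (λ u′y≈0 → y≉0 (moore y uy≈0 u′y≈0 u″y≈0)) , λ i → x-y≈0⇒x≈y (trans
          (solve 4 (λ s t y e → s :* y :- t :* e := s :* y :+ (:- t) :* e) refl (dot u′ e) (dot u′ y) (y i) (e i)) (difference i)))
          where
          u′e≉0 : ¬ (dot u′ e ≈ 0#)
          u′e≉0 u′e≈0 = e≉0 (moore e ue≈0 u′e≈0 u″e≈0)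
          vanish : ∀ f → dot f y ≈ 0# → dot f e ≈ 0# → ∀ s t → dot f (s ⊙ y ⊕ t ⊙ e) ≈ 0#
          vanish f p r s t = ∋⊕ {s ⊙ y} {t ⊙ e} (∋⊙ s {y} p) (∋⊙ t {e} r)
            where open IsLinearSubspace (dot-kernel f)
          difference : dot u′ e ⊙ y ⊕ (- dot u′ y) ⊙ e ≋ 𝟎
          difference = moore _ (vanish u uy≈0 ue≈0 _ _)
            (trans (dot-⊕ u′ (dot u′ e ⊙ y) ((- dot u′ y) ⊙ e)) (trans (+-cong (dot-⊙ u′ (dot u′ e) y) (dot-⊙ u′ (- dot u′ y) e))
              (solve 2 (λ s t → s :* t :+ (:- t) :* s := con (ℤ.+ 0)) refl (dot u′ e) (dot u′ y))))
            (vanish u″ u″y≈0 u″e≈0 _ _)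

        -- The Frobenius conjugate of `pair₂₀`, applied to φ 5 y, the preimage of y.
        pair₀₁ : ∀ y → ¬ (y ≋ 𝟎) → dot u y ≈ 0# → dot u′ y ≈ 0# → y ∼ φ 1 e
        pair₀₁ y y≉0 uy≈0 u′y≈0 = ∼-trans (≋⇒∼ (≋-sym (≋-trans (φ-∘ 1 5 y) (φ-6 y)))) (∼-φ 1 (pair₂₀ (φ 5 y) (φ-≉𝟎 5 y≉0)
          (frob-≈0 1 (trans (frob-dot-u (φ 5 y)) (trans (dot-congʳ u (≋-trans (φ-∘ 1 5 y) (φ-6 y))) uy≈0)))
          (frob-≈0 1 (trans (frob-dot-u′ (φ 5 y)) (trans (dot-congʳ u′ (≋-trans (φ-∘ 1 5 y) (φ-6 y))) u′y≈0)))))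

        pair₁₂ : ∀ y → ¬ (y ≋ 𝟎) → dot u′ y ≈ 0# → dot u″ y ≈ 0# → y ∼ φ 2 e
        pair₁₂ y y≉0 u′y≈0 u″y≈0 = ∼-trans (∼-trans (≋⇒∼ (≋-sym (≋-trans (φ-∘ 1 5 y) (φ-6 y)))) (∼-φ 1 (pair₀₁ (φ 5 y) (φ-≉𝟎 5 y≉0)
          (frob-≈0 1 (trans (frob-dot-u′ (φ 5 y)) (trans (dot-congʳ u′ (≋-trans (φ-∘ 1 5 y) (φ-6 y))) u′y≈0)))
          (frob-≈0 1 (trans (frob-dot-u″ (φ 5 y)) (trans (dot-congʳ u″ (≋-trans (φ-∘ 1 5 y) (φ-6 y))) u″y≈0)))))) (≋⇒∼ (φ-∘ 1 1 e))

        ∞-not-on-line : ¬ (x nothing ≈ 0#)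
        ∞-not-on-line = Splits.∞-not-root u-splits

        γ∈PG⇒parameter : ∀ θ → γ (just θ) ∈ PG 2 3 → θ ∈ F 3
        γ∈PG⇒parameter θ (_ , y , (a , _ , γ≋) , y-rational) =
          F-cong 3 (trans (sym (γ≋ 1F)) (*-identityʳ θ))
            (F-* 3 (F-inverse 3 (y-rational 0F) (trans (*-comm (y 0F) a) (sym (γ≋ 0F)))) (y-rational 1F))

        module OnConic (E∈C⁺ : E ∈ C⁺) where

          private
            parameter-E = ParametrisedBy.parameter C⁺-parametrised E∈C⁺

            finite : ∀ τ → E ∼ N *ᵥ γ τ → Parameter 3 τ → ∃ λ ρ → ρ ∈ F 3 × E ∼ N *ᵥ γ (just ρ)
            finite (just ρ) E∼ ρ∈F = ρ , ρ∈F , E∼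
            finite nothing  E∼ _   = contradiction (line-equation-∼ (γ nothing) E∼ E∈ℓ∞) ∞-not-on-line

            finite-E = finite (proj₁ parameter-E) (proj₂ (proj₂ parameter-E)) (proj₁ (proj₂ parameter-E))

          ρ : Carrier
          ρ = proj₁ finite-E

          ρ∈F : ρ ∈ F 3
          ρ∈F = proj₁ (proj₂ finite-E)

          E∼Nγ : E ∼ N *ᵥ γ (just ρ)
          E∼Nγ = proj₂ (proj₂ finite-E)

          root₀ : x (just ρ) ≈ 0#
          root₀ = line-equation-∼ (γ (just ρ)) E∼Nγ E∈ℓ∞

          𝖼E∼Nγ : 𝖼 1 E ∼ N *ᵥ γ (just (frob 1 ρ))
          𝖼E∼Nγ = ∼-trans (𝖼-∼ 1 (γ (just ρ)) E∼Nγ) (≋⇒∼ (Linear.cong (*ᵥ-linear N) (≋-sym (veronese-φ 1 2 ρ))))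

          root₁ : x (just (frob 1 ρ)) ≈ 0#
          root₁ = line-equation-∼ (γ (just (frob 1 ρ))) 𝖼E∼Nγ 𝖼E∈ℓ∞

          ρ∉F₁ : ¬ (ρ ∈ F 1)
          ρ∉F₁ ρ∈F₁ = u-regular line (γ (just ρ)) (veronese-rational 1 2 (just ρ) ρ∈F₁) (veronese-≉𝟎 2 (just ρ)) root₀

          -- C⁺ is stable under 𝖼, which acts on parameters by θ ↦ θ^q. So E ∈ C⁺ puts the other
          -- carrier on C⁺ as well, and the quadratic u has no zeros besides these two. The first
          -- case thus amounts to E ∈ C⁺.
          C⁺∩ℓ∞ : C⁺ ∩ ℓ∞ ≐ points (E ∷ 𝖼 1 E ∷ [])
          C⁺∩ℓ∞ = (λ (v∈C⁺ , v∈ℓ∞) → let τ , _ , v∼ = ParametrisedBy.parameter C⁺-parametrised v∈C⁺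
                                     in at τ v∼ (line-equation-∼ (γ τ) v∼ v∈ℓ∞)) ,
            λ { (here v∼)         → ParametrisedBy.point C⁺-parametrised (just ρ) ρ∈F (∼-trans v∼ E∼Nγ) , line-resp v∼ E∈ℓ∞
              ; (there (here v∼)) → ParametrisedBy.point C⁺-parametrised (just (frob 1 ρ)) (F-frob 1 3 ρ∈F) (∼-trans v∼ 𝖼E∼Nγ) , line-resp v∼ 𝖼E∈ℓ∞ }
            where
            open Cubic ρ ρ∈F ρ∉F₁ root₀ root₁ using (splits)
            at : ∀ τ {v} → v ∼ N *ᵥ γ τ → x τ ≈ 0# → v ∈ points (E ∷ 𝖼 1 E ∷ [])
            at nothing  v∼ x≈0 = contradiction x≈0 ∞-not-on-line
            at (just θ) {v} v∼ x≈0 = by-root (Splits.roots splits θ x≈0)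
              where
              at-root : ∀ {ρ} → θ ≈ ρ → v ∼ N *ᵥ γ (just ρ)
              at-root θ≈ρ = ∼-trans v∼ (≋⇒∼ (Linear.cong (*ᵥ-linear N) (veronese-cong 2 θ≈ρ)))
              by-root : θ ≈ ρ ⊎ θ ≈ frob 1 ρ → v ∈ points (E ∷ 𝖼 1 E ∷ [])
              by-root (inj₁ θ≈) = here (∼-trans (at-root θ≈) (∼-sym E∼Nγ))
              by-root (inj₂ θ≈) = there (here (∼-trans (at-root θ≈) (∼-sym 𝖼E∼Nγ)))

        module OffConic (E∉C⁺ : ¬ (E ∈ C⁺)) where

          -- The inverse Frobenius power turns γ τ into a point of the standard conic equal to e. As
          -- e is a point of PG(2,q³), its parameter lies in F_{q³}, which would put E on C⁺.
          no-carrier : ∀ j k → j ℕ.+ k ≡ 6 → ∀ τ → ¬ (γ τ ∼ φ j e)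
          no-carrier j k j+k≡6 τ γ∼ = at τ (∼-trans (∼-φ k γ∼) (≋⇒∼ (≋-trans (φ-∘ k j e)
            (≋-trans (λ i → reflexive (≡.cong (λ m → frob m (e i)) j+k≡6)) (φ-6 e)))))
            where
            at : ∀ τ → ¬ (φ k (γ τ) ∼ e)
            at nothing  eq = ∞-not-on-line (dot-∼ u {γ nothing} {e} (∼-trans (≋⇒∼ (≋-sym (e-last-rational k 2))) eq) ue≈0)
            at (just θ) eq =
              let γ∼e = ∼-trans (≋⇒∼ (veronese-φ k 2 θ)) eq
              in E∉C⁺ (ParametrisedBy.point C⁺-parametrised (just (frob k θ)) (γ∈PG⇒parameter (frob k θ) (PG-resp 3 γ∼e e∈PG))
                   (∼-trans E∼Ne (∼-*ᵥ N (∼-sym γ∼e))))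

          coprime₀₁ : Coprime u u′
          coprime₀₁ τ p r = no-carrier 1 5 ≡.refl τ (pair₀₁ (γ τ) (veronese-≉𝟎 2 τ) p r)

          coprime₁₂ : Coprime u′ u″
          coprime₁₂ τ p r = no-carrier 2 4 ≡.refl τ (pair₁₂ (γ τ) (veronese-≉𝟎 2 τ) p r)

          coprime₂₀ : Coprime u″ u
          coprime₂₀ τ p r = no-carrier 0 6 ≡.refl τ (∼-trans (pair₂₀ (γ τ) (veronese-≉𝟎 2 τ) p r) (≋⇒∼ (λ i → sym (frob-0th (e i)))))

      record Hyperplane : Set (Level.suc (c ⊔ ℓ)) where
        field
          𝒱             : Fin 9 → Matrix 9 9
          𝒱-variety     : IsVarietyOf C C⁺ C⁺⁺ 𝒱
          Σ₆            : PointSet 8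
          Σ₆⊆PG         : ∀ {v} → v ∈ Σ₆ → v ∈ PG 8 1
          Span∩PG⊆Σ₆    : ∀ {v} → v ∈ Span Σ₆ → v ∈ PG 8 1 → v ∈ Σ₆
          Span⇒balanced : ∀ {v} → v ∈ Span Σ₆ → Balanced v
          balanced⇒Span : ∀ {v} → Balanced v → v ∈ Span Σ₆

      module WithHyperplane (hyperplane : Hyperplane) where

        open Hyperplane hyperplane
        open IsVarietyOf 𝒱-variety

        private
          scroll⇒section : ∀ {k v} → InScroll k v → Balanced v → VarietySection k v
          scroll⇒section (v∈PG , τ , τ∈F , a , b , d , v≋) v-balanced =
            let p , r = balanced (a ⊙ γ τ) (b ⊙ γ τ) (d ⊙ γ τ) v≋ v-balanced
            in v∈PG , τ , τ∈F , a , b , d , v≋ ,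
               trans (sym (dot-⊙ u a (γ τ))) (trans p (dot-⊙ u′ b (γ τ))) , trans (sym (dot-⊙ u′ b (γ τ))) (trans r (dot-⊙ u″ d (γ τ)))

          section⇒scroll : ∀ {k v} → VarietySection k v → InScroll k v × Balanced v
          section⇒scroll (v∈PG , τ , τ∈F , a , b , d , v≋ , p , r) =
            (v∈PG , τ , τ∈F , a , b , d , v≋) , a ⊙ γ τ , b ⊙ γ τ , d ⊙ γ τ , v≋ ,
            trans (dot-⊙ u a (γ τ)) (trans p (sym (dot-⊙ u′ b (γ τ)))) , trans (dot-⊙ u′ b (γ τ)) (trans r (sym (dot-⊙ u″ d (γ τ))))

        section₁ : ∀ {v} → v ∈ Variety 1 𝒱 ∩ Σ₆ → VarietySection 1 v
        section₁ (v∈𝒱 , v∈Σ₆) = scroll⇒section (spread⇒tensor (proj₁ pointset v∈𝒱)) (Span⇒balanced (Span∋ {S = Σ₆} v∈Σ₆))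

        section₁⁻¹ : ∀ {v} → VarietySection 1 v → v ∈ Variety 1 𝒱 ∩ Σ₆
        section₁⁻¹ v∈ = let in-scroll , v-balanced = section⇒scroll v∈
                        in proj₂ pointset (tensor⇒spread in-scroll) , Span∩PG⊆Σ₆ (balanced⇒Span v-balanced) (proj₁ v∈)

        section₃ : ∀ {v} → v ∈ Variety 3 𝒱 ∩ ⟨ Σ₆ ⟩[ 3 ] → VarietySection 3 v
        section₃ (v∈𝒱 , v∈Span , _) = scroll⇒section (scroll⇒tensor C⁺ C⁺-parametrised (proj₁ extension v∈𝒱)) (Span⇒balanced v∈Span)

        section₃⁻¹ : ∀ {v} → VarietySection 3 v → v ∈ Variety 3 𝒱 ∩ ⟨ Σ₆ ⟩[ 3 ]
        section₃⁻¹ v∈ = let in-scroll , v-balanced = section⇒scroll v∈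
                        in proj₂ extension (tensor⇒scroll C⁺ C⁺-parametrised in-scroll) , balanced⇒Span v-balanced , proj₁ v∈

        module WithCarrier (E : Vector Carrier 3) (E∈ℓ∞ : E ∈ ℓ∞) (𝖼E∈ℓ∞ : 𝖼 1 E ∈ ℓ∞) where

          open Carrier E E∈ℓ∞ 𝖼E∈ℓ∞

          h h^q h^q² : PointSet 8
          h    = ⟨ points (ι E ∷ φ 2 (ι (𝖼 1 E)) ∷ []) ⟩[ 3 ]
          h^q  = image (φ 1) h
          h^q² = image (φ 2) h

          -- The conjugated basis matrix spans the conjugate line; the power φ k, inverse to φ j,
          -- carries points and relations back.
          IsSubspace-φ : ∀ j k → j ℕ.+ k ≡ 6 → {U : PointSet 8} → IsSubspace 3 1 U → IsSubspace 3 1 (image (φ j) U)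
          IsSubspace-φ j k j+k≡6 {U} (M , M-over , M-nonsingular , ⊆image , image⊆) =
            φᴹ j M , (λ i i′ → F-frob j 3 (M-over i i′)) ,
            (λ x eq → φ-zero x (M-nonsingular (φ k x) (≋-trans (≋-sym (back x)) (≋-trans (φ-cong k eq) (φ-𝟎 k))))) ,
            (λ (x , x∈U , y∼) → let p , p∈PG , x∼ = ⊆image x∈U
                                in φ j p , PG-φ j 3 p∈PG , ∼-trans y∼ (∼-trans (∼-φ j x∼) (≋⇒∼ (φ-*ᵥ j M p)))) ,
            λ (p , p∈PG , y∼) → M *ᵥ φ k p , image⊆ (φ k p , PG-φ k 3 p∈PG , ∼-refl) ,
              ∼-trans y∼ (≋⇒∼ (≋-sym (≋-trans (φ-*ᵥ j M (φ k p)) (Linear.cong (*ᵥ-linear (φᴹ j M)) (forth p)))))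
            where
            j∘k : ∀ a → frob k (frob j a) ≈ a
            j∘k a = trans (frob-∘ k j a) (trans (reflexive (≡.cong (λ m → frob m a) j+k≡6)) (frob-6 a))
            forth : ∀ {n} (p : Vector Carrier n) → φ j (φ k p) ≋ p
            forth p i = trans (frob-∘ j k (p i)) (trans (reflexive (≡.cong (λ m → frob m (p i)) (≡.trans (ℕ.+-comm k j) j+k≡6))) (frob-6 (p i)))
            back : ∀ x → φ k (φᴹ j M *ᵥ x) ≋ M *ᵥ φ k x
            back x = ≋-trans (φ-*ᵥ k (φᴹ j M) x) (*ᵥ-congˡ {M = φᴹ k (φᴹ j M)} {N = M} (λ i i′ → j∘k (M i i′)) (φ k x))
            φ-zero : ∀ {n} (x : Vector Carrier n) → φ k x ≋ 𝟎 → x ≋ 𝟎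
            φ-zero x eq i = frob-≈0 k (eq i)

          module CubicCase (E∈C⁺ : E ∈ C⁺) where

            open OnConic E∈C⁺
            module TwistedCubic = Cubic ρ ρ∈F ρ∉F₁ root₀ root₁
            open TwistedCubic hiding (N₃; R)
            open TwistedCubic public using (N₃; R)

            private
              γ₀ : Vector Carrier 3
              γ₀ = γ τ₀

              γ₀-rational : Rational 3 γ₀
              γ₀-rational = veronese-rational 3 2 τ₀ ρ∈F

              γ₀≉0 : ¬ (γ₀ ≋ 𝟎)
              γ₀≉0 = veronese-≉𝟎 2 τ₀

              ιE∼ : ι E ∼ e₀ γ₀
              ιE∼ = ι-∼ γ₀ E∼Nγ

              -- The exponents 1 and 2 add up to 3, which fixes γ₀ over F_{q³}. So h joins the first
              -- and third vertices of the scroll-plane over ρ, that is, it is the line b = 0 there.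
              φ2ι𝖼E∼ : φ 2 (ι (𝖼 1 E)) ∼ e₂ γ₀
              φ2ι𝖼E∼ = ∼-trans (φ2ι-∼ (φ 1 γ₀) (𝖼-∼ 1 γ₀ E∼Nγ)) (≋⇒∼ (Linear.cong e₂-linear (≋-trans (φ-∘ 2 1 γ₀) γ₀-rational)))

              tensor-line : ∀ a b → tensor τ₀ a 0# b ≋ a ⊙ e₀ γ₀ ⊕ b ⊙ e₂ γ₀
              tensor-line a b i = trans (tensor≋e τ₀ a 0# b i) (+-congʳ (trans (+-congˡ (zeroˡ _)) (+-identityʳ _)))

              h⇒OnLine : ∀ {v} → v ∈ h → OnLine₀ v
              h⇒OnLine (v∈Span , _) = let a , b , v≋ = Span-points₂ ιE∼ φ2ι𝖼E∼ v∈Span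
                                      in a , b , ≋-trans v≋ (≋-sym (tensor-line a b))

              OnLine⇒h : ∀ {v} → v ∈ PG 8 3 → OnLine₀ v → v ∈ h
              OnLine⇒h v∈PG (a , b , v≋) = points₂⊆Span ιE∼ φ2ι𝖼E∼ a b (≋-trans v≋ (tensor-line a b)) , v∈PG

              h^q⇒ : ∀ {v} → v ∈ h^q → v ∈ PG 8 3 × OnLine₁ v
              h^q⇒ (w , w∈h , v∼) = PG-resp 3 v∼ (PG-φ 1 3 (proj₂ w∈h)) , OnLine₁-∼ v∼ (φ-OnLine₀ (h⇒OnLine w∈h))

              h^q⇐ : ∀ {v} → v ∈ PG 8 3 → OnLine₁ v → v ∈ h^q
              h^q⇐ {v} v∈PG l = φ 5 v , OnLine⇒h (PG-φ 5 3 v∈PG) (OnLine₁⇒₀ l) , ≋⇒∼ (≋-sym (≋-trans (φ-∘ 1 5 v) (φ-6 v)))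

              h^q²⇒ : ∀ {v} → v ∈ h^q² → v ∈ PG 8 3 × OnLine₂ v
              h^q²⇒ (w , w∈h , v∼) = PG-resp 3 v∼ (PG-φ 2 3 (proj₂ w∈h)) ,
                OnLine₂-∼ (∼-trans v∼ (≋⇒∼ (≋-sym (φ-∘ 1 1 w)))) (φ-OnLine₁ (φ-OnLine₀ (h⇒OnLine w∈h)))

              h^q²⇐ : ∀ {v} → v ∈ PG 8 3 → OnLine₂ v → v ∈ h^q²
              h^q²⇐ {v} v∈PG l = φ 4 v , OnLine⇒h (PG-φ 4 3 v∈PG) (OnLine₂⇒₀ l) , ≋⇒∼ (≋-sym (≋-trans (φ-∘ 2 4 v) (φ-6 v)))

              ιE∈PG : ι E ∈ PG 8 3
              ιE∈PG = PG-*ᵥ 3 {M = G} IsBose-G.over IsBose-G.nonsingular (line⊆PG E∈ℓ∞)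

              ι𝖼E∈PG : ι (𝖼 1 E) ∈ PG 8 3
              ι𝖼E∈PG = PG-*ᵥ 3 {M = G} IsBose-G.over IsBose-G.nonsingular (line⊆PG 𝖼E∈ℓ∞)

              ιE∈g : ι E ∈ g
              ιE∈g = E , E∈ℓ∞ , ∼-refl

              ι𝖼E∈g : ι (𝖼 1 E) ∈ g
              ι𝖼E∈g = 𝖼 1 E , 𝖼E∈ℓ∞ , ∼-refl

              ιE∈h : ι E ∈ h
              ιE∈h = Span∋ {S = points (ι E ∷ φ 2 (ι (𝖼 1 E)) ∷ [])} (here ∼-refl) , ιE∈PG

              φ2ι𝖼E∈h : φ 2 (ι (𝖼 1 E)) ∈ h
              φ2ι𝖼E∈h = Span∋ {S = points (ι E ∷ φ 2 (ι (𝖼 1 E)) ∷ [])} (there (here ∼-refl)) , PG-φ 2 3 ι𝖼E∈PG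

              φ∘φ2-∼ : φ 1 (φ 2 (ι (𝖼 1 E))) ∼ ι (𝖼 1 E)
              φ∘φ2-∼ = ∼-trans (≋⇒∼ (φ-∘ 1 2 (ι (𝖼 1 E)))) (φ³-∼ ι𝖼E∈PG)

              φ2∘φ2-∼ : φ 2 (φ 2 (ι (𝖼 1 E))) ∼ φ 1 (ι (𝖼 1 E))
              φ2∘φ2-∼ = ∼-trans (≋⇒∼ (≋-sym (φ-∘ 1 1 (φ 2 (ι (𝖼 1 E)))))) (∼-φ 1 φ∘φ2-∼)

              on-h : Vector Carrier 2 → Vector Carrier 9
              on-h d = d 0F ⊙ e₀ γ₀ ⊕ d 1F ⊙ e₂ γ₀

              on-h-linear : Linear on-h
              on-h-linear = record
                { cong   = λ p → ⊕-cong (⊙-congˡ (e₀ γ₀) (p 0F)) (⊙-congˡ (e₂ γ₀) (p 1F))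
                ; homo-⊕ = λ x y k → solve 6 (λ x₁ x₂ y₁ y₂ a b → (x₁ :+ y₁) :* a :+ (x₂ :+ y₂) :* b := (x₁ :* a :+ x₂ :* b) :+ (y₁ :* a :+ y₂ :* b)) refl (x 0F) (x 1F) (y 0F) (y 1F) (e₀ γ₀ k) (e₂ γ₀ k)
                ; homo-⊙ = λ t x k → solve 5 (λ t x₁ x₂ a b → (t :* x₁) :* a :+ (t :* x₂) :* b := t :* (x₁ :* a :+ x₂ :* b)) refl t (x 0F) (x 1F) (e₀ γ₀ k) (e₂ γ₀ k) }

              e₀-rational : ∀ w → Rational 3 w → Rational 3 (e₀ w)
              e₀-rational w w-rational i = F-cong 3 (join-first w i) (*ᵥ-rational 3 {M = H} H-over w-rational i)

              e₂γ₀-rational : Rational 3 (e₂ γ₀)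
              e₂γ₀-rational i = F-cong 3 (trans (φ2-e₀ (φ 1 γ₀) i) (Linear.cong e₂-linear (≋-trans (φ-∘ 2 1 γ₀) γ₀-rational) i))
                (F-frob 2 3 (e₀-rational (φ 1 γ₀) (λ i → F-frob 1 3 (γ₀-rational i)) i))

              h-basis : Matrix 9 2
              h-basis = matrixOf on-h

              h-basis-over : h-basis Over 3
              h-basis-over i j = F-+ 3 (F-* 3 (δ-rational 3 j 0F) (e₀-rational γ₀ γ₀-rational i)) (F-* 3 (δ-rational 3 j 1F) (e₂γ₀-rational i))

              h-basis≋ : ∀ d → h-basis *ᵥ d ≋ tensor τ₀ (d 0F) 0# (d 1F)
              h-basis≋ d = ≋-trans (matrixOf-*ᵥ on-h-linear d) (≋-sym (tensor-line (d 0F) (d 1F)))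

              h-basis-nonsingular : Nonsingular h-basis
              h-basis-nonsingular d eq = entry
                where
                zeros = tensor-injective τ₀ (d 0F) 0# (d 1F) 0# 0# 0# (≋-trans (≋-sym (h-basis≋ d)) (≋-trans eq
                  (≋-sym (≋-trans (join-cong (0⊙ γ₀) (0⊙ γ₀) (0⊙ γ₀)) join-𝟎))))
                entry : d ≋ 𝟎
                entry 0F = proj₁ zeros
                entry 1F = proj₂ (proj₂ zeros)

              coefficients : Carrier → Carrier → Vector Carrier 2
              coefficients a b 0F = a
              coefficients a b 1F = b

              h-subspace : IsSubspace 3 1 h
              h-subspace = h-basis , h-basis-over , h-basis-nonsingular ,
                (λ v∈h → let a , b , v≋ = h⇒OnLine v∈h
                             v∼ = ≋⇒∼ (≋-trans v≋ (≋-sym (h-basis≋ (coefficients a b))))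
                         in coefficients a b , PG-preimage 3 {M = h-basis} h-basis-over h-basis-nonsingular (PG-resp 3 (∼-sym v∼) (proj₂ v∈h)) , v∼) ,
                λ (d , d∈PG , v∼) → OnLine⇒h (PG-resp 3 v∼ (PG-*ᵥ 3 {M = h-basis} h-basis-over h-basis-nonsingular d∈PG))
                  (OnLine₀-∼ v∼ (d 0F , d 1F , h-basis≋ d))

              ∞⇒Σ∞⋆ : ∀ {v} → v ∈ PG 8 3 → AtInfinity⁺ v → v ∈ ⟨ Σ∞ ⟩[ 3 ]
              ∞⇒Σ∞⋆ v∈PG v∈∞ = ⊆Span-Σ∞ v∈∞ , v∈PG

              e₂γ₀∈h : e₂ γ₀ ∈ h
              e₂γ₀∈h = OnLine⇒h (PG-resp 3 (∼-sym φ2ι𝖼E∼) (PG-φ 2 3 ι𝖼E∈PG)) (0# , 1# , ≋-sym (join-cong (0⊙ γ₀) (0⊙ γ₀) (1⊙ γ₀)))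

              e₀γ₀∈h : e₀ γ₀ ∈ h
              e₀γ₀∈h = OnLine⇒h (PG-resp 3 (∼-sym ιE∼) ιE∈PG) (1# , 0# , ≋-sym (join-cong (1⊙ γ₀) (0⊙ γ₀) (0⊙ γ₀)))

            h-TLine : IsTLine h
            h-TLine = h-subspace , (λ v∈h → ∞⇒Σ∞⋆ (proj₂ v∈h) (OnLine₀⇒∞ (h⇒OnLine v∈h))) ,
              inj₂ (inj₁ ((ι E , ιE∈h , ιE∈g) , (φ 2 (ι (𝖼 1 E)) , φ2ι𝖼E∈h , ι (𝖼 1 E) , ι𝖼E∈g , ∼-refl)))

            h^q-TLine : IsTLine h^q
            h^q-TLine = IsSubspace-φ 1 5 ≡.refl h-subspace , (λ v∈ → let v∈PG , l = h^q⇒ v∈ in ∞⇒Σ∞⋆ v∈PG (OnLine₁⇒∞ l)) ,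
              inj₁ ( (φ 1 (φ 2 (ι (𝖼 1 E))) , (φ 2 (ι (𝖼 1 E)) , φ2ι𝖼E∈h , ∼-refl) , 𝖼 1 E , 𝖼E∈ℓ∞ , φ∘φ2-∼)
                   , (φ 1 (ι E) , (ι E , ιE∈h , ∼-refl) , ι E , ιE∈g , ∼-refl) )

            h^q²-TLine : IsTLine h^q²
            h^q²-TLine = IsSubspace-φ 2 4 ≡.refl h-subspace , (λ v∈ → let v∈PG , l = h^q²⇒ v∈ in ∞⇒Σ∞⋆ v∈PG (OnLine₂⇒∞ l)) ,
              inj₂ (inj₂ ( (φ 2 (φ 2 (ι (𝖼 1 E))) , (φ 2 (ι (𝖼 1 E)) , φ2ι𝖼E∈h , ∼-refl) , ι (𝖼 1 E) , ι𝖼E∈g , φ2∘φ2-∼)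
                         , (φ 2 (ι E) , (ι E , ιE∈h , ∼-refl) , ι E , ιE∈g , ∼-refl) ))

            private
              ≋0⊙⇒𝟎 : ∀ {w z : Vector Carrier 3} → w ≋ 0# ⊙ z → w ≋ 𝟎
              ≋0⊙⇒𝟎 {z = z} eq = ≋-trans eq (0⊙ z)

            -- The line h contains a point with only a third component, whereas every point of h^q
            -- has third component zero.
            h≢h^q : ¬ (h ≐ h^q)
            h≢h^q (h⊆ , _) =
              let _ , a , b , eq = h^q⇒ (h⊆ e₂γ₀∈h)
                  _ , _ , γ₀≋ = join-injective 𝟎 𝟎 γ₀ (a ⊙ γ τ₁) (b ⊙ γ τ₁) (0# ⊙ γ τ₁) eq
              in γ₀≉0 (≋0⊙⇒𝟎 {z = γ τ₁} γ₀≋)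

            h≢h^q² : ¬ (h ≐ h^q²)
            h≢h^q² (h⊆ , _) =
              let _ , b , d , eq = h^q²⇒ (h⊆ e₀γ₀∈h)
                  γ₀≋ , _ = join-injective γ₀ 𝟎 𝟎 (0# ⊙ γ τ₂) (b ⊙ γ τ₂) (d ⊙ γ τ₂) eq
              in γ₀≉0 (≋0⊙⇒𝟎 {z = γ τ₂} γ₀≋)

            h^q≢h^q² : ¬ (h^q ≐ h^q²)
            h^q≢h^q² (h^q⊆ , _) =
              let _ , b , d , eq = h^q²⇒ (h^q⊆ (e₂ γ₀ , e₂γ₀∈h , ∼-refl))
                  φγ₀≋ , _ = join-injective (φ 1 γ₀) (φ 1 𝟎) (φ 1 𝟎) (0# ⊙ γ τ₂) (b ⊙ γ τ₂) (d ⊙ γ τ₂) (≋-trans (≋-sym (φ-join 𝟎 𝟎 γ₀)) eq)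
              in φ-≉𝟎 1 γ₀≉0 (≋0⊙⇒𝟎 {z = γ τ₂} φγ₀≋)

            𝒱[C]≐ : Variety 1 𝒱 ∩ Σ₆ ≐ curve 1 N₃
            𝒱[C]≐ = (λ v∈ → section⇒curve (section₁ v∈)) , λ v∈ → section₁⁻¹ (curve⇒section 1 v∈)

            𝒱[C]⋆∩Σ∞⋆≐ : (Variety 3 𝒱 ∩ ⟨ Σ₆ ⟩[ 3 ]) ∩ ⟨ Σ∞ ⟩[ 3 ] ≐ h ∪ h^q ∪ h^q²
            𝒱[C]⋆∩Σ∞⋆≐ = (λ (v∈ , v∈∞) → by-line (proj₂ v∈∞) (section∩∞⇒OnLine (section₃ v∈) (Σ∞-extension {3} v∈∞))) ,
              λ { (inj₁ v∈h)          → both (proj₂ v∈h) (OnLine₀⇒section (proj₂ v∈h) (h⇒OnLine v∈h))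
                ; (inj₂ (inj₁ v∈h^q)) → let v∈PG , l = h^q⇒ v∈h^q in both v∈PG (OnLine₁⇒section v∈PG l)
                ; (inj₂ (inj₂ v∈h^q²)) → let v∈PG , l = h^q²⇒ v∈h^q² in both v∈PG (OnLine₂⇒section v∈PG l) }
              where
              by-line : ∀ {v} → v ∈ PG 8 3 → OnLine₀ v ⊎ OnLine₁ v ⊎ OnLine₂ v → v ∈ h ∪ h^q ∪ h^q²
              by-line v∈PG (inj₁ l)        = inj₁ (OnLine⇒h v∈PG l)
              by-line v∈PG (inj₂ (inj₁ l)) = inj₂ (inj₁ (h^q⇐ v∈PG l))
              by-line v∈PG (inj₂ (inj₂ l)) = inj₂ (inj₂ (h^q²⇐ v∈PG l))
              both : ∀ {v} → v ∈ PG 8 3 → VarietySection 3 v × AtInfinity⁺ v → v ∈ (Variety 3 𝒱 ∩ ⟨ Σ₆ ⟩[ 3 ]) ∩ ⟨ Σ∞ ⟩[ 3 ]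
              both v∈PG (v∈ , v∈∞) = section₃⁻¹ v∈ , ∞⇒Σ∞⋆ v∈PG v∈∞

            R∈h : R ∈ h
            R∈h = OnLine⇒h (curve⊆PG 3 N₃ R∈curve) R-OnLine

            N₃∩Σ∞⋆≐ : curve 3 N₃ ∩ ⟨ Σ∞ ⟩[ 3 ] ≐ points (R ∷ φ 1 R ∷ φ 2 R ∷ [])
            N₃∩Σ∞⋆≐ = (λ (v∈ , v∈∞) → curve∩∞⇒points {R} ≋-refl {3} v∈ (Σ∞-extension {3} v∈∞)) ,
              λ v∈ → let v∈N₃ , v∈∞ = points⇒curve∩∞ {R} ≋-refl v∈ in v∈N₃ , ∞⇒Σ∞⋆ (curve⊆PG 3 N₃ v∈N₃) v∈∞

            R∉spreadPlane : ∀ X → X ∈ g → R ∉ spreadPlane 3 X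
            R∉spreadPlane X (x , _ , X∼ιx) (R∈Span , _) =
              let y , x≋ = preimage x
                  x∼ = ≋⇒∼ x≋
                  a , b , d , R≋ = Span-points₃ (∼-trans X∼ιx (ι-∼ y x∼)) (∼-trans (∼-φ 1 X∼ιx) (φι-∼ y x∼)) (∼-trans (∼-φ 2 X∼ιx) (φ2ι-∼ y x∼)) R∈Span
              in R∉conjugate-span y a b d (≋-trans R≋ (≋-sym (≋-trans (join≋e (a ⊙ y) (b ⊙ φ 1 y) (d ⊙ φ 2 y))
                   (⊕-cong (⊕-cong (Linear.homo-⊙ e₀-linear a y) (Linear.homo-⊙ e₁-linear b (φ 1 y))) (Linear.homo-⊙ e₂-linear d (φ 2 y))))))

          module SexticCase (E∉C⁺ : ¬ (E ∈ C⁺)) where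

            open OffConic E∉C⁺
            module NormalSextic = Sextic coprime₀₁ coprime₁₂ coprime₂₀
            open NormalSextic hiding (N₆)
            open NormalSextic public using (N₆)
            open Splits u-splits using (a₂≉0; a₁≈; root-α; root-β; roots)
            open Splits u-splits public using (α; β)

            P̄ Q̄ : Vector Carrier 3
            P̄ = N *ᵥ γ (just α)
            Q̄ = N *ᵥ γ (just β)

            P Q : Vector Carrier 9
            P = ι P̄
            Q = ι Q̄

            sixPoints : PointSet 8
            sixPoints = points (P ∷ φ 1 P ∷ φ 2 P ∷ Q ∷ φ 1 Q ∷ φ 2 Q ∷ [])

            private
              P≋ : P ≋ H *ᵥ γ (just α)
              P≋ = ≋-sym (H≋ (γ (just α)))

              Q≋ : Q ≋ H *ᵥ γ (just β)
              Q≋ = ≋-sym (H≋ (γ (just β)))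

              Span-ℓ∞⇒ : ∀ {v} → v ∈ Span ℓ∞ → ∃ λ y → v ≋ N *ᵥ y × dot u y ≈ 0#
              Span-ℓ∞⇒ = Span⊆ {S = ℓ∞} T-subspace λ {v} v∈ℓ∞ →
                let y , v≋ = preimage v in y , v≋ , line-equation-∼ y (≋⇒∼ v≋) v∈ℓ∞
                where
                T-subspace : IsLinearSubspace (λ v → ∃ λ y → v ≋ N *ᵥ y × dot u y ≈ 0#)
                T-subspace = record
                  { resp = λ v≋v′ (y , eq , p) → y , ≋-trans (≋-sym v≋v′) eq , p
                  ; ∋𝟎   = 𝟎 , ≋-sym (Linear.homo-𝟎 (*ᵥ-linear N)) , dot-𝟎 u
                  ; ∋⊕   = λ (y , eq , p) (y′ , eq′ , p′) → y ⊕ y′ , ≋-trans (⊕-cong eq eq′) (≋-sym (Linear.homo-⊕ (*ᵥ-linear N) y y′)) , Ker.∋⊕ {y} {y′} p p′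
                  ; ∋⊙   = λ a (y , eq , p) → a ⊙ y , ≋-trans (⊙-congʳ a eq) (≋-sym (Linear.homo-⊙ (*ᵥ-linear N) a y)) , Ker.∋⊙ a {y} p }
                  where module Ker = IsLinearSubspace (dot-kernel u)

              Span-line : ∀ {p n} {T : Vector Carrier n → Set p} → IsLinearSubspace T → ∀ {f : Vector Carrier 3 → Vector Carrier n} → Linear f →
                          T (f b₀) → T (f b₁) → ∀ y → dot u y ≈ 0# → T (f y)
              Span-line T-subspace f-linear t₀ t₁ y uy≈0 =
                let s , t , y≋ = b-spans y uy≈0
                in resp (≋-sym (≋-trans (Linear.cong f-linear y≋) (≋-trans (Linear.homo-⊕ f-linear (s ⊙ b₀) (t ⊙ b₁))
                     (⊕-cong (Linear.homo-⊙ f-linear s b₀) (Linear.homo-⊙ f-linear t b₁))))) (∋⊕ (∋⊙ s t₀) (∋⊙ t t₁))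
                where open IsLinearSubspace T-subspace

              -- By Vieta the sum is -u₁/u₂. Hence α and β lie in F_{q³} together or not at all.
              α+β∈F : (α + β) ∈ F 3
              α+β∈F =
                let r , ar≈1 = inverse (u 2F) a₂≉0
                in F-cong 3 (trans (-‿cong (trans (*-congʳ a₁≈) (solve 3 (λ k s r → k :* (:- s) :* r := :- s :* (k :* r)) refl (u 2F) (α + β) r)))
                     (trans (-‿cong (*-congˡ ar≈1)) (solve 1 (λ s → :- (:- s :* con (ℤ.+ 1)) := s) refl (α + β))))
                     (F-neg 3 (F-* 3 (u-rational 1F) (F-inverse 3 (u-rational 2F) ar≈1)))

              β∈F⇒α∈F : β ∈ F 3 → α ∈ F 3
              β∈F⇒α∈F β∈F = F-cong 3 (solve 2 (λ a b → (a :+ b) :- b := a) refl α β) (F-sub 3 α+β∈F β∈F)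

              α∈F⇒β∈F : α ∈ F 3 → β ∈ F 3
              α∈F⇒β∈F α∈F = F-cong 3 (solve 2 (λ a b → (a :+ b) :- a := b) refl α β) (F-sub 3 α+β∈F α∈F)

              at-root : ∀ θ η {v} → θ ≈ η → v ∼ N *ᵥ γ (just θ) → v ∼ N *ᵥ γ (just η)
              at-root θ η θ≈η v∼ = ∼-trans v∼ (≋⇒∼ (Linear.cong (*ᵥ-linear N) (veronese-cong 2 θ≈η)))

              on-conic-and-line : ∀ τ {v} → v ∼ N *ᵥ γ τ → x τ ≈ 0# → v ∈ points (P̄ ∷ Q̄ ∷ [])
              on-conic-and-line nothing  v∼ x≈0 = contradiction x≈0 ∞-not-on-line
              on-conic-and-line (just θ) {v} v∼ x≈0 = by-root (roots θ x≈0)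
                where
                by-root : θ ≈ α ⊎ θ ≈ β → v ∈ points (P̄ ∷ Q̄ ∷ [])
                by-root (inj₁ θ≈) = here (at-root θ α θ≈ v∼)
                by-root (inj₂ θ≈) = there (here (at-root θ β θ≈ v∼))

              Nγ≉0 : ∀ θ → ¬ (N *ᵥ γ (just θ) ≋ 𝟎)
              Nγ≉0 θ = nonsingular-≉𝟎 {M = N} N-nonsingular (veronese-≉𝟎 2 (just θ))

              Nγ∈PG : ∀ θ → θ ∈ F 3 → N *ᵥ γ (just θ) ∈ PG 2 3
              Nγ∈PG θ θ∈F = PG-*ᵥ 3 {M = N} N-over N-nonsingular (rational⇒PG 3 (veronese-≉𝟎 2 (just θ)) (veronese-rational 3 2 (just θ) θ∈F))

              Nγ∈ℓ∞ : ∀ θ → θ ∈ F 3 → x (just θ) ≈ 0# → N *ᵥ γ (just θ) ∈ ℓ∞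
              Nγ∈ℓ∞ θ θ∈F x≈0 = ∈line (γ (just θ)) (Nγ∈PG θ θ∈F) x≈0

              rational-root : ∀ θ {v} → v ∼ N *ᵥ γ (just θ) → v ∈ PG 2 3 → θ ∈ F 3
              rational-root θ v∼ v∈PG = γ∈PG⇒parameter θ (PG-preimage 3 {M = N} N-over N-nonsingular (PG-resp 3 (∼-sym v∼) v∈PG))

            C⁺⁺∩ℓ∞≐ : C⁺⁺ ∩ ⟨ ℓ∞ ⟩[ 6 ] ≐ points (P̄ ∷ Q̄ ∷ [])
            C⁺⁺∩ℓ∞≐ = (λ { (v∈C⁺⁺ , v∈Span , _) →
                let τ , _ , v∼ = ParametrisedBy.parameter C⁺⁺-parametrised v∈C⁺⁺
                    y , v≋ , uy≈0 = Span-ℓ∞⇒ v∈Span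
                    y∼γ = nonsingular-∼ {M = N} N-nonsingular y (γ τ) (∼-trans (≋⇒∼ (≋-sym v≋)) v∼)
                in on-conic-and-line τ v∼ (dot-∼ u {γ τ} {y} (∼-sym y∼γ) uy≈0) }) ,
              λ { (here v∼) → point α root-α v∼ ; (there (here v∼)) → point β root-β v∼ }
              where
              point : ∀ θ → x (just θ) ≈ 0# → ∀ {v} → v ∼ N *ᵥ γ (just θ) → v ∈ C⁺⁺ ∩ ⟨ ℓ∞ ⟩[ 6 ]
              point θ x≈0 v∼ = ParametrisedBy.point C⁺⁺-parametrised (just θ) (frob-6 θ) v∼ ,
                ∼-subspace (Span-subspace {S = ℓ∞}) v∼ (Span-line (Span-subspace {S = ℓ∞}) (*ᵥ-linear N)
                  (Span∋ {S = ℓ∞} (N-b∈ℓ∞ b₀ b₀-rational b₀≉0 ub₀≈0)) (Span∋ {S = ℓ∞} (N-b∈ℓ∞ b₁ b₁-rational b₁≉0 ub₁≈0)) (γ (just θ)) x≈0) ,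
                PG-6 (∼-≉𝟎 v∼ (Nγ≉0 θ))

            -- The images of ℓ∞ under 𝖼 and its square have the equations u′ and u″, so a carrier is
            -- a common zero of two of the three forms. Coprimality allows none on the conic.
            Nγ∉IsCarrier : ∀ θ → N *ᵥ γ (just θ) ∉ IsCarrier
            Nγ∉IsCarrier θ = λ
              { (inj₁ (∈ℓ , ∈𝖼ℓ))          → coprime₀₁ τ (line-equation (γ τ) ∈ℓ) (on-𝖼¹ ∈𝖼ℓ)
              ; (inj₂ (inj₁ (∈ℓ , ∈𝖼²ℓ)))  → coprime₂₀ τ (on-𝖼² ∈𝖼²ℓ) (line-equation (γ τ) ∈ℓ)
              ; (inj₂ (inj₂ (∈𝖼ℓ , ∈𝖼²ℓ))) → coprime₁₂ τ (on-𝖼¹ ∈𝖼ℓ) (on-𝖼² ∈𝖼²ℓ) }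
              where
              τ : Maybe Carrier
              τ = just θ
              on-𝖼¹ : N *ᵥ γ τ ∈ image (𝖼 1) ℓ∞ → y τ ≈ 0#
              on-𝖼¹ (X , X∈ℓ∞ , Nγ∼) =
                let w , X≋ = preimage X
                in dot-∼ u′ {γ τ} {φ 1 w} (nonsingular-∼ {M = N} N-nonsingular (γ τ) (φ 1 w) (∼-trans Nγ∼ (𝖼-∼ 1 w (≋⇒∼ X≋)))) (dot-φ₁ w (line-equation-∼ w (≋⇒∼ X≋) X∈ℓ∞))
              on-𝖼² : N *ᵥ γ τ ∈ image (𝖼 2) ℓ∞ → z τ ≈ 0#
              on-𝖼² (X , X∈ℓ∞ , Nγ∼) =
                let w , X≋ = preimage X
                in dot-∼ u″ {γ τ} {φ 2 w} (nonsingular-∼ {M = N} N-nonsingular (γ τ) (φ 2 w) (∼-trans Nγ∼ (𝖼-∼ 2 w (≋⇒∼ X≋)))) (dot-φ₂ w (line-equation-∼ w (≋⇒∼ X≋) X∈ℓ∞))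

            𝒱[C]≐ : Variety 1 𝒱 ∩ Σ₆ ≐ curve 1 N₆
            𝒱[C]≐ = (λ v∈ → section⇒curve 1 (section₁ v∈)) , λ v∈ → section₁⁻¹ (curve⇒section 1 v∈)

            𝒱[C]⋆≐ : Variety 3 𝒱 ∩ ⟨ Σ₆ ⟩[ 3 ] ≐ curve 3 N₆
            𝒱[C]⋆≐ = (λ v∈ → section⇒curve 3 (section₃ v∈)) , λ v∈ → section₃⁻¹ (curve⇒section 3 v∈)

            -- Stated for a variable field because the six points are visible over F_{q³} only when
            -- α and β lie there; otherwise k = 6 is needed.
            N₆∩∞≐ : ∀ k → α ∈ F k → β ∈ F k → curve k N₆ ∩ ⟨ Σ∞ ⟩[ k ] ≐ sixPoints
            N₆∩∞≐ k α∈F β∈F = (λ (v∈ , v∈∞) → curve∩∞⇒points {P} {Q} P≋ Q≋ k v∈ (Σ∞-extension {k} v∈∞)) ,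
              λ v∈ → let v∈N₆ , v∈∞ = points⇒curve∩∞ {P} {Q} P≋ Q≋ k α∈F β∈F v∈ in v∈N₆ , ⊆Span-Σ∞ v∈∞ , curve⊆PG k N₆ v∈N₆

            RationalRoots ConjugateRoots : Set _
            RationalRoots  = C⁺ ∩ ℓ∞ ≐ points (P̄ ∷ Q̄ ∷ []) × P ∈ g × Q ∈ g × curve 3 N₆ ∩ ⟨ Σ∞ ⟩[ 3 ] ≐ sixPoints
            ConjugateRoots = Empty (C⁺ ∩ ℓ∞) × P ∈ ⟨ g ⟩[ 6 ] × P ∉ g × Q ∈ ⟨ g ⟩[ 6 ] × Q ∉ g × Q ∼ φ 3 P × curve 6 N₆ ∩ ⟨ Σ∞ ⟩[ 6 ] ≐ sixPoints

            private
              C⁺∩ℓ∞⇒ : ∀ {v} → v ∈ C⁺ ∩ ℓ∞ → v ∈ points (P̄ ∷ Q̄ ∷ [])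
              C⁺∩ℓ∞⇒ (v∈C⁺ , v∈ℓ∞) = let τ , _ , v∼ = ParametrisedBy.parameter C⁺-parametrised v∈C⁺
                                      in on-conic-and-line τ v∼ (line-equation-∼ (γ τ) v∼ v∈ℓ∞)

              on-C⁺∩ℓ∞ : ∀ θ → θ ∈ F 3 → x (just θ) ≈ 0# → ∀ {v} → v ∼ N *ᵥ γ (just θ) → v ∈ C⁺ ∩ ℓ∞
              on-C⁺∩ℓ∞ θ θ∈F x≈0 v∼ = ParametrisedBy.point C⁺-parametrised (just θ) θ∈F v∼ , line-resp v∼ (Nγ∈ℓ∞ θ θ∈F x≈0)

              C⁺∩ℓ∞⇐ : α ∈ F 3 → β ∈ F 3 → ∀ {v} → v ∈ points (P̄ ∷ Q̄ ∷ []) → v ∈ C⁺ ∩ ℓ∞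
              C⁺∩ℓ∞⇐ α∈F β∈F (here v∼)         = on-C⁺∩ℓ∞ α α∈F root-α v∼
              C⁺∩ℓ∞⇐ α∈F β∈F (there (here v∼)) = on-C⁺∩ℓ∞ β β∈F root-β v∼

              ιN∈g : ∀ θ → θ ∈ F 3 → x (just θ) ≈ 0# → ι (N *ᵥ γ (just θ)) ∈ g
              ιN∈g θ θ∈F x≈0 = N *ᵥ γ (just θ) , Nγ∈ℓ∞ θ θ∈F x≈0 , ∼-refl {x = ι (N *ᵥ γ (just θ))}

              rational : α ∈ F 3 → β ∈ F 3 → RationalRoots
              rational α∈F β∈F =
                ((λ {v} → C⁺∩ℓ∞⇒ {v}) , λ {v} → C⁺∩ℓ∞⇐ α∈F β∈F {v}) , ιN∈g α α∈F root-α , ιN∈g β β∈F root-β , N₆∩∞≐ 3 α∈F β∈F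

              at-parameter : ¬ (α ∈ F 3) → ¬ (β ∈ F 3) → ∀ τ → Parameter 3 τ → ¬ (x τ ≈ 0#)
              at-parameter α∉F β∉F nothing  _   x≈0 = ∞-not-on-line x≈0
              at-parameter α∉F β∉F (just θ) θ∈F x≈0 = [ (λ θ≈α → α∉F (F-cong 3 θ≈α θ∈F)) , (λ θ≈β → β∉F (F-cong 3 θ≈β θ∈F)) ] (roots θ x≈0)

              empty : ¬ (α ∈ F 3) → ¬ (β ∈ F 3) → ∀ {v} → v ∈ C⁺ → ¬ (v ∈ ℓ∞)
              empty α∉F β∉F v∈C⁺ v∈ℓ∞ =
                let τ , τ∈F , v∼ = ParametrisedBy.parameter C⁺-parametrised v∈C⁺
                in at-parameter α∉F β∉F τ τ∈F (line-equation-∼ (γ τ) v∼ v∈ℓ∞)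

              in-g : ∀ θ → x (just θ) ≈ 0# → ι (N *ᵥ γ (just θ)) ∈ ⟨ g ⟩[ 6 ]
              in-g θ x≈0 =
                IsLinearSubspace.resp (Span-subspace {S = g}) (≋-sym (ι-N (γ (just θ)))) (Span-line (Span-subspace {S = g}) e₀-linear
                  (Span∋ {S = g} (ι-b∈g b₀ b₀-rational b₀≉0 ub₀≈0)) (Span∋ {S = g} (ι-b∈g b₁ b₁-rational b₁≉0 ub₁≈0)) (γ (just θ)) x≈0) ,
                PG-6 (nonsingular-≉𝟎 {M = G} IsBose-G.nonsingular (Nγ≉0 θ))

              not-in-g : ∀ θ → ¬ (θ ∈ F 3) → ι (N *ᵥ γ (just θ)) ∉ g
              not-in-g θ θ∉F (X , X∈ℓ∞ , ιNγ∼ιX) = θ∉F (rational-root θ {X}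
                (∼-sym (nonsingular-∼ {M = G} IsBose-G.nonsingular (N *ᵥ γ (just θ)) X ιNγ∼ιX)) (line⊆PG X∈ℓ∞))

              conjugate-root : ∀ θ → x (just θ) ≈ 0# → x (just (frob 3 θ)) ≈ 0#
              conjugate-root θ xθ≈0 = trans (dot-cong {u} {φ 3 u} {γ (just (frob 3 θ))} {φ 3 (γ (just θ))} (≋-sym u-rational) (veronese-φ 3 2 θ))
                (trans (sym (frob-dot 3 u (γ (just θ)))) (trans (frob-cong 3 xθ≈0) (frob-0 3)))

              -- The q³-th power of α is again a root of u, whose coefficients it leaves fixed; so
              -- it is α or β.
              conjugate-of-α : α ∈ F 3 ⊎ β ≈ frob 3 α
              conjugate-of-α = by-root (roots (frob 3 α) (conjugate-root α root-α))
                where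
                by-root : frob 3 α ≈ α ⊎ frob 3 α ≈ β → α ∈ F 3 ⊎ β ≈ frob 3 α
                by-root (inj₁ eq) = inj₁ eq
                by-root (inj₂ eq) = inj₂ (sym eq)

              ιNγ-φ : ∀ θ η → η ≈ frob 3 θ → ι (N *ᵥ γ (just η)) ≋ φ 3 (ι (N *ᵥ γ (just θ)))
              ιNγ-φ θ η η≈ = ≋-trans (Linear.cong (*ᵥ-linear G) Nγη≋) (≋-sym (φ-*ᵥ-over 3 {M = G} IsBose-G.over (N *ᵥ γ (just θ))))
                where
                Nγη≋ : N *ᵥ γ (just η) ≋ φ 3 (N *ᵥ γ (just θ))
                Nγη≋ = ≋-trans (Linear.cong (*ᵥ-linear N) (≋-trans (veronese-cong 2 η≈) (veronese-φ 3 2 θ))) (≋-sym (φ-*ᵥ-over 3 {M = N} N-over (γ (just θ))))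

              conjugate : ¬ (α ∈ F 3) → ¬ (β ∈ F 3) → β ≈ frob 3 α → ConjugateRoots
              conjugate α∉F β∉F β≈ = (λ v (v∈C⁺ , v∈ℓ∞) → empty α∉F β∉F {v} v∈C⁺ v∈ℓ∞) ,
                in-g α root-α , not-in-g α α∉F , in-g β root-β , not-in-g β β∉F , ≋⇒∼ {x = Q} {φ 3 P} (ιNγ-φ α β β≈) , N₆∩∞≐ 6 (frob-6 α) (frob-6 β)

            intersection : RationalRoots ⊎ ConjugateRoots
            intersection = by-α (F? 3 α) conjugate-of-α
              where
              by-α : Dec (α ∈ F 3) → α ∈ F 3 ⊎ β ≈ frob 3 α → RationalRoots ⊎ ConjugateRoots
              by-α (yes α∈F) _          = inj₁ (rational α∈F (α∈F⇒β∈F α∈F))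
              by-α (no α∉F) (inj₁ α∈F)  = contradiction α∈F α∉F
              by-α (no α∉F) (inj₂ β≈)   = inj₂ (conjugate α∉F (λ β∈F → α∉F (β∈F⇒α∈F β∈F)) β≈)

          conclusion :
            (C⁺ ∩ ℓ∞ ≐ points (E ∷ 𝖼 1 E ∷ []) →
              ∃ λ (N₃ : NormalRationalCurve 8 3) →
                (Variety 1 𝒱 ∩ Σ₆) ≐ curve 1 N₃ ×
                IsTLine h × IsTLine h^q × IsTLine h^q² ×
                ¬ (h ≐ h^q) × ¬ (h ≐ h^q²) × ¬ (h^q ≐ h^q²) ×
                (Variety 3 𝒱 ∩ ⟨ Σ₆ ⟩[ 3 ]) ∩ ⟨ Σ∞ ⟩[ 3 ] ≐ h ∪ h^q ∪ h^q² ×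
                ∃ λ R →
                  R ∈ h ×
                  curve 3 N₃ ∩ ⟨ Σ∞ ⟩[ 3 ] ≐ points (R ∷ φ 1 R ∷ φ 2 R ∷ []) ×
                  (∀ X → X ∈ g → R ∉ spreadPlane 3 X))
            ×
            (¬ (C⁺ ∩ ℓ∞ ≐ points (E ∷ 𝖼 1 E ∷ [])) →
              ∃₂ λ (P̄ Q̄ : Vector Carrier 3) →
                let P = ι P̄
                    Q = ι Q̄
                    sixPoints = points (P ∷ φ 1 P ∷ φ 2 P ∷ Q ∷ φ 1 Q ∷ φ 2 Q ∷ [])
                in
                C⁺⁺ ∩ ⟨ ℓ∞ ⟩[ 6 ] ≐ points (P̄ ∷ Q̄ ∷ []) ×
                P̄ ∉ IsCarrier × Q̄ ∉ IsCarrier ×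
                ∃ λ (N₆ : NormalRationalCurve 8 6) →
                  (Variety 1 𝒱 ∩ Σ₆) ≐ curve 1 N₆ ×
                  (Variety 3 𝒱 ∩ ⟨ Σ₆ ⟩[ 3 ]) ≐ curve 3 N₆ ×
                  ((C⁺ ∩ ℓ∞ ≐ points (P̄ ∷ Q̄ ∷ []) ×
                    P ∈ g × Q ∈ g ×
                    curve 3 N₆ ∩ ⟨ Σ∞ ⟩[ 3 ] ≐ sixPoints)
                   ⊎
                   (Empty (C⁺ ∩ ℓ∞) ×
                    P ∈ ⟨ g ⟩[ 6 ] × P ∉ g × Q ∈ ⟨ g ⟩[ 6 ] × Q ∉ g ×
                    Q ∼ φ 3 P ×
                    curve 6 N₆ ∩ ⟨ Σ∞ ⟩[ 6 ] ≐ sixPoints)))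
          conclusion =
            (λ carriers → let E∈C⁺ = proj₁ (proj₂ carriers (here ∼-refl)) in
              CubicCase.N₃ E∈C⁺ , CubicCase.𝒱[C]≐ E∈C⁺ , CubicCase.h-TLine E∈C⁺ , CubicCase.h^q-TLine E∈C⁺ , CubicCase.h^q²-TLine E∈C⁺ ,
              CubicCase.h≢h^q E∈C⁺ , CubicCase.h≢h^q² E∈C⁺ , CubicCase.h^q≢h^q² E∈C⁺ , CubicCase.𝒱[C]⋆∩Σ∞⋆≐ E∈C⁺ ,
              CubicCase.R E∈C⁺ , CubicCase.R∈h E∈C⁺ , CubicCase.N₃∩Σ∞⋆≐ E∈C⁺ , CubicCase.R∉spreadPlane E∈C⁺) ,
            -- By contraposition E is not on C⁺, since E ∈ C⁺ already makes the intersection equal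
            -- to the two carriers.
            (λ not-carriers → let E∉C⁺ = λ E∈C⁺ → not-carriers (OnConic.C⁺∩ℓ∞ E∈C⁺) in
              SexticCase.P̄ E∉C⁺ , SexticCase.Q̄ E∉C⁺ , SexticCase.C⁺⁺∩ℓ∞≐ E∉C⁺ ,
              SexticCase.Nγ∉IsCarrier E∉C⁺ (SexticCase.α E∉C⁺) , SexticCase.Nγ∉IsCarrier E∉C⁺ (SexticCase.β E∉C⁺) ,
              SexticCase.N₆ E∉C⁺ , SexticCase.𝒱[C]≐ E∉C⁺ , SexticCase.𝒱[C]⋆≐ E∉C⁺ , SexticCase.intersection E∉C⁺)

  -- Assembling the configuration from the given data

  module Main where

    open Projective
    open Subfields
    open LinearAlgebra using (≋-trans; Span∋)
    open Coordinates
    open Ambient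
    open Core

    module _
      (ℓ∞ : PointSet 2) (ℓ∞-line : IsSubspace 3 1 ℓ∞)
      (π : PointSet 2) (π∩ℓ∞-empty : Empty (π ∩ ℓ∞))
      (B : Matrix 3 3) (B-conjugation : IsConjugation π B)
      (C C⁺ C⁺⁺ : PointSet 2) (C-conic : IsConicOf π C)
      (C⁺-conic : IsConic 3 C⁺) (C⊆C⁺ : C ⊆ C⁺) (C⁺⁺-conic : IsConic 6 C⁺⁺) (C⁺⊆C⁺⁺ : C⁺ ⊆ C⁺⁺)
      (G : Matrix 9 3) (G-Bose : Bose.IsBose G)
      (Σ₆ : PointSet 8) (Σ₆-subspace : IsSubspace 1 6 Σ₆) (Σ∞⊆Σ₆ : Bose.AtInfinity.Σ∞ G ℓ∞ ⊆ Σ₆) where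

      abstract
        frame : Frame π C
        frame = conicOf⇒frame C-conic

      open Frame frame

      abstract
        line₀ : LineEquation ℓ∞ N
        line₀ = lineEquation ℓ∞-line over nonsingular

        C⁺-parametrised : ParametrisedBy 3 N C⁺
        C⁺-parametrised = conic-extends 3 frame over C⁺-conic C⊆C⁺

        C⁺⁺-parametrised : ParametrisedBy 6 N C⁺⁺
        C⁺⁺-parametrised = conic-extends 6 frame (λ i j → frob-6 _) C⁺⁺-conic (λ x∈C → C⁺⊆C⁺⁺ (C⊆C⁺ x∈C))

        B-frame : ∀ y → B *ᵥ φ 1 (N *ᵥ y) ∼ N *ᵥ φ 1 y
        B-frame = conjugation-frame B N nonsingular λ y y∈F y≉0 → IsConjugation.fixes B-conjugation (N *ᵥ y) (rational∈π y y∈F y≉0)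

        rational∉ℓ∞ : ∀ y → Rational 1 y → ¬ (y ≋ 𝟎) → ¬ (N *ᵥ y ∈ ℓ∞)
        rational∉ℓ∞ y y∈F y≉0 Ny∈ℓ∞ = π∩ℓ∞-empty (N *ᵥ y) (rational∈π y y∈F y≉0 , Ny∈ℓ∞)

      model : Model
      model = record
        { N = N ; N-over = over ; N-nonsingular = nonsingular ; ℓ∞ = ℓ∞ ; rational∉ℓ∞ = rational∉ℓ∞ ; G = G ; G-Bose = G-Bose }

      module Σ = Representation.OnLine.HyperplaneOf model line₀ Σ₆ Σ₆-subspace Σ∞⊆Σ₆

      -- The scalar s was found from an arbitrary equation of ℓ∞. From here on the equation is the
      -- rescaled one, for which `BalancedBy s` has become `Balanced`.
      conicModel : ConicModel
      conicModel = record
        { model = model ; line = Representation.rescale model Σ.s Σ.s∈F Σ.s≉0 line₀ ; B = B ; B-frame = B-frame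
        ; C = C ; C⁺ = C⁺ ; C⁺⁺ = C⁺⁺ ; C-parametrised = parametrised
        ; C⁺-parametrised = C⁺-parametrised ; C⁺⁺-parametrised = C⁺⁺-parametrised }

      module _ (𝒱 : Fin 9 → Matrix 9 9) (𝒱-variety : Bose.Scroll.IsVarietyOf G B C C⁺ C⁺⁺ 𝒱)
               (E : Vector Carrier 3) (E∈ℓ∞ : E ∈ ℓ∞) (𝖼E∈ℓ∞ : Carriers.𝖼 ℓ∞ B 1 E ∈ ℓ∞) where

        conclusion = Configuration.WithHyperplane.WithCarrier.conclusion conicModel (record
          { 𝒱 = 𝒱 ; 𝒱-variety = 𝒱-variety ; Σ₆ = Σ₆ ; Σ₆⊆PG = Σ.Σ₆⊆PG ; Span∩PG⊆Σ₆ = Σ.Span∩PG⊆Σ₆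
          ; Span⇒balanced = Σ.Span⇒balanced ; balanced⇒Span = Σ.balanced⇒Span }) E E∈ℓ∞ 𝖼E∈ℓ∞

open import Data.List.Base using ([]; _∷_)

corollary4p6 :
  ∀ {a b : Level} (q : ℕ) → IsPrimePower q → 6 ℕ.≤ q →
  (K : FiniteField a b (q ℕ.^ 6)) →
  let open FiniteField K using (Carrier)
      open Geometry q K in
  (ℓ∞ : PointSet 2) → IsSubspace 3 1 ℓ∞ →
  (π : PointSet 2) → IsSubplane π → Empty (π ∩ ℓ∞) →
  (B : Matrix 3 3) → IsConjugation π B →
  (C C⁺ C⁺⁺ : PointSet 2) → IsConicOf π C →
  IsConic 3 C⁺ → C ⊆ C⁺ → IsConic 6 C⁺⁺ → C⁺ ⊆ C⁺⁺ →
  let open Carriers ℓ∞ B in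
  (E : Vector Carrier 3) → E ∈ IsCarrier → E ∈ ℓ∞ → 𝖼 1 E ∈ ℓ∞ →
  (G : Matrix 9 3) →
  let open Bose G
      open Scroll B
      open AtInfinity ℓ∞ in
  IsBose →
  (𝒱 : Fin 9 → Matrix 9 9) → IsVarietyOf C C⁺ C⁺⁺ 𝒱 →
  (Σ₆ : PointSet 8) → IsSubspace 1 6 Σ₆ → Σ∞ ⊆ Σ₆ →
  let 𝒱[C]  = Variety 1 𝒱 ∩ Σ₆
      𝒱[C]⋆ = Variety 3 𝒱 ∩ ⟨ Σ₆ ⟩[ 3 ]
      Σ∞⋆   = ⟨ Σ∞ ⟩[ 3 ]
      Σ∞⋆⋆  = ⟨ Σ∞ ⟩[ 6 ]
      h     = ⟨ points (ι E ∷ φ 2 (ι (𝖼 1 E)) ∷ []) ⟩[ 3 ]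
      h^q   = image (φ 1) h
      h^q²  = image (φ 2) h
  in
  (C⁺ ∩ ℓ∞ ≐ points (E ∷ 𝖼 1 E ∷ []) →
    ∃ λ (N₃ : NormalRationalCurve 8 3) →
      𝒱[C] ≐ curve 1 N₃ ×
      IsTLine h × IsTLine h^q × IsTLine h^q² ×
      ¬ (h ≐ h^q) × ¬ (h ≐ h^q²) × ¬ (h^q ≐ h^q²) ×
      𝒱[C]⋆ ∩ Σ∞⋆ ≐ h ∪ h^q ∪ h^q² ×
      ∃ λ R →
        R ∈ h ×
        curve 3 N₃ ∩ Σ∞⋆ ≐ points (R ∷ φ 1 R ∷ φ 2 R ∷ []) ×
        (∀ X → X ∈ g → R ∉ spreadPlane 3 X))
  ×
  (¬ (C⁺ ∩ ℓ∞ ≐ points (E ∷ 𝖼 1 E ∷ [])) →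
    ∃₂ λ (P̄ Q̄ : Vector Carrier 3) →
      let P = ι P̄
          Q = ι Q̄
          sixPoints = points (P ∷ φ 1 P ∷ φ 2 P ∷ Q ∷ φ 1 Q ∷ φ 2 Q ∷ [])
      in
      C⁺⁺ ∩ ⟨ ℓ∞ ⟩[ 6 ] ≐ points (P̄ ∷ Q̄ ∷ []) ×
      P̄ ∉ IsCarrier × Q̄ ∉ IsCarrier ×
      ∃ λ (N₆ : NormalRationalCurve 8 6) →
        𝒱[C] ≐ curve 1 N₆ ×
        𝒱[C]⋆ ≐ curve 3 N₆ ×
        ((C⁺ ∩ ℓ∞ ≐ points (P̄ ∷ Q̄ ∷ []) ×
          P ∈ g × Q ∈ g ×
          curve 3 N₆ ∩ Σ∞⋆ ≐ sixPoints)
         ⊎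
         (Empty (C⁺ ∩ ℓ∞) ×
          P ∈ ⟨ g ⟩[ 6 ] × P ∉ g × Q ∈ ⟨ g ⟩[ 6 ] × Q ∉ g ×
          Q ∼ φ 3 P ×
          curve 6 N₆ ∩ Σ∞⋆⋆ ≐ sixPoints)))
corollary4p6 q q-primePower 6≤q K ℓ∞ ℓ∞-line π _ π∩ℓ∞-empty B B-conjugation C C⁺ C⁺⁺ C-conic C⁺-conic C⊆C⁺ C⁺⁺-conic C⁺⊆C⁺⁺
             E _ E∈ℓ∞ 𝖼E∈ℓ∞ G G-Bose 𝒱 𝒱-variety Σ₆ Σ₆-subspace Σ∞⊆Σ₆ =
  Plane.Main.conclusion q q-primePower 6≤q K ℓ∞ ℓ∞-line π π∩ℓ∞-empty B B-conjugation C C⁺ C⁺⁺ C-conic C⁺-conic C⊆C⁺ C⁺⁺-conic C⁺⊆C⁺⁺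
    G G-Bose Σ₆ Σ₆-subspace Σ∞⊆Σ₆ 𝒱 𝒱-variety E E∈ℓ∞ 𝖼E∈ℓ∞
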